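{- For all integers $n\ge0$ and each $t\in\{15,25,50,75,90,100,115,140,165,175,240,275\}$, \[c\phi_5(325n+t)\equiv0\pmod{13}.\]
   Context: $c\phi_5(n)$ denotes the number of $5$-colored generalized Frobenius partitions of $n$, defined by the generating function \[\sum_{n\ge0}c\phi_5(n)q^n=\frac{\sum_{m_1,\dots,m_4\in\mathbb{Z}}q^{\sum_{i=1}^4m_i^2+\sum_{1\le i<j\le4}m_im_j}}{\prod_{n\ge1}(1-q^n)^5}.\] -}

module Defs where

open import Data.Nat using (ℕ; zero; suc; _+_; _*_; _∸_; _≡ᵇ_)
open import Data.Integer as ℤ using (ℤ; +_; -[1+_])
open import Data.List using (List; []; _∷_; map; upTo; concatMap; length; filterᵇ)
open import Data.Nat.ListAction using (sum)
open import Data.Bool using (Bool; true; false; if_then_else_)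
open import Relation.Binary.PropositionalEquality using (_≡_)

Series : Set
Series = ℕ → ℕ

_⊙_ : Series → Series → Series
(f ⊙ g) n = sum (map (λ k → f k * g (n ∸ k)) (upTo (suc n)))

-- Coefficients of ∏_{i=1}^{k} 1/(1 - q^i):
-- prodInv 0 n = [n = 0],  prodInv (k+1) n = Σ_{j ≥ 0, (k+1) j ≤ n} prodInv k (n - (k+1) j)
prodInv : ℕ → Series
prodInv zero zero = 1
prodInv zero (suc n) = 0
prodInv (suc k) n = sum (map (λ j → prodInv k (n ∸ suc k * j)) (filter' (upTo (suc n))))
  where
  le : ℕ → ℕ → Bool
  le zero _ = true
  le (suc a) zero = false
  le (suc a) (suc b) = le a b
  filter' : List ℕ → List ℕ
  filter' [] = []
  filter' (j ∷ js) = if le (suc k * j) n then j ∷ filter' js else filter' js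

-- Partition function: coefficients of ∏_{n≥1} 1/(1 - q^n)
-- (factors with i > n do not affect the coefficient of q^n).
partitions : Series
partitions n = prodInv n n

invEta5 : Series
invEta5 = partitions ⊙ (partitions ⊙ (partitions ⊙ (partitions ⊙ partitions)))

Q : ℤ → ℤ → ℤ → ℤ → ℤ
Q a b c d = (a ℤ.* a ℤ.+ b ℤ.* b ℤ.+ c ℤ.* c ℤ.+ d ℤ.* d)
            ℤ.+ (a ℤ.* b ℤ.+ a ℤ.* c ℤ.+ a ℤ.* d ℤ.+ b ℤ.* c ℤ.+ b ℤ.* d ℤ.+ c ℤ.* d)

range : ℕ → List ℤ
range B = map (λ k → + k ℤ.- + B) (upTo (suc (B + B)))

eqℤ : ℤ → ℤ → Bool
eqℤ (+ m) (+ n) = m ≡ᵇ n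
eqℤ -[1+ m ] -[1+ n ] = m ≡ᵇ n
eqℤ _ _ = false

-- Coefficient of q^n in Σ_{m ∈ ℤ^4} q^{Q(m)}.  Since 2Q(m) = Σ m_i^2 + (Σ m_i)^2,
-- Q(m) = n forces |m_i| ≤ √(2n) ≤ 2n, so enumerating the box [-2n, 2n]^4 counts
-- all solutions.
theta : Series
theta n = length (filterᵇ (λ v → v) (concatMap (λ a → concatMap (λ b → concatMap (λ c →
            map (λ d → eqℤ (Q a b c d) (+ n)) box) box) box) box))
  where
  box : List ℤ
  box = range (2 * n)

cφ5 : ℕ → ℕ
cφ5 = theta ⊙ invEta5

module Submission where

open import Algebra.Bundles using (CommutativeRing; RawRing)
open import Algebra.Structures using (IsCommutativeRing)
open import Data.Bool using (Bool; true; false; if_then_else_; T)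
open import Data.Empty using (⊥-elim)
open import Data.Fin as Fin using (Fin)
open import Data.Integer as ℤ using (ℤ; +_; -[1+_]; 0ℤ; 1ℤ)
import Data.Integer.Properties as ℤP
open import Data.List as List using (List; []; _∷_; upTo)
open import Data.Nat as ℕ using (ℕ; zero; suc; _≤_; _<_; z≤n; s≤s; _∸_)
import Data.Nat.Properties as ℕP
open import Data.Product using (Σ; ∃; _×_; _,_; proj₁; proj₂)
open import Data.Sum using (_⊎_; inj₁; inj₂)
open import Data.Unit using (⊤; tt)
open import Data.Vec using (Vec)
open import Data.Vec.N-ary using (N-ary; curryⁿ; Eq; Eqʰ)
open import Function using (_∘_; id)
open import Level using (0ℓ)
open import Relation.Binary.PropositionalEquality as ≡ using (_≡_)
open import Relation.Nullary using (¬_; Dec; yes; no)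
import Relation.Binary.Reasoning.Setoid
import Relation.Binary.Reflection
open import Tactic.RingSolver.Core.Polynomial.Parameters using (Homomorphism)
import Tactic.RingSolver.Core.Polynomial.Base
import Tactic.RingSolver.Core.Polynomial.Semantics
import Tactic.RingSolver.Core.Polynomial.Homomorphism
import Tactic.RingSolver.Core.AlmostCommutativeRing as ACR
open import Tactic.RingSolver.Core.Expression using (Expr; Κ; Ι; _⊕_; _⊗_; _⊛_; ⊝_; module Eval)
import Algebra.Properties.Semiring.Mult.TCOptimised
import Algebra.Properties.Semiring.Exp.TCOptimised
import Algebra.Properties.CommutativeSemiring.Exp.TCOptimised
import Algebra.Properties.Ring
import Data.List.Properties as ListP
import Relation.Binary
import Data.Integer.Solver
import Data.Nat.Solver
import Data.Fin.Properties as FinP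
import Data.Integer.DivMod as ℤD
open import Data.Integer using (∣_∣)
import Data.Nat.Divisibility as ℕDiv
open import Data.Nat.Divisibility using () renaming (_∣_ to _ℕ∣_; _∣?_ to _ℕ∣?_)
open import Data.Integer.Divisibility.Signed using (divides) renaming (∣⇒∣ᵤ to signed⇒abs; _∣_ to _ℤ∣_; _∣?_ to _ℤ∣?_)
open import Relation.Nullary.Decidable using (True; False; toWitness; toWitnessFalse; ¬?)
open import Data.List using (cartesianProduct; filter)
open import Data.List.Membership.Propositional using (_∈_)
import Data.List.Membership.Propositional.Properties as ∈P
import Data.List.Membership.Propositional.Properties.WithK as ∈PK
open import Data.List.Relation.Binary.BagAndSetEquality using (∼bag⇒↭)
open import Data.List.Relation.Binary.Permutation.Propositional as Perm using (_↭_)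
open import Data.List.Relation.Unary.All as All using (All; []; _∷_)
open import Data.List.Relation.Unary.Any using (here; there)
open import Data.List.Relation.Unary.AllPairs using ([]; _∷_)
open import Data.List.Relation.Unary.Unique.Propositional using (Unique)
import Data.List.Relation.Unary.Unique.Propositional.Properties as UniqueP
open import Function.Bundles using (mk⇔)
open import Relation.Nullary using (_×-dec_; does)
open import Data.List using (filterᵇ; concatMap; length)
import Data.Vec as Vec
open import Data.Vec.Properties using (lookup-map)
open import Data.Nat.ListAction using (sum)
import Defs
open import Defs using (range; prodInv; partitions; eqℤ; _⊙_; cφ5; invEta5)

-- Write E(q) = ∏ (1 - q^n), called `eta`, and let λ, μ, ν be E(q), E(q^5), E(q^25).
--
-- The quadratic form is half the square norm on the root lattice A₄, and its theta series is λ^5/μ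
-- + 25 q μ^5/λ (`theta-expansion`). To see this, weight each lattice vector v by ζ^(moment v),
-- where ζ is a fifth root of unity. The weighted count has generating function λ^5/μ, being the
-- constant term of a product of five Jacobi theta series (`roots-series`). Orthogonality of
-- characters, combined with two symmetries of the lattice, shows that the plain count exceeds the
-- weighted one by 25 times the number of vectors in one class modulo 5 (`special-count`). A
-- Gauss-sum matrix, which scales norms by 5, identifies that class with a coset of 5A₄
-- (`enlarge-matching`), whose generating function is μ^5/λ, again by the triple product
-- (`cosets-series`). Hence the generating function of `cφ5` is (λ^5/μ + 25 q μ^5/λ)/λ^5.
--
-- Its terms with exponent divisible by 5 are extracted by the 5-dissection λ = X (1 - ρ - ρ²),
-- where X is a series in q^5 and ρ is q times a series in q^5 (the Rogers-Ramanujan continued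
-- fraction at q^5). Euler's pentagonal number theorem gives the three sections of λ, the support of
-- E^3 gives the relation between them (`XZ≋Y²`), and multiplying over q ↦ ζ^j q gives X^5 (1 - 11
-- ρ^5 - ρ^10) ν = μ^6 (`golden`). The quotients of λ, μ, ν that occur thereby become polynomials in
-- ρ times series in q^5, and taking a section amounts to sorting a polynomial by exponents modulo
-- 5.
--
-- Modulo 13, two polynomial identities in ρ do the rest. The first (`identity`) shows that a
-- certain combination of eta quotients of weight 12 is unchanged under q ↦ q^5; its constant term
-- is 1, so it is 1 (`modular`), an analogue of the congruence of the Eisenstein series E₁₂ to 1.
-- With it, the second (`identity′`) gives q ∑ cφ5(5n) q^n ≡ F - λ^(-25), where F = λ^5/μ^6 + 5q/λ
-- (`q*f`). Now F is a polynomial J(ρ) times a series in q^5, and the coefficients of J at exponents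
-- ±1 modulo 5 are divisible by 13, so F has no terms there (`F-section`). Moreover λ^(-25) ≡ E(q)
-- E(q^13)^(-2), which has no terms in the classes modulo 13 that contain no pentagonal number
-- (`p^25-section`). Two classes modulo 5 and six modulo 13 give twelve classes of N modulo 65, and
-- the progressions of the theorem are 5(N - 1).

-- Commutative rings: integer constants, a ring solver, finite sums and products

module Ring (R : CommutativeRing 0ℓ 0ℓ) where
  open CommutativeRing R public hiding (_-_)
  open Algebra.Properties.Ring ring public using (-‿distribˡ-*; -‿distribʳ-*; -‿+-comm; -‿involutive; -0#≈0#)
  open Algebra.Properties.Semiring.Exp.TCOptimised semiring public using (_^_; ^-homo-*; ^-congˡ; ^-assocʳ)
  open Algebra.Properties.CommutativeSemiring.Exp.TCOptimised commutativeSemiring public using (^-distrib-*)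
  module M = Algebra.Properties.Semiring.Mult.TCOptimised semiring
  module Rsn = Relation.Binary.Reasoning.Setoid setoid
  open Rsn

  infixl 6 _-_
  _-_ : Carrier → Carrier → Carrier
  x - y = x + - y

  ι : ℤ → Carrier
  ι (+ n) = n M.× 1#
  ι -[1+ n ] = - (suc n M.× 1#)

  ι-neg : ∀ i → ι (ℤ.- i) ≈ - ι i
  ι-neg (+ zero) = sym -0#≈0#
  ι-neg (+ suc n) = refl
  ι-neg -[1+ n ] = sym (-‿involutive _)

  private
    ι-⊖ : ∀ m n → ι (m ℤ.⊖ n) ≈ m M.× 1# - n M.× 1#
    ι-⊖ m zero = sym (trans (+-congˡ -0#≈0#) (+-identityʳ _))
    ι-⊖ zero (suc n) = sym (+-identityˡ _)
    ι-⊖ (suc m) (suc n) = begin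
      ι (suc m ℤ.⊖ suc n) ≡⟨ ≡.cong ι (ℤP.[1+m]⊖[1+n]≡m⊖n m n) ⟩
      ι (m ℤ.⊖ n) ≈⟨ ι-⊖ m n ⟩
      a - b ≈⟨ +-identityˡ _ ⟨
      0# + (a - b) ≈⟨ +-congʳ (-‿inverseʳ 1#) ⟨
      (1# - 1#) + (a - b) ≈⟨ +-assoc _ _ _ ⟩
      1# + (- 1# + (a - b)) ≈⟨ +-congˡ (+-congˡ (+-comm _ _)) ⟩
      1# + (- 1# + (- b + a)) ≈⟨ +-congˡ (+-assoc _ _ _) ⟨
      1# + ((- 1# + - b) + a) ≈⟨ +-congˡ (+-comm _ _) ⟩
      1# + (a + (- 1# + - b)) ≈⟨ +-assoc _ _ _ ⟨
      (1# + a) + (- 1# + - b) ≈⟨ +-cong (sym (M.1+× m 1#)) (trans (-‿+-comm 1# b) (-‿cong (sym (M.1+× n 1#)))) ⟩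
      (suc m M.× 1#) - (suc n M.× 1#) ∎
      where a = m M.× 1# ; b = n M.× 1#

  ι-+ : ∀ i j → ι (i ℤ.+ j) ≈ ι i + ι j
  ι-+ (+ m) (+ n) = M.×-homo-+ 1# m n
  ι-+ (+ m) -[1+ n ] = ι-⊖ m (suc n)
  ι-+ -[1+ m ] (+ n) = trans (ι-⊖ n (suc m)) (+-comm _ _)
  ι-+ -[1+ m ] -[1+ n ] = begin
    - (suc (suc (m ℕ.+ n)) M.× 1#) ≡⟨ ≡.cong (λ k → - (suc k M.× 1#)) (ℕP.+-suc m n) ⟨
    - ((suc m ℕ.+ suc n) M.× 1#) ≈⟨ -‿cong (M.×-homo-+ 1# (suc m) (suc n)) ⟩
    - (suc m M.× 1# + suc n M.× 1#) ≈⟨ -‿+-comm _ _ ⟨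
    _ ∎

  private
    ι-+* : ∀ m j → ι (+ m ℤ.* j) ≈ ι (+ m) * ι j
    ι-+* m (+ n) = begin
      ι (+ m ℤ.* + n) ≡⟨ ≡.cong ι (ℤP.pos-* m n) ⟨
      (m ℕ.* n) M.× 1# ≈⟨ M.×1-homo-* m n ⟩
      _ ∎
    ι-+* m -[1+ n ] = begin
      ι (+ m ℤ.* (ℤ.- (+ suc n))) ≡⟨ ≡.cong ι (ℤP.neg-distribʳ-* (+ m) (+ suc n)) ⟨
      ι (ℤ.- (+ m ℤ.* + suc n)) ≈⟨ ι-neg (+ m ℤ.* + suc n) ⟩
      - ι (+ m ℤ.* + suc n) ≈⟨ -‿cong (ι-+* m (+ suc n)) ⟩
      - (ι (+ m) * ι (+ suc n)) ≈⟨ -‿distribʳ-* _ _ ⟩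
      _ ∎

  ι-* : ∀ i j → ι (i ℤ.* j) ≈ ι i * ι j
  ι-* (+ m) j = ι-+* m j
  ι-* -[1+ m ] j = begin
      ι ((ℤ.- (+ suc m)) ℤ.* j) ≡⟨ ≡.cong ι (ℤP.neg-distribˡ-* (+ suc m) j) ⟨
      ι (ℤ.- (+ suc m ℤ.* j)) ≈⟨ ι-neg (+ suc m ℤ.* j) ⟩
      - ι (+ suc m ℤ.* j) ≈⟨ -‿cong (ι-+* (suc m) j) ⟩
      - (ι (+ suc m) * ι j) ≈⟨ -‿distribˡ-* _ _ ⟩
      _ ∎

  private
    isZero : ℤ → Bool
    isZero (+ zero) = true
    isZero _ = false
    zeroι : ∀ x → T (isZero x) → 0# ≈ ι x
    zeroι (+ zero) _ = refl
    acr : ACR.AlmostCommutativeRing 0ℓ 0ℓ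
    acr = ACR.fromCommutativeRing R (λ _ → Data.Maybe.nothing)
      where import Data.Maybe
    -- The solver computes with coefficients in ℤ, interpreted by `ι`. One identity with integer
    -- literals can thus be normalised in every commutative ring, whether or not its equality is
    -- decidable.
    homo : Homomorphism 0ℓ 0ℓ 0ℓ 0ℓ
    homo = record
      { from = record { rawRing = CommutativeRing.rawRing ℤP.+-*-commutativeRing ; isZero = isZero }
      ; to = acr
      ; morphism = record { ⟦_⟧ = ι ; +-homo = ι-+ ; *-homo = ι-* ; -‿homo = ι-neg ; 0-homo = refl ; 1-homo = refl }
      ; Zero-C⟶Zero-R = zeroι }
    module PB = Tactic.RingSolver.Core.Polynomial.Base (Homomorphism.from homo)
    module PS = Tactic.RingSolver.Core.Polynomial.Semantics homo
    module PH = Tactic.RingSolver.Core.Polynomial.Homomorphism homo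
    norm : ∀ {n} → Expr ℤ n → PB.Poly n
    norm (Κ x) = PB.κ x
    norm (Ι x) = PB.ι x
    norm (x ⊕ y) = norm x PB.⊞ norm y
    norm (x ⊗ y) = norm x PB.⊠ norm y
    norm (⊝ x) = PB.⊟ norm x
    norm (x ⊛ i) = norm x PB.⊡ i
    open Eval rawRing ι
    ⟦_⇓⟧ : ∀ {n} → Expr ℤ n → Vec Carrier n → Carrier
    ⟦ e ⇓⟧ = PS.⟦ norm e ⟧
    correct : ∀ {n} (e : Expr ℤ n) ρ → ⟦ e ⇓⟧ ρ ≈ ⟦ e ⟧ ρ
    correct (Κ x) ρ = PH.κ-hom x ρ
    correct (Ι x) ρ = PH.ι-hom x ρ
    correct (x ⊕ y) ρ = trans (PH.⊞-hom (norm x) (norm y) ρ) (+-cong (correct x ρ) (correct y ρ))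
    correct (x ⊗ y) ρ = trans (PH.⊠-hom (norm x) (norm y) ρ) (*-cong (correct x ρ) (correct y ρ))
    correct (⊝ x) ρ = trans (PH.⊟-hom (norm x) ρ) (-‿cong (correct x ρ))
    correct (x ⊛ i) ρ = trans (PH.⊡-hom (norm x) i ρ) (^-congˡ i (correct x ρ))
  open Relation.Binary.Reflection setoid Ι ⟦_⟧ ⟦_⇓⟧ correct public using (solve)

  infix 5 _⊜_
  _⊜_ : ∀ {n} → Expr ℤ n → Expr ℤ n → Expr ℤ n × Expr ℤ n
  _⊜_ = _,_
  infixl 6 _⊖_
  _⊖_ : ∀ {n} → Expr ℤ n → Expr ℤ n → Expr ℤ n
  x ⊖ y = x ⊕ ⊝ y

  ≡⇒≈ : ∀ {x y} → x ≡ y → x ≈ y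
  ≡⇒≈ ≡.refl = refl

  ^-suc : ∀ x n → x ^ suc n ≈ x * x ^ n
  ^-suc x n = ^-homo-* x 1 n

  *-zero-both : ∀ {x y} → y ≈ 0# → x * y ≈ 0#
  *-zero-both {x} e = trans (*-congˡ e) (zeroʳ x)

  ∑ ∏ : ℕ → (ℕ → Carrier) → Carrier
  ∑ zero f = 0#
  ∑ (suc n) f = ∑ n f + f n
  ∏ zero f = 1#
  ∏ (suc n) f = ∏ n f * f n

  ∏-cong : ∀ n {f g : ℕ → Carrier} → (∀ i → f i ≈ g i) → ∏ n f ≈ ∏ n g
  ∏-cong zero e = refl
  ∏-cong (suc n) e = *-cong (∏-cong n e) (e n)

  ∏-* : ∀ n (f g : ℕ → Carrier) → ∏ n (λ i → f i * g i) ≈ ∏ n f * ∏ n g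
  ∏-* zero f g = sym (*-identityˡ _)
  ∏-* (suc n) f g = trans (*-congʳ (∏-* n f g))
    (solve 4 (λ a b c d → (a ⊗ b) ⊗ (c ⊗ d) ⊜ (a ⊗ c) ⊗ (b ⊗ d)) refl _ _ _ _)

  -- The sum of F k d over all k + d = n.
  ∑² : ℕ → (ℕ → ℕ → Carrier) → Carrier
  ∑² zero F = F 0 0
  ∑² (suc n) F = F 0 (suc n) + ∑² n (λ k d → F (suc k) d)

  ∑²-cong : ∀ n {F G : ℕ → ℕ → Carrier} → (∀ k d → k ℕ.+ d ≡ n → F k d ≈ G k d) → ∑² n F ≈ ∑² n G
  ∑²-cong zero e = e 0 0 ≡.refl
  ∑²-cong (suc n) e = +-cong (e 0 (suc n) ≡.refl) (∑²-cong n (λ k d p → e (suc k) d (≡.cong suc p)))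

  ∑²-+ : ∀ n F G → ∑² n (λ k d → F k d + G k d) ≈ ∑² n F + ∑² n G
  ∑²-+ zero F G = refl
  ∑²-+ (suc n) F G = trans (+-congˡ (∑²-+ n _ _))
    (solve 4 (λ a b c d → (a ⊕ b) ⊕ (c ⊕ d) ⊜ (a ⊕ c) ⊕ (b ⊕ d)) refl _ _ _ _)

  ∑²-*ˡ : ∀ n c F → ∑² n (λ k d → c * F k d) ≈ c * ∑² n F
  ∑²-*ˡ zero c F = refl
  ∑²-*ˡ (suc n) c F = trans (+-congˡ (∑²-*ˡ n c _)) (sym (distribˡ _ _ _))

  ∑²-last : ∀ n F → ∑² (suc n) F ≈ ∑² n (λ k d → F k (suc d)) + F (suc n) 0
  ∑²-last zero F = refl
  ∑²-last (suc n) F = trans (+-congˡ (∑²-last n (λ k d → F (suc k) d))) (sym (+-assoc _ _ _))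

  ∑²-zero : ∀ n {F : ℕ → ℕ → Carrier} → (∀ k d → k ℕ.+ d ≡ n → F k d ≈ 0#) → ∑² n F ≈ 0#
  ∑²-zero zero e = e 0 0 ≡.refl
  ∑²-zero (suc n) e = trans (+-cong (e 0 (suc n) ≡.refl) (∑²-zero n (λ k d p → e (suc k) d (≡.cong suc p)))) (+-identityˡ _)

  ∑²-swap : ∀ n F → ∑² n F ≈ ∑² n (λ k d → F d k)
  ∑²-swap zero F = refl
  ∑²-swap (suc n) F = trans (+-congˡ (∑²-swap n _)) (trans (+-comm _ _) (sym (∑²-last n (λ k d → F d k))))

  sumL : ∀ {X : Set} → List X → (X → Carrier) → Carrier
  sumL [] f = 0#
  sumL (x ∷ xs) f = f x + sumL xs f

  sumL-cong : ∀ {X : Set} (l : List X) {f g : X → Carrier} → (∀ x → f x ≈ g x) → sumL l f ≈ sumL l g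
  sumL-cong [] e = refl
  sumL-cong (x ∷ l) e = +-cong (e x) (sumL-cong l e)

  sumL-*ˡ : ∀ {X : Set} (l : List X) c (f : X → Carrier) → sumL l (λ x → c * f x) ≈ c * sumL l f
  sumL-*ˡ [] c f = sym (zeroʳ _)
  sumL-*ˡ (x ∷ l) c f = trans (+-congˡ (sumL-*ˡ l c f)) (sym (distribˡ _ _ _))

  sumL-*ʳ : ∀ {X : Set} (l : List X) c (f : X → Carrier) → sumL l (λ x → f x * c) ≈ sumL l f * c
  sumL-*ʳ [] c f = sym (zeroˡ _)
  sumL-*ʳ (x ∷ l) c f = trans (+-congˡ (sumL-*ʳ l c f)) (sym (distribʳ _ _ _))

  sumL-+ : ∀ {X : Set} (l : List X) (f g : X → Carrier) → sumL l (λ x → f x + g x) ≈ sumL l f + sumL l g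
  sumL-+ [] f g = sym (+-identityˡ _)
  sumL-+ (x ∷ l) f g = trans (+-congˡ (sumL-+ l f g))
    (solve 4 (λ a b c d → (a ⊕ b) ⊕ (c ⊕ d) ⊜ (a ⊕ c) ⊕ (b ⊕ d)) refl _ _ _ _)

  sumL-zero : ∀ {X : Set} (l : List X) {f : X → Carrier} → (∀ x → f x ≈ 0#) → sumL l f ≈ 0#
  sumL-zero [] e = refl
  sumL-zero (x ∷ l) e = trans (+-cong (e x) (sumL-zero l e)) (+-identityˡ _)

  sumL-++ : ∀ {X : Set} (l m : List X) (f : X → Carrier) → sumL (l List.++ m) f ≈ sumL l f + sumL m f
  sumL-++ [] m f = sym (+-identityˡ _)
  sumL-++ (x ∷ l) m f = trans (+-congˡ (sumL-++ l m f)) (sym (+-assoc _ _ _))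

  sumL-map : ∀ {X Y : Set} (h : X → Y) (l : List X) (f : Y → Carrier) → sumL (List.map h l) f ≡ sumL l (f ∘ h)
  sumL-map h [] f = ≡.refl
  sumL-map h (x ∷ l) f = ≡.cong (λ s → f (h x) + s) (sumL-map h l f)

  sumL-swap : ∀ {X Y : Set} (l : List X) (m : List Y) (f : X → Y → Carrier) →
    sumL l (λ x → sumL m (f x)) ≈ sumL m (λ y → sumL l (λ x → f x y))
  sumL-swap [] m f = sym (sumL-zero m (λ _ → refl))
  sumL-swap (x ∷ l) m f = trans (+-congˡ (sumL-swap l m f)) (sym (sumL-+ m _ _))

  sumL-applyUpTo : ∀ n (h : ℕ → ℕ) (f : ℕ → Carrier) → sumL (List.applyUpTo h (suc n)) f ≈ ∑² n (λ k d → f (h k))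
  sumL-applyUpTo zero h f = +-identityʳ _
  sumL-applyUpTo (suc n) h f = +-congˡ (sumL-applyUpTo n (h ∘ suc) f)

record Hom (R R′ : CommutativeRing 0ℓ 0ℓ) : Set where
  private module R = Ring R
  private module R′ = Ring R′
  field
    ⟦_⟧ : R.Carrier → R′.Carrier
    cong : ∀ {x y} → x R.≈ y → ⟦ x ⟧ R′.≈ ⟦ y ⟧
    +-hom : ∀ x y → ⟦ x R.+ y ⟧ R′.≈ ⟦ x ⟧ R′.+ ⟦ y ⟧
    *-hom : ∀ x y → ⟦ x R.* y ⟧ R′.≈ ⟦ x ⟧ R′.* ⟦ y ⟧
    1-hom : ⟦ R.1# ⟧ R′.≈ R′.1#
  0-hom : ⟦ R.0# ⟧ R′.≈ R′.0#
  0-hom = begin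
    a ≈⟨ R′.solve 1 (λ a → a R′.⊜ (a ⊕ a) R′.⊖ a) R′.refl a ⟩
    (a R′.+ a) R′.- a ≈⟨ R′.+-congʳ (+-hom _ _) ⟨
    ⟦ R.0# R.+ R.0# ⟧ R′.- a ≈⟨ R′.+-congʳ (cong (R.+-identityˡ _)) ⟩
    a R′.- a ≈⟨ R′.-‿inverseʳ a ⟩
    R′.0# ∎
    where a = ⟦ R.0# ⟧
          open R′.Rsn
  neg-hom : ∀ x → ⟦ R.- x ⟧ R′.≈ R′.- ⟦ x ⟧
  neg-hom x = begin
    a ≈⟨ R′.solve 2 (λ a b → a R′.⊜ (a ⊕ b) R′.⊖ b) R′.refl a b ⟩
    (a R′.+ b) R′.- b ≈⟨ R′.+-congʳ (+-hom _ _) ⟨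
    ⟦ R.- x R.+ x ⟧ R′.- b ≈⟨ R′.+-congʳ (R′.trans (cong (R.-‿inverseˡ _)) 0-hom) ⟩
    R′.0# R′.- b ≈⟨ R′.+-identityˡ _ ⟩
    R′.- b ∎
    where a = ⟦ R.- x ⟧
          b = ⟦ x ⟧
          open R′.Rsn
  ι-hom : ∀ i → ⟦ R.ι i ⟧ R′.≈ R′.ι i
  ι-hom (+ n) = go n
    where go : ∀ n → ⟦ n R.M.× R.1# ⟧ R′.≈ n R′.M.× R′.1#
          go zero = 0-hom
          go (suc n) = R′.trans (cong (R.M.1+× n R.1#)) (R′.trans (+-hom _ _) (R′.trans (R′.+-cong 1-hom (go n)) (R′.sym (R′.M.1+× n R′.1#))))
  ι-hom -[1+ n ] = R′.trans (neg-hom _) (R′.-‿cong (ι-hom (+ suc n)))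
  ^-hom : ∀ x n → ⟦ x R.^ n ⟧ R′.≈ ⟦ x ⟧ R′.^ n
  ^-hom x zero = 1-hom
  ^-hom x (suc zero) = R′.refl
  ^-hom x (suc (suc n)) = R′.trans (*-hom _ _) (R′.*-congʳ (^-hom x (suc n)))
  ∏-hom : ∀ n f → ⟦ R.∏ n f ⟧ R′.≈ R′.∏ n (λ i → ⟦ f i ⟧)
  ∏-hom zero f = 1-hom
  ∏-hom (suc n) f = R′.trans (*-hom _ _) (R′.*-congʳ (∏-hom n f))
  poch-hom : ∀ m x → ⟦ R.∏ m (λ i → R.1# R.- x R.^ suc i) ⟧ R′.≈ R′.∏ m (λ i → R′.1# R′.- ⟦ x ⟧ R′.^ suc i)
  poch-hom m x = R′.trans (∏-hom m _) (R′.∏-cong m (λ i → R′.trans (+-hom _ _) (R′.+-cong 1-hom (R′.trans (neg-hom _) (R′.-‿cong (^-hom x (suc i)))))))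

-- Formal power series

module Series (A : CommutativeRing 0ℓ 0ℓ) where
  private module A = Ring A
  open A using (_≈_; ∑²; ∑²-cong)

  PS : Set
  PS = ℕ → A.Carrier

  infix 4 _≋_
  -- A record rather than a function type, so that both series can be inferred from the type of an
  -- equation.
  record _≋_ (f g : PS) : Set where
    constructor mk
    field at : ∀ n → f n ≈ g n
  open _≋_ public

  tail : PS → PS
  tail f n = f (suc n)

  mul : PS → PS → PS
  mul f g n = ∑² n (λ i j → f i A.* g j)

  mul-cong≤ : ∀ n {f f′ g g′ : PS} → (∀ i → i ≤ n → f i ≈ f′ i) → (∀ i → i ≤ n → g i ≈ g′ i) → mul f g n ≈ mul f′ g′ n
  mul-cong≤ n p r = ∑²-cong n (λ { i j ≡.refl → A.*-cong (p i (ℕP.m≤m+n i j)) (r j (ℕP.m≤n+m j i)) })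

  private
    mul-comm : ∀ f g → mul f g ≋ mul g f
    mul-comm f g = mk λ n → A.trans (A.∑²-swap n _) (∑²-cong n (λ _ _ _ → A.*-comm _ _))

    mul-distribʳ : ∀ h f g → mul (λ n → f n A.+ g n) h ≋ (λ n → mul f h n A.+ mul g h n)
    mul-distribʳ h f g = mk λ n → A.trans (∑²-cong n (λ _ _ _ → A.distribʳ _ _ _)) (A.∑²-+ n _ _)

    mul-scale : ∀ c f g → mul (λ n → c A.* f n) g ≋ (λ n → c A.* mul f g n)
    mul-scale c f g = mk λ n → A.trans (∑²-cong n (λ _ _ _ → A.*-assoc _ _ _)) (A.∑²-*ˡ n c _)

    mul-assoc : ∀ f g h → mul (mul f g) h ≋ mul f (mul g h)
    mul-assoc f g h = mk (go f g h)
      where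
      open A.Rsn
      go : ∀ f g h n → mul (mul f g) h n ≈ mul f (mul g h) n
      go f g h zero = A.*-assoc _ _ _
      go f g h (suc n) = begin
        (f 0 A.* g 0) A.* h (suc n) A.+ mul (λ k → f 0 A.* g (suc k) A.+ mul (tail f) g k) h n
          ≈⟨ A.+-congˡ (A.trans (at (mul-distribʳ h (λ k → f 0 A.* g (suc k)) (mul (tail f) g)) n) (A.+-cong (at (mul-scale (f 0) (tail g) h) n) (go (tail f) g h n))) ⟩
        (f 0 A.* g 0) A.* h (suc n) A.+ (f 0 A.* mul (tail g) h n A.+ mul (tail f) (mul g h) n)
          ≈⟨ A.solve 5 (λ a b c d e → (a ⊗ b) ⊗ c ⊕ (a ⊗ d ⊕ e) A.⊜ a ⊗ (b ⊗ c ⊕ d) ⊕ e) A.refl _ _ _ _ _ ⟩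
        f 0 A.* (g 0 A.* h (suc n) A.+ mul (tail g) h n) A.+ mul (tail f) (mul g h) n ∎

  one : PS
  one zero = A.1#
  one (suc _) = A.0#

  private
    mul-identityˡ : ∀ f → mul one f ≋ f
    mul-identityˡ f = mk λ { zero → A.*-identityˡ _ ; (suc n) → A.trans (A.+-cong (A.*-identityˡ _) (A.∑²-zero n (λ _ _ _ → A.zeroˡ _))) (A.+-identityʳ _) }

  ring : CommutativeRing 0ℓ 0ℓ
  ring = record
    { Carrier = PS ; _≈_ = _≋_ ; _+_ = λ f g n → f n A.+ g n ; _*_ = mul ; -_ = λ f n → A.- f n ; 0# = λ _ → A.0# ; 1# = one
    ; isCommutativeRing = record
      { isRing = record
        { +-isAbelianGroup = record
          { isGroup = record
            { isMonoid = record
              { isSemigroup = record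
                { isMagma = record
                  { isEquivalence = record { refl = mk λ _ → A.refl ; sym = λ e → mk λ n → A.sym (at e n) ; trans = λ e f → mk λ n → A.trans (at e n) (at f n) }
                  ; ∙-cong = λ e f → mk λ n → A.+-cong (at e n) (at f n) }
                ; assoc = λ _ _ _ → mk λ _ → A.+-assoc _ _ _ }
              ; identity = (λ _ → mk λ _ → A.+-identityˡ _) , (λ _ → mk λ _ → A.+-identityʳ _) }
            ; inverse = (λ _ → mk λ _ → A.-‿inverseˡ _) , (λ _ → mk λ _ → A.-‿inverseʳ _)
            ; ⁻¹-cong = λ e → mk λ n → A.-‿cong (at e n) }
          ; comm = λ _ _ → mk λ _ → A.+-comm _ _ }
        ; *-cong = λ e f → mk λ n → mul-cong≤ n (λ i _ → at e i) (λ i _ → at f i)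
        ; *-assoc = mul-assoc
        ; *-identity = mul-identityˡ , (λ f → mk λ n → A.trans (at (mul-comm f one) n) (at (mul-identityˡ f) n))
        ; distrib = (λ h f g → mk λ n → A.trans (at (mul-comm h _) n) (A.trans (at (mul-distribʳ h f g) n) (A.+-cong (at (mul-comm f h) n) (at (mul-comm g h) n)))) , mul-distribʳ }
      ; *-comm = mul-comm } }

  module S = Ring ring
  open S using (_*_; _+_; _-_; -_; 0#; 1#; _^_)

  infix 4 _≈[_]_
  -- Congruence modulo q^N. Identities between infinite products are proved for partial products to
  -- this precision.
  _≈[_]_ : PS → ℕ → PS → Set
  f ≈[ N ] g = ∀ i → i < N → f i ≈ g i

  ≋⇒≈[] : ∀ {N f g} → f ≋ g → f ≈[ N ] g
  ≋⇒≈[] e i _ = at e i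

  ≈[]⇒≋ : ∀ {f g} → (∀ N → f ≈[ N ] g) → f ≋ g
  ≈[]⇒≋ e = mk λ n → e (suc n) n ℕP.≤-refl

  ≈[]-weaken : ∀ {N M f g} → M ≤ N → f ≈[ N ] g → f ≈[ M ] g
  ≈[]-weaken p e i i<M = e i (ℕP.≤-trans i<M p)

  []-refl : ∀ {N f} → f ≈[ N ] f
  []-refl _ _ = A.refl

  []-sym : ∀ {N f g} → f ≈[ N ] g → g ≈[ N ] f
  []-sym e i l = A.sym (e i l)

  []-trans : ∀ {N f g h} → f ≈[ N ] g → g ≈[ N ] h → f ≈[ N ] h
  []-trans e e′ i l = A.trans (e i l) (e′ i l)

  []-+ : ∀ {N f g f′ g′} → f ≈[ N ] f′ → g ≈[ N ] g′ → (f + g) ≈[ N ] (f′ + g′)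
  []-+ e e′ i l = A.+-cong (e i l) (e′ i l)

  []-* : ∀ {N f g f′ g′} → f ≈[ N ] f′ → g ≈[ N ] g′ → (f * g) ≈[ N ] (f′ * g′)
  []-* e e′ i l = mul-cong≤ i (λ j j≤i → e j (ℕP.≤-<-trans j≤i l)) (λ j j≤i → e′ j (ℕP.≤-<-trans j≤i l))

  []-∏ : ∀ {N} n {f g : ℕ → PS} → (∀ i → f i ≈[ N ] g i) → S.∏ n f ≈[ N ] S.∏ n g
  []-∏ zero e = []-refl
  []-∏ (suc n) e = []-* ([]-∏ n e) (e n)

  ∑²-coef : ∀ m (F : ℕ → ℕ → PS) n → S.∑² m F n ≈ ∑² m (λ k d → F k d n)
  ∑²-coef zero F n = A.refl
  ∑²-coef (suc m) F n = A.+-congˡ (∑²-coef m _ n)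

  sumL-coef : ∀ {X : Set} (l : List X) (F : X → PS) n → S.sumL l F n ≈ A.sumL l (λ x → F x n)
  sumL-coef [] F n = A.refl
  sumL-coef (x ∷ l) F n = A.+-congˡ (sumL-coef l F n)

  q : PS
  q zero = A.0#
  q (suc n) = one n

  C : A.Carrier → PS
  C c zero = c
  C c (suc _) = A.0#

  C*-coef : ∀ c f n → (C c * f) n ≈ c A.* f n
  C*-coef c f zero = A.refl
  C*-coef c f (suc n) = A.trans (A.+-congˡ (A.∑²-zero n (λ _ _ _ → A.zeroˡ _))) (A.+-identityʳ _)

  C-hom : Hom A ring
  C-hom = record
    { ⟦_⟧ = C ; cong = λ e → mk λ { zero → e ; (suc _) → A.refl }
    ; +-hom = λ _ _ → mk λ { zero → A.refl ; (suc _) → A.sym (A.+-identityˡ _) }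
    ; *-hom = λ x y → mk λ { zero → A.refl ; (suc n) → A.sym (A.trans (C*-coef x (C y) (suc n)) (A.zeroʳ _)) }
    ; 1-hom = mk λ { zero → A.refl ; (suc _) → A.refl } }

  q*-zero : ∀ f → (q * f) 0 ≈ A.0#
  q*-zero f = A.zeroˡ _

  q*-suc : ∀ f n → (q * f) (suc n) ≈ f n
  q*-suc f n = A.trans (A.+-cong (A.zeroˡ _) (at (S.*-identityˡ f) n)) (A.+-identityˡ _)

  q^*-+ : ∀ k f n → (q ^ k * f) (k ℕ.+ n) ≈ f n
  q^*-+ zero f n = at (S.*-identityˡ f) n
  q^*-+ (suc k) f n = A.trans (at (S.trans (S.*-congʳ (S.^-suc q k)) (S.*-assoc q (q ^ k) f)) (suc k ℕ.+ n)) (A.trans (q*-suc (q ^ k * f) (k ℕ.+ n)) (q^*-+ k f n))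

  q^*-< : ∀ k f n → n < k → (q ^ k * f) n ≈ A.0#
  q^*-< (suc k) f n l = A.trans (at (S.trans (S.*-congʳ (S.^-suc q k)) (S.*-assoc q (q ^ k) f)) n) (go n l)
    where go : ∀ n → n < suc k → (q * (q ^ k * f)) n ≈ A.0#
          go zero _ = q*-zero (q ^ k * f)
          go (suc n) (s≤s l) = A.trans (q*-suc (q ^ k * f) n) (q^*-< k f n l)

  drop : ℕ → PS → PS
  drop k f n = f (k ℕ.+ n)

  order-split : ∀ k f → f ≈[ k ] 0# → f ≋ q ^ k * drop k f
  order-split k f e = mk go
    where
    go : ∀ n → f n ≈ (q ^ k * drop k f) n
    go n with n ℕP.<? k
    ... | yes l = A.trans (e n l) (A.sym (q^*-< k (drop k f) n l))
    ... | no g = ≡.subst (λ n → f n ≈ (q ^ k * drop k f) n) (ℕP.m+[n∸m]≡n (ℕP.≮⇒≥ g)) (A.sym (q^*-+ k (drop k f) (n ∸ k)))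

  order-* : ∀ j k {f g} → f ≈[ j ] 0# → g ≈[ k ] 0# → (f * g) ≈[ j ℕ.+ k ] 0#
  order-* j k {f} {g} p r i l = A.trans (at (S.trans (S.*-cong (order-split j f p) (order-split k g r))
      (S.trans (S.solve 4 (λ a b c d → (a ⊗ b) ⊗ (c ⊗ d) S.⊜ (a ⊗ c) ⊗ (b ⊗ d)) S.refl (q ^ j) (drop j f) (q ^ k) (drop k g))
      (S.*-congʳ (S.sym (S.^-homo-* q j k))))) i)
    (q^*-< (j ℕ.+ k) (drop j f * drop k g) i l)

  []-minus : ∀ {N f g} → (f - g) ≈[ N ] 0# → f ≈[ N ] g
  []-minus {N} {f} {g} e i l = A.trans (A.solve 2 (λ a b → a A.⊜ (a A.⊖ b) ⊕ b) A.refl (f i) (g i)) (A.trans (A.+-congʳ (e i l)) (A.+-identityˡ _))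

  minus-[] : ∀ {N f g} → f ≈[ N ] g → (f - g) ≈[ N ] 0#
  minus-[] e i l = A.trans (A.+-congʳ (e i l)) (A.-‿inverseʳ _)

  -- Once g vanishes below degree i, the coefficient of q^i in f * g is f 0 times the coefficient of
  -- q^i in g, and f 0 is 1.
  cancel-zero : ∀ {N} f g → f 0 ≈ A.1# → (f * g) ≈[ N ] 0# → g ≈[ N ] 0#
  cancel-zero {N} f g f0 e i l = go (suc i) l i ℕP.≤-refl
    where
    go : ∀ M → M ≤ N → g ≈[ M ] 0#
    step : ∀ i → i < N → g ≈[ i ] 0# → g i ≈ A.0#
    step zero l h = A.trans (A.trans (A.sym (A.*-identityˡ _)) (A.*-congʳ (A.sym f0))) (e 0 l)
    step (suc i) l h = begin
      g (suc i) ≈⟨ A.trans (A.*-congʳ f0) (A.*-identityˡ _) ⟨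
      f 0 A.* g (suc i) ≈⟨ A.+-identityʳ _ ⟨
      f 0 A.* g (suc i) A.+ A.0# ≈⟨ A.+-congˡ (A.∑²-zero i (λ k d p → A.trans (A.*-congˡ (h d (s≤s (≡.subst (d ≤_) p (ℕP.m≤n+m d k))))) (A.zeroʳ _))) ⟨
      (f * g) (suc i) ≈⟨ e (suc i) l ⟩
      A.0# ∎
      where open A.Rsn
    go zero _ i ()
    go (suc M) p i l with ℕP.m≤n⇒m<n∨m≡n (ℕP.≤-pred l)
    ... | inj₁ i<M = go M (ℕP.<⇒≤ p) i i<M
    ... | inj₂ ≡.refl = step M p (go M (ℕP.<⇒≤ p))

  cancel[] : ∀ {N} f g h → f 0 ≈ A.1# → (f * g) ≈[ N ] (f * h) → g ≈[ N ] h
  cancel[] f g h f0 e = []-minus (cancel-zero f (g - h) f0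
    ([]-trans (≋⇒≈[] (S.solve 3 (λ f g h → f ⊗ (g S.⊖ h) S.⊜ f ⊗ g S.⊖ f ⊗ h) S.refl f g h)) (minus-[] e)))

  cancel : ∀ f g h → f 0 ≈ A.1# → f * g ≋ f * h → g ≋ h
  cancel f g h f0 e = ≈[]⇒≋ (λ N → cancel[] f g h f0 (≋⇒≈[] e))

  cancel-q^ : ∀ k f g → q ^ k * f ≋ q ^ k * g → f ≋ g
  cancel-q^ k f g e = mk λ n → A.trans (A.sym (q^*-+ k f n)) (A.trans (at e (k ℕ.+ n)) (q^*-+ k g n))

  *-coef0 : ∀ f g → (f * g) 0 ≈ f 0 A.* g 0
  *-coef0 f g = A.refl

  unit-* : ∀ f g → f 0 ≈ A.1# → g 0 ≈ A.1# → (f * g) 0 ≈ A.1#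
  unit-* f g e e′ = A.trans (A.*-cong e e′) (A.*-identityˡ _)

  order-^ : ∀ f → f 0 ≈ A.0# → ∀ n → f ^ n ≈[ n ] 0#
  order-^ f e zero i ()
  order-^ f e (suc n) = []-trans (≋⇒≈[] (S.^-suc f n)) (order-* 1 n (λ { zero _ → e ; (suc i) (s≤s ()) }) (order-^ f e n))

-- Gaussian binomials and Jacobi's triple product

module Gauss (A : CommutativeRing 0ℓ 0ℓ) where
  private module A = Ring A
  open Series A public
  open S using (_*_; _+_; _-_; -_; 0#; 1#; _^_; ∏; ∑²; ∑²-cong)

  poch : PS → ℕ → PS
  poch Q m = ∏ m (λ i → 1# - Q ^ suc i)

  -- The Gaussian binomial coefficient of k + d over k in base Q. Indexing by both parts avoids
  -- subtraction and matches the sums `∑²`.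
  binom : PS → ℕ → ℕ → PS
  binom Q zero d = 1#
  binom Q (suc k) zero = 1#
  binom Q (suc k) (suc d) = binom Q k (suc d) + Q ^ suc k * binom Q (suc k) d

  module _ (Q : PS) (Q0 : Q 0 A.≈ A.0#) where
    private
      B = binom Q
      P = poch Q

    B0 : ∀ k → B k 0 S.≈ 1#
    B0 zero = S.refl
    B0 (suc k) = S.refl

    Q^-order : ∀ n → Q ^ n ≈[ n ] 0#
    Q^-order = order-^ Q Q0

    one-minus : ∀ i → (1# - Q ^ suc i) ≈[ suc i ] 1#
    one-minus i = []-trans ([]-+ ([]-refl {f = 1#}) neg) (≋⇒≈[] (S.+-identityʳ 1#))
      where neg : (- (Q ^ suc i)) ≈[ suc i ] 0#
            neg j l = A.trans (A.-‿cong (Q^-order (suc i) j l)) A.-0#≈0#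

    -- Since Q has no constant term, every factor after the first m is 1 modulo q^(m+1).
    poch-stable : ∀ m k → P (k ℕ.+ m) ≈[ suc m ] P m
    poch-stable m zero = []-refl
    poch-stable m (suc k) = []-trans ([]-* (poch-stable m k) (≈[]-weaken (s≤s (ℕP.m≤n+m m k)) (one-minus (k ℕ.+ m)))) (≋⇒≈[] (S.*-identityʳ (P m)))

    poch-unit : ∀ m → P m 0 A.≈ A.1#
    poch-unit m = A.trans (A.reflexive (≡.cong (λ k → P k 0) (≡.sym (ℕP.+-identityʳ m)))) (poch-stable 0 m 0 (s≤s z≤n))

    poch-binom : ∀ k d → (P k * P d) * B k d S.≈ P (k ℕ.+ d)
    poch-binom zero d = S.trans (S.*-identityʳ _) (S.*-identityˡ (P d))
    poch-binom (suc k) zero = S.trans (S.trans (S.*-identityʳ _) (S.*-identityʳ _)) (S.≡⇒≈ (≡.cong P (≡.sym (ℕP.+-identityʳ (suc k)))))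
    poch-binom (suc k) (suc d) = begin
      ((P k * (1# - x)) * (P d * (1# - y))) * (B k (suc d) + x * B (suc k) d)
        ≈⟨ S.solve 6 (λ p x r y b c → ((p ⊗ (Κ 1ℤ S.⊖ x)) ⊗ (r ⊗ (Κ 1ℤ S.⊖ y))) ⊗ (b ⊕ x ⊗ c) S.⊜
             (Κ 1ℤ S.⊖ x) ⊗ ((p ⊗ (r ⊗ (Κ 1ℤ S.⊖ y))) ⊗ b) ⊕ x ⊗ (Κ 1ℤ S.⊖ y) ⊗ (((p ⊗ (Κ 1ℤ S.⊖ x)) ⊗ r) ⊗ c)) S.refl (P k) x (P d) y (B k (suc d)) (B (suc k) d) ⟩
      (1# - x) * ((P k * P (suc d)) * B k (suc d)) + x * (1# - y) * ((P (suc k) * P d) * B (suc k) d)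
        ≈⟨ S.+-cong (S.*-congˡ {1# - x} (poch-binom k (suc d))) (S.*-congˡ {x * (1# - y)} (S.trans (poch-binom (suc k) d) (S.≡⇒≈ (≡.cong P (≡.sym (ℕP.+-suc k d)))))) ⟩
      (1# - x) * P (k ℕ.+ suc d) + x * (1# - y) * P (k ℕ.+ suc d)
        ≈⟨ S.solve 3 (λ x y p → (Κ 1ℤ S.⊖ x) ⊗ p ⊕ x ⊗ (Κ 1ℤ S.⊖ y) ⊗ p S.⊜ p ⊗ (Κ 1ℤ S.⊖ x ⊗ y)) S.refl x y (P (k ℕ.+ suc d)) ⟩
      P (k ℕ.+ suc d) * (1# - x * y)
        ≈⟨ S.*-congˡ {P (k ℕ.+ suc d)} (S.+-congˡ {1#} (S.-‿cong (S.sym (S.^-homo-* Q (suc k) (suc d))))) ⟩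
      P (suc k ℕ.+ suc d) ∎
      where
      open S.Rsn
      x = Q ^ suc k
      y = Q ^ suc d

    -- The second Pascal rule differs from the defining one by the relation `ratio`, which follows
    -- from `poch-binom` after cancelling `P k * P d`, a series with constant term 1.
    pascal′ : ∀ k d → B (suc k) (suc d) S.≈ B (suc k) d + Q ^ suc d * B k (suc d)
    pascal′ k d = begin
      B k (suc d) + x * B (suc k) d
        ≈⟨ S.solve 4 (λ b x c y → b ⊕ x ⊗ c S.⊜ (Κ 1ℤ S.⊖ y) ⊗ b ⊕ (x ⊗ c ⊕ y ⊗ b)) S.refl (B k (suc d)) x (B (suc k) d) y ⟩
      (1# - y) * B k (suc d) + (x * B (suc k) d + y * B k (suc d))
        ≈⟨ S.+-congʳ {x * B (suc k) d + y * B k (suc d)} ratio ⟩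
      (1# - x) * B (suc k) d + (x * B (suc k) d + y * B k (suc d))
        ≈⟨ S.solve 4 (λ b x c y → (Κ 1ℤ S.⊖ x) ⊗ c ⊕ (x ⊗ c ⊕ y ⊗ b) S.⊜ c ⊕ y ⊗ b) S.refl (B k (suc d)) x (B (suc k) d) y ⟩
      B (suc k) d + y * B k (suc d) ∎
      where
      open S.Rsn
      x = Q ^ suc k
      y = Q ^ suc d
      ratio : (1# - y) * B k (suc d) S.≈ (1# - x) * B (suc k) d
      ratio = cancel (P k * P d) _ _ (unit-* (P k) (P d) (poch-unit k) (poch-unit d)) (begin
        (P k * P d) * ((1# - y) * B k (suc d))
          ≈⟨ S.solve 4 (λ p r y b → (p ⊗ r) ⊗ (y ⊗ b) S.⊜ (p ⊗ (r ⊗ y)) ⊗ b) S.refl (P k) (P d) (1# - y) (B k (suc d)) ⟩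
        (P k * P (suc d)) * B k (suc d) ≈⟨ poch-binom k (suc d) ⟩
        P (k ℕ.+ suc d) ≡⟨ ≡.cong P (ℕP.+-suc k d) ⟩
        P (suc k ℕ.+ d) ≈⟨ poch-binom (suc k) d ⟨
        (P (suc k) * P d) * B (suc k) d
          ≈⟨ S.solve 4 (λ p r y b → (p ⊗ y) ⊗ r ⊗ b S.⊜ (p ⊗ r) ⊗ (y ⊗ b)) S.refl (P k) (P d) (1# - x) (B (suc k) d) ⟩
        (P k * P d) * ((1# - x) * B (suc k) d) ∎)

    private
      first : (ℕ → ℕ → PS) → ℕ → ℕ → PS
      first F zero d = 0#
      first F (suc k) d = F k d
      second : (ℕ → ℕ → PS) → ℕ → ℕ → PS
      second F k zero = 0#
      second F k (suc d) = F k d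

      split : ∀ n F G H → (∀ k d → k ℕ.+ d ≡ suc n → H k d S.≈ first F k d + second G k d) →
        ∑² (suc n) H S.≈ ∑² n F + ∑² n G
      split n F G H e = S.trans (∑²-cong (suc n) e) (S.trans (S.∑²-+ (suc n) (first F) (second G))
        (S.+-cong (S.+-identityˡ (∑² n F)) (S.trans (S.∑²-last n (second G)) (S.+-identityʳ (∑² n G)))))

    -- A factor `1 + c` turns row n of Gaussian binomials into row n + 1. The hypothesis rewrites
    -- the multiples by c as terms at k + 1 weighted by Q^d, which are the second summand of
    -- `pascal′`; the range grows at its upper end.
    step₁ : ∀ n c (s : ℕ → PS) → (∀ k d → k ℕ.+ d ≡ n → c * s k S.≈ Q ^ d * s (suc k)) →
      ∑² n (λ k d → B k d * s k) * (1# + c) S.≈ ∑² (suc n) (λ k d → B k d * s k)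
    step₁ n c s h = begin
      X * (1# + c) ≈⟨ S.solve 2 (λ x c → x ⊗ (Κ 1ℤ ⊕ c) S.⊜ c ⊗ x ⊕ x) S.refl X c ⟩
      c * X + X ≈⟨ S.+-congʳ {X} (S.trans (S.sym (S.∑²-*ˡ n c _)) (∑²-cong n (λ k d p → S.trans
          (S.solve 3 (λ c b s → c ⊗ (b ⊗ s) S.⊜ b ⊗ (c ⊗ s)) S.refl c (B k d) (s k)) (S.*-congˡ {B k d} (h k d p))))) ⟩
      ∑² n (λ k d → B k d * (Q ^ d * s (suc k))) + X ≈⟨ split n _ _ _ pas ⟨
      ∑² (suc n) (λ k d → B k d * s k) ∎
      where
      open S.Rsn
      X = ∑² n (λ k d → B k d * s k)
      pas : ∀ k d → k ℕ.+ d ≡ suc n → B k d * s k S.≈ first (λ k d → B k d * (Q ^ d * s (suc k))) k d + second (λ k d → B k d * s k) k d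
      pas zero (suc d) _ = S.sym (S.+-identityˡ (1# * s 0))
      pas (suc k) zero _ = S.sym (S.trans (S.+-identityʳ _) (S.trans (S.*-congʳ {1# * s (suc k)} (B0 k)) (S.*-identityˡ (1# * s (suc k)))))
      pas (suc k) (suc d) _ = S.trans (S.*-congʳ {s (suc k)} (pascal′ k d))
        (S.solve 4 (λ b y c s → (b ⊕ y ⊗ c) ⊗ s S.⊜ c ⊗ (y ⊗ s) ⊕ b ⊗ s) S.refl (B (suc k) d) (Q ^ suc d) (B k (suc d)) (s (suc k)))

    -- The mirror image of `step₁`: the range grows at its lower end, and the defining recurrence of
    -- `binom` takes the place of `pascal′`.
    step₂ : ∀ n c (s : ℕ → PS) → (∀ k d → k ℕ.+ d ≡ n → c * s (suc k) S.≈ Q ^ k * s k) →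
      ∑² n (λ k d → B k d * s (suc k)) * (1# + c) S.≈ ∑² (suc n) (λ k d → B k d * s k)
    step₂ n c s h = begin
      X * (1# + c) ≈⟨ S.solve 2 (λ x c → x ⊗ (Κ 1ℤ ⊕ c) S.⊜ x ⊕ c ⊗ x) S.refl X c ⟩
      X + c * X ≈⟨ S.+-congˡ {X} (S.trans (S.sym (S.∑²-*ˡ n c _)) (∑²-cong n (λ k d p → S.trans
          (S.solve 3 (λ c b s → c ⊗ (b ⊗ s) S.⊜ b ⊗ (c ⊗ s)) S.refl c (B k d) (s (suc k))) (S.*-congˡ {B k d} (h k d p))))) ⟩
      X + ∑² n (λ k d → B k d * (Q ^ k * s k)) ≈⟨ split n _ _ _ pas ⟨
      ∑² (suc n) (λ k d → B k d * s k) ∎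
      where
      open S.Rsn
      X = ∑² n (λ k d → B k d * s (suc k))
      pas : ∀ k d → k ℕ.+ d ≡ suc n → B k d * s k S.≈ first (λ k d → B k d * s (suc k)) k d + second (λ k d → B k d * (Q ^ k * s k)) k d
      pas zero (suc d) _ = S.solve 1 (λ s → Κ 1ℤ ⊗ s S.⊜ Κ (+ 0) ⊕ Κ 1ℤ ⊗ (Κ 1ℤ ⊗ s)) S.refl (s 0)
      pas (suc k) zero _ = S.trans (S.*-congʳ {s (suc k)} (S.sym (B0 k))) (S.sym (S.+-identityʳ (B k 0 * s (suc k))))
      pas (suc k) (suc d) _ = S.solve 4 (λ b y c s → (b ⊕ y ⊗ c) ⊗ s S.⊜ b ⊗ s ⊕ c ⊗ (y ⊗ s)) S.refl (B k (suc d)) (Q ^ suc k) (B (suc k) d) (s (suc k))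

  powers : PS → PS → ℕ → PS
  powers Q a zero = 1#
  powers Q a (suc n) = a * Q ^ n * powers Q a n

  -- theta-term Q a b j = a^{j(j+1)/2} b^{j(j-1)/2} when Q = ab.
  theta-term : PS → PS → PS → ℤ → PS
  theta-term Q a b (+ n) = powers Q a n
  theta-term Q a b -[1+ n ] = powers Q b (suc n)

  module _ (Q a b : PS) (ab : a * b S.≈ Q) (Q0 : Q 0 A.≈ A.0#) where
    private
      B = binom Q
      P = poch Q
      t = theta-term Q a b

      powers-order : ∀ c n → powers Q c (suc n) ≈[ n ] 0#
      powers-order c n = []-trans ([]-* ([]-* ([]-refl {f = c}) (Q^-order Q Q0 n)) ([]-refl {f = powers Q c n}))
        (≋⇒≈[] (S.solve 2 (λ c p → c ⊗ Κ (+ 0) ⊗ p S.⊜ Κ (+ 0)) S.refl c (powers Q c n)))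

      Q^+ : ∀ i j x → Q ^ (i ℕ.+ j) * x S.≈ Q ^ i * (Q ^ j * x)
      Q^+ i j x = S.trans (S.*-congʳ {x} (S.^-homo-* Q i j)) (S.*-assoc (Q ^ i) (Q ^ j) x)

      t-pos : ∀ m j → t ((m ℕ.+ j) ℤ.⊖ m) ≡ powers Q a j
      t-pos m j = ≡.cong t (≡.trans (ℤP.⊖-≥ (ℕP.m≤m+n m j)) (≡.cong +_ (ℕP.m+n∸m≡n m j)))

      t-neg : ∀ k j → t (k ℤ.⊖ (k ℕ.+ j)) ≡ powers Q b j
      t-neg k j = ≡.trans (≡.cong t (≡.trans (ℤP.⊖-≤ (ℕP.m≤m+n k j)) (≡.cong (λ i → ℤ.- (+ i)) (ℕP.m+n∸m≡n k j)))) (neg j)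
        where neg : ∀ j → t (ℤ.- (+ j)) ≡ powers Q b j
              neg zero = ≡.refl
              neg (suc j) = ≡.refl

      data Cmp (m : ℕ) : ℕ → Set where
        ge : ∀ j → Cmp m (m ℕ.+ j)
        lt : ∀ k j → m ≡ k ℕ.+ suc j → Cmp m k

      cmp : ∀ m k → Cmp m k
      cmp m k with ℕP.≤-<-connex m k
      ... | inj₁ m≤k = ≡.subst (Cmp m) (ℕP.m+[n∸m]≡n m≤k) (ge (k ∸ m))
      ... | inj₂ k<m = lt k (m ∸ suc k) (≡.sym (≡.trans (ℕP.+-suc k _) (ℕP.m+[n∸m]≡n k<m)))

      -- Consecutive theta terms satisfy t(j+1) = a Q^j t(j), for negative j thanks to ab = Q. With
      -- j = k - m this is the hypothesis of `step₁`; the factor Q^d on the right keeps all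
      -- exponents natural.
      up : ∀ m k d → k ℕ.+ d ≡ m ℕ.+ m → a * Q ^ m * t (k ℤ.⊖ m) S.≈ Q ^ d * t (suc k ℤ.⊖ m)
      up m k d p with cmp m k
      ... | ge j = begin
        a * Q ^ m * t ((m ℕ.+ j) ℤ.⊖ m) ≡⟨ ≡.cong₂ (λ i u → a * Q ^ i * u) m≡ (t-pos m j) ⟩
        a * Q ^ (d ℕ.+ j) * u ≈⟨ S.*-congʳ {u} (S.*-congˡ {a} (S.^-homo-* Q d j)) ⟩
        a * (Q ^ d * Q ^ j) * u ≈⟨ S.solve 4 (λ a x y z → a ⊗ (x ⊗ y) ⊗ z S.⊜ x ⊗ (a ⊗ y ⊗ z)) S.refl a (Q ^ d) (Q ^ j) u ⟩
        Q ^ d * powers Q a (suc j) ≡⟨ ≡.cong (Q ^ d *_) (≡.trans (≡.cong (λ i → t (i ℤ.⊖ m)) (≡.sym (ℕP.+-suc m j))) (t-pos m (suc j))) ⟨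
        Q ^ d * t (suc (m ℕ.+ j) ℤ.⊖ m) ∎
        where
        open S.Rsn
        u = powers Q a j
        m≡ : m ≡ d ℕ.+ j
        m≡ = ≡.trans (ℕP.+-cancelˡ-≡ m m (j ℕ.+ d) (≡.trans (≡.sym p) (ℕP.+-assoc m j d))) (ℕP.+-comm j d)
      ... | lt .k j ≡.refl = begin
        a * Q ^ (k ℕ.+ suc j) * t (k ℤ.⊖ (k ℕ.+ suc j)) ≡⟨ ≡.cong (a * Q ^ (k ℕ.+ suc j) *_) (t-neg k (suc j)) ⟩
        a * Q ^ (k ℕ.+ suc j) * (b * Q ^ j * u) ≈⟨ S.solve 5 (λ a b x y z → a ⊗ x ⊗ (b ⊗ y ⊗ z) S.⊜ (a ⊗ b) ⊗ x ⊗ y ⊗ z) S.refl a b (Q ^ (k ℕ.+ suc j)) (Q ^ j) u ⟩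
        a * b * Q ^ (k ℕ.+ suc j) * Q ^ j * u ≈⟨ S.*-congʳ {u} (S.*-congʳ {Q ^ j} (S.*-congʳ {Q ^ (k ℕ.+ suc j)} ab)) ⟩
        Q * Q ^ (k ℕ.+ suc j) * Q ^ j * u ≈⟨ S.*-congʳ {u} (S.*-congʳ {Q ^ j} (S.sym (S.^-suc Q (k ℕ.+ suc j)))) ⟩
        Q ^ suc (k ℕ.+ suc j) * Q ^ j * u ≈⟨ S.*-congʳ {u} (S.sym (S.^-homo-* Q (suc (k ℕ.+ suc j)) j)) ⟩
        Q ^ (suc (k ℕ.+ suc j) ℕ.+ j) * u ≡⟨ ≡.cong₂ (λ i u → Q ^ i * u) (≡.sym d≡) (≡.sym tt′) ⟩
        Q ^ d * t (suc k ℤ.⊖ (k ℕ.+ suc j)) ∎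
        where
        open S.Rsn
        u = powers Q b j
        d≡ : d ≡ suc (k ℕ.+ suc j) ℕ.+ j
        d≡ = ℕP.+-cancelˡ-≡ k d _ (≡.trans p (≡.trans (ℕP.+-assoc k (suc j) _) (≡.cong (k ℕ.+_) (≡.cong suc (≡.trans (ℕP.+-comm j _) (≡.trans (≡.cong (ℕ._+ j) (ℕP.+-suc k j)) (≡.cong (ℕ._+ j) (≡.sym (ℕP.+-suc k j)))))))))
        tt′ : t (suc k ℤ.⊖ (k ℕ.+ suc j)) ≡ u
        tt′ = ≡.trans (≡.cong (λ i → t (suc k ℤ.⊖ i)) (ℕP.+-suc k j)) (t-neg (suc k) j)

      down : ∀ m k d → k ℕ.+ d ≡ suc (m ℕ.+ m) → b * Q ^ m * t (k ℤ.⊖ m) S.≈ Q ^ k * t (k ℤ.⊖ suc m)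
      down m k d p with cmp m k
      ... | lt .k j ≡.refl = begin
        b * Q ^ (k ℕ.+ suc j) * t (k ℤ.⊖ (k ℕ.+ suc j)) ≡⟨ ≡.cong (b * Q ^ (k ℕ.+ suc j) *_) (t-neg k (suc j)) ⟩
        b * Q ^ (k ℕ.+ suc j) * u ≈⟨ S.*-congʳ {u} (S.*-congˡ {b} (S.^-homo-* Q k (suc j))) ⟩
        b * (Q ^ k * Q ^ suc j) * u ≈⟨ S.solve 4 (λ a x y z → a ⊗ (x ⊗ y) ⊗ z S.⊜ x ⊗ (a ⊗ y ⊗ z)) S.refl b (Q ^ k) (Q ^ suc j) u ⟩
        Q ^ k * powers Q b (suc (suc j)) ≡⟨ ≡.cong (Q ^ k *_) (≡.trans (≡.cong (λ i → t (k ℤ.⊖ i)) (≡.sym (ℕP.+-suc k (suc j)))) (t-neg k (suc (suc j)))) ⟨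
        Q ^ k * t (k ℤ.⊖ suc (k ℕ.+ suc j)) ∎
        where
        open S.Rsn
        u = powers Q b (suc j)
      ... | ge zero = begin
        b * Q ^ m * t ((m ℕ.+ 0) ℤ.⊖ m) ≡⟨ ≡.cong (b * Q ^ m *_) (t-pos m 0) ⟩
        b * Q ^ m * 1# ≈⟨ S.solve 2 (λ b x → b ⊗ x ⊗ Κ 1ℤ S.⊜ x ⊗ (b ⊗ Κ 1ℤ ⊗ Κ 1ℤ)) S.refl b (Q ^ m) ⟩
        Q ^ m * powers Q b 1 ≡⟨ ≡.cong₂ (λ i u → Q ^ i * u) (≡.sym (ℕP.+-identityʳ m)) (≡.sym (≡.trans (≡.cong (λ i → t (m ℕ.+ 0 ℤ.⊖ i)) (≡.trans (≡.cong suc (≡.sym (ℕP.+-identityʳ m))) (ℕP.+-comm 1 (m ℕ.+ 0)))) (t-neg (m ℕ.+ 0) 1))) ⟩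
        Q ^ (m ℕ.+ 0) * t ((m ℕ.+ 0) ℤ.⊖ suc m) ∎
        where open S.Rsn
      ... | ge (suc j) = begin
        b * Q ^ m * t ((m ℕ.+ suc j) ℤ.⊖ m) ≡⟨ ≡.cong (b * Q ^ m *_) (t-pos m (suc j)) ⟩
        b * Q ^ m * (a * Q ^ j * u) ≈⟨ S.solve 5 (λ a b x y z → b ⊗ x ⊗ (a ⊗ y ⊗ z) S.⊜ (a ⊗ b) ⊗ (x ⊗ y) ⊗ z) S.refl a b (Q ^ m) (Q ^ j) u ⟩
        a * b * (Q ^ m * Q ^ j) * u ≈⟨ S.*-congʳ {u} (S.*-cong ab (S.sym (S.^-homo-* Q m j))) ⟩
        Q * Q ^ (m ℕ.+ j) * u ≈⟨ S.*-congʳ {u} (S.sym (S.^-suc Q (m ℕ.+ j))) ⟩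
        Q ^ suc (m ℕ.+ j) * u ≡⟨ ≡.cong₂ (λ i u → Q ^ i * u) (≡.sym (ℕP.+-suc m j)) (≡.sym (≡.trans (≡.cong (λ i → t (i ℤ.⊖ suc m)) (ℕP.+-suc m j)) (t-pos (suc m) j))) ⟩
        Q ^ (m ℕ.+ suc j) * t ((m ℕ.+ suc j) ℤ.⊖ suc m) ∎
        where
        open S.Rsn
        u = powers Q a j

    pair : ℕ → PS
    pair i = (1# + a * Q ^ i) * (1# + b * Q ^ i)

    -- Induction on m: the factor 1 + aQ^m extends the sum upwards by `step₁`, the factor 1 + bQ^m
    -- extends it downwards by `step₂`.
    finite-triple : ∀ m → ∏ m pair S.≈ ∑² (m ℕ.+ m) (λ k d → B k d * t (k ℤ.⊖ m))
    finite-triple zero = S.sym (S.*-identityˡ 1#)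
    finite-triple (suc m) = begin
      ∏ m pair * ((1# + a * Q ^ m) * (1# + b * Q ^ m))
        ≈⟨ S.*-congʳ {pair m} (finite-triple m) ⟩
      X * ((1# + a * Q ^ m) * (1# + b * Q ^ m))
        ≈⟨ S.*-assoc X (1# + a * Q ^ m) (1# + b * Q ^ m) ⟨
      X * (1# + a * Q ^ m) * (1# + b * Q ^ m)
        ≈⟨ S.*-congʳ {1# + b * Q ^ m} (step₁ Q Q0 (m ℕ.+ m) (a * Q ^ m) (λ k → t (k ℤ.⊖ m)) (up m)) ⟩
      ∑² (suc (m ℕ.+ m)) (λ k d → B k d * t (k ℤ.⊖ m)) * (1# + b * Q ^ m)
        ≈⟨ S.*-congʳ {1# + b * Q ^ m} (∑²-cong (suc (m ℕ.+ m)) (λ k d _ → S.*-congˡ {B k d} (S.≡⇒≈ (≡.cong t (≡.sym (ℤP.[1+m]⊖[1+n]≡m⊖n k m)))))) ⟩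
      ∑² (suc (m ℕ.+ m)) (λ k d → B k d * t (suc k ℤ.⊖ suc m)) * (1# + b * Q ^ m)
        ≈⟨ step₂ Q Q0 (suc (m ℕ.+ m)) (b * Q ^ m) (λ k → t (k ℤ.⊖ suc m)) (λ k d p → S.trans (S.*-congˡ {b * Q ^ m} (S.≡⇒≈ (≡.cong t (ℤP.[1+m]⊖[1+n]≡m⊖n k m)))) (down m k d p)) ⟩
      ∑² (suc (suc (m ℕ.+ m))) (λ k d → B k d * t (k ℤ.⊖ suc m))
        ≡⟨ ≡.cong (λ n → ∑² (suc n) (λ k d → B k d * t (k ℤ.⊖ suc m))) (ℕP.+-suc m m) ⟨
      ∑² (suc m ℕ.+ suc m) (λ k d → B k d * t (k ℤ.⊖ suc m)) ∎
      where
      open S.Rsn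
      X = ∑² (m ℕ.+ m) (λ k d → B k d * t (k ℤ.⊖ m))

    private
      -- By `poch-binom` the left side is P(m) P(k+d) / (P(k) P(d)), and all four partial products
      -- agree with P(e) modulo q^(e+1).
      close : ∀ e m k d → k ℕ.+ d ≡ m ℕ.+ m → e ≤ k → e ≤ d → e ≤ m → (P m * B k d) ≈[ suc e ] 1#
      close e m k d p ek ed em = cancel[] (P e) (P m * B k d) 1# (poch-unit Q Q0 e)
        ([]-trans ([]-trans ([]-trans (≋⇒≈[] (S.solve 3 (λ x y z → x ⊗ (y ⊗ z) S.⊜ (x ⊗ y) ⊗ z) S.refl (P e) (P m) (B k d)))
          ([]-* ([]-* ([]-sym (st ek)) ([]-trans (st em) ([]-sym (st ed)))) ([]-refl {f = B k d})))
          (≋⇒≈[] (poch-binom Q Q0 k d))) ([]-trans (st (ℕP.≤-trans ek (ℕP.m≤m+n k d))) (≋⇒≈[] (S.sym (S.*-identityʳ (P e))))))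
        where st : ∀ {i} → e ≤ i → P i ≈[ suc e ] P e
              st {i} l = ≡.subst (λ n → P n ≈[ suc e ] P e) (ℕP.m∸n+n≡m l) (poch-stable Q Q0 e (i ∸ e))

      -- Two orders of vanishing add up. With e the smaller of k and d, the factor `P m * B k d` is
      -- 1 only modulo q^(e+1), but when e is far below m the theta term is itself divisible by a
      -- complementary power of q, so the total error has order at least m.
      term : ∀ m k d → k ℕ.+ d ≡ m ℕ.+ m → (P m * (B k d * t (k ℤ.⊖ m))) ≈[ m ] t (k ℤ.⊖ m)
      combine : ∀ e j {m x u} → m ≤ suc e ℕ.+ j → x ≈[ suc e ] 1# → u ≈[ j ] 0# → (x * u) ≈[ m ] u
      combine e j {m} {x} {u} l p r = []-minus (≈[]-weaken l ([]-trans (≋⇒≈[] (S.solve 2 (λ x u → x ⊗ u S.⊖ u S.⊜ (x S.⊖ Κ 1ℤ) ⊗ u) S.refl x u))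
        (order-* (suc e) j (minus-[] p) r)))
      term m k d p = []-trans (≋⇒≈[] (S.sym (S.*-assoc (P m) (B k d) (t (k ℤ.⊖ m))))) (go (cmp m k))
        where
        ord : ∀ c j → powers Q c j ≈[ j ∸ 1 ] 0#
        ord c zero i ()
        ord c (suc j) = powers-order c j
        go : Cmp m k → (P m * B k d * t (k ℤ.⊖ m)) ≈[ m ] t (k ℤ.⊖ m)
        go (ge j) rewrite t-pos m j = combine d (j ∸ 1) (≡.subst (_≤ suc d ℕ.+ (j ∸ 1)) (≡.sym m≡) (ineq j)) (close d m _ d p (ℕP.≤-trans d≤m (ℕP.m≤m+n m j)) ℕP.≤-refl d≤m) (ord a j)
          where
          m≡ : m ≡ d ℕ.+ j
          m≡ = ≡.trans (ℕP.+-cancelˡ-≡ m m (j ℕ.+ d) (≡.trans (≡.sym p) (ℕP.+-assoc m j d))) (ℕP.+-comm j d)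
          d≤m : d ≤ m
          d≤m = ≡.subst (d ≤_) (≡.sym m≡) (ℕP.m≤m+n d j)
          ineq : ∀ j → d ℕ.+ j ≤ suc d ℕ.+ (j ∸ 1)
          ineq zero = ℕP.n≤1+n _
          ineq (suc j) = ℕP.≤-reflexive (ℕP.+-suc d j)
        go (lt .k j ≡.refl) rewrite t-neg k (suc j) = combine k j (ℕP.≤-reflexive (ℕP.+-suc k j)) (close k (k ℕ.+ suc j) k d p ℕP.≤-refl k≤d (ℕP.m≤m+n k _)) (powers-order b j)
          where
          k≤d : k ≤ d
          k≤d = ℕP.≤-trans (ℕP.≤-trans (ℕP.m≤m+n k (suc j)) (ℕP.m≤n+m _ (suc j))) (ℕP.≤-reflexive (≡.sym (ℕP.+-cancelˡ-≡ k d _ (≡.trans p (ℕP.+-assoc k (suc j) _)))))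

    jacobi-triple : ∀ m → (P m * ∏ m pair) ≈[ m ] ∑² (m ℕ.+ m) (λ k d → t (k ℤ.⊖ m))
    jacobi-triple m i l = A.trans (at (S.trans (S.*-congˡ {P m} (finite-triple m)) (S.sym (S.∑²-*ˡ (m ℕ.+ m) (P m) _))) i)
      (A.trans (∑²-coef (m ℕ.+ m) _ i) (A.trans (A.∑²-cong (m ℕ.+ m) (λ k d p → term m k d p i l)) (A.sym (∑²-coef (m ℕ.+ m) _ i))))

-- The substitution q ↦ q^k and the sections of a series modulo k

module Spread (A : CommutativeRing 0ℓ 0ℓ) (k′ : ℕ) where
  private module A = Ring A
  open Series A
  open S using (_*_; _+_; _-_; -_; 0#; 1#; _^_)

  k : ℕ
  k = suc k′

  private
    -- c zeros, then the entries of f separated by k′ zeros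
    spread : ℕ → PS → PS
    spread zero f zero = f 0
    spread zero f (suc n) = spread k′ (tail f) n
    spread (suc c) f zero = A.0#
    spread (suc c) f (suc n) = spread c f n

    spread-cong : ∀ c {f g} → f ≋ g → ∀ n → spread c f n A.≈ spread c g n
    spread-cong zero e zero = at e 0
    spread-cong zero e (suc n) = spread-cong k′ (mk λ i → at e (suc i)) n
    spread-cong (suc c) e zero = A.refl
    spread-cong (suc c) e (suc n) = spread-cong c e n

    spread-+ : ∀ c f n → spread c f (c ℕ.+ n) ≡ spread 0 f n
    spread-+ zero f n = ≡.refl
    spread-+ (suc c) f n = spread-+ c f n

    spread-< : ∀ c f n → n < c → spread c f n ≡ A.0#
    spread-< (suc c) f zero l = ≡.refl
    spread-< (suc c) f (suc n) (s≤s l) = spread-< c f n l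

    mul-spread-+ : ∀ c f g n → (spread c f * g) (c ℕ.+ n) A.≈ (spread 0 f * g) n
    mul-spread-+ zero f g n = A.refl
    mul-spread-+ (suc c) f g n = A.trans (A.+-congʳ (A.zeroˡ _)) (A.trans (A.+-identityˡ _) (mul-spread-+ c f g n))

    mul-spread-< : ∀ c f g n → n < c → (spread c f * g) n A.≈ A.0#
    mul-spread-< (suc c) f g zero l = A.zeroˡ _
    mul-spread-< (suc c) f g (suc n) (s≤s l) = A.trans (A.+-congʳ (A.zeroˡ _)) (A.trans (A.+-identityˡ _) (mul-spread-< c f g n l))

  -- `V` is the substitution q ↦ q^k, and `U r` below collects the coefficients at exponents
  -- congruent to r modulo k; `U 0` is Atkin's operator.
  V : PS → PS
  V = spread 0

  U : ℕ → PS → PS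
  U r f n = f (n ℕ.* k ℕ.+ r)

  U-cong : ∀ r {f g} → f ≋ g → U r f ≋ U r g
  U-cong r e = mk λ n → at e _

  V-cong : ∀ {f g} → f ≋ g → V f ≋ V g
  V-cong e = mk (spread-cong 0 e)

  V-k : ∀ f n → V f (k ℕ.+ n) ≡ V (tail f) n
  V-k f n = spread-+ k′ (tail f) n

  V-< : ∀ f r → suc r < k → V f (suc r) ≡ A.0#
  V-< f r (s≤s l) = spread-< k′ (tail f) r l

  U0V : ∀ f → U 0 (V f) ≋ f
  U0V f = mk (go f)
    where
    go : ∀ f n → U 0 (V f) n A.≈ f n
    go f zero = A.refl
    go f (suc n) = A.trans (A.reflexive (≡.trans (≡.cong (V f) (ℕP.+-assoc k (n ℕ.* k) 0)) (V-k f _))) (go (tail f) n)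

  UrV : ∀ r f → suc r < k → U (suc r) (V f) ≋ 0#
  UrV r f l = mk (go f)
    where
    go : ∀ f n → U (suc r) (V f) n A.≈ A.0#
    go f zero = A.reflexive (V-< f r l)
    go f (suc n) = A.trans (A.reflexive (≡.trans (≡.cong (V f) (ℕP.+-assoc k (n ℕ.* k) (suc r))) (V-k f _))) (go (tail f) n)

  -- A series in q^k moves exponents only by multiples of k, so it can be taken out of every
  -- section.
  U-*V : ∀ r f g → r < k → U r (f * V g) ≋ U r f * g
  U-*V r f g r<k = mk λ n → A.trans (at (S.*-comm f (V g)) (n ℕ.* k ℕ.+ r)) (A.trans (go n g) (at (S.*-comm g (U r f)) n))
    where
    go : ∀ n g → (V g * f) (n ℕ.* k ℕ.+ r) A.≈ (g * U r f) n
    go zero g = base r r<k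
      where base : ∀ r → r < k → (V g * f) r A.≈ g 0 A.* f r
            base zero _ = A.refl
            base (suc r) (s≤s l) = A.trans (A.+-congˡ (mul-spread-< k′ (tail g) f r l)) (A.+-identityʳ _)
    go (suc n) g = A.+-congˡ (A.trans (A.reflexive (≡.cong (spread k′ (tail g) * f) (ℕP.+-assoc k′ (n ℕ.* k) r))) (A.trans (mul-spread-+ k′ (tail g) f (n ℕ.* k ℕ.+ r)) (go n (tail g))))

  split-index : ∀ n → ∃ λ m → ∃ λ r → r < k × n ≡ m ℕ.* k ℕ.+ r
  split-index zero = 0 , 0 , s≤s z≤n , ≡.refl
  split-index (suc n) with split-index n
  ... | m , r , l , ≡.refl with suc r ℕP.<? k
  ... | yes l′ = m , suc r , l′ , ≡.sym (ℕP.+-suc _ r)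
  ... | no g = suc m , 0 , s≤s z≤n , ≡.trans (≡.trans (≡.sym (ℕP.+-suc _ r)) (≡.trans (ℕP.+-comm (m ℕ.* k) (suc r)) (≡.cong (ℕ._+ m ℕ.* k) (ℕP.≤-antisym l (ℕP.≮⇒≥ g))))) (≡.sym (ℕP.+-identityʳ _))

  U-ext : ∀ {f g} → (∀ r → r < k → U r f ≋ U r g) → f ≋ g
  U-ext {f} {g} e = mk go
    where
    go : ∀ n → f n A.≈ g n
    go n with split-index n
    ... | m , r , l , ≡.refl = at (e r l) m

  V-hom : Hom ring ring
  V-hom = record
    { ⟦_⟧ = V ; cong = V-cong
    ; +-hom = λ f g → mk (plus 0 f g)
    -- Multiplicativity is checked section by section, where `U-*V` applies: only section 0 of a
    -- series in q^k is nonzero.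
    ; *-hom = λ f g → U-ext (λ { zero l → S.trans (U0V (f * g)) (S.sym (S.trans (U-*V 0 (V f) g l) (S.*-congʳ {g} (U0V f))))
                               ; (suc r) l → S.trans (UrV r (f * g) l) (S.sym (S.trans (U-*V (suc r) (V f) g l) (S.trans (S.*-congʳ {g} (UrV r f l)) (S.zeroˡ g)))) })
    ; 1-hom = mk λ { zero → A.refl ; (suc n) → zeros k′ n } }
    where
    plus : ∀ c f g n → spread c (f + g) n A.≈ (spread c f + spread c g) n
    plus zero f g zero = A.refl
    plus zero f g (suc n) = plus k′ (tail f) (tail g) n
    plus (suc c) f g zero = A.sym (A.+-identityˡ _)
    plus (suc c) f g (suc n) = plus c f g n
    zeros : ∀ c n → spread c (tail one) n A.≈ A.0#
    zeros zero zero = A.refl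
    zeros zero (suc n) = zeros k′ n
    zeros (suc c) zero = A.refl
    zeros (suc c) (suc n) = zeros c n

  V-injective : ∀ {f g} → V f ≋ V g → f ≋ g
  V-injective {f} {g} e = S.trans (S.sym (U0V f)) (S.trans (U-cong 0 e) (U0V g))

  V-q : V q ≋ q ^ k
  V-q = U-ext (λ { zero l → S.trans (U0V q) lem₀ ; (suc r) l → S.trans (UrV r q l) (lem₁ r l) })
    where
    qk : ∀ n → (q ^ k) n A.≈ (q ^ k * 1#) n
    qk n = A.sym (at (S.*-identityʳ (q ^ k)) n)
    lem₀ : q ≋ U 0 (q ^ k)
    lem₀ = mk λ { zero → A.sym (A.trans (qk 0) (q^*-< k 1# 0 (s≤s z≤n)))
      ; (suc n) → A.sym (A.trans (qk _) (A.trans (A.reflexive (≡.cong (q ^ k * 1#) (ℕP.+-assoc k (n ℕ.* k) 0))) (A.trans (q^*-+ k 1# _) (A.reflexive (one-n n))))) }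
      where one-n : ∀ n → one (n ℕ.* k ℕ.+ 0) ≡ one n
            one-n zero = ≡.refl
            one-n (suc n) = ≡.refl
    lem₁ : ∀ r → suc r < k → 0# ≋ U (suc r) (q ^ k)
    lem₁ r l = mk λ { zero → A.sym (A.trans (qk _) (q^*-< k 1# _ l))
      ; (suc n) → A.sym (A.trans (qk _) (A.trans (A.reflexive (≡.cong (q ^ k * 1#) (ℕP.+-assoc k (n ℕ.* k) (suc r)))) (A.trans (q^*-+ k 1# _) (A.reflexive (≡.cong one (ℕP.+-suc (n ℕ.* k) r)))))) }

  V-[] : ∀ N {f g} → f ≈[ N ] g → V f ≈[ N ] V g
  V-[] N {f} {g} e = go 0 N e
    where
    go : ∀ c N {f g} → f ≈[ N ] g → spread c f ≈[ N ] spread c g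
    go zero (suc N) e zero l = e 0 l
    go zero (suc N) e (suc n) (s≤s l) = go k′ N (λ i l → e (suc i) (s≤s l)) n l
    go (suc c) N e zero l = A.refl
    go (suc c) N e (suc n) l = go c N e n (ℕP.<-trans (ℕP.n<1+n n) l)

  U-q^V : ∀ r f → r < k → U r (q ^ r * V f) ≋ f
  U-q^V r f l = S.trans (U-*V r (q ^ r) f l) (S.trans (S.*-congʳ (mk λ n → A.trans (eq n) (q^*-+′ n))) (S.*-identityˡ f))
    where
    eq : ∀ n → U r (q ^ r) n A.≈ (q ^ r * 1#) (n ℕ.* k ℕ.+ r)
    eq n = A.sym (at (S.*-identityʳ (q ^ r)) _)
    q^*-+′ : ∀ n → (q ^ r * 1#) (n ℕ.* k ℕ.+ r) A.≈ one n
    q^*-+′ zero = A.trans (A.reflexive (≡.cong (q ^ r * 1#) (≡.sym (ℕP.+-identityʳ r)))) (q^*-+ r 1# 0)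
    q^*-+′ (suc n) = A.trans (A.reflexive (≡.cong (q ^ r * 1#) (ℕP.+-comm (suc n ℕ.* k) r))) (q^*-+ r 1# _)

  U-q^V-≢ : ∀ r s f → r < k → s < k → ¬ r ≡ s → U r (q ^ s * V f) ≋ 0#
  U-q^V-≢ r s f l l′ r≢s = S.trans (U-*V r (q ^ s) f l) (S.trans (S.*-congʳ {f} zer) (S.zeroˡ f))
    where
    aux : ∀ n → ¬ n ≡ s → (q ^ s) n A.≈ A.0#
    aux n n≢s with ℕP.<-cmp n s
    ... | Relation.Binary.tri< a _ _ = A.trans (A.sym (at (S.*-identityʳ (q ^ s)) n)) (q^*-< s 1# n a)
    ... | Relation.Binary.tri≈ _ b _ = ⊥-elim (n≢s b)
    ... | Relation.Binary.tri> _ _ c = A.trans (A.sym (at (S.*-identityʳ (q ^ s)) n)) (A.trans (A.reflexive (≡.cong (q ^ s * 1#) (≡.sym (≡.trans (ℕP.+-suc s _) (ℕP.m+[n∸m]≡n c))))) (q^*-+ s 1# (suc (n ∸ suc s))))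
    zer : U r (q ^ s) ≋ 0#
    zer = mk λ n → aux _ (λ e → r≢s (bad n e))
      where
      bad : ∀ n → n ℕ.* k ℕ.+ r ≡ s → r ≡ s
      bad zero e = e
      bad (suc n) e = ⊥-elim (ℕP.<⇒≱ l′ (≡.subst (k ≤_) e (ℕP.≤-trans (ℕP.m≤m+n k _) (ℕP.m≤m+n _ r))))

module MapSeries {A B : CommutativeRing 0ℓ 0ℓ} (φ : Hom A B) where
  private
    module A = Ring A
    module B = Ring B
    module SA = Series A
    module SB = Series B
    module φ = Hom φ

  ∑²-hom : ∀ n F → φ.⟦ A.∑² n F ⟧ B.≈ B.∑² n (λ k d → φ.⟦ F k d ⟧)
  ∑²-hom zero F = B.refl
  ∑²-hom (suc n) F = B.trans (φ.+-hom _ _) (B.+-congˡ (∑²-hom n _))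

  map : Hom SA.ring SB.ring
  map = record
    { ⟦_⟧ = λ f n → φ.⟦ f n ⟧ ; cong = λ e → SB.mk λ n → φ.cong (SA.at e n) ; +-hom = λ _ _ → SB.mk λ _ → φ.+-hom _ _
    ; *-hom = λ f g → SB.mk λ n → B.trans (∑²-hom n _) (B.∑²-cong n (λ _ _ _ → φ.*-hom _ _))
    ; 1-hom = SB.mk λ { zero → φ.1-hom ; (suc _) → φ.0-hom } }

  map-q : Hom.⟦ map ⟧ SA.q SB.≋ SB.q
  map-q = SB.mk λ { zero → φ.0-hom ; (suc zero) → φ.1-hom ; (suc (suc n)) → φ.0-hom }

module ℤS = Data.Integer.Solver.+-*-Solver

-- Quadratic extensions and a fifth root of unity

-- A[x] / (x² - s x + p)
module Quad (A : CommutativeRing 0ℓ 0ℓ) (s p : CommutativeRing.Carrier A) where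
  private module A = Ring A

  Carrier : Set
  Carrier = A.Carrier × A.Carrier

  _≈_ : Carrier → Carrier → Set
  (a , b) ≈ (c , d) = a A.≈ c × b A.≈ d

  _*_ : Carrier → Carrier → Carrier
  (a , b) * (c , d) = a A.* c A.- p A.* (b A.* d) , a A.* d A.+ b A.* c A.+ s A.* (b A.* d)

  private
    comm : ∀ x y → (x * y) ≈ (y * x)
    comm (a , b) (c , d) =
      A.solve 5 (λ a b c d p → a ⊗ c A.⊖ p ⊗ (b ⊗ d) A.⊜ c ⊗ a A.⊖ p ⊗ (d ⊗ b)) A.refl a b c d p ,
      A.solve 5 (λ a b c d s → a ⊗ d ⊕ b ⊗ c ⊕ s ⊗ (b ⊗ d) A.⊜ c ⊗ b ⊕ d ⊗ a ⊕ s ⊗ (d ⊗ b)) A.refl a b c d s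

    idˡ : ∀ x → ((A.1# , A.0#) * x) ≈ x
    idˡ (a , b) =
      A.solve 3 (λ a b p → Κ 1ℤ ⊗ a A.⊖ p ⊗ (Κ 0ℤ ⊗ b) A.⊜ a) A.refl a b p ,
      A.solve 3 (λ a b s → Κ 1ℤ ⊗ b ⊕ Κ 0ℤ ⊗ a ⊕ s ⊗ (Κ 0ℤ ⊗ b) A.⊜ b) A.refl a b s

    distribʳ : ∀ x y z → (((proj₁ y A.+ proj₁ z) , (proj₂ y A.+ proj₂ z)) * x) ≈ ((proj₁ (y * x) A.+ proj₁ (z * x)) , (proj₂ (y * x) A.+ proj₂ (z * x)))
    distribʳ (a , b) (c , d) (e , f) =
      A.solve 7 (λ a b c d e f p → (c ⊕ e) ⊗ a A.⊖ p ⊗ ((d ⊕ f) ⊗ b) A.⊜ (c ⊗ a A.⊖ p ⊗ (d ⊗ b)) ⊕ (e ⊗ a A.⊖ p ⊗ (f ⊗ b))) A.refl a b c d e f p ,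
      A.solve 7 (λ a b c d e f s → (c ⊕ e) ⊗ b ⊕ (d ⊕ f) ⊗ a ⊕ s ⊗ ((d ⊕ f) ⊗ b) A.⊜ (c ⊗ b ⊕ d ⊗ a ⊕ s ⊗ (d ⊗ b)) ⊕ (e ⊗ b ⊕ f ⊗ a ⊕ s ⊗ (f ⊗ b))) A.refl a b c d e f s

    assoc : ∀ x y z → ((x * y) * z) ≈ (x * (y * z))
    assoc (a , b) (c , d) (e , f) =
      A.solve 8 (λ a b c d e f s p → (a ⊗ c A.⊖ p ⊗ (b ⊗ d)) ⊗ e A.⊖ p ⊗ ((a ⊗ d ⊕ b ⊗ c ⊕ s ⊗ (b ⊗ d)) ⊗ f) A.⊜
         a ⊗ (c ⊗ e A.⊖ p ⊗ (d ⊗ f)) A.⊖ p ⊗ (b ⊗ (c ⊗ f ⊕ d ⊗ e ⊕ s ⊗ (d ⊗ f)))) A.refl a b c d e f s p ,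
      A.solve 8 (λ a b c d e f s p → (a ⊗ c A.⊖ p ⊗ (b ⊗ d)) ⊗ f ⊕ (a ⊗ d ⊕ b ⊗ c ⊕ s ⊗ (b ⊗ d)) ⊗ e ⊕ s ⊗ ((a ⊗ d ⊕ b ⊗ c ⊕ s ⊗ (b ⊗ d)) ⊗ f) A.⊜
         a ⊗ (c ⊗ f ⊕ d ⊗ e ⊕ s ⊗ (d ⊗ f)) ⊕ b ⊗ (c ⊗ e A.⊖ p ⊗ (d ⊗ f)) ⊕ s ⊗ (b ⊗ (c ⊗ f ⊕ d ⊗ e ⊕ s ⊗ (d ⊗ f)))) A.refl a b c d e f s p

    trans : ∀ {x y z} → x ≈ y → y ≈ z → x ≈ z
    trans (e , f) (g , h) = A.trans e g , A.trans f h

  ring : CommutativeRing 0ℓ 0ℓ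
  ring = record
    { Carrier = Carrier ; _≈_ = _≈_ ; _+_ = λ x y → proj₁ x A.+ proj₁ y , proj₂ x A.+ proj₂ y ; _*_ = _*_
    ; -_ = λ x → A.- proj₁ x , A.- proj₂ x ; 0# = A.0# , A.0# ; 1# = A.1# , A.0#
    ; isCommutativeRing = record
      { isRing = record
        { +-isAbelianGroup = record
          { isGroup = record
            { isMonoid = record
              { isSemigroup = record
                { isMagma = record
                  { isEquivalence = record { refl = A.refl , A.refl ; sym = λ (e , f) → A.sym e , A.sym f ; trans = trans }
                  ; ∙-cong = λ (e , f) (g , h) → A.+-cong e g , A.+-cong f h }
                ; assoc = λ _ _ _ → A.+-assoc _ _ _ , A.+-assoc _ _ _ }
              ; identity = (λ _ → A.+-identityˡ _ , A.+-identityˡ _) , (λ _ → A.+-identityʳ _ , A.+-identityʳ _) }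
            ; inverse = (λ _ → A.-‿inverseˡ _ , A.-‿inverseˡ _) , (λ _ → A.-‿inverseʳ _ , A.-‿inverseʳ _)
            ; ⁻¹-cong = λ (e , f) → A.-‿cong e , A.-‿cong f }
          ; comm = λ _ _ → A.+-comm _ _ , A.+-comm _ _ }
        ; *-cong = λ (e , f) (g , h) → A.+-cong (A.*-cong e g) (A.-‿cong (A.*-congˡ (A.*-cong f h))) , A.+-cong (A.+-cong (A.*-cong e h) (A.*-cong f g)) (A.*-congˡ (A.*-cong f h))
        ; *-assoc = assoc
        ; *-identity = idˡ , (λ x → trans (comm x _) (idˡ x))
        ; distrib = (λ x y z → trans (comm x _) (trans (distribʳ x y z) (A.+-cong (proj₁ (comm y x)) (proj₁ (comm z x)) , A.+-cong (proj₂ (comm y x)) (proj₂ (comm z x))))) , distribʳ }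
      ; *-comm = comm } }

  embed : Hom A ring
  embed = record
    { ⟦_⟧ = λ a → a , A.0# ; cong = λ e → e , A.refl ; +-hom = λ _ _ → A.refl , A.sym (A.+-identityˡ _)
    ; *-hom = λ a b → A.solve 3 (λ a b p → a ⊗ b A.⊜ a ⊗ b A.⊖ p ⊗ (Κ 0ℤ ⊗ Κ 0ℤ)) A.refl a b p ,
        A.solve 3 (λ a b s → Κ 0ℤ A.⊜ a ⊗ Κ 0ℤ ⊕ Κ 0ℤ ⊗ b ⊕ s ⊗ (Κ 0ℤ ⊗ Κ 0ℤ)) A.refl a b s
    ; 1-hom = A.refl , A.refl }

  root : Carrier
  root = A.0# , A.1#

  root² : (root * root) ≈ (A.- p , s)
  root² = A.solve 1 (λ p → Κ 0ℤ ⊗ Κ 0ℤ A.⊖ p ⊗ (Κ 1ℤ ⊗ Κ 1ℤ) A.⊜ ⊝ p) A.refl p ,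
          A.solve 1 (λ s → Κ 0ℤ ⊗ Κ 1ℤ ⊕ Κ 1ℤ ⊗ Κ 0ℤ ⊕ s ⊗ (Κ 1ℤ ⊗ Κ 1ℤ) A.⊜ s) A.refl s

-- Here τ plays the part of ζ + 1/ζ. Modulo τ² + τ - 1, the fifth cyclotomic polynomial factors as
-- (x² - τx + 1)(x² + (1+τ)x + 1), and ζ is a root of the first factor.
cyclotomic-sum : (R : CommutativeRing 0ℓ 0ℓ) (let open Ring R) → ∀ ζ τ → ζ * ζ ≈ τ * ζ - 1# → τ * τ ≈ 1# - τ →
  1# + ζ + ζ ^ 2 + ζ ^ 3 + ζ ^ 4 ≈ 0#
cyclotomic-sum R ζ τ ζ² τ² = begin
  1# + ζ + ζ ^ 2 + ζ ^ 3 + ζ ^ 4 ≈⟨ solve 2 (λ z t → Κ 1ℤ ⊕ z ⊕ z ⊛ 2 ⊕ z ⊛ 3 ⊕ z ⊛ 4 ⊜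
      (z ⊗ z ⊖ (t ⊗ z ⊖ Κ 1ℤ)) ⊗ (z ⊗ z ⊕ (Κ 1ℤ ⊕ t) ⊗ z ⊕ Κ 1ℤ) ⊖ ((Κ 1ℤ ⊖ t) ⊖ t ⊗ t) ⊗ (z ⊗ z)) refl ζ τ ⟩
  (ζ * ζ - (τ * ζ - 1#)) * (ζ * ζ + (1# + τ) * ζ + 1#) - ((1# - τ) - τ * τ) * (ζ * ζ)
    ≈⟨ +-cong (*-congʳ (null ζ²)) (-‿cong (*-congʳ (null (sym τ²)))) ⟩
  0# * (ζ * ζ + (1# + τ) * ζ + 1#) - 0# * (ζ * ζ)
    ≈⟨ solve 2 (λ x y → Κ 0ℤ ⊗ x ⊖ Κ 0ℤ ⊗ y ⊜ Κ 0ℤ) refl _ _ ⟩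
  0# ∎
  where
  open Ring R
  open Rsn
  null : ∀ {x y} → x ≈ y → x - y ≈ 0#
  null e = trans (+-congʳ e) (-‿inverseʳ _)

-- A[ζ] with ζ² = τζ - 1 and τ² = 1 - τ, so that 1 + ζ + ζ² + ζ³ + ζ⁴ = 0.
module Cyclotomic (A : CommutativeRing 0ℓ 0ℓ) where
  private
    module A = Ring A
    module T = Quad A (A.- A.1#) (A.- A.1#)
    module TR = Ring T.ring
    module Z = Quad T.ring T.root TR.1#

  ring : CommutativeRing 0ℓ 0ℓ
  ring = Z.ring
  module R = Ring ring
  open R using (_≈_; _*_; _+_; 0#; 1#; _^_)

  embed : Hom A ring
  embed = record
    { ⟦_⟧ = λ a → (a , A.0#) , (A.0# , A.0#)
    ; cong = λ e → (e , A.refl) , A.refl , A.refl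
    ; +-hom = λ a b → R.trans (Hom.cong Z.embed (Hom.+-hom T.embed a b)) (Hom.+-hom Z.embed _ _)
    ; *-hom = λ a b → R.trans (Hom.cong Z.embed (Hom.*-hom T.embed a b)) (Hom.*-hom Z.embed _ _)
    ; 1-hom = R.refl }

  -- Elements of A[ζ] are quadruples over A, with A in the first coordinate. Identities proved with
  -- the help of ζ therefore descend to A, for every A.
  embed-injective : ∀ {a b} → Hom.⟦ embed ⟧ a ≈ Hom.⟦ embed ⟧ b → a A.≈ b
  embed-injective ((e , _) , _) = e

  ζ : R.Carrier
  ζ = Z.root

  ζ-sum : 1# + ζ + ζ ^ 2 + ζ ^ 3 + ζ ^ 4 ≈ 0#
  ζ-sum = cyclotomic-sum ring ζ τ ζ² τ²
    where
    open R using (_-_)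
    τ : R.Carrier
    τ = T.root , TR.0#
    τ² : τ * τ ≈ 1# - τ
    τ² = R.trans (R.sym (Hom.*-hom Z.embed T.root T.root)) (R.trans (Hom.cong Z.embed {T.root TR.* T.root} {TR.1# TR.- T.root} (TR.trans {T.root TR.* T.root} {_} {TR.1# TR.- T.root} T.root² (A.solve 0 (⊝ (⊝ Κ 1ℤ) A.⊜ Κ 1ℤ A.⊖ Κ 0ℤ) A.refl , A.solve 0 (⊝ Κ 1ℤ A.⊜ Κ 0ℤ A.⊖ Κ 1ℤ) A.refl)))
       (R.trans (Hom.+-hom Z.embed TR.1# (TR.- T.root)) (R.+-congˡ {1#} (Hom.neg-hom Z.embed T.root))))
    ζ² : ζ * ζ ≈ τ * ζ - 1#
    ζ² = R.trans Z.root² (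
      TR.solve 1 (λ t → ⊝ Κ 1ℤ TR.⊜ (t ⊗ Κ 0ℤ TR.⊖ Κ 1ℤ ⊗ (Κ 0ℤ ⊗ Κ 1ℤ)) TR.⊖ Κ 1ℤ) TR.refl T.root ,
      TR.solve 1 (λ t → t TR.⊜ (t ⊗ Κ 1ℤ ⊕ Κ 0ℤ ⊗ Κ 0ℤ ⊕ t ⊗ (Κ 0ℤ ⊗ Κ 1ℤ)) TR.⊖ Κ 0ℤ) TR.refl T.root)

-- Laurent polynomials and their constant terms

module Laurent (A : CommutativeRing 0ℓ 0ℓ) where
  private module A = Ring A
  open A using (sumL)

  -- Lists of exponent-coefficient pairs, with repetitions allowed. Equality compares collected
  -- coefficients, so no normal form and no decision of zero in A is involved.
  Carrier : Set
  Carrier = List (ℤ × A.Carrier)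

  δ : ℤ → ℤ → A.Carrier → A.Carrier
  δ e j c with e ℤ.≟ j
  ... | yes _ = c
  ... | no _ = A.0#

  coef : Carrier → ℤ → A.Carrier
  coef l j = sumL l (λ (e , c) → δ e j c)

  infix 4 _≈_
  record _≈_ (l m : Carrier) : Set where
    constructor mk
    field at : ∀ j → coef l j A.≈ coef m j
  open _≈_

  shift : ℤ → A.Carrier → ℤ × A.Carrier → ℤ × A.Carrier
  shift e c (f , d) = e ℤ.+ f , c A.* d

  mul : Carrier → Carrier → Carrier
  mul [] m = []
  mul ((e , c) ∷ l) m = List.map (shift e c) m List.++ mul l m

  private
    δ-yes : ∀ {e j} c → e ≡ j → δ e j c ≡ c
    δ-yes {e} {j} c p with e ℤ.≟ j
    ... | yes _ = ≡.refl
    ... | no n = ⊥-elim (n p)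

    δ-no : ∀ {e j} c → ¬ e ≡ j → δ e j c ≡ A.0#
    δ-no {e} {j} c p with e ℤ.≟ j
    ... | yes y = ⊥-elim (p y)
    ... | no _ = ≡.refl

    δ-iff : ∀ {e j e′ j′ c c′} → (e ≡ j → e′ ≡ j′) → (e′ ≡ j′ → e ≡ j) → c A.≈ c′ → δ e j c A.≈ δ e′ j′ c′
    δ-iff {e} {j} {e′} {j′} {c} {c′} to from cc with e ℤ.≟ j
    ... | yes p = A.trans cc (A.reflexive (≡.sym (δ-yes c′ (to p))))
    ... | no n = A.reflexive (≡.sym (δ-no c′ (λ p → n (from p))))

    δ-*ˡ : ∀ a e j c → a A.* δ e j c A.≈ δ e j (a A.* c)
    δ-*ˡ a e j c with e ℤ.≟ j
    ... | yes p = A.refl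
    ... | no n = A.zeroʳ a

    δ-+ : ∀ e j c d → δ e j (c A.+ d) A.≈ δ e j c A.+ δ e j d
    δ-+ e j c d with e ℤ.≟ j
    ... | yes p = A.refl
    ... | no n = A.sym (A.+-identityˡ _)

    δ-cong : ∀ e j {c d} → c A.≈ d → δ e j c A.≈ δ e j d
    δ-cong e j p with e ℤ.≟ j
    ... | yes _ = p
    ... | no _ = A.refl

    move : ∀ e f j → e ℤ.+ f ≡ j → f ≡ j ℤ.- e
    move e f j ≡.refl = ℤS.solve 2 (λ e f → f ℤS.:= (e ℤS.:+ f) ℤS.:- e) ≡.refl e f

    move′ : ∀ e f j → f ≡ j ℤ.- e → e ℤ.+ f ≡ j
    move′ e f j ≡.refl = ℤS.solve 2 (λ e j → e ℤS.:+ (j ℤS.:- e) ℤS.:= j) ≡.refl e j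

    coef-++ : ∀ l m j → coef (l List.++ m) j A.≈ coef l j A.+ coef m j
    coef-++ l m j = A.sumL-++ l m _

    sumL-mul : ∀ l m (F : ℤ × A.Carrier → A.Carrier) → sumL (mul l m) F A.≈ sumL l (λ (e , c) → sumL m (λ x → F (shift e c x)))
    sumL-mul [] m F = A.refl
    sumL-mul ((e , c) ∷ l) m F = A.trans (A.sumL-++ (List.map (shift e c) m) (mul l m) F) (A.+-cong (A.reflexive (A.sumL-map (shift e c) m F)) (sumL-mul l m F))

    coef-mul : ∀ l m j → coef (mul l m) j A.≈ sumL l (λ (e , c) → c A.* coef m (j ℤ.- e))
    coef-mul l m j = A.trans (sumL-mul l m _) (A.sumL-cong l (λ (e , c) → A.trans (A.sumL-cong m (λ (f , d) →
      A.trans (δ-iff (move e f j) (move′ e f j) A.refl) (A.sym (δ-*ˡ c f (j ℤ.- e) d)))) (A.sumL-*ˡ m c _)))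

    comm : ∀ l m → mul l m ≈ mul m l
    comm l m = mk λ j → A.trans (sumL-mul l m _) (A.trans (A.sumL-swap l m _) (A.trans (A.sumL-cong m (λ (f , d) → A.sumL-cong l (λ (e , c) →
      δ-iff (≡.trans (ℤP.+-comm f e)) (≡.trans (ℤP.+-comm e f)) (A.*-comm c d)))) (A.sym (sumL-mul m l _))))

    congʳ : ∀ l {m m′} → m ≈ m′ → mul l m ≈ mul l m′
    congʳ l e = mk λ j → A.trans (coef-mul l _ j) (A.trans (A.sumL-cong l (λ (f , c) → A.*-congˡ (at e (j ℤ.- f)))) (A.sym (coef-mul l _ j)))

    trans : ∀ {l m n} → l ≈ m → m ≈ n → l ≈ n
    trans p r = mk λ j → A.trans (at p j) (at r j)

    *-cong : ∀ {l l′ m m′} → l ≈ l′ → m ≈ m′ → mul l m ≈ mul l′ m′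
    *-cong {l} {l′} {m} {m′} p r = trans (congʳ l r) (trans (comm l m′) (trans (congʳ m′ p) (comm m′ l′)))

    assoc : ∀ l m n → mul (mul l m) n ≈ mul l (mul m n)
    assoc l m n = mk λ j → begin
      coef (mul (mul l m) n) j ≈⟨ coef-mul (mul l m) n j ⟩
      sumL (mul l m) (λ (e , c) → c A.* coef n (j ℤ.- e)) ≈⟨ sumL-mul l m _ ⟩
      sumL l (λ (e , c) → sumL m (λ (f , d) → (c A.* d) A.* coef n (j ℤ.- (e ℤ.+ f))))
        ≈⟨ A.sumL-cong l (λ (e , c) → A.trans (A.sumL-cong m (λ (f , d) → A.trans (A.*-assoc c d _) (A.*-congˡ (A.*-congˡ (A.reflexive (≡.cong (coef n) (assoc-eq j e f)))))))
            (A.trans (A.sumL-*ˡ m c _) (A.*-congˡ (A.sym (coef-mul m n (j ℤ.- e)))))) ⟩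
      sumL l (λ (e , c) → c A.* coef (mul m n) (j ℤ.- e)) ≈⟨ coef-mul l (mul m n) j ⟨
      coef (mul l (mul m n)) j ∎
      where
      open A.Rsn
      assoc-eq : ∀ j e f → j ℤ.- (e ℤ.+ f) ≡ (j ℤ.- e) ℤ.- f
      assoc-eq j e f = ℤS.solve 3 (λ j e f → j ℤS.:- (e ℤS.:+ f) ℤS.:= (j ℤS.:- e) ℤS.:- f) ≡.refl j e f

    neg : Carrier → Carrier
    neg = List.map (λ (e , c) → e , A.- c)

    coef-neg : ∀ l j → coef (neg l) j A.≈ A.- coef l j
    coef-neg [] j = A.sym A.-0#≈0#
    coef-neg ((e , c) ∷ l) j = A.trans (A.+-cong (neg-δ e c) (coef-neg l j)) (A.-‿+-comm _ _)
      where neg-δ : ∀ e c → δ e j (A.- c) A.≈ A.- δ e j c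
            neg-δ e c with e ℤ.≟ j
            ... | yes _ = A.refl
            ... | no _ = A.sym A.-0#≈0#

    idˡ : ∀ l → mul ((0ℤ , A.1#) ∷ []) l ≈ l
    idˡ l = mk λ j → A.trans (coef-mul ((0ℤ , A.1#) ∷ []) l j) (A.trans (A.+-identityʳ _) (A.trans (A.*-identityˡ _) (A.reflexive (≡.cong (coef l) (ℤP.+-identityʳ j)))))

    distribʳ : ∀ n l m → mul (l List.++ m) n ≈ (mul l n List.++ mul m n)
    distribʳ n l m = mk λ j → A.trans (sumL-mul (l List.++ m) n _) (A.trans (A.sumL-++ l m _) (A.sym (A.trans (A.sumL-++ (mul l n) (mul m n) _) (A.+-cong (sumL-mul l n _) (sumL-mul m n _)))))

    ++-cong : ∀ {l l′ m m′} → l ≈ l′ → m ≈ m′ → (l List.++ m) ≈ (l′ List.++ m′)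
    ++-cong {l} {l′} {m} {m′} p r = mk λ j → A.trans (coef-++ l m j) (A.trans (A.+-cong (at p j) (at r j)) (A.sym (coef-++ l′ m′ j)))

    ++-comm : ∀ l m → (l List.++ m) ≈ (m List.++ l)
    ++-comm l m = mk λ j → A.trans (coef-++ l m j) (A.trans (A.+-comm _ _) (A.sym (coef-++ m l j)))

    invˡ : ∀ l → (neg l List.++ l) ≈ []
    invˡ l = mk λ j → A.trans (coef-++ (neg l) l j) (A.trans (A.+-congʳ (coef-neg l j)) (A.-‿inverseˡ _))

    ++-assoc : ∀ l m n → ((l List.++ m) List.++ n) ≈ (l List.++ (m List.++ n))
    ++-assoc l m n = mk λ j → A.trans (A.trans (coef-++ (l List.++ m) n j) (A.+-congʳ (coef-++ l m j))) (A.trans (A.+-assoc _ _ _) (A.sym (A.trans (coef-++ l (m List.++ n) j) (A.+-congˡ (coef-++ m n j)))))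

  ring : CommutativeRing 0ℓ 0ℓ
  ring = record
    { Carrier = Carrier ; _≈_ = _≈_ ; _+_ = List._++_ ; _*_ = mul ; -_ = neg ; 0# = [] ; 1# = (0ℤ , A.1#) ∷ []
    ; isCommutativeRing = record
      { isRing = record
        { +-isAbelianGroup = record
          { isGroup = record
            { isMonoid = record
              { isSemigroup = record
                { isMagma = record
                  { isEquivalence = record { refl = mk λ _ → A.refl ; sym = λ e → mk λ j → A.sym (at e j) ; trans = trans }
                  ; ∙-cong = ++-cong }
                ; assoc = ++-assoc }
              ; identity = (λ _ → mk λ _ → A.refl) , (λ l → mk λ j → A.trans (coef-++ l [] j) (A.+-identityʳ _)) }
            ; inverse = invˡ , (λ l → trans (++-comm l (neg l)) (invˡ l))
            ; ⁻¹-cong = λ {l} {m} e → mk λ j → A.trans (coef-neg l j) (A.trans (A.-‿cong (at e j)) (A.sym (coef-neg m j))) }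
          ; comm = ++-comm }
        ; *-cong = *-cong
        ; *-assoc = assoc
        ; *-identity = idˡ , (λ l → trans (comm l ((0ℤ , A.1#) ∷ [])) (idˡ l))
        ; distrib = (λ n l m → trans (comm n (l List.++ m)) (trans (distribʳ n l m) (++-cong (comm l n) (comm m n)))) , distribʳ }
      ; *-comm = comm } }

  monomial : ℤ → A.Carrier → Carrier
  monomial e c = (e , c) ∷ []

  monomial-* : ∀ e f c d → mul (monomial e c) (monomial f d) ≈ monomial (e ℤ.+ f) (c A.* d)
  monomial-* e f c d = mk λ j → A.refl

  monomial-cong : ∀ e {c d} → c A.≈ d → monomial e c ≈ monomial e d
  monomial-cong e p = mk λ j → A.+-congʳ (δ-cong e j p)

  embed : Hom A ring
  embed = record
    { ⟦_⟧ = monomial 0ℤ ; cong = monomial-cong 0ℤ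
    ; +-hom = λ c d → mk λ j → A.trans (A.+-congʳ (δ-+ 0ℤ j c d)) (A.+-assoc _ _ _)
    ; *-hom = λ c d → mk λ j → A.refl ; 1-hom = mk λ j → A.refl }

  ct : Carrier → A.Carrier
  ct l = coef l 0ℤ

  ct-cong : ∀ {l m} → l ≈ m → ct l A.≈ ct m
  ct-cong e = at e 0ℤ

  ct-+ : ∀ l m → ct (l List.++ m) A.≈ ct l A.+ ct m
  ct-+ l m = coef-++ l m 0ℤ

  ct-* : ∀ c l → ct (mul (monomial 0ℤ c) l) A.≈ c A.* ct l
  ct-* c l = A.trans (coef-mul (monomial 0ℤ c) l 0ℤ) (A.+-identityʳ _)

  ct-monomial-0 : ∀ c → ct (monomial 0ℤ c) A.≈ c
  ct-monomial-0 c = A.+-identityʳ c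

  ct-monomial-≢0 : ∀ e c → ¬ e ≡ 0ℤ → ct (monomial e c) A.≈ A.0#
  ct-monomial-≢0 e c n = A.trans (A.+-identityʳ _) (A.reflexive (δ-no c n))

-- Theta series with quadratic exponents

module ℕS = Data.Nat.Solver.+-*-Solver

-- k n(n-1)/2 + c n
expo⁺ : ℕ → ℕ → ℕ → ℕ
expo⁺ k c zero = 0
expo⁺ k c (suc n) = c ℕ.+ k ℕ.* n ℕ.+ expo⁺ k c n

-- This is a j(j+1)/2 + b j(j-1)/2, the exponent of the j-th term of the triple product with
-- parameters q^a and q^b; the two signs are separated to stay in ℕ.
expo : ℕ → ℕ → ℤ → ℕ
expo a b (+ n) = expo⁺ (a ℕ.+ b) a n
expo a b -[1+ n ] = expo⁺ (a ℕ.+ b) b (suc n)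

2expo⁺ : ∀ a b n → + 2 ℤ.* + expo⁺ (a ℕ.+ b) a n ≡ + (a ℕ.+ b) ℤ.* (+ n ℤ.* + n) ℤ.+ (+ a ℤ.- + b) ℤ.* + n
2expo⁺ a b zero = ℤS.solve 2 (λ a b → ℤS.con (+ 0) ℤS.:= (a ℤS.:+ b) ℤS.:* ℤS.con (+ 0) ℤS.:+ (a ℤS.:- b) ℤS.:* ℤS.con (+ 0)) ≡.refl (+ a) (+ b)
2expo⁺ a b (suc n) = begin
  + 2 ℤ.* (+ a ℤ.+ + ((a ℕ.+ b) ℕ.* n) ℤ.+ + x) ≡⟨ ≡.cong (λ z → + 2 ℤ.* (+ a ℤ.+ z ℤ.+ + x)) (ℤP.pos-* (a ℕ.+ b) n) ⟩
  + 2 ℤ.* (+ a ℤ.+ (+ a ℤ.+ + b) ℤ.* + n ℤ.+ + x)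
    ≡⟨ ℤS.solve 4 (λ a b n x → ℤS.con (+ 2) ℤS.:* (a ℤS.:+ (a ℤS.:+ b) ℤS.:* n ℤS.:+ x) ℤS.:= ℤS.con (+ 2) ℤS.:* (a ℤS.:+ (a ℤS.:+ b) ℤS.:* n) ℤS.:+ ℤS.con (+ 2) ℤS.:* x) ≡.refl (+ a) (+ b) (+ n) (+ x) ⟩
  + 2 ℤ.* (+ a ℤ.+ (+ a ℤ.+ + b) ℤ.* + n) ℤ.+ + 2 ℤ.* + x ≡⟨ ≡.cong (ℤ._+_ (+ 2 ℤ.* (+ a ℤ.+ (+ a ℤ.+ + b) ℤ.* + n))) (2expo⁺ a b n) ⟩
  + 2 ℤ.* (+ a ℤ.+ (+ a ℤ.+ + b) ℤ.* + n) ℤ.+ ((+ a ℤ.+ + b) ℤ.* (+ n ℤ.* + n) ℤ.+ (+ a ℤ.- + b) ℤ.* + n)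
    ≡⟨ ℤS.solve 3 (λ a b n → ℤS.con (+ 2) ℤS.:* (a ℤS.:+ (a ℤS.:+ b) ℤS.:* n) ℤS.:+ ((a ℤS.:+ b) ℤS.:* (n ℤS.:* n) ℤS.:+ (a ℤS.:- b) ℤS.:* n) ℤS.:=
        (a ℤS.:+ b) ℤS.:* ((ℤS.con (+ 1) ℤS.:+ n) ℤS.:* (ℤS.con (+ 1) ℤS.:+ n)) ℤS.:+ (a ℤS.:- b) ℤS.:* (ℤS.con (+ 1) ℤS.:+ n)) ≡.refl (+ a) (+ b) (+ n) ⟩
  (+ a ℤ.+ + b) ℤ.* (+ suc n ℤ.* + suc n) ℤ.+ (+ a ℤ.- + b) ℤ.* + suc n ∎
  where
  open ≡.≡-Reasoning
  x = expo⁺ (a ℕ.+ b) a n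

-- Doubling clears the denominators and gives one polynomial in j for both signs, on which the
-- integer solver can work.
2expo : ∀ a b j → + 2 ℤ.* + expo a b j ≡ + (a ℕ.+ b) ℤ.* (j ℤ.* j) ℤ.+ (+ a ℤ.- + b) ℤ.* j
2expo a b (+ n) = 2expo⁺ a b n
2expo a b -[1+ n ] = begin
  + 2 ℤ.* + expo⁺ (a ℕ.+ b) b (suc n) ≡⟨ ≡.cong (λ k → + 2 ℤ.* + expo⁺ k b (suc n)) (ℕP.+-comm a b) ⟩
  + 2 ℤ.* + expo⁺ (b ℕ.+ a) b (suc n) ≡⟨ 2expo⁺ b a (suc n) ⟩
  (+ b ℤ.+ + a) ℤ.* (+ suc n ℤ.* + suc n) ℤ.+ (+ b ℤ.- + a) ℤ.* + suc n
    ≡⟨ ℤS.solve 3 (λ a b n → (b ℤS.:+ a) ℤS.:* (n ℤS.:* n) ℤS.:+ (b ℤS.:- a) ℤS.:* n ℤS.:=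
        (a ℤS.:+ b) ℤS.:* ((ℤS.:- n) ℤS.:* (ℤS.:- n)) ℤS.:+ (a ℤS.:- b) ℤS.:* (ℤS.:- n)) ≡.refl (+ a) (+ b) (+ suc n) ⟩
  + (a ℕ.+ b) ℤ.* (-[1+ n ] ℤ.* -[1+ n ]) ℤ.+ (+ a ℤ.- + b) ℤ.* -[1+ n ] ∎
  where open ≡.≡-Reasoning

module Symmetric (A : CommutativeRing 0ℓ 0ℓ) where
  open Ring A

  -- The sum of F j over -m ≤ j ≤ m.
  ∑± : ℕ → (ℤ → Carrier) → Carrier
  ∑± zero F = F 0ℤ
  ∑± (suc m) F = F -[1+ m ] + (∑± m F + F (+ suc m))

  ∑±-cong : ∀ m {F G} → (∀ j → F j ≈ G j) → ∑± m F ≈ ∑± m G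
  ∑±-cong zero e = e 0ℤ
  ∑±-cong (suc m) e = +-cong (e _) (+-cong (∑±-cong m e) (e _))

  ∑±-zero : ∀ m {F} → (∀ j → F j ≈ 0#) → ∑± m F ≈ 0#
  ∑±-zero zero e = e 0ℤ
  ∑±-zero (suc m) e = trans (+-cong (e _) (trans (+-cong (∑±-zero m e) (e _)) (+-identityˡ _))) (+-identityˡ _)

  ∑²⇒∑± : ∀ m F → ∑² (m ℕ.+ m) (λ k d → F (k ℤ.⊖ m)) ≈ ∑± m F
  ∑²⇒∑± zero F = refl
  ∑²⇒∑± (suc m) F = +-congˡ (begin
    ∑² (m ℕ.+ suc m) (λ k d → F (suc k ℤ.⊖ suc m)) ≡⟨ ≡.cong (λ n → ∑² n (λ k d → F (suc k ℤ.⊖ suc m))) (ℕP.+-suc m m) ⟩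
    ∑² (suc (m ℕ.+ m)) (λ k d → F (suc k ℤ.⊖ suc m)) ≈⟨ ∑²-last (m ℕ.+ m) (λ k d → F (suc k ℤ.⊖ suc m)) ⟩
    ∑² (m ℕ.+ m) (λ k d → F (suc k ℤ.⊖ suc m)) + F (suc (suc (m ℕ.+ m)) ℤ.⊖ suc m)
      ≈⟨ +-cong (∑²-cong (m ℕ.+ m) (λ k d _ → reflexive (≡.cong F (ℤP.[1+m]⊖[1+n]≡m⊖n k m))))
          (reflexive (≡.cong F (≡.trans (ℤP.⊖-≥ (s≤s (ℕP.≤-trans (ℕP.m≤m+n m m) (ℕP.n≤1+n _)))) (≡.cong +_ (≡.trans (≡.cong (_∸ m) (≡.sym (ℕP.+-suc m m))) (ℕP.m+n∸m≡n m (suc m))))))) ⟩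
    ∑² (m ℕ.+ m) (λ k d → F (k ℤ.⊖ m)) + F (+ suc m) ≈⟨ +-congʳ (∑²⇒∑± m F) ⟩
    ∑± m F + F (+ suc m) ∎)
    where open Rsn

-- Jacobi's triple product with a = u q^c, b = v q^d and uv = 1.
module Triple (A : CommutativeRing 0ℓ 0ℓ) (u v : CommutativeRing.Carrier A) (uv : Ring._≈_ A (Ring._*_ A u v) (Ring.1# A)) (c d′ : ℕ) where
  private module A = Ring A
  open Gauss A
  open S using (_*_; _+_; _-_; -_; 0#; 1#; _^_; ∏)
  private
    module Sy = Symmetric A
    module C = Hom C-hom

  -- With d positive the base q^(c+d) has no constant term, as the triple product demands, while c
  -- may be zero.
  d = suc d′
  k = c ℕ.+ d

  weight : ℤ → A.Carrier
  weight (+ n) = u A.^ n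
  weight -[1+ n ] = v A.^ suc n

  term : ℤ → PS
  term j = C (weight j) * q ^ expo c d j

  factor : ℕ → PS
  factor i = (1# + C u * q ^ c * (q ^ k) ^ i) * (1# + C v * q ^ d * (q ^ k) ^ i)

  private
    Q = q ^ k
    a = C u * q ^ c
    b = C v * q ^ d

    k≡ : k ≡ suc (c ℕ.+ d′)
    k≡ = ℕP.+-suc c d′

    Q0 : Q 0 A.≈ A.0#
    Q0 = A.trans (A.reflexive (≡.cong (λ k → (q ^ k) 0) k≡)) (A.trans (at (S.^-suc q (c ℕ.+ d′)) 0) (A.zeroˡ _))

    ab : a * b S.≈ Q
    ab = S.trans (S.solve 4 (λ u x v y → (u ⊗ x) ⊗ (v ⊗ y) S.⊜ (u ⊗ v) ⊗ (x ⊗ y)) S.refl (C u) (q ^ c) (C v) (q ^ d))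
      (S.trans (S.*-cong (S.trans (S.sym (C.*-hom u v)) (S.trans (C.cong uv) C.1-hom)) (S.sym (S.^-homo-* q c d))) (S.*-identityˡ Q))

    powers-term : ∀ u c n → powers Q (C u * q ^ c) n S.≈ C (u A.^ n) * q ^ expo⁺ k c n
    powers-term u c zero = S.sym (S.trans (S.*-identityʳ _) C.1-hom)
    powers-term u c (suc n) = begin
      C u * q ^ c * Q ^ n * powers Q (C u * q ^ c) n ≈⟨ S.*-cong (S.*-congˡ {C u * q ^ c} (S.^-assocʳ q k n)) (powers-term u c n) ⟩
      C u * q ^ c * q ^ (k ℕ.* n) * (C (u A.^ n) * q ^ expo⁺ k c n)
        ≈⟨ S.solve 5 (λ u x y v z → u ⊗ x ⊗ y ⊗ (v ⊗ z) S.⊜ (u ⊗ v) ⊗ (x ⊗ y ⊗ z)) S.refl (C u) (q ^ c) (q ^ (k ℕ.* n)) (C (u A.^ n)) (q ^ expo⁺ k c n) ⟩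
      (C u * C (u A.^ n)) * (q ^ c * q ^ (k ℕ.* n) * q ^ expo⁺ k c n)
        ≈⟨ S.*-cong (S.trans (S.sym (C.*-hom u _)) (C.cong (A.sym (A.^-suc u n)))) (S.trans (S.*-congʳ {q ^ expo⁺ k c n} (S.sym (S.^-homo-* q c (k ℕ.* n)))) (S.sym (S.^-homo-* q (c ℕ.+ k ℕ.* n) (expo⁺ k c n)))) ⟩
      C (u A.^ suc n) * q ^ expo⁺ k c (suc n) ∎
      where open S.Rsn

    theta≈term : ∀ j → theta-term Q a b j S.≈ term j
    theta≈term (+ n) = powers-term u c n
    theta≈term -[1+ n ] = powers-term v d (suc n)

  triple : ∀ m → (poch (q ^ k) m * ∏ m factor) ≈[ m ] (λ n → Sy.∑± m (λ j → term j n))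
  triple m n l = A.trans (jacobi-triple Q a b ab Q0 m n l) (A.trans (∑²-coef (m ℕ.+ m) _ n) (A.trans (Sy.∑²⇒∑± m (λ j → theta-term Q a b j n)) (Sy.∑±-cong m (λ j → at (theta≈term j) n))))

module Monomials (A : CommutativeRing 0ℓ 0ℓ) where
  private module A = Ring A
  open Series A
  open S using (_*_; _^_)

  ind : ℕ → ℕ → A.Carrier → A.Carrier
  ind e n c with e ℕ.≟ n
  ... | yes _ = c
  ... | no _ = A.0#

  ind-yes : ∀ {e n} c → e ≡ n → ind e n c ≡ c
  ind-yes {e} {n} c p with e ℕ.≟ n
  ... | yes _ = ≡.refl
  ... | no x = ⊥-elim (x p)

  ind-no : ∀ {e n} c → ¬ e ≡ n → ind e n c ≡ A.0#
  ind-no {e} {n} c p with e ℕ.≟ n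
  ... | yes x = ⊥-elim (p x)
  ... | no _ = ≡.refl

  mono-coef : ∀ c e n → (C c * q ^ e) n A.≈ ind e n c
  mono-coef c e n with e ℕ.≟ n
  ... | yes ≡.refl = A.trans (C*-coef c (q ^ e) e) (A.trans (A.*-congˡ (A.trans (A.trans (A.sym (at (S.*-identityʳ (q ^ e)) e)) (A.reflexive (≡.cong (q ^ e * one) (≡.sym (ℕP.+-identityʳ e))))) (q^*-+ e one 0))) (A.*-identityʳ c))
  ... | no e≢n = A.trans (C*-coef c (q ^ e) n) (A.trans (A.*-congˡ (zer (ℕP.<-cmp n e))) (A.zeroʳ c))
    where
    zer : Relation.Binary.Tri (n < e) (n ≡ e) (e < n) → (q ^ e) n A.≈ A.0#
    zer (Relation.Binary.tri< l _ _) = A.trans (A.sym (at (S.*-identityʳ (q ^ e)) n)) (q^*-< e one n l)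
    zer (Relation.Binary.tri≈ _ p _) = ⊥-elim (e≢n (≡.sym p))
    zer (Relation.Binary.tri> _ _ l) = A.trans (A.sym (at (S.*-identityʳ (q ^ e)) n)) (A.trans (A.reflexive (≡.cong (q ^ e * one) (≡.sym (≡.trans (ℕP.+-suc e _) (ℕP.m+[n∸m]≡n l))))) (q^*-+ e one (suc (n ∸ suc e))))

-- Euler's product, the pentagonal number theorem and the support of the cube

module Eta (A : CommutativeRing 0ℓ 0ℓ) where
  private module A = Ring A
  open Gauss A
  open S using (_*_; _+_; _-_; -_; 0#; 1#; _^_; ∏)
  open Monomials A
  private
    module Sy = Symmetric A
    module C = Hom C-hom

  -- Euler's product ∏ (1 - q^n), that is Dedekind's eta function without q^(1/24). The coefficient
  -- of q^n is already settled by the first n factors.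
  eta : PS
  eta n = poch q n n

  eta-poch : ∀ m → eta ≈[ suc m ] poch q m
  eta-poch m i (s≤s i≤m) = A.sym (A.trans (A.reflexive (≡.cong (λ m → poch q m i) (≡.sym (ℕP.m∸n+n≡m i≤m)))) (poch-stable q A.refl i (m ∸ i) i ℕP.≤-refl))

  eta0 : eta 0 A.≈ A.1#
  eta0 = A.refl

  private
    module P = Triple A (A.- A.1#) (A.- A.1#) (A.solve 0 ((⊝ Κ 1ℤ) ⊗ (⊝ Κ 1ℤ) A.⊜ Κ 1ℤ) A.refl) 1 1

    C-neg1 : C (A.- A.1#) S.≈ - 1#
    C-neg1 = S.trans (C.neg-hom A.1#) (S.-‿cong C.1-hom)

    -- With u = v = -1 and exponents 1 and 2, `P.factor` supplies the factors 1 - q^i with i in the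
    -- classes 1 and 2 modulo 3, and `poch (q ^ 3)` those with i divisible by 3.
    poch-3 : ∀ m → poch (q ^ 3) m * ∏ m P.factor S.≈ poch q (m ℕ.* 3)
    poch-3 zero = S.*-identityˡ 1#
    poch-3 (suc m) = begin
      poch (q ^ 3) m * (1# - (q ^ 3) ^ suc m) * (∏ m P.factor * ((1# + C n1 * q * (q ^ 3) ^ m) * (1# + C n1 * q ^ 2 * (q ^ 3) ^ m)))
        ≈⟨ S.*-cong (S.*-congˡ {poch (q ^ 3) m} (S.+-congˡ {1#} (S.-‿cong (S.trans (S.^-suc (q ^ 3) m) (S.*-congˡ {q ^ 3} e)))))
             (S.*-congˡ {∏ m P.factor} (S.*-cong (S.+-congˡ {1#} (S.*-cong (S.*-congʳ {q} C-neg1) e)) (S.+-congˡ {1#} (S.*-cong (S.*-congʳ {q ^ 2} C-neg1) e)))) ⟩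
      poch (q ^ 3) m * (1# - q ^ 3 * x) * (∏ m P.factor * ((1# + - 1# * q * x) * (1# + - 1# * q ^ 2 * x)))
        ≈⟨ S.solve 4 (λ p f q x → p ⊗ (Κ 1ℤ S.⊖ q ⊛ 3 ⊗ x) ⊗ (f ⊗ ((Κ 1ℤ ⊕ ⊝ Κ 1ℤ ⊗ q ⊗ x) ⊗ (Κ 1ℤ ⊕ ⊝ Κ 1ℤ ⊗ q ⊛ 2 ⊗ x))) S.⊜
             p ⊗ f ⊗ (Κ 1ℤ S.⊖ q ⊗ x) ⊗ (Κ 1ℤ S.⊖ q ⊗ (q ⊗ x)) ⊗ (Κ 1ℤ S.⊖ q ⊗ (q ⊗ (q ⊗ x)))) S.refl (poch (q ^ 3) m) (∏ m P.factor) q x ⟩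
      poch (q ^ 3) m * ∏ m P.factor * (1# - q * x) * (1# - q * (q * x)) * (1# - q * (q * (q * x)))
        ≈⟨ S.*-cong (S.*-cong (S.*-cong (poch-3 m) (mi e₁)) (mi e₂)) (mi e₃) ⟩
      poch q (suc m ℕ.* 3) ∎
      where
      open S.Rsn
      n1 = A.- A.1#
      x = q ^ (m ℕ.* 3)
      e : (q ^ 3) ^ m S.≈ x
      e = S.trans (S.^-assocʳ q 3 m) (S.≡⇒≈ (≡.cong (q ^_) (ℕP.*-comm 3 m)))
      mi : ∀ {x y} → x S.≈ y → (1# - x) S.≈ (1# - y)
      mi p = S.+-congˡ {1#} (S.-‿cong p)
      e₁ : q * x S.≈ q ^ suc (m ℕ.* 3)
      e₁ = S.sym (S.^-suc q (m ℕ.* 3))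
      e₂ : q * (q * x) S.≈ q ^ suc (suc (m ℕ.* 3))
      e₂ = S.trans (S.*-congˡ e₁) (S.sym (S.^-suc q (suc (m ℕ.* 3))))
      e₃ : q * (q * (q * x)) S.≈ q ^ suc (suc (suc (m ℕ.* 3)))
      e₃ = S.trans (S.*-congˡ e₂) (S.sym (S.^-suc q (suc (suc (m ℕ.* 3)))))

  sign : ℤ → A.Carrier
  sign = P.weight

  -- Euler's theorem, with `expo 1 2 j` the pentagonal number j(3j-1)/2. The range -m ≤ j ≤ m
  -- suffices because the triple product is known modulo q^m.
  pentagonal : ∀ n m → n < m → eta n A.≈ Sy.∑± m (λ j → ind (expo 1 2 j) n (sign j))
  pentagonal n m l = A.trans (eta-poch (m ℕ.* 3) n (ℕP.≤-trans l (ℕP.≤-trans (ℕP.m≤m*n m 3) (ℕP.n≤1+n _))))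
    (A.trans (A.sym (at (poch-3 m) n)) (A.trans (P.triple m n l) (Sy.∑±-cong m (λ j → mono-coef (sign j) (expo 1 2 j) n))))

  eta-support : ∀ n → (∀ j → ¬ expo 1 2 j ≡ n) → eta n A.≈ A.0#
  eta-support n h = A.trans (pentagonal n (suc n) ℕP.≤-refl) (Sy.∑±-zero (suc n) (λ j → A.reflexive (ind-no (sign j) (h j))))

-- With ε² = 0 and u = -(1+ε), v = -(1-ε) the triple product becomes -ε η³.
-- D stands for A[ε], imag for the coefficient of ε.
module _ (A D : CommutativeRing 0ℓ 0ℓ) (real : Hom D A) where
  private
    module A = Ring A
    module DR = Ring D
    module real = Hom real

  module Cube
    (imag : DR.Carrier → A.Carrier)
    (imag-cong : ∀ {x y} → x DR.≈ y → imag x A.≈ imag y)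
    (imag-+ : ∀ x y → imag (x DR.+ y) A.≈ imag x A.+ imag y)
    (imag-0 : imag DR.0# A.≈ A.0#)
    (-ε u v : DR.Carrier) (uv : u DR.* v DR.≈ DR.1#)
    (real-u : real.⟦ u ⟧ A.≈ A.- A.1#) (real-v : real.⟦ v ⟧ A.≈ A.- A.1#)
    (1+u : DR.1# DR.+ u DR.≈ -ε) (imag-ε : ∀ x → imag (-ε DR.* x) A.≈ A.- real.⟦ x ⟧)
    where
    open Gauss A
    open S using (_*_; _+_; _-_; -_; 0#; 1#; _^_; ∏)
    open Eta A
    private
      module Sy = Symmetric A
      module C = Hom C-hom
      module GD = Gauss D
      module SD = GD.S
      module SyD = Symmetric D
      module MD = Monomials D
      module CD = Hom GD.C-hom
      module J = Triple D u v uv 0 0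
      module RM = MapSeries real
      module rm = Hom RM.map

      ∏-first : ∀ m (f : ℕ → GD.PS) → SD.∏ (suc m) f SD.≈ f 0 SD.* SD.∏ m (f ∘ suc)
      ∏-first zero f = SD.trans (SD.*-identityˡ (f 0)) (SD.sym (SD.*-identityʳ (f 0)))
      ∏-first (suc m) f = SD.trans (SD.*-congʳ {f (suc m)} (∏-first m f)) (SD.*-assoc (f 0) (SD.∏ m (f ∘ suc)) (f (suc m)))

      rest : ℕ → GD.PS
      rest m = GD.poch (GD.q SD.^ 1) (suc m) SD.* (SD.1# SD.+ GD.C v SD.* GD.q SD.^ 1 SD.* (GD.q SD.^ 1) SD.^ 0) SD.* SD.∏ m (J.factor ∘ suc)

      -- The factor of index 0 contains 1 + u = -ε, the only one that vanishes at ε = 0; it is split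
      -- off.
      LHS : ∀ m → GD.poch (GD.q SD.^ 1) (suc m) SD.* SD.∏ (suc m) J.factor SD.≈ GD.C -ε SD.* rest m
      LHS m = SD.trans (SD.*-congˡ {p} (∏-first m J.factor)) (SD.trans (SD.*-congˡ {p} (SD.*-congʳ {F} (SD.*-congʳ {y} one+u)))
        (SD.solve 4 (λ p e y f → p ⊗ ((e ⊗ y) ⊗ f) SD.⊜ e ⊗ (p ⊗ y ⊗ f)) SD.refl p (GD.C -ε) y F))
        where
        p = GD.poch (GD.q SD.^ 1) (suc m)
        F = SD.∏ m (J.factor ∘ suc)
        y = SD.1# SD.+ GD.C v SD.* GD.q SD.^ 1 SD.* (GD.q SD.^ 1) SD.^ 0
        one+u : SD.1# SD.+ GD.C u SD.* GD.q SD.^ 0 SD.* (GD.q SD.^ 1) SD.^ 0 SD.≈ GD.C -ε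
        one+u = SD.trans (SD.+-congˡ {SD.1#} (SD.trans (SD.*-identityʳ _) (SD.*-identityʳ (GD.C u)))) (GD.mk λ { zero → 1+u ; (suc n) → DR.+-identityˡ _ })

      map-C : ∀ c → rm.⟦ GD.C c ⟧ S.≈ C real.⟦ c ⟧
      map-C c = mk λ { zero → A.refl ; (suc n) → real.0-hom }

      map-poch : ∀ m → rm.⟦ GD.poch (GD.q SD.^ 1) m ⟧ S.≈ poch q m
      map-poch m = S.trans (rm.poch-hom m (GD.q SD.^ 1)) (S.∏-cong m (λ i → S.+-congˡ {1#} (S.-‿cong (S.^-congˡ (suc i) RM.map-q))))

      map-lin : ∀ w c i → real.⟦ w ⟧ A.≈ A.- A.1# → rm.⟦ SD.1# SD.+ GD.C w SD.* GD.q SD.^ c SD.* (GD.q SD.^ 1) SD.^ i ⟧ S.≈ 1# - q ^ c * q ^ i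
      map-lin w c i e = S.trans (rm.+-hom SD.1# _) (S.+-cong rm.1-hom (S.trans (rm.*-hom (GD.C w SD.* GD.q SD.^ c) (GD.q SD.^ i)) (S.trans
        (S.*-cong (S.trans (rm.*-hom (GD.C w) (GD.q SD.^ c)) (S.*-cong (S.trans (map-C w) (S.trans (C.cong e) (S.trans (C.neg-hom A.1#) (S.-‿cong C.1-hom)))) (S.trans (rm.^-hom GD.q c) (S.^-congˡ c RM.map-q)))) (S.trans (rm.^-hom GD.q i) (S.^-congˡ i RM.map-q)))
        (S.solve 2 (λ x y → ⊝ Κ 1ℤ ⊗ x ⊗ y S.⊜ ⊝ (x ⊗ y)) S.refl (q ^ c) (q ^ i)))))

      -- At ε = 0 the factors that remain regroup into three partial products of Euler's product.
      map-rest : ∀ m → rm.⟦ rest m ⟧ S.≈ poch q (suc m) * (poch q (suc m) * poch q m)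
      map-rest m = S.trans (rm.*-hom (GD.poch (GD.q SD.^ 1) (suc m) SD.* y) F) (S.trans (S.*-cong (S.trans (rm.*-hom (GD.poch (GD.q SD.^ 1) (suc m)) y) (S.*-cong (map-poch (suc m)) (map-lin v 1 0 real-v))) (S.trans (rm.∏-hom m _) (S.∏-cong m factor′)))
          (S.trans (S.*-assoc (poch q (suc m)) (1# - q ^ 1 * q ^ 0) (∏ m (λ i → (1# - q ^ suc i) * (1# - q ^ suc (suc i))))) (S.*-congˡ {poch q (suc m)} (go m))))
        where
        F = SD.∏ m (J.factor ∘ suc)
        y = SD.1# SD.+ GD.C v SD.* GD.q SD.^ 1 SD.* (GD.q SD.^ 1) SD.^ 0
        factor′ : ∀ i → rm.⟦ J.factor (suc i) ⟧ S.≈ (1# - q ^ suc i) * (1# - q ^ suc (suc i))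
        factor′ i = S.trans (rm.*-hom (SD.1# SD.+ GD.C u SD.* GD.q SD.^ 0 SD.* (GD.q SD.^ 1) SD.^ suc i) (SD.1# SD.+ GD.C v SD.* GD.q SD.^ 1 SD.* (GD.q SD.^ 1) SD.^ suc i)) (S.*-cong (S.trans (map-lin u 0 (suc i) real-u) (S.+-congˡ {1#} (S.-‿cong (S.*-identityˡ (q ^ suc i))))) (S.trans (map-lin v 1 (suc i) real-v) (S.+-congˡ {1#} (S.-‿cong (S.sym (S.^-homo-* q 1 (suc i)))))))
        go : ∀ m → (1# - q ^ 1 * q ^ 0) * ∏ m (λ i → (1# - q ^ suc i) * (1# - q ^ suc (suc i))) S.≈ poch q (suc m) * poch q m
        go zero = S.solve 1 (λ q → (Κ 1ℤ S.⊖ q ⊛ 1 ⊗ Κ 1ℤ) ⊗ Κ 1ℤ S.⊜ (Κ 1ℤ ⊗ (Κ 1ℤ S.⊖ q ⊛ 1)) ⊗ Κ 1ℤ) S.refl q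
        go (suc m) = S.trans (S.sym (S.*-assoc (1# - q ^ 1 * q ^ 0) (∏ m (λ i → (1# - q ^ suc i) * (1# - q ^ suc (suc i)))) ((1# - q ^ suc m) * (1# - q ^ suc (suc m))))) (S.trans (S.*-congʳ {(1# - q ^ suc m) * (1# - q ^ suc (suc m))} (go m))
          (S.solve 4 (λ a b x y → a ⊗ b ⊗ (x ⊗ y) S.⊜ a ⊗ y ⊗ (b ⊗ x)) S.refl (poch q (suc m)) (poch q m) (1# - q ^ suc m) (1# - q ^ suc (suc m))))

      imag-∑± : ∀ m F → imag (SyD.∑± m F) A.≈ Sy.∑± m (imag ∘ F)
      imag-∑± zero F = A.refl
      imag-∑± (suc m) F = A.trans (imag-+ _ _) (A.+-congˡ (A.trans (imag-+ _ _) (A.+-congʳ (imag-∑± m F))))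

    -- The ε-coefficient of -ε times a series depends only on its value at ε = 0, so here it is
    -- minus the cube of `eta`. On the theta side only the exponents j(j-1)/2 occur.
    eta³-support : ∀ n → (∀ j → ¬ expo 0 1 j ≡ n) → (eta ^ 3) n A.≈ A.0#
    eta³-support n h = begin
      (eta ^ 3) n ≈⟨ ([]-* ([]-* e₁ e₁) e₀) n ℕP.≤-refl ⟩
      (poch q (suc n) * poch q (suc n) * poch q n) n ≈⟨ at (S.*-assoc (poch q (suc n)) (poch q (suc n)) (poch q n)) n ⟩
      (poch q (suc n) * (poch q (suc n) * poch q n)) n ≈⟨ at (map-rest n) n ⟨
      real.⟦ rest n n ⟧ ≈⟨ A.-‿involutive _ ⟨
      A.- (A.- real.⟦ rest n n ⟧) ≈⟨ A.-‿cong (imag-ε (rest n n)) ⟨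
      A.- imag (-ε DR.* rest n n) ≈⟨ A.-‿cong (imag-cong (GD.C*-coef -ε (rest n) n)) ⟨
      A.- imag ((GD.C -ε SD.* rest n) n) ≈⟨ A.-‿cong (imag-cong (GD.at (LHS n) n)) ⟨
      A.- imag ((GD.poch (GD.q SD.^ 1) (suc n) SD.* SD.∏ (suc n) J.factor) n) ≈⟨ A.-‿cong (imag-cong (J.triple (suc n) n ℕP.≤-refl)) ⟩
      A.- imag (SyD.∑± (suc n) (λ j → J.term j n)) ≈⟨ A.-‿cong (imag-∑± (suc n) _) ⟩
      A.- Sy.∑± (suc n) (λ j → imag (J.term j n))
        ≈⟨ A.-‿cong (Sy.∑±-zero (suc n) (λ j → A.trans (imag-cong (DR.trans (MD.mono-coef (J.weight j) (expo 0 1 j) n) (DR.reflexive (MD.ind-no (J.weight j) (h j))))) imag-0)) ⟩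
      A.- A.0# ≈⟨ A.-0#≈0# ⟩
      A.0# ∎
      where
      open A.Rsn
      e₁ : eta ≈[ suc n ] poch q (suc n)
      e₁ = ≈[]-weaken (ℕP.n≤1+n _) (eta-poch (suc n))
      e₀ : eta ≈[ suc n ] poch q n
      e₀ = eta-poch n

eta³-support : (A : CommutativeRing 0ℓ 0ℓ) (let open Ring A) (let open Series A using (module S)) (let open Eta A) →
  ∀ n → (∀ j → ¬ expo 0 1 j ≡ n) → (eta S.^ 3) n ≈ 0#
eta³-support A = Cube.eta³-support A D.ring
  (record { ⟦_⟧ = proj₁ ; cong = proj₁ ; +-hom = λ _ _ → A.refl
    ; *-hom = λ (a , b) (c , d) → A.solve 4 (λ a b c d → a ⊗ c A.⊖ Κ 0ℤ ⊗ (b ⊗ d) A.⊜ a ⊗ c) A.refl a b c d ; 1-hom = A.refl })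
  proj₂ proj₂ (λ _ _ → A.refl) A.refl
  -- In dual numbers these are -ε, u = -1 - ε and v = -1 + ε, so that uv = 1 - ε² = 1 and 1 + u =
  -- -ε.
  (A.0# , A.- A.1#) (A.- A.1# , A.- A.1#) (A.- A.1# , A.1#)
  (A.solve 0 (⊝ Κ 1ℤ ⊗ ⊝ Κ 1ℤ A.⊖ Κ 0ℤ ⊗ (⊝ Κ 1ℤ ⊗ Κ 1ℤ) A.⊜ Κ 1ℤ) A.refl , A.solve 0 (⊝ Κ 1ℤ ⊗ Κ 1ℤ ⊕ ⊝ Κ 1ℤ ⊗ ⊝ Κ 1ℤ ⊕ Κ 0ℤ ⊗ (⊝ Κ 1ℤ ⊗ Κ 1ℤ) A.⊜ Κ 0ℤ) A.refl)
  A.refl A.refl (A.-‿inverseʳ _ , A.+-identityˡ _)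
  (λ (a , b) → A.solve 2 (λ a b → Κ 0ℤ ⊗ b ⊕ ⊝ Κ 1ℤ ⊗ a ⊕ Κ 0ℤ ⊗ (⊝ Κ 1ℤ ⊗ b) A.⊜ ⊝ a) A.refl a b)
  where
  module A = Ring A
  module D = Quad A A.0# A.0#

-- Exponents missing from theta series

-- A quadratic congruence without solutions modulo M, decided by inspecting residues.
Insoluble : (M : ℕ) → (α β γ : ℤ) → Set
Insoluble M α β γ = True (FinP.all? {n = M} (λ s → ¬? (M ℕ∣? ∣ α ℤ.* (+ Fin.toℕ s ℤ.* + Fin.toℕ s) ℤ.+ β ℤ.* + Fin.toℕ s ℤ.- γ ∣)))

-- Writing j = r + dM turns a solution j into a solution r among the residues, all of which the
-- decision procedure has excluded.
insoluble : ∀ M .{{_ : ℕ.NonZero M}} α β γ → Insoluble M α β γ → ∀ j t → ¬ α ℤ.* (j ℤ.* j) ℤ.+ β ℤ.* j ≡ + M ℤ.* t ℤ.+ γ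
insoluble M α β γ w j t e = toWitness w s (≡.subst (λ x → M ℕ∣ ∣ α ℤ.* (x ℤ.* x) ℤ.+ β ℤ.* x ℤ.- γ ∣) (≡.cong +_ (≡.sym (FinP.toℕ-fromℕ< r<M))) (signed⇒abs (divides k eq)))
  where
  r = j ℤD.%ℕ M
  d = j ℤD./ℕ M
  r<M : r < M
  r<M = ℤD.n%ℕd<d j M
  s = Fin.fromℕ< r<M
  k = t ℤ.- (α ℤ.* (+ 2 ℤ.* + r ℤ.* d ℤ.+ d ℤ.* d ℤ.* + M) ℤ.+ β ℤ.* d)
  eq : α ℤ.* (+ r ℤ.* + r) ℤ.+ β ℤ.* + r ℤ.- γ ≡ k ℤ.* + M
  eq = ≡.trans (ℤS.solve 6 (λ α β γ r d m → α ℤS.:* (r ℤS.:* r) ℤS.:+ β ℤS.:* r ℤS.:- γ ℤS.:=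
         (α ℤS.:* ((r ℤS.:+ d ℤS.:* m) ℤS.:* (r ℤS.:+ d ℤS.:* m)) ℤS.:+ β ℤS.:* (r ℤS.:+ d ℤS.:* m)) ℤS.:- γ ℤS.:- (α ℤS.:* (ℤS.con (+ 2) ℤS.:* r ℤS.:* d ℤS.:+ d ℤS.:* d ℤS.:* m) ℤS.:+ β ℤS.:* d) ℤS.:* m) ≡.refl α β γ (+ r) d (+ M))
       (≡.trans (≡.cong (λ z → z ℤ.- γ ℤ.- (α ℤ.* (+ 2 ℤ.* + r ℤ.* d ℤ.+ d ℤ.* d ℤ.* + M) ℤ.+ β ℤ.* d) ℤ.* + M) (≡.trans (≡.cong (λ j → α ℤ.* (j ℤ.* j) ℤ.+ β ℤ.* j) (≡.sym (ℤD.a≡a%ℕn+[a/ℕn]*n j M))) e))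
       (ℤS.solve 4 (λ m t γ x → (m ℤS.:* t ℤS.:+ γ) ℤS.:- γ ℤS.:- x ℤS.:* m ℤS.:= (t ℤS.:- x) ℤS.:* m) ≡.refl (+ M) t γ (α ℤ.* (+ 2 ℤ.* + r ℤ.* d ℤ.+ d ℤ.* d ℤ.* + M) ℤ.+ β ℤ.* d)))

expo-missing : ∀ M .{{_ : ℕ.NonZero M}} a b r → Insoluble M (+ (a ℕ.+ b)) (+ a ℤ.- + b) (+ (2 ℕ.* r)) → ∀ n j → ¬ expo a b j ≡ n ℕ.* M ℕ.+ r
expo-missing M a b r w n j e = insoluble M (+ (a ℕ.+ b)) (+ a ℤ.- + b) (+ (2 ℕ.* r)) w j (+ 2 ℤ.* + n)
  (≡.trans (≡.sym (2expo a b j)) (≡.trans (≡.cong (λ x → + 2 ℤ.* + x) e)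
    (≡.trans (≡.cong (λ x → + 2 ℤ.* (x ℤ.+ + r)) (ℤP.pos-* n M))
      (≡.trans (ℤS.solve 3 (λ n m r → ℤS.con (+ 2) ℤS.:* (n ℤS.:* m ℤS.:+ r) ℤS.:= m ℤS.:* (ℤS.con (+ 2) ℤS.:* n) ℤS.:+ ℤS.con (+ 2) ℤS.:* r) ≡.refl (+ n) (+ M) (+ r))
        (≡.cong (ℤ._+_ (+ M ℤ.* (+ 2 ℤ.* + n))) (≡.sym (ℤP.pos-* 2 r)))))))

-- The 5-dissection of Euler's product

module Dissection (A : CommutativeRing 0ℓ 0ℓ) where
  private module A = Ring A
  open Gauss A
  open S using (_*_; _+_; _-_; -_; 0#; 1#; _^_)
  open Eta A
  open Monomials A
  open Spread A 4
  private
    module Sy = Symmetric A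
    module V = Hom V-hom
    r<5 : ∀ {r} → {True (r ℕP.<? 5)} → r < 5
    r<5 {r} {w} = toWitness w

    shell : ∀ m F {x y} → F -[1+ m ] A.≈ x → F (+ suc m) A.≈ y → Sy.∑± (suc m) F A.≈ Sy.∑± m F A.+ (x A.+ y)
    shell m F e f = A.trans (A.+-cong e (A.+-congˡ f)) (A.solve 3 (λ x s y → x ⊕ (s ⊕ y) A.⊜ s ⊕ (x ⊕ y)) A.refl _ _ _)

    -- The range |j| ≤ 5M + 2 contains 5i + 1 exactly for |i| ≤ M. Raising M by one adds five pairs
    -- of indices, among which only -(5M+4) and 5M+6 are congruent to 1.
    ∑±-5i+1 : ∀ M F → (∀ i → F (+ 5 ℤ.* i) A.≈ A.0#) → (∀ i → F (+ 5 ℤ.* i ℤ.+ + 2) A.≈ A.0#) → (∀ i → F (+ 5 ℤ.* i ℤ.+ + 3) A.≈ A.0#) → (∀ i → F (+ 5 ℤ.* i ℤ.+ + 4) A.≈ A.0#) →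
      Sy.∑± (M ℕ.* 5 ℕ.+ 2) F A.≈ Sy.∑± M (λ i → F (+ 5 ℤ.* i ℤ.+ + 1))
    ∑±-5i+1 zero F f0 f2 f3 f4 = A.trans (A.+-cong (f3 -[1+ 0 ]) (A.+-cong (A.+-cong (f4 -[1+ 0 ]) (A.+-congʳ (f0 0ℤ))) (f2 0ℤ)))
      (A.solve 1 (λ x → Κ 0ℤ ⊕ ((Κ 0ℤ ⊕ (Κ 0ℤ ⊕ x)) ⊕ Κ 0ℤ) A.⊜ x) A.refl (F (+ 1)))
    ∑±-5i+1 (suc M) F f0 f2 f3 f4 = begin
      Sy.∑± (5 ℕ.+ N) F ≈⟨ shell (4 ℕ.+ N) F (zer (neg 4 (+ 2) (+ 3)) (f3 (ℤ.- (+ 2 ℤ.+ + M)))) (zer (pos 4 (+ 1) (+ 2)) (f2 (+ 1 ℤ.+ + M))) ⟩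
      Sy.∑± (4 ℕ.+ N) F A.+ z ≈⟨ A.+-congʳ (shell (3 ℕ.+ N) F (zer (neg 3 (+ 2) (+ 4)) (f4 (ℤ.- (+ 2 ℤ.+ + M)))) (A.reflexive (≡.cong F (pos 3 (+ 1) (+ 1))))) ⟩
      Sy.∑± (3 ℕ.+ N) F A.+ (A.0# A.+ b) A.+ z ≈⟨ A.+-congʳ (A.+-congʳ (shell (2 ℕ.+ N) F (zer (neg 2 (+ 1) (+ 0)) (f0′ (ℤ.- (+ 1 ℤ.+ + M)))) (zer (pos 2 (+ 1) (+ 0)) (f0′ (+ 1 ℤ.+ + M))))) ⟩
      Sy.∑± (2 ℕ.+ N) F A.+ z A.+ (A.0# A.+ b) A.+ z ≈⟨ A.+-congʳ (A.+-congʳ (A.+-congʳ (shell (1 ℕ.+ N) F (A.reflexive (≡.cong F (neg 1 (+ 1) (+ 1)))) (zer (pos 1 (+ 0) (+ 4)) (f4 (+ 0 ℤ.+ + M)))))) ⟩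
      Sy.∑± (1 ℕ.+ N) F A.+ (a A.+ A.0#) A.+ z A.+ (A.0# A.+ b) A.+ z ≈⟨ A.+-congʳ (A.+-congʳ (A.+-congʳ (A.+-congʳ (shell N F (zer (neg 0 (+ 1) (+ 2)) (f2 (ℤ.- (+ 1 ℤ.+ + M)))) (zer (pos 0 (+ 0) (+ 3)) (f3 (+ 0 ℤ.+ + M))))))) ⟩
      Sy.∑± N F A.+ z A.+ (a A.+ A.0#) A.+ z A.+ (A.0# A.+ b) A.+ z
        ≈⟨ A.solve 3 (λ s a b → s ⊕ (Κ 0ℤ ⊕ Κ 0ℤ) ⊕ (a ⊕ Κ 0ℤ) ⊕ (Κ 0ℤ ⊕ Κ 0ℤ) ⊕ (Κ 0ℤ ⊕ b) ⊕ (Κ 0ℤ ⊕ Κ 0ℤ) A.⊜ a ⊕ (s ⊕ b)) A.refl (Sy.∑± N F) a b ⟩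
      a A.+ (Sy.∑± N F A.+ b) ≈⟨ A.+-cong (A.reflexive ≡.refl) (A.+-cong (∑±-5i+1 M F f0 f2 f3 f4) (A.reflexive ≡.refl)) ⟩
      Sy.∑± (suc M) (λ i → F (+ 5 ℤ.* i ℤ.+ + 1)) ∎
      where
      open A.Rsn
      N = M ℕ.* 5 ℕ.+ 2
      z = A.0# A.+ A.0#
      a = F (+ 5 ℤ.* (ℤ.- (+ 1 ℤ.+ + M)) ℤ.+ + 1)
      b = F (+ 5 ℤ.* (+ 1 ℤ.+ + M) ℤ.+ + 1)
      f0′ : ∀ i → F (+ 5 ℤ.* i ℤ.+ + 0) A.≈ A.0#
      f0′ i = A.trans (A.reflexive (≡.cong F (ℤP.+-identityʳ (+ 5 ℤ.* i)))) (f0 i)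
      zer : ∀ {j j′} → j ≡ j′ → F j′ A.≈ A.0# → F j A.≈ A.0#
      zer p e = A.trans (A.reflexive (≡.cong F p)) e
      pos : ∀ c s r {_ : True (+ c ℤ.+ + 3 ℤ.≟ + 5 ℤ.* s ℤ.+ r)} → + suc (c ℕ.+ N) ≡ + 5 ℤ.* (s ℤ.+ + M) ℤ.+ r
      pos c s r {w} = ≡.trans (≡.cong (λ x → + 1 ℤ.+ (+ c ℤ.+ (x ℤ.+ + 2))) (ℤP.pos-* M 5))
        (≡.trans (ℤS.solve 2 (λ c m → ℤS.con (+ 1) ℤS.:+ (c ℤS.:+ (m ℤS.:* ℤS.con (+ 5) ℤS.:+ ℤS.con (+ 2))) ℤS.:= (c ℤS.:+ ℤS.con (+ 3)) ℤS.:+ ℤS.con (+ 5) ℤS.:* m) ≡.refl (+ c) (+ M))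
        (≡.trans (≡.cong (λ x → x ℤ.+ + 5 ℤ.* + M) (toWitness w)) (ℤS.solve 3 (λ s r m → (ℤS.con (+ 5) ℤS.:* s ℤS.:+ r) ℤS.:+ ℤS.con (+ 5) ℤS.:* m ℤS.:= ℤS.con (+ 5) ℤS.:* (s ℤS.:+ m) ℤS.:+ r) ≡.refl s r (+ M))))
      neg : ∀ c s r {_ : True (ℤ.- (+ c ℤ.+ + 3) ℤ.≟ + 5 ℤ.* (ℤ.- s) ℤ.+ r)} → -[1+ c ℕ.+ N ] ≡ + 5 ℤ.* (ℤ.- (s ℤ.+ + M)) ℤ.+ r
      neg c s r {w} = ≡.trans (≡.cong (λ x → ℤ.- (+ 1 ℤ.+ (+ c ℤ.+ (x ℤ.+ + 2)))) (ℤP.pos-* M 5))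
        (≡.trans (ℤS.solve 2 (λ c m → ℤS.:- (ℤS.con (+ 1) ℤS.:+ (c ℤS.:+ (m ℤS.:* ℤS.con (+ 5) ℤS.:+ ℤS.con (+ 2)))) ℤS.:= (ℤS.:- (c ℤS.:+ ℤS.con (+ 3))) ℤS.:- ℤS.con (+ 5) ℤS.:* m) ≡.refl (+ c) (+ M))
        (≡.trans (≡.cong (λ x → x ℤ.- + 5 ℤ.* + M) (toWitness w)) (ℤS.solve 3 (λ s r m → (ℤS.con (+ 5) ℤS.:* (ℤS.:- s) ℤS.:+ r) ℤS.:- ℤS.con (+ 5) ℤS.:* m ℤS.:= ℤS.con (+ 5) ℤS.:* (ℤS.:- (s ℤS.:+ m)) ℤS.:+ r) ≡.refl s r (+ M))))

    ∑±-neg : ∀ M F → Sy.∑± M (λ i → F (ℤ.- i)) A.≈ Sy.∑± M F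
    ∑±-neg zero F = A.refl
    ∑±-neg (suc M) F = A.trans (A.+-congˡ (A.+-congʳ (∑±-neg M F))) (A.solve 3 (λ x s y → x ⊕ (s ⊕ y) A.⊜ y ⊕ (s ⊕ x)) A.refl _ _ _)

    sign-suc : ∀ j → sign (+ 1 ℤ.+ j) A.≈ A.- sign j
    sign-suc (+ n) = A.trans (A.^-suc (A.- A.1#) n) (A.solve 1 (λ x → ⊝ Κ 1ℤ ⊗ x A.⊜ ⊝ x) A.refl _)
    sign-suc -[1+ zero ] = A.sym (A.-‿involutive _)
    sign-suc -[1+ suc n ] = A.sym (A.trans (A.-‿cong (A.^-suc (A.- A.1#) (suc n))) (A.solve 1 (λ x → ⊝ (⊝ Κ 1ℤ ⊗ x) A.⊜ x) A.refl _))

    sign-+5 : ∀ j → sign (+ 5 ℤ.+ j) A.≈ A.- sign j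
    sign-+5 j = A.trans (step 4 j) (A.trans (A.-‿cong (A.trans (step 3 j) (A.trans (A.-‿cong (A.trans (step 2 j) (A.trans (A.-‿cong (A.trans (step 1 j) (A.-‿cong (sign-suc j)))) (A.-‿involutive _)))) A.refl))) (A.-‿cong (A.-‿involutive _)))
      where step : ∀ c j → sign (+ suc c ℤ.+ j) A.≈ A.- sign (+ c ℤ.+ j)
            step c j = A.trans (A.reflexive (≡.cong sign (ℤP.+-assoc (+ 1) (+ c) j))) (sign-suc (+ c ℤ.+ j))

    sign-5i+1 : ∀ i → sign (+ 5 ℤ.* i ℤ.+ + 1) A.≈ A.- sign (ℤ.- i)
    sign-5i+1 (+ n) = A.trans (A.reflexive (≡.cong sign (≡.cong (ℤ._+ + 1) (≡.trans (≡.sym (ℤP.pos-* 5 n)) (≡.cong +_ (ℕP.*-comm 5 n)))))) (go n)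
      where
      go : ∀ n → sign (+ (n ℕ.* 5) ℤ.+ + 1) A.≈ A.- sign (ℤ.- (+ n))
      go zero = A.refl
      go (suc n) = A.trans (sign-+5 (+ (n ℕ.* 5) ℤ.+ + 1)) (A.-‿cong (A.trans (go n) (A.sym (down n))))
        where down : ∀ n → sign -[1+ n ] A.≈ A.- sign (ℤ.- (+ n))
              down zero = A.refl
              down (suc n) = A.trans (A.^-suc (A.- A.1#) (suc n)) (A.solve 1 (λ x → ⊝ Κ 1ℤ ⊗ x A.⊜ ⊝ x) A.refl _)
    sign-5i+1 -[1+ n ] = go n
      where
      go : ∀ n → sign (+ 5 ℤ.* -[1+ n ] ℤ.+ + 1) A.≈ A.- sign (+ suc n)
      back : ∀ j → sign j A.≈ A.- sign (+ 5 ℤ.+ j)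
      back j = A.trans (A.sym (A.-‿involutive _)) (A.-‿cong (A.sym (sign-+5 j)))
      go zero = A.solve 0 (((⊝ Κ 1ℤ) ⊛ 4) A.⊜ ⊝ (⊝ Κ 1ℤ)) A.refl
      go (suc n) = A.trans (back (+ 5 ℤ.* -[1+ suc n ] ℤ.+ + 1)) (A.-‿cong (A.trans (A.reflexive (≡.cong sign (ℤS.solve 1 (λ m → ℤS.con (+ 5) ℤS.:+ (ℤS.con (+ 5) ℤS.:* (ℤS.:- (ℤS.con (+ 1) ℤS.:+ m)) ℤS.:+ ℤS.con (+ 1)) ℤS.:= ℤS.con (+ 5) ℤS.:* (ℤS.:- m) ℤS.:+ ℤS.con (+ 1)) ≡.refl (+ suc n))))
        (A.trans (go n) (A.sym (sign-suc (+ suc n))))))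

    expo-5i+r : ∀ r → {False (5 ℕ∣? ∣ + 3 ℤ.* (r ℤ.* r) ℤ.- r ℤ.- + 2 ∣)} → ∀ i n → ¬ expo 1 2 (+ 5 ℤ.* i ℤ.+ r) ≡ n ℕ.* 25 ℕ.+ 1
    expo-5i+r r {w} i n e = toWitnessFalse w (signed⇒abs (divides (+ 10 ℤ.* + n ℤ.- (+ 15 ℤ.* (i ℤ.* i) ℤ.+ + 6 ℤ.* i ℤ.* r ℤ.- i))
      (≡.trans (ℤS.solve 2 (λ i r → ℤS.con (+ 3) ℤS.:* (r ℤS.:* r) ℤS.:- r ℤS.:- ℤS.con (+ 2) ℤS.:=
           (ℤS.con (+ 3) ℤS.:* ((ℤS.con (+ 5) ℤS.:* i ℤS.:+ r) ℤS.:* (ℤS.con (+ 5) ℤS.:* i ℤS.:+ r)) ℤS.:+ ℤS.con -[1+ 0 ] ℤS.:* (ℤS.con (+ 5) ℤS.:* i ℤS.:+ r)) ℤS.:- (ℤS.con (+ 2) ℤS.:+ ℤS.con (+ 5) ℤS.:* (ℤS.con (+ 15) ℤS.:* (i ℤS.:* i) ℤS.:+ ℤS.con (+ 6) ℤS.:* i ℤS.:* r ℤS.:- i))) ≡.refl i r)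
      (≡.trans (≡.cong (λ x → x ℤ.- (+ 2 ℤ.+ + 5 ℤ.* (+ 15 ℤ.* (i ℤ.* i) ℤ.+ + 6 ℤ.* i ℤ.* r ℤ.- i))) (≡.trans (≡.sym (2expo 1 2 (+ 5 ℤ.* i ℤ.+ r))) (≡.trans (≡.cong (λ x → + 2 ℤ.* + x) e) (≡.cong (λ x → + 2 ℤ.* (x ℤ.+ + 1)) (ℤP.pos-* n 25)))))
        (ℤS.solve 3 (λ i r n → ℤS.con (+ 2) ℤS.:* (n ℤS.:* ℤS.con (+ 25) ℤS.:+ ℤS.con (+ 1)) ℤS.:- (ℤS.con (+ 2) ℤS.:+ ℤS.con (+ 5) ℤS.:* (ℤS.con (+ 15) ℤS.:* (i ℤS.:* i) ℤS.:+ ℤS.con (+ 6) ℤS.:* i ℤS.:* r ℤS.:- i)) ℤS.:=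
           (ℤS.con (+ 10) ℤS.:* n ℤS.:- (ℤS.con (+ 15) ℤS.:* (i ℤS.:* i) ℤS.:+ ℤS.con (+ 6) ℤS.:* i ℤS.:* r ℤS.:- i)) ℤS.:* ℤS.con (+ 5)) ≡.refl i r (+ n))))))

    expo-5i+1 : ∀ i → expo 1 2 (+ 5 ℤ.* i ℤ.+ + 1) ≡ expo 1 2 (ℤ.- i) ℕ.* 25 ℕ.+ 1
    expo-5i+1 i = ℤP.+-injective (ℤP.*-cancelˡ-≡ (+ 2) _ _ (≡.trans (2expo 1 2 (+ 5 ℤ.* i ℤ.+ + 1))
      (≡.trans (ℤS.solve 1 (λ i → ℤS.con (+ 3) ℤS.:* ((ℤS.con (+ 5) ℤS.:* i ℤS.:+ ℤS.con (+ 1)) ℤS.:* (ℤS.con (+ 5) ℤS.:* i ℤS.:+ ℤS.con (+ 1))) ℤS.:+ ℤS.con -[1+ 0 ] ℤS.:* (ℤS.con (+ 5) ℤS.:* i ℤS.:+ ℤS.con (+ 1)) ℤS.:=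
          (ℤS.con (+ 3) ℤS.:* ((ℤS.:- i) ℤS.:* (ℤS.:- i)) ℤS.:+ ℤS.con -[1+ 0 ] ℤS.:* (ℤS.:- i)) ℤS.:* ℤS.con (+ 25) ℤS.:+ ℤS.con (+ 2)) ≡.refl i)
      (≡.trans (≡.cong (λ x → x ℤ.* + 25 ℤ.+ + 2) (≡.sym (2expo 1 2 (ℤ.- i))))
      (≡.trans (ℤS.solve 1 (λ x → (ℤS.con (+ 2) ℤS.:* x) ℤS.:* ℤS.con (+ 25) ℤS.:+ ℤS.con (+ 2) ℤS.:= ℤS.con (+ 2) ℤS.:* (x ℤS.:* ℤS.con (+ 25) ℤS.:+ ℤS.con (+ 1))) ≡.refl (+ expo 1 2 (ℤ.- i)))
        (≡.cong (λ x → + 2 ℤ.* (x ℤ.+ + 1)) (≡.sym (ℤP.pos-* (expo 1 2 (ℤ.- i)) 25))))))))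

    -- A pentagonal number that is 1 modulo 25 has index j = 5i + 1, the other classes of j being
    -- excluded modulo 5. The pentagonal number is then 25 times the one of index -i, plus 1, and
    -- the sign is the opposite one.
    eta-25n+1 : ∀ n → eta (n ℕ.* 25 ℕ.+ 1) A.≈ A.- eta n
    eta-25n+1 n = begin
      eta N ≈⟨ pentagonal N (M ℕ.* 5 ℕ.+ 2) big ⟩
      Sy.∑± (M ℕ.* 5 ℕ.+ 2) F ≈⟨ ∑±-5i+1 M F
          (λ i → A.trans (A.reflexive (≡.cong F {x = + 5 ℤ.* i} {y = + 5 ℤ.* i ℤ.+ + 0} (≡.sym (ℤP.+-identityʳ (+ 5 ℤ.* i))))) (A.reflexive (ind-no (sign (+ 5 ℤ.* i ℤ.+ + 0)) (expo-5i+r (+ 0) i n)))) (λ i → A.reflexive (ind-no (sign (+ 5 ℤ.* i ℤ.+ + 2)) (expo-5i+r (+ 2) i n)))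
          (λ i → A.reflexive (ind-no (sign (+ 5 ℤ.* i ℤ.+ + 3)) (expo-5i+r (+ 3) i n))) (λ i → A.reflexive (ind-no (sign (+ 5 ℤ.* i ℤ.+ + 4)) (expo-5i+r (+ 4) i n))) ⟩
      Sy.∑± M (λ i → F (+ 5 ℤ.* i ℤ.+ + 1)) ≈⟨ Sy.∑±-cong M term ⟩
      Sy.∑± M (λ i → G (ℤ.- i)) ≈⟨ ∑±-neg M G ⟩
      Sy.∑± M G ≈⟨ ∑±-minus M (λ j → ind (expo 1 2 j) n (sign j)) ⟩
      A.- Sy.∑± M (λ j → ind (expo 1 2 j) n (sign j)) ≈⟨ A.-‿cong (pentagonal n M n<M) ⟨
      A.- eta n ∎
      where
      open A.Rsn
      N = n ℕ.* 25 ℕ.+ 1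
      M = suc (n ℕ.* 5)
      F G : ℤ → A.Carrier
      F j = ind (expo 1 2 j) N (sign j)
      G j = A.- ind (expo 1 2 j) n (sign j)
      n<M : n < M
      n<M = s≤s (ℕP.m≤m*n n 5)
      big : N < M ℕ.* 5 ℕ.+ 2
      big = ≡.subst (_< M ℕ.* 5 ℕ.+ 2) (≡.cong (ℕ._+ 1) (ℕP.*-assoc n 5 5)) (ℕP.+-mono-<-≤ (ℕP.m<n+m (n ℕ.* 5 ℕ.* 5) {5} (s≤s z≤n)) (s≤s z≤n))
      ∑±-minus : ∀ M f → Sy.∑± M (λ j → A.- f j) A.≈ A.- Sy.∑± M f
      ∑±-minus zero f = A.refl
      ∑±-minus (suc M) f = A.trans (A.+-congˡ (A.+-congʳ (∑±-minus M f))) (A.solve 3 (λ x s y → ⊝ x ⊕ (⊝ s ⊕ ⊝ y) A.⊜ ⊝ (x ⊕ (s ⊕ y))) A.refl _ _ _)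
      term : ∀ i → F (+ 5 ℤ.* i ℤ.+ + 1) A.≈ G (ℤ.- i)
      term i with expo 1 2 (ℤ.- i) ℕ.≟ n
      ... | yes p = A.trans (A.reflexive (ind-yes _ (≡.trans (expo-5i+1 i) (≡.cong (λ x → x ℕ.* 25 ℕ.+ 1) p)))) (sign-5i+1 i)
      ... | no ¬p = A.trans (A.reflexive (ind-no _ (λ p → ¬p (ℕP.*-cancelʳ-≡ _ _ 25 (ℕP.+-cancelʳ-≡ 1 _ _ (≡.trans (≡.sym (expo-5i+1 i)) p)))))) (A.sym A.-0#≈0#)

    idx : ∀ n r s → (n ℕ.* 5 ℕ.+ r) ℕ.* 5 ℕ.+ s ≡ n ℕ.* 25 ℕ.+ (r ℕ.* 5 ℕ.+ s)
    idx = ℕS.solve 3 (λ n r s → (n ℕS.:* ℕS.con 5 ℕS.:+ r) ℕS.:* ℕS.con 5 ℕS.:+ s ℕS.:= n ℕS.:* ℕS.con 25 ℕS.:+ (r ℕS.:* ℕS.con 5 ℕS.:+ s)) ≡.refl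

  -- Pentagonal numbers that are 1 modulo 5 are 1 modulo 25: the classes 6, 11, 16 and 21 contain
  -- none, and `eta-25n+1` describes the remaining class.
  U1-eta : U 1 eta ≋ - V eta
  U1-eta = U-ext λ
    { 0 _ → mk λ n → A.trans (A.reflexive (≡.cong eta (idx n 0 1))) (A.trans (eta-25n+1 n) (A.-‿cong (A.sym (at (U0V eta) n))))
    ; (suc r) l → S.trans (mk λ n → A.trans (A.reflexive (≡.cong eta (idx n (suc r) 1))) (miss r l n)) (S.trans (S.sym S.-0#≈0#) (S.-‿cong (S.sym (UrV r eta l)))) }
    where
    miss : ∀ r → suc r < 5 → ∀ n → eta (n ℕ.* 25 ℕ.+ (suc r ℕ.* 5 ℕ.+ 1)) A.≈ A.0#
    miss 0 _ n = eta-support _ (expo-missing 25 1 2 6 _ n)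
    miss 1 _ n = eta-support _ (expo-missing 25 1 2 11 _ n)
    miss 2 _ n = eta-support _ (expo-missing 25 1 2 16 _ n)
    miss 3 _ n = eta-support _ (expo-missing 25 1 2 21 _ n)
    miss (suc (suc (suc (suc r)))) (s≤s (s≤s (s≤s (s≤s (s≤s ())))))

  U3-eta : U 3 eta ≋ 0#
  U3-eta = mk λ n → eta-support _ (expo-missing 5 1 2 3 _ n)

  U4-eta : U 4 eta ≋ 0#
  U4-eta = mk λ n → eta-support _ (expo-missing 5 1 2 4 _ n)

  -- The numbers j(j-1)/2 are 0, 1 or 3 modulo 5.
  U2-eta³ : U 2 (eta ^ 3) ≋ 0#
  U2-eta³ = mk λ n → eta³-support A _ (expo-missing 5 0 1 2 _ n)

  assemble : PS → PS → PS → PS → PS → PS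
  assemble f₀ f₁ f₂ f₃ f₄ = V f₀ + q ^ 1 * V f₁ + q ^ 2 * V f₂ + q ^ 3 * V f₃ + q ^ 4 * V f₄

  private
    pick : ∀ r f₀ f₁ f₂ f₃ f₄ → r < 5 → U r (assemble f₀ f₁ f₂ f₃ f₄) ≋
      U r (q ^ 0 * V f₀) + U r (q ^ 1 * V f₁) + U r (q ^ 2 * V f₂) + U r (q ^ 3 * V f₃) + U r (q ^ 4 * V f₄)
    pick r f₀ f₁ f₂ f₃ f₄ l = mk λ n → A.+-congʳ (A.+-congʳ (A.+-congʳ (A.+-congʳ (A.sym (at (S.*-identityˡ (V f₀)) (n ℕ.* 5 ℕ.+ r))))))

  U2-assemble : ∀ f₀ f₁ f₂ f₃ f₄ → U 2 (assemble f₀ f₁ f₂ f₃ f₄) ≋ f₂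
  U2-assemble f₀ f₁ f₂ f₃ f₄ = S.trans (pick 2 f₀ f₁ f₂ f₃ f₄ r<5) (S.trans
    (S.+-cong (S.+-cong (S.+-cong (S.+-cong (U-q^V-≢ 2 0 f₀ r<5 r<5 λ ()) (U-q^V-≢ 2 1 f₁ r<5 r<5 λ ())) (U-q^V 2 f₂ r<5)) (U-q^V-≢ 2 3 f₃ r<5 r<5 λ ())) (U-q^V-≢ 2 4 f₄ r<5 r<5 λ ()))
    (S.solve 1 (λ x → Κ 0ℤ ⊕ Κ 0ℤ ⊕ x ⊕ Κ 0ℤ ⊕ Κ 0ℤ S.⊜ x) S.refl f₂))

  U0-assemble : ∀ f₀ f₁ f₂ f₃ f₄ → U 0 (assemble f₀ f₁ f₂ f₃ f₄) ≋ f₀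
  U0-assemble f₀ f₁ f₂ f₃ f₄ = S.trans (pick 0 f₀ f₁ f₂ f₃ f₄ r<5) (S.trans
    (S.+-cong (S.+-cong (S.+-cong (S.+-cong (U-q^V 0 f₀ r<5) (U-q^V-≢ 0 1 f₁ r<5 r<5 λ ())) (U-q^V-≢ 0 2 f₂ r<5 r<5 λ ())) (U-q^V-≢ 0 3 f₃ r<5 r<5 λ ())) (U-q^V-≢ 0 4 f₄ r<5 r<5 λ ()))
    (S.solve 1 (λ x → x ⊕ Κ 0ℤ ⊕ Κ 0ℤ ⊕ Κ 0ℤ ⊕ Κ 0ℤ S.⊜ x) S.refl f₀))

  U1-assemble : ∀ f₀ f₁ f₂ f₃ f₄ → U 1 (assemble f₀ f₁ f₂ f₃ f₄) ≋ f₁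
  U1-assemble f₀ f₁ f₂ f₃ f₄ = S.trans (pick 1 f₀ f₁ f₂ f₃ f₄ r<5) (S.trans
    (S.+-cong (S.+-cong (S.+-cong (S.+-cong (U-q^V-≢ 1 0 f₀ r<5 r<5 λ ()) (U-q^V 1 f₁ r<5)) (U-q^V-≢ 1 2 f₂ r<5 r<5 λ ())) (U-q^V-≢ 1 3 f₃ r<5 r<5 λ ())) (U-q^V-≢ 1 4 f₄ r<5 r<5 λ ()))
    (S.solve 1 (λ x → Κ 0ℤ ⊕ x ⊕ Κ 0ℤ ⊕ Κ 0ℤ ⊕ Κ 0ℤ S.⊜ x) S.refl f₁))

  U3-assemble : ∀ f₀ f₁ f₂ f₃ f₄ → U 3 (assemble f₀ f₁ f₂ f₃ f₄) ≋ f₃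
  U3-assemble f₀ f₁ f₂ f₃ f₄ = S.trans (pick 3 f₀ f₁ f₂ f₃ f₄ r<5) (S.trans
    (S.+-cong (S.+-cong (S.+-cong (S.+-cong (U-q^V-≢ 3 0 f₀ r<5 r<5 λ ()) (U-q^V-≢ 3 1 f₁ r<5 r<5 λ ())) (U-q^V-≢ 3 2 f₂ r<5 r<5 λ ())) (U-q^V 3 f₃ r<5)) (U-q^V-≢ 3 4 f₄ r<5 r<5 λ ()))
    (S.solve 1 (λ x → Κ 0ℤ ⊕ Κ 0ℤ ⊕ Κ 0ℤ ⊕ x ⊕ Κ 0ℤ S.⊜ x) S.refl f₃))

  U4-assemble : ∀ f₀ f₁ f₂ f₃ f₄ → U 4 (assemble f₀ f₁ f₂ f₃ f₄) ≋ f₄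
  U4-assemble f₀ f₁ f₂ f₃ f₄ = S.trans (pick 4 f₀ f₁ f₂ f₃ f₄ r<5) (S.trans
    (S.+-cong (S.+-cong (S.+-cong (S.+-cong (U-q^V-≢ 4 0 f₀ r<5 r<5 λ ()) (U-q^V-≢ 4 1 f₁ r<5 r<5 λ ())) (U-q^V-≢ 4 2 f₂ r<5 r<5 λ ())) (U-q^V-≢ 4 3 f₃ r<5 r<5 λ ())) (U-q^V 4 f₄ r<5))
    (S.solve 1 (λ x → Κ 0ℤ ⊕ Κ 0ℤ ⊕ Κ 0ℤ ⊕ Κ 0ℤ ⊕ x S.⊜ x) S.refl f₄))

  U-assemble-ext : ∀ {f f₀ f₁ f₂ f₃ f₄} → U 0 f ≋ f₀ → U 1 f ≋ f₁ → U 2 f ≋ f₂ → U 3 f ≋ f₃ → U 4 f ≋ f₄ → f ≋ assemble f₀ f₁ f₂ f₃ f₄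
  U-assemble-ext {f} {f₀} {f₁} {f₂} {f₃} {f₄} e₀ e₁ e₂ e₃ e₄ = U-ext λ
    { 0 _ → S.trans e₀ (S.sym (U0-assemble f₀ f₁ f₂ f₃ f₄)) ; 1 _ → S.trans e₁ (S.sym (U1-assemble f₀ f₁ f₂ f₃ f₄))
    ; 2 _ → S.trans e₂ (S.sym (U2-assemble f₀ f₁ f₂ f₃ f₄)) ; 3 _ → S.trans e₃ (S.sym (U3-assemble f₀ f₁ f₂ f₃ f₄))
    ; 4 _ → S.trans e₄ (S.sym (U4-assemble f₀ f₁ f₂ f₃ f₄))
    ; (suc (suc (suc (suc (suc r))))) (s≤s (s≤s (s≤s (s≤s (s≤s ()))))) }

  -- The sections of `eta` before and after q ↦ q^5. The sign in `z` makes both `x` and `z` start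
  -- with 1.
  x z X Y Z : PS
  x = U 0 eta
  z = - U 2 eta
  X = V x
  Y = V (V eta)
  Z = V z

  eta-dissection : eta ≋ X - q * Y - q ^ 2 * Z
  eta-dissection = S.trans (U-assemble-ext S.refl U1-eta S.refl U3-eta U4-eta)
    (S.trans (S.+-cong (S.+-cong (S.+-cong (S.+-congˡ {X} (S.*-congˡ {q ^ 1} (V.neg-hom (V eta)))) (S.*-congˡ {q ^ 2} (S.trans (V-cong (S.sym (S.-‿involutive (U 2 eta)))) (V.neg-hom z)))) (S.*-congˡ {q ^ 3} V.0-hom)) (S.*-congˡ {q ^ 4} V.0-hom))
      (S.solve 4 (λ x y z q → x ⊕ q ⊗ ⊝ y ⊕ q ⊛ 2 ⊗ ⊝ z ⊕ q ⊛ 3 ⊗ Κ 0ℤ ⊕ q ⊛ 4 ⊗ Κ 0ℤ S.⊜ x S.⊖ q ⊗ y S.⊖ q ⊛ 2 ⊗ z) S.refl X Y Z q))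

  module _ (third : A.Carrier) (3≠0 : third A.* A.ι (+ 3) A.≈ A.1#) where
    private
      module Cm = Hom C-hom
      y = V eta

      cube : eta ^ 3 ≋ assemble (x ^ 3 - q * (S.ι (+ 3) * y * z ^ 2)) (- (S.ι (+ 3) * x ^ 2 * y) - q * z ^ 3) (S.ι (+ 3) * (x * (y ^ 2 - x * z))) (S.ι (+ 6) * x * y * z - y ^ 3) (S.ι (+ 3) * (x * z ^ 2 - y ^ 2 * z))
      cube = S.trans (S.^-congˡ 3 eta-dissection) (S.trans
        (S.solve 4 (λ q x y z → (x S.⊖ q ⊗ y S.⊖ q ⊛ 2 ⊗ z) ⊛ 3 S.⊜
           (x ⊛ 3 S.⊖ q ⊛ 5 ⊗ (Κ (+ 3) ⊗ y ⊗ z ⊛ 2)) ⊕ q ⊛ 1 ⊗ (⊝ (Κ (+ 3) ⊗ x ⊛ 2 ⊗ y) S.⊖ q ⊛ 5 ⊗ z ⊛ 3) ⊕ q ⊛ 2 ⊗ (Κ (+ 3) ⊗ (x ⊗ (y ⊛ 2 S.⊖ x ⊗ z))) ⊕ q ⊛ 3 ⊗ (Κ (+ 6) ⊗ x ⊗ y ⊗ z S.⊖ y ⊛ 3) ⊕ q ⊛ 4 ⊗ (Κ (+ 3) ⊗ (x ⊗ z ⊛ 2 S.⊖ y ⊛ 2 ⊗ z))) S.refl q X Y Z)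
        (S.sym (S.+-cong (S.+-cong (S.+-cong (S.+-cong
          (h− (V.^-hom x 3) (h* V-q (h* (h* (Vι (+ 3)) S.refl) (V.^-hom z 2))))
          (S.*-congˡ {q ^ 1} (h− (S.trans (V.neg-hom _) (S.-‿cong (h* (h* (Vι (+ 3)) (V.^-hom x 2)) S.refl))) (h* V-q (V.^-hom z 3)))))
          (S.*-congˡ {q ^ 2} (h* (Vι (+ 3)) (h* S.refl (h− (V.^-hom y 2) (h* S.refl S.refl))))))
          (S.*-congˡ {q ^ 3} (h− (h* (h* (h* (Vι (+ 6)) S.refl) S.refl) S.refl) (V.^-hom y 3))))
          (S.*-congˡ {q ^ 4} (h* (Vι (+ 3)) (h− (h* S.refl (V.^-hom z 2)) (h* (V.^-hom y 2) S.refl)))))))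
        where
        h* : ∀ {f g f′ g′} → V f S.≈ f′ → V g S.≈ g′ → V (f * g) S.≈ f′ * g′
        h* {f} {g} p r = S.trans (V.*-hom f g) (S.*-cong p r)
        h− : ∀ {f g f′ g′} → V f S.≈ f′ → V g S.≈ g′ → V (f - g) S.≈ f′ - g′
        h− {f} {g} p r = S.trans (V.+-hom f (- g)) (S.+-cong p (S.trans (V.neg-hom g) (S.-‿cong r)))
        Vι : ∀ i → V (S.ι i) S.≈ S.ι i
        Vι = V.ι-hom

    -- By `cube`, the exponents congruent to 2 modulo 5 in the cube of `eta` carry 3x(y² - xz), and
    -- `U2-eta³` says that this is zero. The invertible 3 and then x, which has constant term 1, are
    -- cancelled.
    XZ≋Y² : X * Z ≋ Y ^ 2
    XZ≋Y² = S.trans (S.sym (V.*-hom x z)) (S.trans (V-cong (S.sym key)) (V.^-hom y 2))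
      where
      key : y ^ 2 ≋ x * z
      w = x * (y ^ 2 - x * z)
      3w≋0 : S.ι (+ 3) * w ≋ 0#
      3w≋0 = S.trans (S.sym (U2-assemble _ _ (S.ι (+ 3) * w) _ _)) (S.trans (U-cong 2 (S.sym cube)) U2-eta³)
      third*3 : C third * S.ι (+ 3) ≋ 1#
      third*3 = S.trans (S.*-congˡ {C third} (S.sym (Cm.ι-hom (+ 3)))) (S.trans (S.sym (Cm.*-hom third (A.ι (+ 3)))) (S.trans (Cm.cong 3≠0) Cm.1-hom))
      w≋0 : w ≋ 0#
      w≋0 = S.trans (S.sym (S.trans (S.*-congʳ third*3) (S.*-identityˡ w))) (S.trans (S.*-assoc (C third) (S.ι (+ 3)) w) (S.trans (S.*-congˡ {C third} 3w≋0) (S.zeroʳ (C third))))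
      key = cancel x (y ^ 2) (x * z) A.refl (S.trans (S.solve 3 (λ x a b → x ⊗ a S.⊜ x ⊗ (a S.⊖ b) ⊕ x ⊗ b) S.refl x (y ^ 2) (x * z)) (S.trans (S.+-congʳ w≋0) (S.+-identityˡ (x * (x * z)))))

-- Products over fifth roots of unity and the norm of Euler's product

module RootsOfUnity (R : CommutativeRing 0ℓ 0ℓ) where
  open Ring R
  open Rsn

  ∏-roots : ∀ η x → 1# + η + η ^ 2 + η ^ 3 + η ^ 4 ≈ 0# →
    (1# - x) * (1# - η * x) * (1# - η ^ 2 * x) * (1# - η ^ 3 * x) * (1# - η ^ 4 * x) ≈ 1# - x ^ 5
  ∏-roots η x e = begin
    (1# - x) * (1# - η * x) * (1# - η ^ 2 * x) * (1# - η ^ 3 * x) * (1# - η ^ 4 * x)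
      -- The product differs from 1 - x^5 by a multiple of the vanishing sum s; the cofactor written
      -- out is the quotient.
      ≈⟨ solve 2 (λ η x → let s = Κ 1ℤ ⊕ η ⊕ η ⊛ 2 ⊕ η ⊛ 3 ⊕ η ⊛ 4 in
           (Κ 1ℤ ⊖ x) ⊗ (Κ 1ℤ ⊖ η ⊗ x) ⊗ (Κ 1ℤ ⊖ η ⊛ 2 ⊗ x) ⊗ (Κ 1ℤ ⊖ η ⊛ 3 ⊗ x) ⊗ (Κ 1ℤ ⊖ η ⊛ 4 ⊗ x) ⊜
           Κ 1ℤ ⊖ x ⊛ 5 ⊖ s ⊗ (x ⊖ (η ⊕ η ⊛ 3) ⊗ x ⊛ 2 ⊕ (η ⊛ 3 ⊕ η ⊛ 5) ⊗ x ⊛ 3 ⊖ η ⊛ 6 ⊗ x ⊛ 4 ⊕ (η ⊖ Κ 1ℤ) ⊗ (Κ 1ℤ ⊕ η ⊛ 5) ⊗ x ⊛ 5)) refl η x ⟩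
    1# - x ^ 5 - (1# + η + η ^ 2 + η ^ 3 + η ^ 4) * w ≈⟨ +-congˡ (-‿cong (trans (*-congʳ e) (zeroˡ w))) ⟩
    1# - x ^ 5 - 0# ≈⟨ trans (+-congˡ -0#≈0#) (+-identityʳ _) ⟩
    1# - x ^ 5 ∎
    where
    w = x - (η + η ^ 3) * x ^ 2 + (η ^ 3 + η ^ 5) * x ^ 3 - η ^ 6 * x ^ 4 + (η - 1#) * (1# + η ^ 5) * x ^ 5

  root⁵ : ∀ η → 1# + η + η ^ 2 + η ^ 3 + η ^ 4 ≈ 0# → η ^ 5 ≈ 1#
  root⁵ η e = begin
    η ^ 5 ≈⟨ solve 1 (λ η → η ⊛ 5 ⊜ Κ 1ℤ ⊕ (η ⊖ Κ 1ℤ) ⊗ (Κ 1ℤ ⊕ η ⊕ η ⊛ 2 ⊕ η ⊛ 3 ⊕ η ⊛ 4)) refl η ⟩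
    1# + (η - 1#) * (1# + η + η ^ 2 + η ^ 3 + η ^ 4) ≈⟨ +-congˡ (trans (*-congˡ e) (zeroʳ _)) ⟩
    1# + 0# ≈⟨ +-identityʳ 1# ⟩
    1# ∎

  -- The sums of five powers of η² and so on are permutations of the sum for η.
  conjugate-sum : ∀ η → 1# + η + η ^ 2 + η ^ 3 + η ^ 4 ≈ 0# → ∀ r → suc r < 5 →
    1# + η ^ suc r + (η ^ suc r) ^ 2 + (η ^ suc r) ^ 3 + (η ^ suc r) ^ 4 ≈ 0#
  conjugate-sum η e 0 _ = e
  conjugate-sum η e 1 _ = trans (solve 1 (λ η → Κ 1ℤ ⊕ η ⊛ 2 ⊕ (η ⊛ 2) ⊛ 2 ⊕ (η ⊛ 2) ⊛ 3 ⊕ (η ⊛ 2) ⊛ 4 ⊜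
      (Κ 1ℤ ⊕ η ⊕ η ⊛ 2 ⊕ η ⊛ 3 ⊕ η ⊛ 4) ⊗ (Κ 1ℤ ⊖ η ⊕ η ⊛ 2 ⊖ η ⊛ 3 ⊕ η ⊛ 4)) refl η) (trans (*-congʳ e) (zeroˡ _))
  conjugate-sum η e 2 _ = trans (solve 1 (λ η → Κ 1ℤ ⊕ η ⊛ 3 ⊕ (η ⊛ 3) ⊛ 2 ⊕ (η ⊛ 3) ⊛ 3 ⊕ (η ⊛ 3) ⊛ 4 ⊜
      (Κ 1ℤ ⊕ η ⊕ η ⊛ 2 ⊕ η ⊛ 3 ⊕ η ⊛ 4) ⊗ (Κ 1ℤ ⊖ η ⊕ η ⊛ 3 ⊖ η ⊛ 4 ⊕ η ⊛ 5 ⊖ η ⊛ 7 ⊕ η ⊛ 8)) refl η) (trans (*-congʳ e) (zeroˡ _))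
  conjugate-sum η e 3 _ = trans (solve 1 (λ η → Κ 1ℤ ⊕ η ⊛ 4 ⊕ (η ⊛ 4) ⊛ 2 ⊕ (η ⊛ 4) ⊛ 3 ⊕ (η ⊛ 4) ⊛ 4 ⊜
      (Κ 1ℤ ⊕ η ⊕ η ⊛ 2 ⊕ η ⊛ 3 ⊕ η ⊛ 4) ⊗ (Κ 1ℤ ⊖ η ⊕ η ⊛ 2 ⊖ η ⊛ 3 ⊕ η ⊛ 4) ⊗ (Κ 1ℤ ⊖ η ⊛ 2 ⊕ η ⊛ 4 ⊖ η ⊛ 6 ⊕ η ⊛ 8)) refl η) (trans (*-congʳ (trans (*-congʳ e) (zeroˡ _))) (zeroˡ _))
  conjugate-sum η e (suc (suc (suc (suc r)))) (s≤s (s≤s (s≤s (s≤s (s≤s ())))))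

  -- 1 - ρ - ρ² = (1 - αρ)(1 - βρ) with α, β the golden ratio and its conjugate, and 11 = α⁵ + β⁵.
  ∏-golden : ∀ η ρ → 1# + η + η ^ 2 + η ^ 3 + η ^ 4 ≈ 0# →
    (1# - ρ - ρ ^ 2) * (1# - η * ρ - (η * ρ) ^ 2) * (1# - η ^ 2 * ρ - (η ^ 2 * ρ) ^ 2) * (1# - η ^ 3 * ρ - (η ^ 3 * ρ) ^ 2) * (1# - η ^ 4 * ρ - (η ^ 4 * ρ) ^ 2)
      ≈ 1# - ι (+ 11) * ρ ^ 5 - ρ ^ 10
  ∏-golden η ρ e = begin
    (1# - ρ - ρ ^ 2) * F 1 * F 2 * F 3 * F 4
      ≈⟨ solve 5 (λ a b c d e → a ⊗ b ⊗ c ⊗ d ⊗ e ⊜ a ⊗ ((b ⊗ e) ⊗ (c ⊗ d))) refl _ _ _ _ _ ⟩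
    (1# - ρ - ρ ^ 2) * ((F 1 * F 4) * (F 2 * F 3))
      ≈⟨ *-congˡ (*-cong pair₁ pair₂) ⟩
    (1# - ρ - ρ ^ 2) * ((1# - a * ρ + (ι (+ 2) + a) * ρ ^ 2 + a * ρ ^ 3 + ρ ^ 4) * (1# + (1# + a) * ρ + (1# - a) * ρ ^ 2 - (1# + a) * ρ ^ 3 + ρ ^ 4))
      ≈⟨ solve 2 (λ a ρ → (Κ 1ℤ ⊖ ρ ⊖ ρ ⊛ 2) ⊗ ((Κ 1ℤ ⊖ a ⊗ ρ ⊕ (Κ (+ 2) ⊕ a) ⊗ ρ ⊛ 2 ⊕ a ⊗ ρ ⊛ 3 ⊕ ρ ⊛ 4) ⊗ (Κ 1ℤ ⊕ (Κ 1ℤ ⊕ a) ⊗ ρ ⊕ (Κ 1ℤ ⊖ a) ⊗ ρ ⊛ 2 ⊖ (Κ 1ℤ ⊕ a) ⊗ ρ ⊛ 3 ⊕ ρ ⊛ 4)) ⊜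
           Κ 1ℤ ⊖ Κ (+ 11) ⊗ ρ ⊛ 5 ⊖ ρ ⊛ 10 ⊕ (a ⊛ 2 ⊕ a ⊖ Κ 1ℤ) ⊗ ((Κ 1ℤ ⊖ ρ ⊖ ρ ⊛ 2) ⊗ (⊝ ρ ⊛ 2 ⊕ Κ (+ 2) ⊗ ρ ⊛ 3 ⊕ ρ ⊛ 4 ⊖ Κ (+ 2) ⊗ ρ ⊛ 5 ⊖ ρ ⊛ 6))) refl a ρ ⟩
    1# - ι (+ 11) * ρ ^ 5 - ρ ^ 10 + (a ^ 2 + a - 1#) * w
      ≈⟨ +-congˡ (trans (*-congʳ a²+a-1) (zeroˡ w)) ⟩
    1# - ι (+ 11) * ρ ^ 5 - ρ ^ 10 + 0# ≈⟨ +-identityʳ _ ⟩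
    1# - ι (+ 11) * ρ ^ 5 - ρ ^ 10 ∎
    where
    -- The factors with index j and 5 - j are conjugate, so their products have coefficients in
    -- ℤ[a], where a² + a = 1.
    a = η + η ^ 4
    F : ℕ → Carrier
    F j = 1# - η ^ j * ρ - (η ^ j * ρ) ^ 2
    w = (1# - ρ - ρ ^ 2) * (- ρ ^ 2 + ι (+ 2) * ρ ^ 3 + ρ ^ 4 - ι (+ 2) * ρ ^ 5 - ρ ^ 6)
    s = 1# + η + η ^ 2 + η ^ 3 + η ^ 4
    kill : ∀ {x y} c → x ≈ y + s * c → x ≈ y
    kill c p = trans p (trans (+-congˡ (trans (*-congʳ e) (zeroˡ c))) (+-identityʳ _))
    kill₂ : ∀ {x y} c d → x ≈ y + (η ^ 5 - 1#) * c + s * d → x ≈ y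
    kill₂ c d p = trans (kill d p) (trans (+-congˡ (trans (*-congʳ (trans (+-congʳ (root⁵ η e)) (-‿inverseʳ 1#))) (zeroˡ c))) (+-identityʳ _))
    a²+a-1 : a ^ 2 + a - 1# ≈ 0#
    a²+a-1 = kill₂ (ι (+ 2) + η ^ 3) 1# (solve 1 (λ η → (η ⊕ η ⊛ 4) ⊛ 2 ⊕ (η ⊕ η ⊛ 4) ⊖ Κ 1ℤ ⊜
      Κ 0ℤ ⊕ (η ⊛ 5 ⊖ Κ 1ℤ) ⊗ (Κ (+ 2) ⊕ η ⊛ 3) ⊕ (Κ 1ℤ ⊕ η ⊕ η ⊛ 2 ⊕ η ⊛ 3 ⊕ η ⊛ 4) ⊗ Κ 1ℤ) refl η)
    pair₁ : F 1 * F 4 ≈ 1# - a * ρ + (ι (+ 2) + a) * ρ ^ 2 + a * ρ ^ 3 + ρ ^ 4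
    pair₁ = kill₂ ((1# - η ^ 3) * ρ ^ 2 + (η ^ 4 + η) * ρ ^ 3 + (η ^ 5 + 1#) * ρ ^ 4) (- ρ ^ 2)
      (solve 2 (λ η ρ → let s = Κ 1ℤ ⊕ η ⊕ η ⊛ 2 ⊕ η ⊛ 3 ⊕ η ⊛ 4 ; a = η ⊕ η ⊛ 4 in
        (Κ 1ℤ ⊖ η ⊛ 1 ⊗ ρ ⊖ (η ⊛ 1 ⊗ ρ) ⊛ 2) ⊗ (Κ 1ℤ ⊖ η ⊛ 4 ⊗ ρ ⊖ (η ⊛ 4 ⊗ ρ) ⊛ 2) ⊜
        Κ 1ℤ ⊖ a ⊗ ρ ⊕ (Κ (+ 2) ⊕ a) ⊗ ρ ⊛ 2 ⊕ a ⊗ ρ ⊛ 3 ⊕ ρ ⊛ 4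
        ⊕ (η ⊛ 5 ⊖ Κ 1ℤ) ⊗ ((Κ 1ℤ ⊖ η ⊛ 3) ⊗ ρ ⊛ 2 ⊕ (η ⊛ 4 ⊕ η) ⊗ ρ ⊛ 3 ⊕ (η ⊛ 5 ⊕ Κ 1ℤ) ⊗ ρ ⊛ 4) ⊕ s ⊗ (⊝ ρ ⊛ 2)) refl η ρ)
    pair₂ : F 2 * F 3 ≈ 1# + (1# + a) * ρ + (1# - a) * ρ ^ 2 - (1# + a) * ρ ^ 3 + ρ ^ 4
    pair₂ = kill₂ ((1# - η) * ρ ^ 2 + (η ^ 3 + η ^ 2) * ρ ^ 3 + (η ^ 5 + 1#) * ρ ^ 4) (- ρ + ρ ^ 3)
      (solve 2 (λ η ρ → let s = Κ 1ℤ ⊕ η ⊕ η ⊛ 2 ⊕ η ⊛ 3 ⊕ η ⊛ 4 ; a = η ⊕ η ⊛ 4 in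
        (Κ 1ℤ ⊖ η ⊛ 2 ⊗ ρ ⊖ (η ⊛ 2 ⊗ ρ) ⊛ 2) ⊗ (Κ 1ℤ ⊖ η ⊛ 3 ⊗ ρ ⊖ (η ⊛ 3 ⊗ ρ) ⊛ 2) ⊜
        Κ 1ℤ ⊕ (Κ 1ℤ ⊕ a) ⊗ ρ ⊕ (Κ 1ℤ ⊖ a) ⊗ ρ ⊛ 2 ⊖ (Κ 1ℤ ⊕ a) ⊗ ρ ⊛ 3 ⊕ ρ ⊛ 4
        ⊕ (η ⊛ 5 ⊖ Κ 1ℤ) ⊗ ((Κ 1ℤ ⊖ η) ⊗ ρ ⊛ 2 ⊕ (η ⊛ 3 ⊕ η ⊛ 2) ⊗ ρ ⊛ 3 ⊕ (η ⊛ 5 ⊕ Κ 1ℤ) ⊗ ρ ⊛ 4) ⊕ s ⊗ (⊝ ρ ⊕ ρ ⊛ 3)) refl η ρ)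

module Twist (K : CommutativeRing 0ℓ 0ℓ) where
  private module K = Ring K
  open Gauss K
  open S using (_*_; _+_; _-_; -_; 0#; 1#; _^_)
  private module C = Hom C-hom

  -- f(q) ↦ f(wq)
  twist : K.Carrier → Hom ring ring
  twist w = record
    { ⟦_⟧ = λ f n → w K.^ n K.* f n ; cong = λ e → mk λ n → K.*-congˡ (at e n) ; +-hom = λ f g → mk λ n → K.distribˡ _ _ _
    ; *-hom = λ f g → mk λ n → K.sym (K.trans (K.∑²-cong n (λ i j p → K.trans
          (K.solve 4 (λ a b c d → (a ⊗ b) ⊗ (c ⊗ d) K.⊜ (a ⊗ c) ⊗ (b ⊗ d)) K.refl (w K.^ i) (f i) (w K.^ j) (g j))
          (K.*-congʳ (K.trans (K.sym (K.^-homo-* w i j)) (K.reflexive (≡.cong (w K.^_) p)))))) (K.∑²-*ˡ n _ _))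
    ; 1-hom = mk λ { zero → K.*-identityʳ _ ; (suc n) → K.zeroʳ _ } }

  twist-q : ∀ w → Hom.⟦ twist w ⟧ q ≋ C w * q
  twist-q w = mk λ n → K.trans (go n) (K.sym (C*-coef w q n))
    where go : ∀ n → w K.^ n K.* q n K.≈ w K.* q n
          go zero = K.trans (K.zeroʳ _) (K.sym (K.zeroʳ _))
          go (suc zero) = K.refl
          go (suc (suc n)) = K.trans (K.zeroʳ _) (K.sym (K.zeroʳ _))

  twist-1 : ∀ f → Hom.⟦ twist K.1# ⟧ f ≋ f
  twist-1 f = mk λ n → K.trans (K.*-congʳ (one^ n)) (K.*-identityˡ _)
    where one^ : ∀ n → K.1# K.^ n K.≈ K.1#
          one^ zero = K.refl
          one^ (suc n) = K.trans (K.^-suc K.1# n) (K.trans (K.*-identityˡ _) (one^ n))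

  twist-[] : ∀ w {N f g} → f ≈[ N ] g → Hom.⟦ twist w ⟧ f ≈[ N ] Hom.⟦ twist w ⟧ g
  twist-[] w e i l = K.*-congˡ (e i l)

  open Spread K 4

  twist-V : ∀ w f → w K.^ 5 K.≈ K.1# → Hom.⟦ twist w ⟧ (V f) ≋ V f
  twist-V w f w⁵ = U-ext λ
    { zero _ → mk λ n → K.trans (K.*-congʳ (pow n)) (K.*-identityˡ _)
    ; (suc r) l → mk λ n → K.trans (K.*-congˡ (at (UrV r f l) n)) (K.trans (K.zeroʳ _) (K.sym (at (UrV r f l) n))) }
    where
    pow : ∀ n → w K.^ (n ℕ.* 5 ℕ.+ 0) K.≈ K.1#
    pow zero = K.refl
    pow (suc n) = K.trans (K.^-homo-* w 5 (n ℕ.* 5 ℕ.+ 0)) (K.trans (K.*-cong w⁵ (pow n)) (K.*-identityˡ _))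

CyclotomicSum : (R : CommutativeRing 0ℓ 0ℓ) → CommutativeRing.Carrier R → Set
CyclotomicSum R ζ = 1# + ζ + ζ ^ 2 + ζ ^ 3 + ζ ^ 4 ≈ 0#
  where open Ring R

module Norm (K : CommutativeRing 0ℓ 0ℓ) (ζ : CommutativeRing.Carrier K) (ζ-sum : CyclotomicSum K ζ) where
  private module K = Ring K
  open Gauss K
  open S using (_*_; _+_; _-_; -_; 0#; 1#; _^_)
  open Twist K
  open Eta K
  open Spread K 4
  open RootsOfUnity ring
  private
    module C = Hom C-hom
    module V = Hom V-hom
    module t (j : ℕ) = Hom (twist (ζ K.^ j))
    ζ⁵ = RootsOfUnity.root⁵ K ζ ζ-sum

  -- The product of f(ζ^j q) over j modulo 5.
  norm : PS → PS
  norm f = f * t.⟦_⟧ 1 f * t.⟦_⟧ 2 f * t.⟦_⟧ 3 f * t.⟦_⟧ 4 f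

  norm-* : ∀ f g → norm (f * g) ≋ norm f * norm g
  norm-* f g = S.trans (S.*-cong (S.*-cong (S.*-cong (S.*-congˡ {f * g} (t.*-hom 1 f g)) (t.*-hom 2 f g)) (t.*-hom 3 f g)) (t.*-hom 4 f g))
    (S.solve 10 (λ a b c d e a′ b′ c′ d′ e′ → (a ⊗ a′) ⊗ (b ⊗ b′) ⊗ (c ⊗ c′) ⊗ (d ⊗ d′) ⊗ (e ⊗ e′) S.⊜ (a ⊗ b ⊗ c ⊗ d ⊗ e) ⊗ (a′ ⊗ b′ ⊗ c′ ⊗ d′ ⊗ e′)) S.refl
      f (t.⟦_⟧ 1 f) (t.⟦_⟧ 2 f) (t.⟦_⟧ 3 f) (t.⟦_⟧ 4 f) g (t.⟦_⟧ 1 g) (t.⟦_⟧ 2 g) (t.⟦_⟧ 3 g) (t.⟦_⟧ 4 g))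

  norm-[] : ∀ {N f g} → f ≈[ N ] g → norm f ≈[ N ] norm g
  norm-[] e = []-* ([]-* ([]-* ([]-* e (twist-[] _ e)) (twist-[] _ e)) (twist-[] _ e)) (twist-[] _ e)

  norm-cong : ∀ {f g} → f ≋ g → norm f ≋ norm g
  norm-cong e = ≈[]⇒≋ (λ N → norm-[] (≋⇒≈[] e))

  private
    -- The exponent i ≡ r mod 5 enters only through ζ^i = ζ^r.
    twist-factor : ∀ j r m → t.⟦_⟧ j (1# - q ^ suc (r ℕ.+ m ℕ.* 5)) ≋ 1# - C (ζ K.^ suc r) ^ j * q ^ suc (r ℕ.+ m ℕ.* 5)
    twist-factor j r m = S.trans (t.+-hom j 1# (- (q ^ i))) (S.+-cong (t.1-hom j) (S.trans (t.neg-hom j (q ^ i)) (S.-‿cong (S.trans (t.^-hom j q i) (S.trans (S.^-congˡ i (twist-q (ζ K.^ j)))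
      (S.trans (S.^-distrib-* (C (ζ K.^ j)) q i) (S.*-congʳ (S.trans (S.sym (C.^-hom (ζ K.^ j) i)) (S.trans (C.cong pw) (C.^-hom (ζ K.^ suc r) j))))))))))
      where
      i = suc (r ℕ.+ m ℕ.* 5)
      ζ5m : ∀ m → ζ K.^ (m ℕ.* 5) K.≈ K.1#
      ζ5m zero = K.refl
      ζ5m (suc m) = K.trans (K.^-homo-* ζ 5 (m ℕ.* 5)) (K.trans (K.*-cong ζ⁵ (ζ5m m)) (K.*-identityˡ _))
      pw : (ζ K.^ j) K.^ i K.≈ (ζ K.^ suc r) K.^ j
      pw = K.trans (K.^-assocʳ ζ j i) (K.trans (K.reflexive (≡.cong (ζ K.^_) (ℕP.*-comm j i))) (K.trans (K.sym (K.^-assocʳ ζ i j))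
        (K.^-congˡ j (K.trans (K.^-homo-* ζ (suc r) (m ℕ.* 5)) (K.trans (K.*-congˡ (ζ5m m)) (K.*-identityʳ _))))))

    norm-factor : ∀ r m → r < 4 → norm (1# - q ^ suc (r ℕ.+ m ℕ.* 5)) ≋ 1# - (q ^ suc (r ℕ.+ m ℕ.* 5)) ^ 5
    norm-factor r m l = S.trans (S.*-cong (S.*-cong (S.*-cong (S.*-congˡ {1# - x} (twist-factor 1 r m)) (twist-factor 2 r m)) (twist-factor 3 r m)) (twist-factor 4 r m))
      (∏-roots η x (S.trans (S.sym (S.+-cong (S.+-cong (S.+-cong (S.+-congʳ C.1-hom) (C.^-hom w 2)) (C.^-hom w 3)) (C.^-hom w 4)))
        (S.trans (S.sym (S.trans (C.+-hom _ _) (S.+-congʳ (S.trans (C.+-hom _ _) (S.+-congʳ (S.trans (C.+-hom _ _) (S.+-congʳ (C.+-hom _ _))))))))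
          (S.trans (C.cong (RootsOfUnity.conjugate-sum K ζ ζ-sum r (s≤s l))) C.0-hom))))
      where x = q ^ suc (r ℕ.+ m ℕ.* 5)
            w = ζ K.^ suc r
            η = C w

    norm-factor₅ : ∀ m → norm (1# - q ^ suc (4 ℕ.+ m ℕ.* 5)) ≋ (1# - q ^ suc (4 ℕ.+ m ℕ.* 5)) ^ 5
    norm-factor₅ m = S.*-cong (S.*-cong (S.*-cong (S.*-congˡ {1# - x} (f 1)) (f 2)) (f 3)) (f 4)
      where
      x = q ^ suc (4 ℕ.+ m ℕ.* 5)
      one^ : ∀ j → 1# ^ j ≋ 1#
      one^ zero = S.refl
      one^ (suc j) = S.trans (S.^-suc 1# j) (S.trans (S.*-identityˡ _) (one^ j))
      f : ∀ j → t.⟦_⟧ j (1# - x) ≋ 1# - x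
      f j = S.trans (twist-factor j 4 m) (S.+-congˡ {1#} (S.-‿cong (S.trans (S.*-congʳ (S.trans (S.^-congˡ j (S.trans (C.cong ζ⁵) C.1-hom)) (one^ j))) (S.*-identityˡ x))))

    q⁵ = q ^ 5

    -- For i prime to 5 the conjugates of 1 - q^i multiply to 1 - q^(5i); for i divisible by 5 they
    -- coincide and give a fifth power. The factor `poch (q⁵ ^ 5) m` supplies the 1 - q^(5i) with i
    -- divisible by 5, which completes `poch q⁵ (m * 5)` without a division.
    norm-poch : ∀ m → norm (poch q (m ℕ.* 5)) * poch (q⁵ ^ 5) m ≋ poch q⁵ (m ℕ.* 5) * poch q⁵ m ^ 5
    norm-poch zero = S.trans (S.*-identityʳ _) (S.trans (S.*-cong (S.*-cong (S.*-cong (S.*-congˡ {1#} (t.1-hom 1)) (t.1-hom 2)) (t.1-hom 3)) (t.1-hom 4))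
      (S.solve 0 (Κ 1ℤ ⊗ Κ 1ℤ ⊗ Κ 1ℤ ⊗ Κ 1ℤ ⊗ Κ 1ℤ S.⊜ Κ 1ℤ ⊗ Κ 1ℤ ⊛ 5) S.refl))
    norm-poch (suc m) = begin
      norm (P * f 0 * f 1 * f 2 * f 3 * f 4) * (P₂₅ * (1# - (q⁵ ^ 5) ^ suc m))
        ≈⟨ S.*-congʳ (S.trans (norm-* (P * f 0 * f 1 * f 2 * f 3) (f 4)) (S.*-cong (S.trans (norm-* (P * f 0 * f 1 * f 2) (f 3)) (S.*-cong (S.trans (norm-* (P * f 0 * f 1) (f 2)) (S.*-cong (S.trans (norm-* (P * f 0) (f 1)) (S.*-cong (S.trans (norm-* P (f 0)) (S.*-congˡ (nf 0 (s≤s z≤n)))) (nf 1 (s≤s (s≤s z≤n))))) (nf 2 (s≤s (s≤s (s≤s z≤n)))))) (nf 3 (s≤s (s≤s (s≤s (s≤s z≤n))))))) (norm-factor₅ m))) ⟩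
      norm P * g 0 * g 1 * g 2 * g 3 * f 4 ^ 5 * (P₂₅ * (1# - (q⁵ ^ 5) ^ suc m))
        ≈⟨ S.*-cong (S.*-congˡ (S.^-congˡ 5 (mi q5m))) (S.*-congˡ (mi q25m)) ⟩
      norm P * g 0 * g 1 * g 2 * g 3 * (1# - q⁵ ^ suc m) ^ 5 * (P₂₅ * g 4)
        ≈⟨ S.solve 8 (λ n a b c d u p e → n ⊗ a ⊗ b ⊗ c ⊗ d ⊗ u ⊗ (p ⊗ e) S.⊜ (n ⊗ p) ⊗ (a ⊗ b ⊗ c ⊗ d ⊗ e ⊗ u)) S.refl (norm P) (g 0) (g 1) (g 2) (g 3) ((1# - q⁵ ^ suc m) ^ 5) P₂₅ (g 4) ⟩
      (norm P * P₂₅) * (g 0 * g 1 * g 2 * g 3 * g 4 * (1# - q⁵ ^ suc m) ^ 5)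
        ≈⟨ S.*-congʳ (norm-poch m) ⟩
      (P₅ * P₅′ ^ 5) * (g 0 * g 1 * g 2 * g 3 * g 4 * (1# - q⁵ ^ suc m) ^ 5)
        ≈⟨ S.solve 8 (λ n a b c d u p e → (n ⊗ p ⊛ 5) ⊗ (a ⊗ b ⊗ c ⊗ d ⊗ e ⊗ u ⊛ 5) S.⊜ (n ⊗ a ⊗ b ⊗ c ⊗ d ⊗ e) ⊗ (p ⊗ u) ⊛ 5) S.refl P₅ (g 0) (g 1) (g 2) (g 3) (1# - q⁵ ^ suc m) P₅′ (g 4) ⟩
      (P₅ * g 0 * g 1 * g 2 * g 3 * g 4) * (P₅′ * (1# - q⁵ ^ suc m)) ^ 5
        ≈⟨ S.*-congʳ (S.*-cong (S.*-cong (S.*-cong (S.*-cong (S.*-congˡ (mi (sw 0))) (mi (sw 1))) (mi (sw 2))) (mi (sw 3))) (mi (sw 4))) ⟩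
      poch q⁵ (suc m ℕ.* 5) * poch q⁵ (suc m) ^ 5 ∎
      where
      open S.Rsn
      P = poch q (m ℕ.* 5)
      P₂₅ = poch (q⁵ ^ 5) m
      P₅ = poch q⁵ (m ℕ.* 5)
      P₅′ = poch q⁵ m
      e : ℕ → ℕ
      e r = suc (r ℕ.+ m ℕ.* 5)
      f g : ℕ → PS
      f r = 1# - q ^ e r
      g r = 1# - (q ^ e r) ^ 5
      nf : ∀ r → r < 4 → norm (f r) ≋ g r
      nf r l = norm-factor r m l
      mi : ∀ {x y} → x ≋ y → (1# - x) ≋ (1# - y)
      mi p = S.+-congˡ {1#} (S.-‿cong p)
      sw : ∀ r → (q ^ e r) ^ 5 ≋ q⁵ ^ e r
      sw r = S.trans (S.^-assocʳ q (e r) 5) (S.trans (S.≡⇒≈ (≡.cong (q ^_) (ℕP.*-comm (e r) 5))) (S.sym (S.^-assocʳ q 5 (e r))))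
      q5m : q ^ e 4 ≋ q⁵ ^ suc m
      q5m = S.trans (S.≡⇒≈ (≡.cong (q ^_) (ℕP.*-comm (suc m) 5))) (S.sym (S.^-assocʳ q 5 (suc m)))
      q25m : (q⁵ ^ 5) ^ suc m ≋ (q ^ e 4) ^ 5
      q25m = S.sym (S.trans (S.^-congˡ 5 q5m) (S.trans (S.^-assocʳ q⁵ (suc m) 5) (S.trans (S.≡⇒≈ (≡.cong (q⁵ ^_) (ℕP.*-comm (suc m) 5))) (S.sym (S.^-assocʳ q⁵ 5 (suc m))))))

  norm-eta : norm eta * V (V eta) ≋ V eta ^ 6
  norm-eta = ≈[]⇒≋ λ N → []-trans ([]-* (norm-[] (eta-near N)) (≋[] (V-[] N ([]-trans (V-[] N (near N)) (≋⇒≈[] (Vp N)))) (S.trans (V.poch-hom N q⁵) (S.∏-cong N (λ i → S.+-congˡ {1#} (S.-‿cong (S.^-congˡ (suc i) (S.trans (V.^-hom q 5) (S.^-congˡ 5 V-q)))))))))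
      ([]-trans (≋⇒≈[] (S.trans (norm-poch N) (S.*-congʳ (S.sym (Vp (N ℕ.* 5))))))
      ([]-trans ([]-* (V-[] N ([]-sym (eta-near N))) (pow5 ([]-sym (≋[] (V-[] N (near N)) (Vp N))))) (≋⇒≈[] (S.solve 1 (λ x → x ⊗ x ⊛ 5 S.⊜ x ⊛ 6) S.refl (V eta)))))
    where
    near : ∀ N → eta ≈[ N ] poch q N
    near N = ≈[]-weaken (ℕP.n≤1+n N) (eta-poch N)
    eta-near : ∀ N → eta ≈[ N ] poch q (N ℕ.* 5)
    eta-near N = ≈[]-weaken (ℕP.≤-trans (ℕP.m≤m*n N 5) (ℕP.n≤1+n _)) (eta-poch (N ℕ.* 5))
    Vp : ∀ m → V (poch q m) ≋ poch q⁵ m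
    Vp m = S.trans (V.poch-hom m q) (S.∏-cong m (λ i → S.+-congˡ {1#} (S.-‿cong (S.^-congˡ (suc i) V-q))))
    ≋[] : ∀ {N f g h} → f ≈[ N ] g → g ≋ h → f ≈[ N ] h
    ≋[] p r = []-trans p (≋⇒≈[] r)
    pow5 : ∀ {N f g} → f ≈[ N ] g → (f ^ 5) ≈[ N ] (g ^ 5)
    pow5 e = []-* ([]-* ([]-* ([]-* e e) e) e) e

  norm-golden : ∀ X ρ f → (∀ j → t.⟦_⟧ j X ≋ X) → (∀ j → t.⟦_⟧ j ρ ≋ C ζ ^ j * ρ) → f ≋ X * (1# - ρ - ρ ^ 2) →
    norm f ≋ X ^ 5 * (1# - S.ι (+ 11) * ρ ^ 5 - ρ ^ 10)
  norm-golden X ρ f tX tρ e = S.trans (S.*-cong (S.*-cong (S.*-cong (S.*-cong e (im 1)) (im 2)) (im 3)) (im 4))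
    (S.trans (S.solve 6 (λ x a b c d e → (x ⊗ a) ⊗ (x ⊗ b) ⊗ (x ⊗ c) ⊗ (x ⊗ d) ⊗ (x ⊗ e) S.⊜ x ⊛ 5 ⊗ (a ⊗ b ⊗ c ⊗ d ⊗ e)) S.refl X (1# - ρ - ρ ^ 2) (F 1) (F 2) (F 3) (F 4))
      (S.*-congˡ (∏-golden (C ζ) ρ (S.trans (S.sym (S.trans (C.+-hom _ _) (S.+-cong (S.trans (C.+-hom _ _) (S.+-cong (S.trans (C.+-hom _ _) (S.+-cong (S.trans (C.+-hom _ _) (S.+-congʳ C.1-hom)) (C.^-hom ζ 2))) (C.^-hom ζ 3))) (C.^-hom ζ 4)))) (S.trans (C.cong ζ-sum) C.0-hom)))))
    where
    F : ℕ → PS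
    F j = 1# - C ζ ^ j * ρ - (C ζ ^ j * ρ) ^ 2
    im : ∀ j → t.⟦_⟧ j f ≋ X * F j
    im j = S.trans (t.cong j e) (S.trans (t.*-hom j X (1# - ρ - ρ ^ 2)) (S.*-cong (tX j) (S.trans (t.+-hom j (1# - ρ) (- (ρ ^ 2))) (S.+-cong (S.trans (t.+-hom j 1# (- ρ)) (S.+-cong (t.1-hom j) (S.trans (t.neg-hom j ρ) (S.-‿cong (tρ j))))) (S.trans (t.neg-hom j (ρ ^ 2)) (S.-‿cong (S.trans (t.^-hom j ρ 2) (S.^-congˡ 2 (tρ j)))))))))

-- The quotient ρ and its golden relation

module MapSpread {A B : CommutativeRing 0ℓ 0ℓ} (φ : Hom A B) where
  private
    module A = Ring A
    module B = Ring B
    module SA = Gauss A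
    module SB = Gauss B
    module φ = Hom φ
    module M = MapSeries φ
    module m = Hom M.map
    module VA = Spread A
    module VB = Spread B

  map-V : ∀ k f → m.⟦ VA.V k f ⟧ SB.≋ VB.V k m.⟦ f ⟧
  map-V k f = VB.U-ext k λ
    { zero _ → SB.mk λ n → B.trans (φ.cong (SA.at (VA.U0V k f) n)) (B.sym (SB.at (VB.U0V k m.⟦ f ⟧) n))
    ; (suc r) l → SB.mk λ n → B.trans (B.trans (φ.cong (SA.at (VA.UrV k r f l) n)) φ.0-hom) (B.sym (SB.at (VB.UrV k r m.⟦ f ⟧ l) n)) }

  map-poch : ∀ n → m.⟦ SA.poch SA.q n ⟧ SB.≋ SB.poch SB.q n
  map-poch n = SB.S.trans (m.poch-hom n SA.q) (SB.S.∏-cong n (λ i → SB.S.+-congˡ {SB.S.1#} (SB.S.-‿cong (SB.S.^-congˡ (suc i) M.map-q))))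

  map-eta : m.⟦ Eta.eta A ⟧ SB.≋ Eta.eta B
  map-eta = SB.mk λ n → SB.at (map-poch n) n

  map-C : ∀ c → m.⟦ SA.C c ⟧ SB.≋ SB.C φ.⟦ c ⟧
  map-C c = SB.mk λ { zero → B.refl ; (suc n) → φ.0-hom }

IsThird : (R : CommutativeRing 0ℓ 0ℓ) → CommutativeRing.Carrier R → Set
IsThird R t = t * ι (+ 3) ≈ 1#
  where open Ring R

IsInverseEta : (R : CommutativeRing 0ℓ 0ℓ) → Series.PS R → Set
IsInverseEta R p = eta * p ≋ 1#
  where
  open Gauss R
  open S
  open Eta R

Injective : ∀ {A K : CommutativeRing 0ℓ 0ℓ} → Hom A K → Set
Injective {A} {K} φ = ∀ {a b} → ⟦ a ⟧ K.≈ ⟦ b ⟧ → a A.≈ b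
  where
  module A = Ring A
  module K = Ring K
  open Hom φ

module Golden (A K : CommutativeRing 0ℓ 0ℓ) (φ : Hom A K) (φ-injective : Injective φ)
  (ζ : CommutativeRing.Carrier K) (ζ-sum : CyclotomicSum K ζ)
  (third : CommutativeRing.Carrier A) (3≠0 : IsThird A third)
  (p : Series.PS A) (eta-p : IsInverseEta A p) where
  private
    module A = Ring A
    module K = Ring K
  open Series A
  open S using (_*_; _+_; _-_; -_; 0#; 1#; _^_)
  open Eta A using (eta)
  open Spread A 4
  open Dissection A using (x; z; X; Y; Z; eta-dissection)
  private
    module SK = Gauss K
    module T = SK.S
    module NK = Norm K ζ ζ-sum
    module TW = Twist K
    module VK = Spread K 4
    module M = MapSeries φ
    module m = Hom M.map
    module MS = MapSpread φ
    module V = Hom V-hom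
    module t (j : ℕ) = Hom (TW.twist (ζ K.^ j))
    module CK = Hom SK.C-hom

  -- `ρ` is qZ/Y, which is the Rogers-Ramanujan continued fraction evaluated at q^5, with leading
  -- term q.
  ν⁻¹ ρ : PS
  ν⁻¹ = V (V p)
  ρ = q * (Z * ν⁻¹)

  Yν⁻¹ : Y * ν⁻¹ ≋ 1#
  Yν⁻¹ = S.trans (S.sym (V.*-hom (V eta) (V p))) (S.trans (V-cong (S.trans (S.sym (V.*-hom eta p)) (S.trans (V-cong eta-p) V.1-hom))) V.1-hom)

  Xρ : X * ρ ≋ q * Y
  Xρ = begin
    X * (q * (Z * ν⁻¹)) ≈⟨ S.solve 4 (λ x q z n → x ⊗ (q ⊗ (z ⊗ n)) S.⊜ q ⊗ ((x ⊗ z) ⊗ n)) S.refl X q Z ν⁻¹ ⟩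
    q * ((X * Z) * ν⁻¹) ≈⟨ S.*-congˡ (S.*-congʳ (Dissection.XZ≋Y² A third 3≠0)) ⟩
    q * (Y ^ 2 * ν⁻¹) ≈⟨ S.solve 3 (λ q y n → q ⊗ (y ⊛ 2 ⊗ n) S.⊜ q ⊗ y ⊗ (y ⊗ n)) S.refl q Y ν⁻¹ ⟩
    q * Y * (Y * ν⁻¹) ≈⟨ S.*-congˡ Yν⁻¹ ⟩
    q * Y * 1# ≈⟨ S.*-identityʳ _ ⟩
    q * Y ∎
    where open S.Rsn

  -- Since XZ = Y², the terms qY and q²Z of the dissection are Xρ and Xρ².
  eta-ρ : eta ≋ X * (1# - ρ - ρ ^ 2)
  eta-ρ = begin
    eta ≈⟨ eta-dissection ⟩
    X - q * Y - q ^ 2 * Z ≈⟨ S.+-cong (S.+-congˡ (S.-‿cong (S.sym Xρ))) (S.-‿cong q²Z) ⟩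
    X - X * ρ - X * ρ ^ 2 ≈⟨ S.solve 2 (λ x r → x S.⊖ x ⊗ r S.⊖ x ⊗ r ⊛ 2 S.⊜ x ⊗ (Κ 1ℤ S.⊖ r S.⊖ r ⊛ 2)) S.refl X ρ ⟩
    X * (1# - ρ - ρ ^ 2) ∎
    where
    open S.Rsn
    q²Z : q ^ 2 * Z ≋ X * ρ ^ 2
    q²Z = S.sym (S.trans (S.solve 2 (λ x r → x ⊗ r ⊛ 2 S.⊜ (x ⊗ r) ⊗ r) S.refl X ρ) (S.trans (S.*-congʳ Xρ)
      (S.trans (S.solve 4 (λ q y z n → q ⊗ y ⊗ (q ⊗ (z ⊗ n)) S.⊜ q ⊛ 2 ⊗ z ⊗ (y ⊗ n)) S.refl q Y Z ν⁻¹) (S.trans (S.*-congˡ Yν⁻¹) (S.*-identityʳ _)))))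

  -- Two evaluations of the norm of `eta`: as a product by `norm-eta`, and from `eta-ρ` by
  -- `norm-golden`, since the substitutions q ↦ ζ^j q fix X and multiply ρ by ζ^j. The comparison
  -- takes place over K and descends because `φ` is injective.
  golden : X ^ 5 * (1# - S.ι (+ 11) * ρ ^ 5 - ρ ^ 10) * Y ≋ V eta ^ 6
  golden = mk λ n → φ-injective (SK.at key n)
    where
    open T.Rsn
    rhs : m.⟦ X ^ 5 * (1# - S.ι (+ 11) * ρ ^ 5 - ρ ^ 10) * Y ⟧ T.≈ m.⟦ X ⟧ T.^ 5 T.* (T.1# T.- T.ι (+ 11) T.* m.⟦ ρ ⟧ T.^ 5 T.- m.⟦ ρ ⟧ T.^ 10) T.* m.⟦ Y ⟧
    rhs = T.trans (m.*-hom (X ^ 5 * (1# - S.ι (+ 11) * ρ ^ 5 - ρ ^ 10)) Y) (T.*-congʳ (T.trans (m.*-hom (X ^ 5) (1# - S.ι (+ 11) * ρ ^ 5 - ρ ^ 10)) (T.*-cong (m.^-hom X 5)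
      (T.trans (m.+-hom (1# - S.ι (+ 11) * ρ ^ 5) (- ρ ^ 10)) (T.+-cong (T.trans (m.+-hom 1# (- (S.ι (+ 11) * ρ ^ 5))) (T.+-cong m.1-hom (T.trans (m.neg-hom (S.ι (+ 11) * ρ ^ 5)) (T.-‿cong (T.trans (m.*-hom (S.ι (+ 11)) (ρ ^ 5)) (T.*-cong (m.ι-hom (+ 11)) (m.^-hom ρ 5)))))))
        (T.trans (m.neg-hom (ρ ^ 10)) (T.-‿cong (m.^-hom ρ 10))))))))
    w⁵ : ∀ j → (ζ K.^ j) K.^ 5 K.≈ K.1#
    w⁵ j = K.trans (K.^-assocʳ ζ j 5) (K.trans (K.reflexive (≡.cong (ζ K.^_) (ℕP.*-comm j 5))) (K.trans (K.sym (K.^-assocʳ ζ 5 j)) (K.trans (K.^-congˡ j (RootsOfUnity.root⁵ K ζ ζ-sum)) (one^ j))))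
      where one^ : ∀ j → K.1# K.^ j K.≈ K.1#
            one^ zero = K.refl
            one^ (suc j) = K.trans (K.^-suc K.1# j) (K.trans (K.*-identityˡ _) (one^ j))
    fixed : ∀ f j → t.⟦_⟧ j m.⟦ V f ⟧ T.≈ m.⟦ V f ⟧
    fixed f j = T.trans (t.cong j (MS.map-V 4 f)) (T.trans (TW.twist-V (ζ K.^ j) m.⟦ f ⟧ (w⁵ j)) (T.sym (MS.map-V 4 f)))
    tρ : ∀ j → t.⟦_⟧ j m.⟦ ρ ⟧ T.≈ SK.C ζ T.^ j T.* m.⟦ ρ ⟧
    tρ j = begin
      t.⟦_⟧ j m.⟦ ρ ⟧ ≈⟨ t.cong j (T.trans (m.*-hom q (Z * ν⁻¹)) (T.*-cong M.map-q (m.*-hom Z ν⁻¹))) ⟩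
      t.⟦_⟧ j (SK.q T.* (m.⟦ Z ⟧ T.* m.⟦ ν⁻¹ ⟧)) ≈⟨ T.trans (t.*-hom j SK.q (m.⟦ Z ⟧ T.* m.⟦ ν⁻¹ ⟧)) (T.*-cong (TW.twist-q (ζ K.^ j)) (T.trans (t.*-hom j m.⟦ Z ⟧ m.⟦ ν⁻¹ ⟧) (T.*-cong (fixed z j) (fixed (V p) j)))) ⟩
      SK.C (ζ K.^ j) T.* SK.q T.* (m.⟦ Z ⟧ T.* m.⟦ ν⁻¹ ⟧) ≈⟨ T.*-assoc _ _ _ ⟩
      SK.C (ζ K.^ j) T.* (SK.q T.* (m.⟦ Z ⟧ T.* m.⟦ ν⁻¹ ⟧)) ≈⟨ T.*-cong (CK.^-hom ζ j) (T.sym (T.trans (m.*-hom q (Z * ν⁻¹)) (T.*-cong M.map-q (m.*-hom Z ν⁻¹)))) ⟩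
      SK.C ζ T.^ j T.* m.⟦ ρ ⟧ ∎
    e : m.⟦ eta ⟧ T.≈ m.⟦ X ⟧ T.* (T.1# T.- m.⟦ ρ ⟧ T.- m.⟦ ρ ⟧ T.^ 2)
    e = T.trans (m.cong eta-ρ) (T.trans (m.*-hom X (1# - ρ - ρ ^ 2)) (T.*-congˡ (T.trans (m.+-hom (1# - ρ) (- ρ ^ 2)) (T.+-cong (T.trans (m.+-hom 1# (- ρ)) (T.+-cong m.1-hom (m.neg-hom ρ))) (T.trans (m.neg-hom (ρ ^ 2)) (T.-‿cong (m.^-hom ρ 2)))))))
    mVeta : m.⟦ V eta ⟧ T.≈ VK.V (Eta.eta K)
    mVeta = T.trans (MS.map-V 4 eta) (VK.V-cong MS.map-eta)
    key : m.⟦ X ^ 5 * (1# - S.ι (+ 11) * ρ ^ 5 - ρ ^ 10) * Y ⟧ T.≈ m.⟦ V eta ^ 6 ⟧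
    key = begin
      m.⟦ X ^ 5 * (1# - S.ι (+ 11) * ρ ^ 5 - ρ ^ 10) * Y ⟧ ≈⟨ rhs ⟩
      m.⟦ X ⟧ T.^ 5 T.* (T.1# T.- T.ι (+ 11) T.* m.⟦ ρ ⟧ T.^ 5 T.- m.⟦ ρ ⟧ T.^ 10) T.* m.⟦ Y ⟧
        ≈⟨ T.*-cong (T.sym (T.trans (NK.norm-cong (T.sym MS.map-eta)) (NK.norm-golden m.⟦ X ⟧ m.⟦ ρ ⟧ m.⟦ eta ⟧ (fixed x) tρ e))) (T.trans (MS.map-V 4 (V eta)) (VK.V-cong mVeta)) ⟩
      NK.norm (Eta.eta K) T.* VK.V (VK.V (Eta.eta K)) ≈⟨ NK.norm-eta ⟩
      VK.V (Eta.eta K) T.^ 6 ≈⟨ T.trans (T.^-congˡ 6 (T.sym mVeta)) (T.sym (m.^-hom (V eta) 6)) ⟩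
      m.⟦ V eta ^ 6 ⟧ ∎

-- Bijections between duplicate-free lists and sums over them

-- f and g are mutually inverse between the members of l and those of m.
record Matching {X Y : Set} (l : List X) (m : List Y) : Set where
  field
    to : X → Y
    from : Y → X
    to-∈ : ∀ {x} → x ∈ l → to x ∈ m
    from-∈ : ∀ {y} → y ∈ m → from y ∈ l
    from-to : ∀ {x} → x ∈ l → from (to x) ≡ x
    to-from : ∀ {y} → y ∈ m → to (from y) ≡ y

  map-unique : Unique l → Unique (List.map to l)
  map-unique u = go l u from-to
    where
    go : ∀ l → Unique l → (∀ {x} → x ∈ l → from (to x) ≡ x) → Unique (List.map to l)
    go [] [] h = []
    go (x ∷ l) (x∉ ∷ u) h = All.tabulate (λ fy∈ p → let (y , y∈ , e) = ∈P.∈-map⁻ to fy∈ in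
        All.lookup x∉ y∈ (≡.trans (≡.sym (h (here ≡.refl))) (≡.trans (≡.cong from (≡.trans p e)) (h (there y∈))))) ∷ go l u (h ∘ there)

  map-↭ : Unique l → Unique m → List.map to l ↭ m
  map-↭ u u′ = ∼bag⇒↭ (∈PK.unique∧set⇒bag (map-unique u) u′ (mk⇔
    (λ fx∈ → let (x , x∈ , e) = ∈P.∈-map⁻ to fx∈ in ≡.subst (_∈ m) (≡.sym e) (to-∈ x∈))
    (λ y∈ → ≡.subst (_∈ List.map to l) (to-from y∈) (∈P.∈-map⁺ to (from-∈ y∈)))))

module ListSums (R : CommutativeRing 0ℓ 0ℓ) where
  open Ring R

  sumL-↭ : ∀ {X : Set} {l m : List X} (F : X → Carrier) → l ↭ m → sumL l F ≈ sumL m F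
  sumL-↭ F Perm.refl = refl
  sumL-↭ F (Perm.prep x p) = +-congˡ (sumL-↭ F p)
  sumL-↭ F (Perm.swap x y p) = trans (+-congˡ (+-congˡ (sumL-↭ F p))) (solve 3 (λ a b c → a ⊕ (b ⊕ c) ⊜ b ⊕ (a ⊕ c)) refl _ _ _)
  sumL-↭ F (Perm.trans p r) = trans (sumL-↭ F p) (sumL-↭ F r)

  sumL-matching : ∀ {X Y : Set} {l : List X} {m : List Y} → Unique l → Unique m → (M : Matching l m) (F : Y → Carrier) → sumL m F ≈ sumL l (F ∘ Matching.to M)
  sumL-matching {l = l} u u′ M F = trans (sym (sumL-↭ F (Matching.map-↭ M u u′))) (reflexive (sumL-map (Matching.to M) l F))

  sumL-cong-∈ : ∀ {X : Set} (l : List X) {F G : X → Carrier} → (∀ {x} → x ∈ l → F x ≈ G x) → sumL l F ≈ sumL l G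
  sumL-cong-∈ [] e = refl
  sumL-cong-∈ (x ∷ l) e = +-cong (e (here ≡.refl)) (sumL-cong-∈ l (e ∘ there))

  sumL-filter : ∀ {X : Set} {P : X → Set} (P? : ∀ x → Dec (P x)) (l : List X) {F G : X → Carrier} →
    (∀ x → P x → F x ≈ G x) → (∀ x → ¬ P x → F x ≈ 0#) → sumL l F ≈ sumL (filter P? l) G
  sumL-filter P? [] h h′ = refl
  sumL-filter P? (x ∷ l) h h′ with P? x
  ... | yes p = +-cong (h x p) (sumL-filter P? l h h′)
  ... | no ¬p = trans (+-congʳ (h′ x ¬p)) (trans (+-identityˡ _) (sumL-filter P? l h h′))

  sumL-product : ∀ {X Y : Set} (l : List X) (m : List Y) (F : X × Y → Carrier) → sumL (cartesianProduct l m) F ≈ sumL l (λ x → sumL m (λ y → F (x , y)))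
  sumL-product [] m F = refl
  sumL-product (x ∷ l) m F = trans (sumL-++ (List.map (x ,_) m) _ F) (+-cong (reflexive (sumL-map (x ,_) m F)) (sumL-product l m F))

module _ (R : CommutativeRing 0ℓ 0ℓ) where
  open Ring R

  module IntegralPowers (u v : Carrier) (uv : u * v ≈ 1#) where
    pow : ℤ → Carrier
    pow (+ n) = u ^ n
    pow -[1+ n ] = v ^ suc n

    pow-suc : ∀ j → pow (+ 1 ℤ.+ j) ≈ u * pow j
    pow-suc (+ n) = ^-suc u n
    pow-suc -[1+ zero ] = sym uv
    pow-suc -[1+ suc n ] = sym (trans (*-congˡ (^-suc v (suc n))) (trans (sym (*-assoc _ _ _)) (trans (*-congʳ uv) (*-identityˡ _))))

    pow-pred : ∀ j → pow (-[1+ 0 ] ℤ.+ j) ≈ v * pow j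
    pow-pred j = begin
      pow j′ ≈⟨ *-identityˡ _ ⟨
      1# * pow j′ ≈⟨ *-congʳ (trans (*-comm v u) uv) ⟨
      v * u * pow j′ ≈⟨ *-assoc _ _ _ ⟩
      v * (u * pow j′) ≈⟨ *-congˡ (pow-suc j′) ⟨
      v * pow (+ 1 ℤ.+ j′) ≡⟨ ≡.cong (λ i → v * pow i) (≡.trans (≡.sym (ℤP.+-assoc (+ 1) -[1+ 0 ] j)) (ℤP.+-identityˡ j)) ⟩
      v * pow j ∎
      where open Rsn
            j′ = -[1+ 0 ] ℤ.+ j

    pow-+ : ∀ i j → pow (i ℤ.+ j) ≈ pow i * pow j
    pow-+ (+ zero) j = trans (reflexive (≡.cong pow (ℤP.+-identityˡ j))) (sym (*-identityˡ _))
    pow-+ (+ suc n) j = trans (reflexive (≡.cong pow (ℤP.+-assoc (+ 1) (+ n) j))) (trans (pow-suc (+ n ℤ.+ j)) (trans (*-congˡ (pow-+ (+ n) j)) (trans (sym (*-assoc _ _ _)) (*-congʳ (sym (pow-suc (+ n)))))))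
    pow-+ -[1+ zero ] j = pow-pred j
    pow-+ -[1+ suc n ] j = trans (reflexive (≡.cong pow (ℤP.+-assoc -[1+ 0 ] -[1+ n ] j))) (trans (pow-pred (-[1+ n ] ℤ.+ j)) (trans (*-congˡ (pow-+ -[1+ n ] j)) (trans (sym (*-assoc _ _ _)) (*-congʳ (sym (pow-pred -[1+ n ]))))))

    -- The upward recurrence determines f at negative arguments as well, because u is invertible.
    pow-unique : ∀ (f : ℤ → Carrier) → f 0ℤ ≈ 1# → (∀ j → f (+ 1 ℤ.+ j) ≈ u * f j) → ∀ j → f j ≈ pow j
    pow-unique f f0 fs (+ zero) = f0
    pow-unique f f0 fs (+ suc n) = trans (fs (+ n)) (trans (*-congˡ (pow-unique f f0 fs (+ n))) (sym (pow-suc (+ n))))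
    pow-unique f f0 fs -[1+ n ] = back -[1+ n ] (next n)
      where
      back : ∀ j → f (+ 1 ℤ.+ j) ≈ pow (+ 1 ℤ.+ j) → f j ≈ pow j
      back j e = trans (sym (*-identityˡ _)) (trans (*-congʳ (sym (trans (*-comm v u) uv))) (trans (*-assoc _ _ _) (trans (*-congˡ (trans (sym (fs j)) (trans e (pow-suc j))))
        (trans (sym (*-assoc _ _ _)) (trans (*-congʳ (trans (*-comm v u) uv)) (*-identityˡ _))))))
      next : ∀ n → f (+ 1 ℤ.+ -[1+ n ]) ≈ pow (+ 1 ℤ.+ -[1+ n ])
      next zero = f0
      next (suc n) = pow-unique f f0 fs -[1+ n ]

-- Vectors of the lattice A₄ and the Gauss-sum matrix

ℤ⁵ : Set
ℤ⁵ = ℤ × ℤ × ℤ × ℤ × ℤ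

cube : ℕ → List ℤ⁵
cube m = cartesianProduct (range m) (cartesianProduct (range m) (cartesianProduct (range m) (cartesianProduct (range m) (range m))))

-- Stated over an arbitrary signature, to be read both in ℤ and in the syntax of the ring solver.
module Forms {X : Set} (plus times : X → X → X) (neg : X → X) (con : ℤ → X) where
  private
    infixl 6 _⊞_ _⊟_
    infixl 7 _⊠_
    _⊞_ _⊟_ _⊠_ : X → X → X
    x ⊞ y = plus x y
    x ⊟ y = plus x (neg y)
    x ⊠ y = times x y

  X⁵ : Set
  X⁵ = X × X × X × X × X

  -- `moment` and `moment₂` weight the coordinates by the indices -2, ..., 2 and by their squares.
  -- Modulo 5 and for total 0, a cyclic shift fixes the first and adds twice the first to the
  -- second; doubling the index doubles the first.
  total norm² moment moment₂ : X⁵ → X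
  total (a , b , c , d , e) = a ⊞ b ⊞ c ⊞ d ⊞ e
  norm² (a , b , c , d , e) = a ⊠ a ⊞ b ⊠ b ⊞ c ⊠ c ⊞ d ⊠ d ⊞ e ⊠ e
  moment (a , b , c , d , e) = con -[1+ 1 ] ⊠ a ⊟ b ⊞ d ⊞ con (+ 2) ⊠ e
  moment₂ (a , b , c , d , e) = con (+ 4) ⊠ a ⊞ b ⊞ d ⊞ con (+ 4) ⊠ e

  -- The circulant matrix of the quadratic character modulo 5; its square is 5 on vectors of total 0.
  gauss : X⁵ → X⁵
  gauss (a , b , c , d , e) = (b ⊞ e ⊟ c ⊟ d) , (c ⊞ a ⊟ d ⊟ e) , (d ⊞ b ⊟ e ⊟ a) , (e ⊞ c ⊟ a ⊟ b) , (a ⊞ d ⊟ b ⊟ c)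

  -- gauss (5v + (-2,-1,0,1,2)) / 5
  enlarge : X⁵ → X⁵
  enlarge v = let (a , b , c , d , e) = gauss v in a , (b ⊟ con (+ 1)) , c , (d ⊞ con (+ 1)) , e

  -- (gauss v - (-2,-1,0,1,2)) / 5, when moment v = 5k + 2 and moment₂ v = 5l.
  quotients : X → X → X⁵ → X⁵
  quotients k l (a , b , c , d , e) =
    (l ⊞ con (+ 4) ⊠ k ⊞ con (+ 2) ⊟ (c ⊞ con (+ 2) ⊠ d ⊞ con (+ 3) ⊠ e)) , (l ⊞ con (+ 2) ⊠ k ⊞ con (+ 1) ⊟ (d ⊞ con (+ 2) ⊠ e)) , (l ⊟ (a ⊞ e)) ,
    (l ⊟ con (+ 2) ⊠ k ⊟ con (+ 1) ⊟ (con (+ 2) ⊠ a ⊞ b)) , (l ⊟ con (+ 4) ⊠ k ⊟ con (+ 2) ⊟ (con (+ 3) ⊠ a ⊞ con (+ 2) ⊠ b ⊞ c))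

  rotate double : X⁵ → X⁵
  rotate (a , b , c , d , e) = e , a , b , c , d
  double (a , b , c , d , e) = b , e , c , a , d

open Forms ℤ._+_ ℤ._*_ ℤ.-_ id hiding (X⁵) public
module Syntax {n} = Forms {Expr ℤ n} _⊕_ _⊗_ ⊝_ Κ
module ℤR = Ring ℤP.+-*-commutativeRing

-- The vectors of the root lattice A₄ with square norm 2n.
Root : ℕ → ℤ⁵ → Set
Root n v = total v ≡ 0ℤ × norm² v ≡ + 2 ℤ.* + n

-- The vectors v of A₄ for which 5v + (-2,-1,0,1,2) has square norm 10(n+1).
Coset : ℕ → ℤ⁵ → Set
Coset n v = total v ≡ 0ℤ × + 5 ℤ.* norm² v ℤ.+ + 2 ℤ.* moment v ≡ + 2 ℤ.* + n

root? : ∀ n v → Dec (Root n v)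
root? n v = (total v ℤ.≟ 0ℤ) ×-dec (norm² v ℤ.≟ + 2 ℤ.* + n)

coset? : ∀ n v → Dec (Coset n v)
coset? n v = (total v ℤ.≟ 0ℤ) ×-dec (+ 5 ℤ.* norm² v ℤ.+ + 2 ℤ.* moment v ℤ.≟ + 2 ℤ.* + n)

roots cosets : ℕ → ℕ → List ℤ⁵
roots m n = filter (root? n) (cube m)
cosets m n = filter (coset? n) (cube m)

range-∈ : ∀ {m i} → ∣ i ∣ ≤ m → i ∈ range m
range-∈ {m} {i} l = ≡.subst (_∈ range m) e (∈P.∈-map⁺ (λ k → + k ℤ.- + m) (∈P.∈-upTo⁺ (s≤s (k≤ i l))))
  where
  k : ℤ → ℕ
  k (+ n) = n ℕ.+ m
  k -[1+ n ] = m ∸ suc n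
  k≤ : ∀ i → ∣ i ∣ ≤ m → k i ≤ m ℕ.+ m
  k≤ (+ n) l = ℕP.+-monoˡ-≤ m l
  k≤ -[1+ n ] l = ℕP.≤-trans (ℕP.m∸n≤m m (suc n)) (ℕP.m≤m+n m m)
  e : + k i ℤ.- + m ≡ i
  e = go i l
    where
    go : ∀ i → ∣ i ∣ ≤ m → + k i ℤ.- + m ≡ i
    go (+ n) l = ℤS.solve 2 (λ n m → (n ℤS.:+ m) ℤS.:- m ℤS.:= n) ≡.refl (+ n) (+ m)
    go -[1+ n ] l = ≡.trans (≡.cong (λ x → + (m ∸ suc n) ℤ.- + x) (≡.sym (ℕP.m∸n+n≡m l))) (ℤS.solve 2 (λ a b → a ℤS.:- (a ℤS.:+ b) ℤS.:= ℤS.:- b) ≡.refl (+ (m ∸ suc n)) (+ suc n))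

range-unique : ∀ m → Unique (range m)
range-unique m = UniqueP.map⁺ (λ {i} {j} e → ℤP.+-injective (≡.trans (un i) (≡.trans (≡.cong (ℤ._+ + m) e) (≡.sym (un j))))) (UniqueP.upTo⁺ _)
  where un : ∀ i → + i ≡ (+ i ℤ.- + m) ℤ.+ + m
        un i = ℤS.solve 2 (λ i m → i ℤS.:= (i ℤS.:- m) ℤS.:+ m) ≡.refl (+ i) (+ m)

cube-∈ : ∀ {m a b c d e} → ∣ a ∣ ≤ m → ∣ b ∣ ≤ m → ∣ c ∣ ≤ m → ∣ d ∣ ≤ m → ∣ e ∣ ≤ m → (a , b , c , d , e) ∈ cube m
cube-∈ p r s t u = ∈P.∈-cartesianProduct⁺ (range-∈ p) (∈P.∈-cartesianProduct⁺ (range-∈ r) (∈P.∈-cartesianProduct⁺ (range-∈ s) (∈P.∈-cartesianProduct⁺ (range-∈ t) (range-∈ u))))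

cube-unique : ∀ m → Unique (cube m)
cube-unique m = UniqueP.cartesianProduct⁺ r (UniqueP.cartesianProduct⁺ r (UniqueP.cartesianProduct⁺ r (UniqueP.cartesianProduct⁺ r r)))
  where r = range-unique m

∣i∣≤i² : ∀ i → + ∣ i ∣ ℤ.≤ i ℤ.* i
∣i∣≤i² (+ zero) = ℤP.≤-refl
∣i∣≤i² (+ suc n) = ℤ.+≤+ (ℕP.m≤m*n (suc n) (suc n))
∣i∣≤i² -[1+ n ] = ℤ.+≤+ (ℕP.m≤m*n (suc n) (suc n))

0≤i² : ∀ i → 0ℤ ℤ.≤ i ℤ.* i
0≤i² i = ℤP.≤-trans (ℤ.+≤+ z≤n) (∣i∣≤i² i)

-- Each coordinate is bounded by the square norm.
norm-bound : ∀ {m} a b c d e → norm² (a , b , c , d , e) ℤ.≤ + m → ∣ a ∣ ≤ m × ∣ b ∣ ≤ m × ∣ c ∣ ≤ m × ∣ d ∣ ≤ m × ∣ e ∣ ≤ m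
norm-bound {m} a b c d e le =
  f a (b² ℤ.+ c² ℤ.+ d² ℤ.+ e²) (nn (nn (nn (0≤i² b) (0≤i² c)) (0≤i² d)) (0≤i² e)) (ℤS.solve 5 (λ a b c d e → a ℤS.:+ (b ℤS.:+ c ℤS.:+ d ℤS.:+ e) ℤS.:= a ℤS.:+ b ℤS.:+ c ℤS.:+ d ℤS.:+ e) ≡.refl a² b² c² d² e²) ,
  f b (a² ℤ.+ c² ℤ.+ d² ℤ.+ e²) (nn (nn (nn (0≤i² a) (0≤i² c)) (0≤i² d)) (0≤i² e)) (ℤS.solve 5 (λ a b c d e → b ℤS.:+ (a ℤS.:+ c ℤS.:+ d ℤS.:+ e) ℤS.:= a ℤS.:+ b ℤS.:+ c ℤS.:+ d ℤS.:+ e) ≡.refl a² b² c² d² e²) ,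
  f c (a² ℤ.+ b² ℤ.+ d² ℤ.+ e²) (nn (nn (nn (0≤i² a) (0≤i² b)) (0≤i² d)) (0≤i² e)) (ℤS.solve 5 (λ a b c d e → c ℤS.:+ (a ℤS.:+ b ℤS.:+ d ℤS.:+ e) ℤS.:= a ℤS.:+ b ℤS.:+ c ℤS.:+ d ℤS.:+ e) ≡.refl a² b² c² d² e²) ,
  f d (a² ℤ.+ b² ℤ.+ c² ℤ.+ e²) (nn (nn (nn (0≤i² a) (0≤i² b)) (0≤i² c)) (0≤i² e)) (ℤS.solve 5 (λ a b c d e → d ℤS.:+ (a ℤS.:+ b ℤS.:+ c ℤS.:+ e) ℤS.:= a ℤS.:+ b ℤS.:+ c ℤS.:+ d ℤS.:+ e) ≡.refl a² b² c² d² e²) ,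
  f e (a² ℤ.+ b² ℤ.+ c² ℤ.+ d²) (nn (nn (nn (0≤i² a) (0≤i² b)) (0≤i² c)) (0≤i² d)) (ℤS.solve 5 (λ a b c d e → e ℤS.:+ (a ℤS.:+ b ℤS.:+ c ℤS.:+ d) ℤS.:= a ℤS.:+ b ℤS.:+ c ℤS.:+ d ℤS.:+ e) ≡.refl a² b² c² d² e²)
  where
  a² = a ℤ.* a ; b² = b ℤ.* b ; c² = c ℤ.* c ; d² = d ℤ.* d ; e² = e ℤ.* e
  nn : ∀ {x y} → 0ℤ ℤ.≤ x → 0ℤ ℤ.≤ y → 0ℤ ℤ.≤ x ℤ.+ y
  nn = ℤP.+-mono-≤
  f : ∀ i r → 0ℤ ℤ.≤ r → i ℤ.* i ℤ.+ r ≡ norm² (a , b , c , d , e) → ∣ i ∣ ≤ m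
  f i r 0≤r eq = ℤP.drop‿+≤+ (ℤP.≤-trans (∣i∣≤i² i) (ℤP.≤-trans (≡.subst (i ℤ.* i ℤ.≤_) eq (≡.subst (ℤ._≤ i ℤ.* i ℤ.+ r) (ℤP.+-identityʳ _) (ℤP.+-monoʳ-≤ (i ℤ.* i) 0≤r))) le))

roots-∈ : ∀ {m n v} → n ℕ.+ n ≤ m → Root n v → v ∈ roots m n
roots-∈ {m} {n} {v@(a , b , c , d , e)} l p@(_ , r) =
  let (ba , bb , bc , bd , be) = norm-bound a b c d e (≡.subst (ℤ._≤ + m) (≡.sym (≡.trans r (ℤS.solve 1 (λ n → ℤS.con (+ 2) ℤS.:* n ℤS.:= n ℤS.:+ n) ≡.refl (+ n)))) (ℤ.+≤+ l))
  in ∈P.∈-filter⁺ (root? n) (cube-∈ ba bb bc bd be) p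

∈-roots : ∀ {m n v} → v ∈ roots m n → Root n v
∈-roots {m} {n} p = proj₂ (∈P.∈-filter⁻ (root? n) {xs = cube m} p)

roots-unique : ∀ m n → Unique (roots m n)
roots-unique m n = UniqueP.filter⁺ (root? n) (cube-unique m)

cosets-unique : ∀ m n → Unique (cosets m n)
cosets-unique m n = UniqueP.filter⁺ (coset? n) (cube-unique m)

∈-cosets : ∀ {m n v} → v ∈ cosets m n → Coset n v
∈-cosets {m} {n} p = proj₂ (∈P.∈-filter⁻ (coset? n) {xs = cube m} p)

div5 : ℤ → ℤ
div5 x = x ℤD./ℕ 5

div5-exact : ∀ q → div5 (q ℤ.* + 5) ≡ q
div5-exact q = ≡.sym (ℤP.*-cancelʳ-≡ q (div5 x) (+ 5) (≡.trans (ℤD.a≡a%ℕn+[a/ℕn]*n x 5) (≡.trans (≡.cong (λ r → + r ℤ.+ div5 x ℤ.* + 5) (small (x ℤD.%ℕ 5) (ℤD.n%ℕd<d x 5) {q ℤ.- div5 x} eq)) (ℤP.+-identityˡ _))))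
  where
  x = q ℤ.* + 5
  eq : + (x ℤD.%ℕ 5) ≡ (q ℤ.- div5 x) ℤ.* + 5
  eq = ≡.trans (ℤS.solve 2 (λ r d → r ℤS.:= (r ℤS.:+ d) ℤS.:- d) ≡.refl (+ (x ℤD.%ℕ 5)) (div5 x ℤ.* + 5))
    (≡.trans (≡.cong (ℤ._- div5 x ℤ.* + 5) (≡.sym (ℤD.a≡a%ℕn+[a/ℕn]*n x 5))) (ℤS.solve 2 (λ q d → q ℤS.:* ℤS.con (+ 5) ℤS.:- d ℤS.:* ℤS.con (+ 5) ℤS.:= (q ℤS.:- d) ℤS.:* ℤS.con (+ 5)) ≡.refl q (div5 x)))
  small : ∀ r → r < 5 → ∀ {t} → + r ≡ t ℤ.* + 5 → r ≡ 0
  small 0 _ _ = ≡.refl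
  small 1 _ {t} e = ⊥-elim (insoluble 5 (+ 0) (+ 0) (+ 1) _ 0ℤ (ℤ.- t) (≡.trans (ℤS.solve 1 (λ u → ℤS.con 0ℤ ℤS.:= ℤS.con (+ 5) ℤS.:* (ℤS.:- u) ℤS.:+ u ℤS.:* ℤS.con (+ 5)) ≡.refl t) (≡.cong (ℤ._+_ (+ 5 ℤ.* (ℤ.- t))) (≡.sym e))))
  small 2 _ {t} e = ⊥-elim (insoluble 5 (+ 0) (+ 0) (+ 2) _ 0ℤ (ℤ.- t) (≡.trans (ℤS.solve 1 (λ u → ℤS.con 0ℤ ℤS.:= ℤS.con (+ 5) ℤS.:* (ℤS.:- u) ℤS.:+ u ℤS.:* ℤS.con (+ 5)) ≡.refl t) (≡.cong (ℤ._+_ (+ 5 ℤ.* (ℤ.- t))) (≡.sym e))))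
  small 3 _ {t} e = ⊥-elim (insoluble 5 (+ 0) (+ 0) (+ 3) _ 0ℤ (ℤ.- t) (≡.trans (ℤS.solve 1 (λ u → ℤS.con 0ℤ ℤS.:= ℤS.con (+ 5) ℤS.:* (ℤS.:- u) ℤS.:+ u ℤS.:* ℤS.con (+ 5)) ≡.refl t) (≡.cong (ℤ._+_ (+ 5 ℤ.* (ℤ.- t))) (≡.sym e))))
  small 4 _ {t} e = ⊥-elim (insoluble 5 (+ 0) (+ 0) (+ 4) _ 0ℤ (ℤ.- t) (≡.trans (ℤS.solve 1 (λ u → ℤS.con 0ℤ ℤS.:= ℤS.con (+ 5) ℤS.:* (ℤS.:- u) ℤS.:+ u ℤS.:* ℤS.con (+ 5)) ≡.refl t) (≡.cong (ℤ._+_ (+ 5 ℤ.* (ℤ.- t))) (≡.sym e))))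
  small (suc (suc (suc (suc (suc r))))) (s≤s (s≤s (s≤s (s≤s (s≤s ()))))) _

≡⁵ : ∀ {a b c d e a′ b′ c′ d′ e′ : ℤ} → a ≡ a′ → b ≡ b′ → c ≡ c′ → d ≡ d′ → e ≡ e′ → (a , b , c , d , e) ≡ (a′ , b′ , c′ , d′ , e′)
≡⁵ ≡.refl ≡.refl ≡.refl ≡.refl ≡.refl = ≡.refl

-- Inverse to `enlarge`, because the square of `gauss` is 5 on total 0. The divisions round in
-- general and are exact on special vectors of total 0.
shrink : ℤ⁵ → ℤ⁵
shrink v = let (a , b , c , d , e) = gauss v in div5 (a ℤ.+ + 2) , div5 (b ℤ.+ + 1) , div5 c , div5 (d ℤ.- + 1) , div5 (e ℤ.- + 2)

-- For total 0 these two congruences hold exactly when gauss v is congruent to (-2,-1,0,1,2) modulo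
-- 5, so they describe the image of `enlarge`.
Special : ℤ⁵ → Set
Special v = (+ 5 ℤ∣ (moment v ℤ.- + 2)) × (+ 5 ℤ∣ moment₂ v)

special? : ∀ v → Dec (Special v)
special? v = (+ 5 ℤ∣? (moment v ℤ.- + 2)) ×-dec (+ 5 ℤ∣? moment₂ v)

private
  S5 : ∀ {n} → Expr ℤ n → Expr ℤ n → Expr ℤ n → Expr ℤ n → Expr ℤ n → Syntax.X⁵ {n}
  S5 a b c d e = a , b , c , d , e

  pr₀ pr₁ pr₂ pr₃ pr₄ : ∀ {X : Set} → X × X × X × X × X → X
  pr₀ (a , b , c , d , e) = a
  pr₁ (a , b , c , d , e) = b
  pr₂ (a , b , c , d , e) = c
  pr₃ (a , b , c , d , e) = d
  pr₄ (a , b , c , d , e) = e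

  -- On total 0, `gauss` multiplies the square norm by 5, so applying it to 5v + (-2,-1,0,1,2) and
  -- dividing by 5 divides the square norm by 5.
  norm-enlarge : ∀ a b c d e → let v = (a , b , c , d , e) in norm² (enlarge v) ≡ (+ 5 ℤ.* norm² v ℤ.+ + 2 ℤ.* moment v) ℤ.+ + 2 ℤ.- total v ℤ.* total v
  norm-enlarge = ℤR.solve 5 (λ a b c d e → let v = S5 a b c d e in Syntax.norm² (Syntax.enlarge v) ℤR.⊜ (Κ (+ 5) ⊗ Syntax.norm² v ⊕ Κ (+ 2) ⊗ Syntax.moment v) ⊕ Κ (+ 2) ℤR.⊖ Syntax.total v ⊗ Syntax.total v) ≡.refl

  total-enlarge : ∀ a b c d e → total (enlarge (a , b , c , d , e)) ≡ 0ℤ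
  total-enlarge = ℤR.solve 5 (λ a b c d e → Syntax.total (Syntax.enlarge (S5 a b c d e)) ℤR.⊜ Κ 0ℤ) ≡.refl

  moment-enlarge : ∀ a b c d e → moment (enlarge (a , b , c , d , e)) ℤ.- + 2 ≡ (d ℤ.- b) ℤ.* + 5
  moment-enlarge = ℤR.solve 5 (λ a b c d e → Syntax.moment (Syntax.enlarge (S5 a b c d e)) ℤR.⊖ Κ (+ 2) ℤR.⊜ (d ℤR.⊖ b) ⊗ Κ (+ 5)) ≡.refl

  moment₂-enlarge : ∀ a b c d e → moment₂ (enlarge (a , b , c , d , e)) ≡ (a ℤ.+ e ℤ.- c) ℤ.* + 5 ℤ.- total (a , b , c , d , e)
  moment₂-enlarge = ℤR.solve 5 (λ a b c d e → Syntax.moment₂ (Syntax.enlarge (S5 a b c d e)) ℤR.⊜ (a ⊕ e ℤR.⊖ c) ⊗ Κ (+ 5) ℤR.⊖ Syntax.total (S5 a b c d e)) ≡.refl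

  shrink-enlarge : ∀ v → total v ≡ 0ℤ → shrink (enlarge v) ≡ v
  shrink-enlarge v@(a , b , c , d , e) t = ≡⁵
    (f a (ℤR.solve 5 (λ a b c d e → let v = S5 a b c d e in pr₀ (Syntax.gauss (Syntax.enlarge v)) ⊕ Κ (+ 2) ℤR.⊜ a ⊗ Κ (+ 5) ℤR.⊖ Syntax.total v) ≡.refl a b c d e))
    (f b (ℤR.solve 5 (λ a b c d e → let v = S5 a b c d e in pr₁ (Syntax.gauss (Syntax.enlarge v)) ⊕ Κ (+ 1) ℤR.⊜ b ⊗ Κ (+ 5) ℤR.⊖ Syntax.total v) ≡.refl a b c d e))
    (f c (ℤR.solve 5 (λ a b c d e → let v = S5 a b c d e in pr₂ (Syntax.gauss (Syntax.enlarge v)) ℤR.⊜ c ⊗ Κ (+ 5) ℤR.⊖ Syntax.total v) ≡.refl a b c d e))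
    (f d (ℤR.solve 5 (λ a b c d e → let v = S5 a b c d e in pr₃ (Syntax.gauss (Syntax.enlarge v)) ℤR.⊖ Κ (+ 1) ℤR.⊜ d ⊗ Κ (+ 5) ℤR.⊖ Syntax.total v) ≡.refl a b c d e))
    (f e (ℤR.solve 5 (λ a b c d e → let v = S5 a b c d e in pr₄ (Syntax.gauss (Syntax.enlarge v)) ℤR.⊖ Κ (+ 2) ℤR.⊜ e ⊗ Κ (+ 5) ℤR.⊖ Syntax.total v) ≡.refl a b c d e))
    where
    f : ∀ i {x} → x ≡ i ℤ.* + 5 ℤ.- total v → div5 x ≡ i
    f i p = ≡.trans (≡.cong div5 (≡.trans p (≡.trans (≡.cong (λ t → i ℤ.* + 5 ℤ.- t) t) (ℤP.+-identityʳ (i ℤ.* + 5))))) (div5-exact i)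

  module _ (v : ℤ⁵) (k l : ℤ) (t : total v ≡ 0ℤ) (p : moment v ℤ.- + 2 ≡ k ℤ.* + 5) (r : moment₂ v ≡ l ℤ.* + 5) where
    -- x vanishes together with the three defects of v.
    reduce : ∀ {x} y α β γ → x ≡ y ℤ.+ (α ℤ.* (moment₂ v ℤ.- l ℤ.* + 5) ℤ.+ β ℤ.* (moment v ℤ.- + 2 ℤ.- k ℤ.* + 5) ℤ.+ γ ℤ.* total v) → x ≡ y
    reduce y α β γ e rewrite t | p | r = ≡.trans e (ℤR.solve 6 (λ y α β γ k l → y ⊕ (α ⊗ (l ⊗ Κ (+ 5) ℤR.⊖ l ⊗ Κ (+ 5)) ⊕ β ⊗ (k ⊗ Κ (+ 5) ℤR.⊖ k ⊗ Κ (+ 5)) ⊕ γ ⊗ Κ 0ℤ) ℤR.⊜ y) ≡.refl y α β γ k l)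

  defect : ∀ {n} → Syntax.X⁵ {n} → Expr ℤ n → Expr ℤ n → ℤ → ℤ → ℤ → Expr ℤ n
  defect v k l α β γ = Κ α ⊗ (Syntax.moment₂ v ℤR.⊖ l ⊗ Κ (+ 5)) ⊕ Κ β ⊗ (Syntax.moment v ℤR.⊖ Κ (+ 2) ℤR.⊖ k ⊗ Κ (+ 5)) ⊕ Κ γ ⊗ Syntax.total v

  shrink-quotients : ∀ v k l → total v ≡ 0ℤ → moment v ℤ.- + 2 ≡ k ℤ.* + 5 → moment₂ v ≡ l ℤ.* + 5 → shrink v ≡ quotients k l v
  shrink-quotients v@(a , b , c , d , e) k l t p r = ≡⁵
    (f _ (+ 4) (+ 4) (ℤR.solve 7 (λ a b c d e k l → let v = S5 a b c d e in pr₀ (Syntax.gauss v) ⊕ Κ (+ 2) ℤR.⊜ pr₀ (Syntax.quotients k l v) ⊗ Κ (+ 5) ⊕ defect v k l (+ 1) (+ 4) (+ 4)) ≡.refl a b c d e k l))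
    (f _ (+ 2) (+ 1) (ℤR.solve 7 (λ a b c d e k l → let v = S5 a b c d e in pr₁ (Syntax.gauss v) ⊕ Κ (+ 1) ℤR.⊜ pr₁ (Syntax.quotients k l v) ⊗ Κ (+ 5) ⊕ defect v k l (+ 1) (+ 2) (+ 1)) ≡.refl a b c d e k l))
    (f _ (+ 0) (+ 0) (ℤR.solve 7 (λ a b c d e k l → let v = S5 a b c d e in pr₂ (Syntax.gauss v) ℤR.⊜ pr₂ (Syntax.quotients k l v) ⊗ Κ (+ 5) ⊕ defect v k l (+ 1) (+ 0) (+ 0)) ≡.refl a b c d e k l))
    (f _ -[1+ 1 ] (+ 1) (ℤR.solve 7 (λ a b c d e k l → let v = S5 a b c d e in pr₃ (Syntax.gauss v) ℤR.⊖ Κ (+ 1) ℤR.⊜ pr₃ (Syntax.quotients k l v) ⊗ Κ (+ 5) ⊕ defect v k l (+ 1) -[1+ 1 ] (+ 1)) ≡.refl a b c d e k l))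
    (f _ -[1+ 3 ] (+ 4) (ℤR.solve 7 (λ a b c d e k l → let v = S5 a b c d e in pr₄ (Syntax.gauss v) ℤR.⊖ Κ (+ 2) ℤR.⊜ pr₄ (Syntax.quotients k l v) ⊗ Κ (+ 5) ⊕ defect v k l (+ 1) -[1+ 3 ] (+ 4)) ≡.refl a b c d e k l))
    where
    f : ∀ {x} q β γ → x ≡ q ℤ.* + 5 ℤ.+ (+ 1 ℤ.* (moment₂ v ℤ.- l ℤ.* + 5) ℤ.+ β ℤ.* (moment v ℤ.- + 2 ℤ.- k ℤ.* + 5) ℤ.+ γ ℤ.* total v) → div5 x ≡ q
    f q β γ e = ≡.trans (≡.cong div5 (reduce v k l t p r (q ℤ.* + 5) (+ 1) β γ e)) (div5-exact q)

  total-quotients : ∀ v k l → total v ≡ 0ℤ → moment v ℤ.- + 2 ≡ k ℤ.* + 5 → moment₂ v ≡ l ℤ.* + 5 → total (quotients k l v) ≡ 0ℤ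
  total-quotients v@(a , b , c , d , e) k l t p r = ℤP.*-cancelʳ-≡ _ 0ℤ (+ 5) (reduce v k l t p r 0ℤ -[1+ 4 ] 0ℤ -[1+ 9 ]
    (ℤR.solve 7 (λ a b c d e k l → let v = S5 a b c d e in Syntax.total (Syntax.quotients k l v) ⊗ Κ (+ 5) ℤR.⊜ Κ 0ℤ ⊕ defect v k l -[1+ 4 ] 0ℤ -[1+ 9 ]) ≡.refl a b c d e k l))

  enlarge-quotients : ∀ v k l → total v ≡ 0ℤ → moment v ℤ.- + 2 ≡ k ℤ.* + 5 → moment₂ v ≡ l ℤ.* + 5 → enlarge (quotients k l v) ≡ v
  enlarge-quotients v@(a , b , c , d , e) k l t p r = ≡⁵
    (reduce v k l t p r a 0ℤ 0ℤ -[1+ 0 ] (ℤR.solve 7 (λ a b c d e k l → let v = S5 a b c d e in pr₀ (Syntax.enlarge (Syntax.quotients k l v)) ℤR.⊜ a ⊕ defect v k l 0ℤ 0ℤ -[1+ 0 ]) ≡.refl a b c d e k l))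
    (reduce v k l t p r b 0ℤ -[1+ 1 ] 0ℤ (ℤR.solve 7 (λ a b c d e k l → let v = S5 a b c d e in pr₁ (Syntax.enlarge (Syntax.quotients k l v)) ℤR.⊜ b ⊕ defect v k l 0ℤ -[1+ 1 ] 0ℤ) ≡.refl a b c d e k l))
    (reduce v k l t p r c 0ℤ 0ℤ (+ 1) (ℤR.solve 7 (λ a b c d e k l → let v = S5 a b c d e in pr₂ (Syntax.enlarge (Syntax.quotients k l v)) ℤR.⊜ c ⊕ defect v k l 0ℤ 0ℤ (+ 1)) ≡.refl a b c d e k l))
    (reduce v k l t p r d 0ℤ (+ 2) 0ℤ (ℤR.solve 7 (λ a b c d e k l → let v = S5 a b c d e in pr₃ (Syntax.enlarge (Syntax.quotients k l v)) ℤR.⊜ d ⊕ defect v k l 0ℤ (+ 2) 0ℤ) ≡.refl a b c d e k l))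
    (reduce v k l t p r e 0ℤ 0ℤ -[1+ 0 ] (ℤR.solve 7 (λ a b c d e k l → let v = S5 a b c d e in pr₄ (Syntax.enlarge (Syntax.quotients k l v)) ℤR.⊜ e ⊕ defect v k l 0ℤ 0ℤ -[1+ 0 ]) ≡.refl a b c d e k l))

  -- Completing the square: 5|v|² + 2 moment v + 10 = 4|v|² + |v + s|² with s = (-2,-1,0,1,2). This
  -- exhibits |v|² plus sums of squares.
  coset-bound : ∀ n v → Coset n v → norm² v ℤ.≤ + (2 ℕ.* n ℕ.+ 10)
  coset-bound n v@(a , b , c , d , e) (_ , p) = ℤP.≤-trans (≡.subst (ℤ._≤ norm² v ℤ.+ rest) (ℤP.+-identityʳ (norm² v)) (ℤP.+-monoʳ-≤ (norm² v) 0≤rest)) (ℤP.≤-reflexive (≡.trans eq (≡.trans (≡.cong (ℤ._+ + 10) p) (≡.cong (ℤ._+ + 10) (≡.sym (ℤP.pos-* 2 n))))))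
    where
    w = (a ℤ.- + 2 , b ℤ.- + 1 , c , d ℤ.+ + 1 , e ℤ.+ + 2)
    0≤norm : ∀ a b c d e → 0ℤ ℤ.≤ norm² (a , b , c , d , e)
    0≤norm a b c d e = ℤP.+-mono-≤ (ℤP.+-mono-≤ (ℤP.+-mono-≤ (ℤP.+-mono-≤ (0≤i² a) (0≤i² b)) (0≤i² c)) (0≤i² d)) (0≤i² e)
    rest = norm² v ℤ.+ (norm² v ℤ.+ (norm² v ℤ.+ norm² w))
    0≤rest : 0ℤ ℤ.≤ rest
    0≤rest = ℤP.+-mono-≤ (0≤norm a b c d e) (ℤP.+-mono-≤ (0≤norm a b c d e) (ℤP.+-mono-≤ (0≤norm a b c d e) (0≤norm (a ℤ.- + 2) (b ℤ.- + 1) c (d ℤ.+ + 1) (e ℤ.+ + 2))))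
    eq : norm² v ℤ.+ rest ≡ (+ 5 ℤ.* norm² v ℤ.+ + 2 ℤ.* moment v) ℤ.+ + 10
    eq = ℤR.solve 5 (λ a b c d e → let v = S5 a b c d e ; w = S5 (a ℤR.⊖ Κ (+ 2)) (b ℤR.⊖ Κ (+ 1)) c (d ⊕ Κ (+ 1)) (e ⊕ Κ (+ 2)) in
      Syntax.norm² v ⊕ (Syntax.norm² v ⊕ (Syntax.norm² v ⊕ (Syntax.norm² v ⊕ Syntax.norm² w))) ℤR.⊜ (Κ (+ 5) ⊗ Syntax.norm² v ⊕ Κ (+ 2) ⊗ Syntax.moment v) ⊕ Κ (+ 10)) ≡.refl a b c d e

cosets-∈ : ∀ {m n v} → 2 ℕ.* n ℕ.+ 10 ≤ m → Coset n v → v ∈ cosets m n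
cosets-∈ {m} {n} {v@(a , b , c , d , e)} l p =
  let (ba , bb , bc , bd , be) = norm-bound a b c d e (ℤP.≤-trans (coset-bound n v p) (ℤ.+≤+ l))
  in ∈P.∈-filter⁺ (coset? n) (cube-∈ ba bb bc bd be) p

-- The Gauss-sum matrix divided by √5 is an isometry and an involution on total 0, up to scale
-- carrying 5A₄ + s to the special vectors. The bound on m ensures that the box omits no vector on
-- either side.
enlarge-matching : ∀ {m n} → 2 ℕ.* n ℕ.+ 10 ≤ m → Matching (cosets m n) (filter special? (roots m (suc n)))
enlarge-matching {m} {n} l = record
  { to = enlarge ; from = shrink
  ; to-∈ = λ {v} v∈ → ∈P.∈-filter⁺ special? (roots-∈ {m} {suc n} bound (root v (∈-cosets {m} {n} v∈))) (special v (∈-cosets {m} {n} v∈))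
  ; from-∈ = λ {v} v∈ → cosets-∈ {m} {n} l (back v (∈-roots {m} {suc n} (in-roots v∈)) (proj₂ (∈P.∈-filter⁻ special? {xs = roots m (suc n)} v∈)))
  ; from-to = λ {v} v∈ → shrink-enlarge v (proj₁ (∈-cosets {m} {n} v∈))
  ; to-from = λ {v} v∈ → inv v (∈-roots {m} {suc n} (in-roots v∈)) (proj₂ (∈P.∈-filter⁻ special? {xs = roots m (suc n)} v∈)) }
  where
  in-roots : ∀ {v} → v ∈ filter special? (roots m (suc n)) → v ∈ roots m (suc n)
  in-roots v∈ = proj₁ (∈P.∈-filter⁻ special? {xs = roots m (suc n)} v∈)
  bound : suc n ℕ.+ suc n ≤ m
  bound = ℕP.≤-trans (ℕP.≤-trans (ℕP.≤-reflexive (ℕS.solve 1 (λ n → (ℕS.con 1 ℕS.:+ n) ℕS.:+ (ℕS.con 1 ℕS.:+ n) ℕS.:= ℕS.con 2 ℕS.:* n ℕS.:+ ℕS.con 2) ≡.refl n)) (ℕP.+-monoʳ-≤ (2 ℕ.* n) (s≤s (s≤s z≤n)))) l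
  root : ∀ v → Coset n v → Root (suc n) (enlarge v)
  root v@(a , b , c , d , e) (t , p) = total-enlarge a b c d e , ≡.trans (norm-enlarge a b c d e) (≡.trans (≡.cong₂ (λ x y → x ℤ.+ + 2 ℤ.- y ℤ.* y) p t)
    (ℤS.solve 1 (λ n → ℤS.con (+ 2) ℤS.:* n ℤS.:+ ℤS.con (+ 2) ℤS.:- ℤS.con 0ℤ ℤS.:= ℤS.con (+ 2) ℤS.:* (ℤS.con (+ 1) ℤS.:+ n)) ≡.refl (+ n)))
  special : ∀ v → Coset n v → Special (enlarge v)
  special v@(a , b , c , d , e) (t , _) = divides (d ℤ.- b) (moment-enlarge a b c d e) , divides (a ℤ.+ e ℤ.- c) (≡.trans (moment₂-enlarge a b c d e) (≡.trans (≡.cong (λ t → (a ℤ.+ e ℤ.- c) ℤ.* + 5 ℤ.- t) t) (ℤP.+-identityʳ _)))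
  inv : ∀ v → Root (suc n) v → Special v → enlarge (shrink v) ≡ v
  inv v (t , _) (divides k p , divides l r) = ≡.trans (≡.cong enlarge (shrink-quotients v k l t p r)) (enlarge-quotients v k l t p r)
  back : ∀ v → Root (suc n) v → Special v → Coset n (shrink v)
  back v R@(t , nv) Sp@(divides k p , divides l r) = ts , ℤP.≤-antisym (ℤP.≤-reflexive eq) (ℤP.≤-reflexive (≡.sym eq))
    where
    w = shrink v
    ts : total w ≡ 0ℤ
    ts = ≡.trans (≡.cong total (shrink-quotients v k l t p r)) (total-quotients v k l t p r)
    N = + 5 ℤ.* norm² w ℤ.+ + 2 ℤ.* moment w
    eq : N ≡ + 2 ℤ.* + n
    eq = ≡.trans (ℤS.solve 1 (λ x → x ℤS.:= (x ℤS.:+ ℤS.con (+ 2) ℤS.:- ℤS.con 0ℤ) ℤS.:- ℤS.con (+ 2)) ≡.refl N)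
      (≡.trans (≡.cong (λ x → x ℤ.- + 2) (≡.trans (≡.cong (λ t → N ℤ.+ + 2 ℤ.- t ℤ.* t) (≡.sym ts)) (≡.trans (≡.sym (norm-enlarge (proj₁ w) (proj₁ (proj₂ w)) (proj₁ (proj₂ (proj₂ w))) (proj₁ (proj₂ (proj₂ (proj₂ w)))) (proj₂ (proj₂ (proj₂ (proj₂ w)))))) (≡.trans (≡.cong norm² (inv v R Sp)) nv))))
        (ℤS.solve 1 (λ n → ℤS.con (+ 2) ℤS.:* (ℤS.con (+ 1) ℤS.:+ n) ℤS.:- ℤS.con (+ 2) ℤS.:= ℤS.con (+ 2) ℤS.:* n) ≡.refl (+ n)))

-- Cyclic shifts and doubling of the index, both modulo 5, permute the vectors of each norm.
rotate-matching : ∀ {m n} → n ℕ.+ n ≤ m → Matching (roots m n) (roots m n)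
rotate-matching {m} {n} l = record
  { to = rotate ; from = λ (a , b , c , d , e) → b , c , d , e , a
  ; to-∈ = λ {v} v∈ → roots-∈ {m} {n} l (fwd v (∈-roots {m} {n} v∈)) ; from-∈ = λ {v} v∈ → roots-∈ {m} {n} l (bwd v (∈-roots {m} {n} v∈))
  ; from-to = λ _ → ≡.refl ; to-from = λ _ → ≡.refl }
  where
  fwd : ∀ v → Root n v → Root n (rotate v)
  fwd (a , b , c , d , e) (t , p) = ≡.trans (ℤS.solve 5 (λ a b c d e → e ℤS.:+ a ℤS.:+ b ℤS.:+ c ℤS.:+ d ℤS.:= a ℤS.:+ b ℤS.:+ c ℤS.:+ d ℤS.:+ e) ≡.refl a b c d e) t ,
    ≡.trans (ℤS.solve 5 (λ a b c d e → e ℤS.:+ a ℤS.:+ b ℤS.:+ c ℤS.:+ d ℤS.:= a ℤS.:+ b ℤS.:+ c ℤS.:+ d ℤS.:+ e) ≡.refl (a ℤ.* a) (b ℤ.* b) (c ℤ.* c) (d ℤ.* d) (e ℤ.* e)) p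
  bwd : ∀ v → Root n v → Root n (proj₁ (proj₂ v) , proj₁ (proj₂ (proj₂ v)) , proj₁ (proj₂ (proj₂ (proj₂ v))) , proj₂ (proj₂ (proj₂ (proj₂ v))) , proj₁ v)
  bwd (a , b , c , d , e) (t , p) = ≡.trans (ℤS.solve 5 (λ a b c d e → b ℤS.:+ c ℤS.:+ d ℤS.:+ e ℤS.:+ a ℤS.:= a ℤS.:+ b ℤS.:+ c ℤS.:+ d ℤS.:+ e) ≡.refl a b c d e) t ,
    ≡.trans (ℤS.solve 5 (λ a b c d e → b ℤS.:+ c ℤS.:+ d ℤS.:+ e ℤS.:+ a ℤS.:= a ℤS.:+ b ℤS.:+ c ℤS.:+ d ℤS.:+ e) ≡.refl (a ℤ.* a) (b ℤ.* b) (c ℤ.* c) (d ℤ.* d) (e ℤ.* e)) p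

double-matching : ∀ {m n} → n ℕ.+ n ≤ m → Matching (roots m n) (roots m n)
double-matching {m} {n} l = record
  { to = double ; from = λ (b , e , c , a , d) → a , b , c , d , e
  ; to-∈ = λ {v} v∈ → roots-∈ {m} {n} l (fwd v (∈-roots {m} {n} v∈)) ; from-∈ = λ {v} v∈ → roots-∈ {m} {n} l (bwd v (∈-roots {m} {n} v∈))
  ; from-to = λ _ → ≡.refl ; to-from = λ _ → ≡.refl }
  where
  fwd : ∀ v → Root n v → Root n (double v)
  fwd (a , b , c , d , e) (t , p) = ≡.trans (ℤS.solve 5 (λ a b c d e → b ℤS.:+ e ℤS.:+ c ℤS.:+ a ℤS.:+ d ℤS.:= a ℤS.:+ b ℤS.:+ c ℤS.:+ d ℤS.:+ e) ≡.refl a b c d e) t ,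
    ≡.trans (ℤS.solve 5 (λ a b c d e → b ℤS.:+ e ℤS.:+ c ℤS.:+ a ℤS.:+ d ℤS.:= a ℤS.:+ b ℤS.:+ c ℤS.:+ d ℤS.:+ e) ≡.refl (a ℤ.* a) (b ℤ.* b) (c ℤ.* c) (d ℤ.* d) (e ℤ.* e)) p
  bwd : ∀ v → Root n v → Root n (proj₁ (proj₂ (proj₂ (proj₂ v))) , proj₁ v , proj₁ (proj₂ (proj₂ v)) , proj₂ (proj₂ (proj₂ (proj₂ v))) , proj₁ (proj₂ v))
  bwd (b , e , c , a , d) (t , p) = ≡.trans (ℤS.solve 5 (λ a b c d e → a ℤS.:+ b ℤS.:+ c ℤS.:+ d ℤS.:+ e ℤS.:= b ℤS.:+ e ℤS.:+ c ℤS.:+ a ℤS.:+ d) ≡.refl a b c d e) t ,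
    ≡.trans (ℤS.solve 5 (λ a b c d e → a ℤS.:+ b ℤS.:+ c ℤS.:+ d ℤS.:+ e ℤS.:= b ℤS.:+ e ℤS.:+ c ℤS.:+ a ℤS.:+ d) ≡.refl (a ℤ.* a) (b ℤ.* b) (c ℤ.* c) (d ℤ.* d) (e ℤ.* e)) p

-- Character sums over the vectors of given norm

module Characters (K : CommutativeRing 0ℓ 0ℓ) (ζ : CommutativeRing.Carrier K) (ζ-sum : CyclotomicSum K ζ) where
  open Ring K
  open RootsOfUnity K
  open ListSums K

  ζ⁵ : ζ ^ 5 ≈ 1#
  ζ⁵ = root⁵ ζ ζ-sum

  ζζ⁴ : ζ * ζ ^ 4 ≈ 1#
  ζζ⁴ = trans (sym (^-suc ζ 4)) ζ⁵

  open IntegralPowers K ζ (ζ ^ 4) ζζ⁴ renaming (pow to zp; pow-+ to zp-+) public using ()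

  zp-5 : ∀ j → zp (j ℤ.* + 5) ≈ 1#
  zp-5 (+ zero) = refl
  zp-5 (+ suc n) = trans (reflexive (≡.cong zp (ℤS.solve 1 (λ n → (ℤS.con (+ 1) ℤS.:+ n) ℤS.:* ℤS.con (+ 5) ℤS.:= ℤS.con (+ 5) ℤS.:+ n ℤS.:* ℤS.con (+ 5)) ≡.refl (+ n))))
    (trans (zp-+ (+ 5) (+ n ℤ.* + 5)) (trans (*-cong ζ⁵ (zp-5 (+ n))) (*-identityˡ _)))
  zp-5 -[1+ zero ] = trans (solve 1 (λ z → (z ⊛ 4) ⊛ 5 ⊜ (z ⊛ 5) ⊛ 4) refl ζ) (trans (^-congˡ 4 ζ⁵) (solve 0 (Κ 1ℤ ⊛ 4 ⊜ Κ 1ℤ) refl))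
  zp-5 -[1+ suc n ] = trans (reflexive (≡.cong zp (ℤS.solve 1 (λ n → (ℤS.:- (ℤS.con (+ 2) ℤS.:+ n)) ℤS.:* ℤS.con (+ 5) ℤS.:= ℤS.con -[1+ 4 ] ℤS.:+ (ℤS.:- (ℤS.con (+ 1) ℤS.:+ n)) ℤS.:* ℤS.con (+ 5)) ≡.refl (+ n))))
    (trans (zp-+ -[1+ 4 ] (-[1+ n ] ℤ.* + 5)) (trans (*-cong (zp-5 -[1+ 0 ]) (zp-5 -[1+ n ])) (*-identityˡ _)))

  zp-mod : ∀ i q → zp (i ℤ.+ q ℤ.* + 5) ≈ zp i
  zp-mod i q = trans (zp-+ i (q ℤ.* + 5)) (trans (*-congˡ (zp-5 q)) (*-identityʳ _))

  zp⁵ : ∀ i → zp i ^ 5 ≈ 1#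
  zp⁵ i = trans (sym (trans (zp-+ (i ℤ.+ i ℤ.+ i ℤ.+ i) i) (*-congʳ (trans (zp-+ (i ℤ.+ i ℤ.+ i) i) (*-congʳ (trans (zp-+ (i ℤ.+ i) i) (*-congʳ (zp-+ i i))))))))
    (trans (reflexive (≡.cong zp (ℤS.solve 1 (λ i → i ℤS.:+ i ℤS.:+ i ℤS.:+ i ℤS.:+ i ℤS.:= i ℤS.:* ℤS.con (+ 5)) ≡.refl i))) (zp-5 i))

  G : Carrier → Carrier
  G y = 1# + y + y ^ 2 + y ^ 3 + y ^ 4

  G-cong : ∀ {x y} → x ≈ y → G x ≈ G y
  G-cong e = +-cong (+-cong (+-cong (+-cong refl e) (^-congˡ 2 e)) (^-congˡ 3 e)) (^-congˡ 4 e)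

  G-divides : ∀ {i} → + 5 ℤ∣ i → G (zp i) ≈ ι (+ 5)
  G-divides (divides q ≡.refl) = trans (G-cong (zp-5 q)) (solve 0 (Κ 1ℤ ⊕ Κ 1ℤ ⊕ Κ 1ℤ ⊛ 2 ⊕ Κ 1ℤ ⊛ 3 ⊕ Κ 1ℤ ⊛ 4 ⊜ Κ (+ 5)) refl)

  G-∤ : ∀ {i} → ¬ (+ 5 ℤ∣ i) → G (zp i) ≈ 0#
  G-∤ {i} n = go (i ℤD.%ℕ 5) (ℤD.n%ℕd<d i 5) (ℤD.a≡a%ℕn+[a/ℕn]*n i 5)
    where
    go : ∀ r → r < 5 → i ≡ + r ℤ.+ (i ℤD./ℕ 5) ℤ.* + 5 → G (zp i) ≈ 0#
    go zero l e = ⊥-elim (n (divides (i ℤD./ℕ 5) (≡.trans e (ℤP.+-identityˡ _))))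
    go (suc r) l e = trans (G-cong (trans (reflexive (≡.cong zp e)) (zp-mod (+ suc r) (i ℤD./ℕ 5)))) (conjugate-sum ζ ζ-sum r l)

  module _ {m n : ℕ} (l : n ℕ.+ n ≤ m) where
    private
      L = roots m n
      x y : ℤ⁵ → Carrier
      x v = zp (moment v)
      y v = zp (moment₂ v)

      x-rotate : ∀ v → Root n v → x (rotate v) ≈ x v
      x-rotate v@(a , b , c , d , e) (t , _) = trans (reflexive (≡.cong zp (≡.trans
        (ℤR.solve 5 (λ a b c d e → let v = a , b , c , d , e in Syntax.moment (Syntax.rotate v) ℤR.⊜ Syntax.moment v ⊕ ⊝ e ⊗ Κ (+ 5) ⊕ Syntax.total v) ≡.refl a b c d e)
        (≡.trans (≡.cong (ℤ._+_ (moment v ℤ.+ (ℤ.- e) ℤ.* + 5)) t) (ℤP.+-identityʳ (moment v ℤ.+ (ℤ.- e) ℤ.* + 5)))))) (zp-mod (moment v) (ℤ.- e))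

      y-rotate : ∀ v → Root n v → y (rotate v) ≈ x v ^ 2 * y v
      y-rotate v@(a , b , c , d , e) (t , _) = trans (reflexive (≡.cong zp (≡.trans
        (ℤR.solve 5 (λ a b c d e → let v = a , b , c , d , e in Syntax.moment₂ (Syntax.rotate v) ℤR.⊜ (Syntax.moment v ⊕ Syntax.moment v ⊕ Syntax.moment₂ v) ⊕ ⊝ e ⊗ Κ (+ 5) ⊕ Syntax.total v) ≡.refl a b c d e)
        (≡.trans (≡.cong (ℤ._+_ ((moment v ℤ.+ moment v ℤ.+ moment₂ v) ℤ.+ (ℤ.- e) ℤ.* + 5)) t) (ℤP.+-identityʳ ((moment v ℤ.+ moment v ℤ.+ moment₂ v) ℤ.+ (ℤ.- e) ℤ.* + 5))))))
        (trans (zp-mod (moment v ℤ.+ moment v ℤ.+ moment₂ v) (ℤ.- e)) (trans (zp-+ (moment v ℤ.+ moment v) (moment₂ v)) (*-congʳ (zp-+ (moment v) (moment v)))))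

      x-double : ∀ v → x (double v) ≈ x v ^ 2
      x-double v@(a , b , c , d , e) = trans (reflexive (≡.cong zp
        (ℤR.solve 5 (λ a b c d e → let v = a , b , c , d , e in Syntax.moment (Syntax.double v) ℤR.⊜ (Syntax.moment v ⊕ Syntax.moment v) ⊕ (a ℤR.⊖ e) ⊗ Κ (+ 5)) ≡.refl a b c d e)))
        (trans (zp-mod (moment v ℤ.+ moment v) (a ℤ.- e)) (zp-+ (moment v) (moment v)))

      W : ℕ → ℕ → Carrier
      W α β = sumL L (λ v → x v ^ α * y v ^ β)

      u = roots-unique m n

      W-rotate : ∀ α β → W α β ≈ W (α ℕ.+ 2 ℕ.* β) β
      W-rotate α β = trans (sumL-matching u u (rotate-matching {m} {n} l) (λ v → x v ^ α * y v ^ β)) (sumL-cong-∈ L (λ {v} v∈ → let r = ∈-roots {m} {n} v∈ in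
        trans (*-cong (^-congˡ α (x-rotate v r)) (trans (^-congˡ β (y-rotate v r)) (^-distrib-* (x v ^ 2) (y v) β)))
          (trans (sym (*-assoc _ _ _)) (*-congʳ (trans (*-congˡ (^-assocʳ (x v) 2 β)) (sym (^-homo-* (x v) α (2 ℕ.* β))))))))

      W-5 : ∀ α β → W (5 ℕ.+ α) β ≈ W α β
      W-5 α β = sumL-cong L (λ v → *-congʳ (trans (^-homo-* (x v) 5 α) (trans (*-congʳ (zp⁵ (moment v))) (*-identityˡ _))))

      -- The cyclic shift replaces α by α + 2β, and 2β is invertible modulo 5, so repeated shifts
      -- connect every α with 0. Each clause spells out such a chain.
      W-flat : ∀ α β → α < 5 → 1 ≤ β → β < 5 → W α β ≈ W 0 β
      W-flat α β a b c = sym (go α β a b c)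
        where
        go : ∀ α β → α < 5 → 1 ≤ β → β < 5 → W 0 β ≈ W α β
        go 0 β _ _ _ = refl
        go 1 1 _ _ _ = trans (go′ 4 1 (trans (W-rotate 0 1) (W-rotate 2 1))) (W-5 1 1)
          where go′ : ∀ α β → W 0 β ≈ W α β → W 0 β ≈ W (α ℕ.+ 2 ℕ.* β) β
                go′ α β e = trans e (W-rotate α β)
        go 2 1 _ _ _ = W-rotate 0 1
        go 3 1 _ _ _ = trans (trans (trans (W-rotate 0 1) (W-rotate 2 1)) (trans (W-rotate 4 1) (W-5 1 1))) (W-rotate 1 1)
        go 4 1 _ _ _ = trans (W-rotate 0 1) (W-rotate 2 1)
        go 1 2 _ _ _ = trans (go 2 2 (s≤s (s≤s (s≤s z≤n))) (s≤s z≤n) (s≤s (s≤s (s≤s z≤n)))) (trans (W-rotate 2 2) (W-5 1 2))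
        go 2 2 _ _ _ = trans (trans (W-rotate 0 2) (trans (W-rotate 4 2) (W-5 3 2))) (trans (W-rotate 3 2) (W-5 2 2))
        go 3 2 _ _ _ = trans (W-rotate 0 2) (trans (W-rotate 4 2) (W-5 3 2))
        go 4 2 _ _ _ = W-rotate 0 2
        go 1 3 _ _ _ = trans (W-rotate 0 3) (W-5 1 3)
        go 2 3 _ _ _ = trans (trans (W-rotate 0 3) (W-5 1 3)) (trans (W-rotate 1 3) (W-5 2 3))
        go 3 3 _ _ _ = trans (trans (trans (W-rotate 0 3) (W-5 1 3)) (trans (W-rotate 1 3) (W-5 2 3))) (trans (W-rotate 2 3) (W-5 3 3))
        go 4 3 _ _ _ = trans (trans (trans (trans (W-rotate 0 3) (W-5 1 3)) (trans (W-rotate 1 3) (W-5 2 3))) (trans (W-rotate 2 3) (W-5 3 3))) (trans (W-rotate 3 3) (W-5 4 3))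
        go 1 4 _ _ _ = trans (trans (W-rotate 0 4) (W-5 3 4)) (trans (W-rotate 3 4) (trans (W-5 6 4) (W-5 1 4)))
        go 2 4 _ _ _ = trans (trans (trans (trans (W-rotate 0 4) (W-5 3 4)) (trans (W-rotate 3 4) (trans (W-5 6 4) (W-5 1 4)))) (trans (W-rotate 1 4) (W-5 4 4))) (trans (W-rotate 4 4) (trans (W-5 7 4) (W-5 2 4)))
        go 3 4 _ _ _ = trans (W-rotate 0 4) (W-5 3 4)
        go 4 4 _ _ _ = trans (trans (trans (W-rotate 0 4) (W-5 3 4)) (trans (W-rotate 3 4) (trans (W-5 6 4) (W-5 1 4)))) (trans (W-rotate 1 4) (W-5 4 4))
        go (suc (suc (suc (suc (suc _))))) _ (s≤s (s≤s (s≤s (s≤s (s≤s ()))))) _ _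
        go (suc _) (suc (suc (suc (suc (suc _))))) _ _ (s≤s (s≤s (s≤s (s≤s (s≤s ())))))

      X : ℕ → Carrier
      X α = sumL L (λ v → x v ^ α)

      X-double : ∀ α → X α ≈ X (2 ℕ.* α)
      X-double α = trans (sumL-matching u u (double-matching {m} {n} l) (λ v → x v ^ α)) (sumL-cong L (λ v → trans (^-congˡ α (x-double v)) (^-assocʳ (x v) 2 α)))

      X-5 : ∀ α → X (5 ℕ.+ α) ≈ X α
      X-5 α = sumL-cong L (λ v → trans (^-homo-* (x v) 5 α) (trans (*-congʳ (zp⁵ (moment v))) (*-identityˡ _)))

      N = X 0
      D = X 1

      ζ³ = ζ ^ 3
      Gζ³ : G ζ³ ≈ 0#
      Gζ³ = conjugate-sum ζ ζ-sum 2 (s≤s (s≤s (s≤s (s≤s z≤n))))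

      -- Only the characters trivial on moment₂ contribute.
      row : ∀ β → 1 ≤ β → β < 5 → sumL L (λ v → G (ζ³ * x v) * y v ^ β) ≈ 0#
      row β b c = begin
        sumL L (λ v → G (ζ³ * x v) * y v ^ β)
          ≈⟨ sumL-cong L (λ v → solve 3 (λ z x y → (Κ 1ℤ ⊕ z ⊗ x ⊕ (z ⊗ x) ⊛ 2 ⊕ (z ⊗ x) ⊛ 3 ⊕ (z ⊗ x) ⊛ 4) ⊗ y ⊜
               Κ 1ℤ ⊗ (Κ 1ℤ ⊗ y) ⊕ z ⊗ (x ⊗ y) ⊕ z ⊛ 2 ⊗ (x ⊛ 2 ⊗ y) ⊕ z ⊛ 3 ⊗ (x ⊛ 3 ⊗ y) ⊕ z ⊛ 4 ⊗ (x ⊛ 4 ⊗ y)) refl ζ³ (x v) (y v ^ β)) ⟩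
        sumL L (λ v → 1# * (1# * y v ^ β) + ζ³ * (x v * y v ^ β) + ζ³ ^ 2 * (x v ^ 2 * y v ^ β) + ζ³ ^ 3 * (x v ^ 3 * y v ^ β) + ζ³ ^ 4 * (x v ^ 4 * y v ^ β))
          ≈⟨ trans (sumL-+ L _ _) (+-cong (trans (sumL-+ L _ _) (+-cong (trans (sumL-+ L _ _) (+-cong (trans (sumL-+ L _ _) (+-cong (sumL-*ˡ L 1# _) (sumL-*ˡ L ζ³ _))) (sumL-*ˡ L (ζ³ ^ 2) _))) (sumL-*ˡ L (ζ³ ^ 3) _))) (sumL-*ˡ L (ζ³ ^ 4) _)) ⟩
        1# * W 0 β + ζ³ * W 1 β + ζ³ ^ 2 * W 2 β + ζ³ ^ 3 * W 3 β + ζ³ ^ 4 * W 4 β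
          ≈⟨ +-cong (+-cong (+-cong (+-congˡ (*-congˡ (fl 1 (s≤s (s≤s z≤n))))) (*-congˡ (fl 2 (s≤s (s≤s (s≤s z≤n)))))) (*-congˡ (fl 3 (s≤s (s≤s (s≤s (s≤s z≤n))))))) (*-congˡ (fl 4 (s≤s (s≤s (s≤s (s≤s (s≤s z≤n))))))) ⟩
        1# * W 0 β + ζ³ * W 0 β + ζ³ ^ 2 * W 0 β + ζ³ ^ 3 * W 0 β + ζ³ ^ 4 * W 0 β
          ≈⟨ solve 2 (λ z w → Κ 1ℤ ⊗ w ⊕ z ⊗ w ⊕ z ⊛ 2 ⊗ w ⊕ z ⊛ 3 ⊗ w ⊕ z ⊛ 4 ⊗ w ⊜ (Κ 1ℤ ⊕ z ⊕ z ⊛ 2 ⊕ z ⊛ 3 ⊕ z ⊛ 4) ⊗ w) refl ζ³ (W 0 β) ⟩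
        G ζ³ * W 0 β ≈⟨ trans (*-congʳ Gζ³) (zeroˡ _) ⟩
        0# ∎
        where open Rsn
              fl : ∀ α → α < 5 → W α β ≈ W 0 β
              fl α a = W-flat α β a b c

      -- Doubling the index gives X 1 = X 2 = X 4 = X 3, and the nontrivial powers of ζ³ add up to
      -- -1.
      row₀ : sumL L (λ v → G (ζ³ * x v)) ≈ N - D
      row₀ = begin
        sumL L (λ v → G (ζ³ * x v))
          ≈⟨ sumL-cong L (λ v → solve 2 (λ z x → Κ 1ℤ ⊕ z ⊗ x ⊕ (z ⊗ x) ⊛ 2 ⊕ (z ⊗ x) ⊛ 3 ⊕ (z ⊗ x) ⊛ 4 ⊜ Κ 1ℤ ⊕ z ⊗ x ⊕ z ⊛ 2 ⊗ x ⊛ 2 ⊕ z ⊛ 3 ⊗ x ⊛ 3 ⊕ z ⊛ 4 ⊗ x ⊛ 4) refl ζ³ (x v)) ⟩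
        sumL L (λ v → 1# + ζ³ * x v + ζ³ ^ 2 * x v ^ 2 + ζ³ ^ 3 * x v ^ 3 + ζ³ ^ 4 * x v ^ 4)
          ≈⟨ trans (sumL-+ L _ _) (+-cong (trans (sumL-+ L _ _) (+-cong (trans (sumL-+ L _ _) (+-cong (trans (sumL-+ L _ _) (+-congˡ (sumL-*ˡ L ζ³ _))) (sumL-*ˡ L (ζ³ ^ 2) _))) (sumL-*ˡ L (ζ³ ^ 3) _))) (sumL-*ˡ L (ζ³ ^ 4) _)) ⟩
        N + ζ³ * X 1 + ζ³ ^ 2 * X 2 + ζ³ ^ 3 * X 3 + ζ³ ^ 4 * X 4
          ≈⟨ +-cong (+-cong (+-congˡ (*-congˡ (sym (X-double 1)))) (*-congˡ (sym (trans (X-double 1) (trans (X-double 2) (trans (X-double 4) (X-5 3))))))) (*-congˡ (sym (trans (X-double 1) (X-double 2)))) ⟩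
        N + ζ³ * D + ζ³ ^ 2 * D + ζ³ ^ 3 * D + ζ³ ^ 4 * D
          ≈⟨ solve 3 (λ z n d → n ⊕ z ⊗ d ⊕ z ⊛ 2 ⊗ d ⊕ z ⊛ 3 ⊗ d ⊕ z ⊛ 4 ⊗ d ⊜ n ⊖ d ⊕ (Κ 1ℤ ⊕ z ⊕ z ⊛ 2 ⊕ z ⊛ 3 ⊕ z ⊛ 4) ⊗ d) refl ζ³ N D ⟩
        N - D + G ζ³ * D ≈⟨ trans (+-congˡ (trans (*-congʳ Gζ³) (zeroˡ _))) (+-identityʳ _) ⟩
        N - D ∎
        where open Rsn

      shift : ∀ v → ζ³ * x v ≈ zp (moment v ℤ.- + 2)
      shift v = sym (trans (zp-+ (moment v) -[1+ 1 ]) (trans (*-comm _ _) (*-congʳ (trans (solve 1 (λ z → (z ⊛ 4) ⊛ 2 ⊜ z ⊛ 5 ⊗ z ⊛ 3) refl ζ) (trans (*-congʳ ζ⁵) (*-identityˡ _))))))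

      special-value : ∀ v → Special v → G (ζ³ * x v) * G (y v) ≈ ι (+ 25)
      special-value v (p , r) = trans (*-cong (trans (G-cong (shift v)) (G-divides {moment v ℤ.- + 2} p)) (G-divides {moment₂ v} r)) (solve 0 (Κ (+ 5) ⊗ Κ (+ 5) ⊜ Κ (+ 25)) refl)

      other-value : ∀ v → ¬ Special v → G (ζ³ * x v) * G (y v) ≈ 0#
      other-value v n = go (+ 5 ℤ∣? (moment v ℤ.- + 2)) (+ 5 ℤ∣? moment₂ v)
        where
        go : Dec (+ 5 ℤ∣ (moment v ℤ.- + 2)) → Dec (+ 5 ℤ∣ moment₂ v) → G (ζ³ * x v) * G (y v) ≈ 0#
        go (yes p) (yes r) = ⊥-elim (n (p , r))
        go (no p) _ = trans (*-congʳ (trans (G-cong (shift v)) (G-∤ {moment v ℤ.- + 2} p))) (zeroˡ _)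
        go (yes _) (no r) = trans (*-congˡ (G-∤ {moment₂ v} r)) (zeroʳ _)

    -- Orthogonality of the 25 characters of the pair (moment, moment₂): the product of the two
    -- geometric sums is 25 on special vectors and 0 elsewhere, the factor ζ³ = ζ^(-2) shifting the
    -- first condition to moment ≡ 2. The rows with β ≠ 0 cancel and the row β = 0 is `row₀`.
    special-count : sumL (filter special? (roots m n)) (λ _ → ι (+ 25)) ≈ sumL (roots m n) (λ _ → 1#) - sumL (roots m n) (λ v → zp (moment v))
    special-count = begin
      sumL (filter special? L) (λ _ → ι (+ 25)) ≈⟨ sumL-filter special? L special-value other-value ⟨
      sumL L (λ v → G (ζ³ * x v) * G (y v))
        ≈⟨ sumL-cong L (λ v → solve 2 (λ g y → g ⊗ (Κ 1ℤ ⊕ y ⊕ y ⊛ 2 ⊕ y ⊛ 3 ⊕ y ⊛ 4) ⊜ g ⊕ g ⊗ y ⊕ g ⊗ y ⊛ 2 ⊕ g ⊗ y ⊛ 3 ⊕ g ⊗ y ⊛ 4) refl (G (ζ³ * x v)) (y v)) ⟩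
      sumL L (λ v → g v + g v * y v + g v * y v ^ 2 + g v * y v ^ 3 + g v * y v ^ 4)
        ≈⟨ trans (sumL-+ L _ _) (+-cong (trans (sumL-+ L _ _) (+-cong (trans (sumL-+ L _ _) (+-cong (trans (sumL-+ L _ _) (+-cong row₀ (row 1 1≤ (s≤s (s≤s z≤n))))) (row 2 1≤ (s≤s (s≤s (s≤s z≤n)))))) (row 3 1≤ (s≤s (s≤s (s≤s (s≤s z≤n))))))) (row 4 1≤ (s≤s (s≤s (s≤s (s≤s (s≤s z≤n))))))) ⟩
      N - D + 0# + 0# + 0# + 0# ≈⟨ solve 1 (λ x → x ⊕ Κ 0ℤ ⊕ Κ 0ℤ ⊕ Κ 0ℤ ⊕ Κ 0ℤ ⊜ x) refl (N - D) ⟩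
      N - D ∎
      where open Rsn
            g : ℤ⁵ → Carrier
            g v = G (ζ³ * x v)
            1≤ : ∀ {n} → 1 ≤ suc n
            1≤ = s≤s z≤n

  -- By `enlarge-matching` the special vectors are as many as the coset vectors one degree lower.
  -- This is the coefficientwise form of the theta expansion.
  root-count : ∀ {m n} → 2 ℕ.* n ℕ.+ 10 ≤ m →
    sumL (roots m (suc n)) (λ _ → 1#) ≈ sumL (roots m (suc n)) (λ v → zp (moment v)) + ι (+ 25) * sumL (cosets m n) (λ _ → 1#)
  root-count {m} {n} l = begin
    N ≈⟨ solve 2 (λ n d → n ⊜ d ⊕ (n ⊖ d)) refl N D ⟩
    D + (N - D) ≈⟨ +-congˡ (special-count {m} {suc n} bound) ⟨
    D + sumL (filter special? (roots m (suc n))) (λ _ → ι (+ 25)) ≈⟨ +-congˡ (sumL-matching (cosets-unique m n) (UniqueP.filter⁺ special? (roots-unique m (suc n))) (enlarge-matching {m} {n} l) (λ _ → ι (+ 25))) ⟩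
    D + sumL (cosets m n) (λ _ → ι (+ 25)) ≈⟨ +-congˡ (trans (sumL-cong (cosets m n) (λ _ → sym (*-identityʳ _))) (sumL-*ˡ (cosets m n) (ι (+ 25)) _)) ⟩
    D + ι (+ 25) * sumL (cosets m n) (λ _ → 1#) ∎
    where
    open Rsn
    N = sumL (roots m (suc n)) (λ _ → 1#)
    D = sumL (roots m (suc n)) (λ v → zp (moment v))
    bound : suc n ℕ.+ suc n ≤ m
    bound = ℕP.≤-trans (ℕP.≤-trans (ℕP.≤-reflexive (ℕS.solve 1 (λ n → (ℕS.con 1 ℕS.:+ n) ℕS.:+ (ℕS.con 1 ℕS.:+ n) ℕS.:= ℕS.con 2 ℕS.:* n ℕS.:+ ℕS.con 2) ≡.refl n)) (ℕP.+-monoʳ-≤ (2 ℕ.* n) (s≤s (s≤s z≤n)))) l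

  root-count₀ : ∀ m → sumL (roots m 0) (λ _ → 1#) ≈ sumL (roots m 0) (λ v → zp (moment v))
  root-count₀ m = sumL-cong-∈ (roots m 0) (λ {v} v∈ → reflexive (≡.cong zp {x = 0ℤ} (≡.sym (zero-moment v (∈-roots {m} {0} v∈)))))
    where
    z : ∀ i → ∣ i ∣ ≤ 0 → i ≡ 0ℤ
    z i l = ℤP.∣i∣≡0⇒i≡0 (ℕP.n≤0⇒n≡0 l)
    zero-moment : ∀ v → Root 0 v → moment v ≡ 0ℤ
    zero-moment (a , b , c , d , e) (_ , p) = let (pa , pb , pc , pd , pe) = norm-bound {0} a b c d e (ℤP.≤-reflexive p) in
      ≡.cong moment {y = 0ℤ , 0ℤ , 0ℤ , 0ℤ , 0ℤ} (≡⁵ (z a pa) (z b pb) (z c pc) (z d pd) (z e pe))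

-- Generating functions of the lattice counts as constant terms

-- L stands for the Laurent polynomials K[z,z⁻¹] and ct for the constant term.
module _ (K L : CommutativeRing 0ℓ 0ℓ) (emb : Hom K L) where
  private
    module K = Ring K
    module L = Ring L
    module emb = Hom emb

  module ConstantTerm
    (ct : L.Carrier → K.Carrier)
    (ct-cong : ∀ {x y} → x L.≈ y → ct x K.≈ ct y)
    (ct-+ : ∀ x y → ct (x L.+ y) K.≈ ct x K.+ ct y)
    (ct-0 : ct L.0# K.≈ K.0#)
    (ct-* : ∀ c x → ct (emb.⟦ c ⟧ L.* x) K.≈ c K.* ct x)
    (z z⁻¹ : L.Carrier) (zz⁻¹ : z L.* z⁻¹ L.≈ L.1#)
    (ct-1 : ct L.1# K.≈ K.1#) (ct-pow : ∀ j → ¬ j ≡ 0ℤ → ct (IntegralPowers.pow L z z⁻¹ zz⁻¹ j) K.≈ K.0#)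
    where
    open IntegralPowers L z z⁻¹ zz⁻¹ using (pow; pow-+; pow-unique)
    private
      module GK = Gauss K
      module GL = Gauss L
      module SK = GK.S
      module SL = GL.S
      module MS = MapSpread emb
      module M = MapSeries emb
      module m = Hom M.map
      module C = Hom GL.C-hom
      module SyL = Symmetric L
      module SyK = Symmetric K
      module MonoL = Monomials L
      module LSL = ListSums GL.ring
      module LSK = ListSums K
    open GK using (_≈[_]_)

    CT : GL.PS → GK.PS
    CT f n = ct (f n)

    CT-* : ∀ f g → CT (m.⟦ f ⟧ SL.* g) GK.≋ f SK.* CT g
    CT-* f g = GK.mk λ n → K.trans (ct-∑² n _) (K.∑²-cong n (λ _ _ _ → ct-* _ _))
      where
      ct-∑² : ∀ n F → ct (L.∑² n F) K.≈ K.∑² n (λ i j → ct (F i j))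
      ct-∑² zero F = K.refl
      ct-∑² (suc n) F = K.trans (ct-+ _ _) (K.+-congˡ (ct-∑² n _))

    CT-[] : ∀ {N f g} → f GL.≈[ N ] g → CT f ≈[ N ] CT g
    CT-[] e i l = ct-cong (e i l)

    ct-sumL : ∀ {X : Set} (l : List X) F → ct (L.sumL l F) K.≈ K.sumL l (ct ∘ F)
    ct-sumL [] F = ct-0
    ct-sumL (x ∷ l) F = K.trans (ct-+ _ _) (K.+-congˡ (ct-sumL l F))

    ct-∑± : ∀ k F → ct (SyL.∑± k F) K.≈ SyK.∑± k (ct ∘ F)
    ct-∑± zero F = K.refl
    ct-∑± (suc k) F = K.trans (ct-+ _ _) (K.+-congˡ (K.trans (ct-+ _ _) (K.+-congʳ (ct-∑± k F))))

    sumL-range : ∀ k F → L.sumL (range k) F L.≈ SyL.∑± k F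
    sumL-range k F = L.trans (L.reflexive (L.sumL-map _ (List.upTo (suc (k ℕ.+ k))) F)) (L.trans (L.sumL-applyUpTo (k ℕ.+ k) id (λ i → F (+ i ℤ.- + k)))
      (L.trans (L.∑²-cong (k ℕ.+ k) (λ i _ _ → L.reflexive (≡.cong F (ℤP.m-n≡m⊖n i k)))) (SyL.∑²⇒∑± k F)))

    mono : (ℤ → K.Carrier) → (ℤ → ℕ) → ℤ → GL.PS
    mono W E j = GL.C (emb.⟦ W j ⟧ L.* pow j) SL.* GL.q SL.^ E j

    -- T is the theta series Σ W(j) z^j q^{E(j)}, up to q^k.
    IsTheta : ℕ → (ℤ → K.Carrier) → (ℤ → ℕ) → GL.PS → Set
    IsTheta k W E T = T GL.≈[ k ] (λ n → SyL.∑± k (λ j → mono W E j n))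

    private
      sumL-* : ∀ {X Y : Set} (l : List X) (l′ : List Y) f g → SL.sumL l f SL.* SL.sumL l′ g SL.≈ SL.sumL (cartesianProduct l l′) (λ (x , y) → f x SL.* g y)
      sumL-* l l′ f g = SL.sym (SL.trans (LSL.sumL-product l l′ _) (SL.trans (SL.sumL-cong l (λ x → SL.sumL-*ˡ l′ (f x) g)) (SL.sumL-*ʳ l (SL.sumL l′ g) f)))

      mono-* : ∀ c i e c′ i′ e′ → (GL.C (emb.⟦ c ⟧ L.* pow i) SL.* GL.q SL.^ e) SL.* (GL.C (emb.⟦ c′ ⟧ L.* pow i′) SL.* GL.q SL.^ e′) SL.≈ GL.C (emb.⟦ c K.* c′ ⟧ L.* pow (i ℤ.+ i′)) SL.* GL.q SL.^ (e ℕ.+ e′)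
      mono-* c i e c′ i′ e′ = SL.trans (SL.solve 4 (λ a b c d → (a ⊗ b) ⊗ (c ⊗ d) SL.⊜ (a ⊗ c) ⊗ (b ⊗ d)) SL.refl (GL.C (emb.⟦ c ⟧ L.* pow i)) (GL.q SL.^ e) (GL.C (emb.⟦ c′ ⟧ L.* pow i′)) (GL.q SL.^ e′))
        (SL.*-cong (SL.trans (SL.sym (C.*-hom _ _)) (C.cong (L.trans (L.solve 4 (λ a b c d → (a ⊗ b) ⊗ (c ⊗ d) L.⊜ (a ⊗ c) ⊗ (b ⊗ d)) L.refl emb.⟦ c ⟧ (pow i) emb.⟦ c′ ⟧ (pow i′)) (L.*-cong (L.sym (emb.*-hom c c′)) (L.sym (pow-+ i i′))))))
          (SL.sym (SL.^-homo-* GL.q e e′)))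

    module _ (k : ℕ) (W₀ W₁ W₂ W₃ W₄ : ℤ → K.Carrier) (E₀ E₁ E₂ E₃ E₄ : ℤ → ℕ) (T₀ T₁ T₂ T₃ T₄ : GL.PS)
      (t₀ : IsTheta k W₀ E₀ T₀) (t₁ : IsTheta k W₁ E₁ T₁) (t₂ : IsTheta k W₂ E₂ T₂) (t₃ : IsTheta k W₃ E₃ T₃) (t₄ : IsTheta k W₄ E₄ T₄) where
      private
        weight : ℤ⁵ → K.Carrier
        weight (a , b , c , d , e) = W₀ a K.* (W₁ b K.* (W₂ c K.* (W₃ d K.* W₄ e)))
        total′ : ℤ⁵ → ℤ
        total′ (a , b , c , d , e) = a ℤ.+ (b ℤ.+ (c ℤ.+ (d ℤ.+ e)))
        degree : ℤ⁵ → ℕ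
        degree (a , b , c , d , e) = E₀ a ℕ.+ (E₁ b ℕ.+ (E₂ c ℕ.+ (E₃ d ℕ.+ E₄ e)))

        list : ∀ W E T → IsTheta k W E T → T GL.≈[ k ] SL.sumL (range k) (mono W E)
        list W E T t = GL.[]-trans t (λ n l → L.sym (L.trans (GL.sumL-coef (range k) (mono W E) n) (sumL-range k (λ j → mono W E j n))))

        r = range k
        r² = cartesianProduct r r
        r³ = cartesianProduct r r²
        r⁴ = cartesianProduct r r³
        M₀ = mono W₀ E₀ ; M₁ = mono W₁ E₁ ; M₂ = mono W₂ E₂ ; M₃ = mono W₃ E₃ ; M₄ = mono W₄ E₄
        M₃₄ : ℤ × ℤ → GL.PS
        M₃₄ (d , e) = M₃ d SL.* M₄ e
        M₂₄ : ℤ × ℤ × ℤ → GL.PS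
        M₂₄ (c , v) = M₂ c SL.* M₃₄ v
        M₁₄ : ℤ × ℤ × ℤ × ℤ → GL.PS
        M₁₄ (b , v) = M₁ b SL.* M₂₄ v
        M₀₄ : ℤ⁵ → GL.PS
        M₀₄ (a , v) = M₀ a SL.* M₁₄ v

        collect : ∀ v → M₀₄ v SL.≈ GL.C (emb.⟦ weight v ⟧ L.* pow (total′ v)) SL.* GL.q SL.^ degree v
        collect (a , b , c , d , e) = SL.trans (SL.*-congˡ {M₀ a} (SL.trans (SL.*-congˡ {M₁ b} (SL.trans (SL.*-congˡ {M₂ c} (mono-* (W₃ d) d (E₃ d) (W₄ e) e (E₄ e)))
          (mono-* (W₂ c) c (E₂ c) _ _ _))) (mono-* (W₁ b) b (E₁ b) _ _ _))) (mono-* (W₀ a) a (E₀ a) _ _ _)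

        prod : (T₀ SL.* (T₁ SL.* (T₂ SL.* (T₃ SL.* T₄)))) GL.≈[ k ] SL.sumL (cube k) (λ v → GL.C (emb.⟦ weight v ⟧ L.* pow (total′ v)) SL.* GL.q SL.^ degree v)
        prod = GL.[]-trans (GL.[]-* (list W₀ E₀ T₀ t₀) (GL.[]-* (list W₁ E₁ T₁ t₁) (GL.[]-* (list W₂ E₂ T₂ t₂) (GL.[]-* (list W₃ E₃ T₃ t₃) (list W₄ E₄ T₄ t₄)))))
          (GL.≋⇒≈[] (SL.trans (SL.*-congˡ {SL.sumL r M₀} (SL.trans (SL.*-congˡ {SL.sumL r M₁} (SL.trans (SL.*-congˡ {SL.sumL r M₂} (sumL-* r r M₃ M₄)) (sumL-* r r² M₂ M₃₄))) (sumL-* r r³ M₁ M₂₄))) (SL.trans (sumL-* r r⁴ M₀ M₁₄)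
            (SL.sumL-cong (cube k) collect))))

      -- In a product of five theta series the constant term in z selects the index vectors of total
      -- 0, each contributing its weight in its degree. The predicate is arbitrary so that both the
      -- lattice and its coset can be described.
      five-theta : ∀ n → n < k → {P : ℤ⁵ → Set} (P? : ∀ v → Dec (P v)) (G : ℤ⁵ → K.Carrier) →
        (∀ v → P v → total′ v ≡ 0ℤ × degree v ≡ n × weight v K.≈ G v) → (∀ v → total′ v ≡ 0ℤ → degree v ≡ n → P v) →
        CT (T₀ SL.* (T₁ SL.* (T₂ SL.* (T₃ SL.* T₄)))) n K.≈ K.sumL (filter P? (cube k)) G
      five-theta n l {P} P? G to from = K.trans (ct-cong (L.trans (prod n l) (GL.sumL-coef (cube k) (λ v → GL.C (emb.⟦ weight v ⟧ L.* pow (total′ v)) SL.* GL.q SL.^ degree v) n))) (K.trans (ct-sumL (cube k) (λ v → (GL.C (emb.⟦ weight v ⟧ L.* pow (total′ v)) SL.* GL.q SL.^ degree v) n)) (LSK.sumL-filter P? (cube k)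
        (λ v p → let (t , d , w) = to v p in K.trans (ct-cong (L.trans (MonoL.mono-coef _ (degree v) n) (L.trans (L.reflexive (MonoL.ind-yes _ d)) (L.*-congˡ (L.reflexive (≡.cong pow t)))))) (K.trans (ct-* _ _) (K.trans (K.*-cong w ct-1) (K.*-identityʳ _))))
        (λ v ¬p → K.trans (ct-cong (MonoL.mono-coef _ (degree v) n)) (off v ¬p (degree v ℕ.≟ n)))))
        where
        off : ∀ v → ¬ P v → Dec (degree v ≡ n) → ct (MonoL.ind (degree v) n (emb.⟦ weight v ⟧ L.* pow (total′ v))) K.≈ K.0#
        off v ¬p (no d) = K.trans (ct-cong (L.reflexive (MonoL.ind-no _ d))) ct-0
        off v ¬p (yes d) = K.trans (ct-cong (L.reflexive (MonoL.ind-yes _ d))) (K.trans (ct-* _ _) (K.trans (K.*-congˡ (ct-pow (total′ v) (λ t → ¬p (from v t d)))) (K.zeroʳ _)))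

    -- The constant term of Σ w(j) q^{E(j)} is 1 when w(j) has no constant term for j ≠ 0.
    CT-theta : ∀ k (w : ℤ → L.Carrier) (E : ℤ → ℕ) → E 0ℤ ≡ 0 → w 0ℤ L.≈ L.1# → (∀ j → ¬ j ≡ 0ℤ → ct (w j) K.≈ K.0#) →
      CT (λ n → SyL.∑± k (λ j → (GL.C (w j) SL.* GL.q SL.^ E j) n)) GK.≋ SK.1#
    CT-theta k w E E0 w0 wj = GK.mk λ n → K.trans (ct-∑± k _) (go k n)
      where
      nonzero : ∀ j n → ¬ j ≡ 0ℤ → ct ((GL.C (w j) SL.* GL.q SL.^ E j) n) K.≈ K.0#
      nonzero j n j≢0 = K.trans (ct-cong (MonoL.mono-coef (w j) (E j) n)) (case (E j ℕ.≟ n))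
        where case : Dec (E j ≡ n) → ct (MonoL.ind (E j) n (w j)) K.≈ K.0#
              case (yes e) = K.trans (ct-cong (L.reflexive (MonoL.ind-yes (w j) e))) (wj j j≢0)
              case (no e) = K.trans (ct-cong (L.reflexive (MonoL.ind-no (w j) e))) ct-0
      go : ∀ k n → SyK.∑± k (λ j → ct ((GL.C (w j) SL.* GL.q SL.^ E j) n)) K.≈ GK.one n
      go zero zero = K.trans (ct-cong (L.trans (MonoL.mono-coef (w 0ℤ) (E 0ℤ) 0) (L.trans (L.reflexive (MonoL.ind-yes (w 0ℤ) E0)) w0))) ct-1
      go zero (suc n) = K.trans (ct-cong (L.trans (MonoL.mono-coef (w 0ℤ) (E 0ℤ) (suc n)) (L.reflexive (MonoL.ind-no (w 0ℤ) (λ e → ℕP.0≢1+n (≡.trans (≡.sym E0) e)))))) ct-0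
      go (suc k) n = K.trans (K.+-cong (nonzero -[1+ k ] n (λ ())) (K.trans (K.+-cong (go k n) (nonzero (+ suc k) n (λ ()))) (K.+-identityʳ _))) (K.+-identityˡ _)

    private
      map-poch : ∀ j k → m.⟦ GK.poch (GK.q SK.^ j) k ⟧ SL.≈ GL.poch (GL.q SL.^ j) k
      map-poch j k = SL.trans (m.poch-hom k (GK.q SK.^ j)) (SL.∏-cong k (λ i → SL.+-congˡ {SL.1#} (SL.-‿cong (SL.^-congˡ (suc i) (SL.trans (m.^-hom GK.q j) (SL.^-congˡ j M.map-q))))))

      -- Comparing constant terms in a product of five theta series of the form P^5 F.
      compare : ∀ N (a b : GK.PS) (F G : GL.PS) → (m.⟦ a ⟧ SL.* F) GL.≈[ N ] (m.⟦ b ⟧ SL.* G) → CT G GK.≋ SK.1# → (a SK.* CT F) ≈[ N ] b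
      compare N a b F G e c = GK.[]-trans (GK.≋⇒≈[] (SK.sym (CT-* a F))) (GK.[]-trans (CT-[] e) (GK.≋⇒≈[] (SK.trans (CT-* b G) (SK.trans (SK.*-congˡ c) (SK.*-identityʳ b)))))

      gather : ∀ p (F₀ F₁ F₂ F₃ F₄ : ℕ → GL.PS) k →
        (p SL.* SL.∏ k F₀) SL.* ((p SL.* SL.∏ k F₁) SL.* ((p SL.* SL.∏ k F₂) SL.* ((p SL.* SL.∏ k F₃) SL.* (p SL.* SL.∏ k F₄))))
          SL.≈ p SL.^ 5 SL.* SL.∏ k (λ i → F₀ i SL.* (F₁ i SL.* (F₂ i SL.* (F₃ i SL.* F₄ i))))
      gather p F₀ F₁ F₂ F₃ F₄ k = SL.trans (SL.solve 6 (λ p a b c d e → (p ⊗ a) ⊗ ((p ⊗ b) ⊗ ((p ⊗ c) ⊗ ((p ⊗ d) ⊗ (p ⊗ e)))) SL.⊜ p ⊛ 5 ⊗ (a ⊗ (b ⊗ (c ⊗ (d ⊗ e))))) SL.refl p (SL.∏ k F₀) (SL.∏ k F₁) (SL.∏ k F₂) (SL.∏ k F₃) (SL.∏ k F₄))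
        (SL.*-congˡ {p SL.^ 5} (SL.sym (SL.trans (SL.∏-* k F₀ _) (SL.*-congˡ {SL.∏ k F₀} (SL.trans (SL.∏-* k F₁ _) (SL.*-congˡ {SL.∏ k F₁} (SL.trans (SL.∏-* k F₂ _) (SL.*-congˡ {SL.∏ k F₂} (SL.∏-* k F₃ F₄)))))))))

      +-total : ∀ a b c d e → a ℤ.+ (b ℤ.+ (c ℤ.+ (d ℤ.+ e))) ≡ total (a , b , c , d , e)
      +-total = ℤS.solve 5 (λ a b c d e → a ℤS.:+ (b ℤS.:+ (c ℤS.:+ (d ℤS.:+ e))) ℤS.:= a ℤS.:+ b ℤS.:+ c ℤS.:+ d ℤS.:+ e) ≡.refl

      2*sum : ∀ x₀ x₁ x₂ x₃ x₄ → + 2 ℤ.* + (x₀ ℕ.+ (x₁ ℕ.+ (x₂ ℕ.+ (x₃ ℕ.+ x₄)))) ≡ + 2 ℤ.* + x₀ ℤ.+ (+ 2 ℤ.* + x₁ ℤ.+ (+ 2 ℤ.* + x₂ ℤ.+ (+ 2 ℤ.* + x₃ ℤ.+ + 2 ℤ.* + x₄)))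
      2*sum x₀ x₁ x₂ x₃ x₄ = ℤS.solve 5 (λ a b c d e → ℤS.con (+ 2) ℤS.:* (a ℤS.:+ (b ℤS.:+ (c ℤS.:+ (d ℤS.:+ e)))) ℤS.:= ℤS.con (+ 2) ℤS.:* a ℤS.:+ (ℤS.con (+ 2) ℤS.:* b ℤS.:+ (ℤS.con (+ 2) ℤS.:* c ℤS.:+ (ℤS.con (+ 2) ℤS.:* d ℤS.:+ ℤS.con (+ 2) ℤS.:* e)))) ≡.refl (+ x₀) (+ x₁) (+ x₂) (+ x₃) (+ x₄)

      cong₅ : ∀ {x₀ y₀ x₁ y₁ x₂ y₂ x₃ y₃ x₄ y₄ : ℤ} → x₀ ≡ y₀ → x₁ ≡ y₁ → x₂ ≡ y₂ → x₃ ≡ y₃ → x₄ ≡ y₄ → x₀ ℤ.+ (x₁ ℤ.+ (x₂ ℤ.+ (x₃ ℤ.+ x₄))) ≡ y₀ ℤ.+ (y₁ ℤ.+ (y₂ ℤ.+ (y₃ ℤ.+ y₄)))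
      cong₅ ≡.refl ≡.refl ≡.refl ≡.refl ≡.refl = ≡.refl

    module _ (ζ : K.Carrier) (ζ-sum : K.1# K.+ ζ K.+ ζ K.^ 2 K.+ ζ K.^ 3 K.+ ζ K.^ 4 K.≈ K.0#) where
      open Characters K ζ ζ-sum using (zp; zp-+; ζ⁵; ζζ⁴)
      private
        u v : ℤ → L.Carrier
        u i = emb.⟦ zp i ⟧ L.* z
        v i = emb.⟦ zp (ℤ.- i) ⟧ L.* z⁻¹

        uv : ∀ i → u i L.* v i L.≈ L.1#
        uv i = L.trans (L.solve 4 (λ a b c d → (a ⊗ b) ⊗ (c ⊗ d) L.⊜ (a ⊗ c) ⊗ (b ⊗ d)) L.refl emb.⟦ zp i ⟧ z emb.⟦ zp (ℤ.- i) ⟧ z⁻¹)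
          (L.trans (L.*-cong (L.trans (L.sym (emb.*-hom (zp i) (zp (ℤ.- i)))) (L.trans (emb.cong (K.trans (K.sym (zp-+ i (ℤ.- i))) (K.reflexive (≡.cong zp (ℤP.+-inverseʳ i))))) emb.1-hom)) zz⁻¹) (L.*-identityˡ _))

        module Tr (i : ℤ) = Triple L (u i) (v i) (uv i) 0 0

        weight≈ : ∀ i j → Tr.weight i j L.≈ emb.⟦ zp (i ℤ.* j) ⟧ L.* pow j
        weight≈ i j = L.trans (L.reflexive (same j)) (L.sym (IntegralPowers.pow-unique L (u i) (v i) (uv i) (λ j → emb.⟦ zp (i ℤ.* j) ⟧ L.* pow j)
          (L.trans (L.*-identityʳ _) (L.trans (emb.cong (K.reflexive (≡.cong zp (ℤP.*-zeroʳ i)))) emb.1-hom))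
          (λ j → L.trans (L.*-cong (L.trans (emb.cong (K.trans (K.reflexive (≡.cong zp (ℤS.solve 2 (λ i j → i ℤS.:* (ℤS.con (+ 1) ℤS.:+ j) ℤS.:= i ℤS.:+ i ℤS.:* j) ≡.refl i j))) (zp-+ i (i ℤ.* j)))) (emb.*-hom (zp i) (zp (i ℤ.* j)))) (IntegralPowers.pow-suc L z z⁻¹ zz⁻¹ j))
            (L.solve 4 (λ a b c d → (a ⊗ b) ⊗ (c ⊗ d) L.⊜ (a ⊗ c) ⊗ (b ⊗ d)) L.refl emb.⟦ zp i ⟧ emb.⟦ zp (i ℤ.* j) ⟧ z (pow j))) j))
          where same : ∀ j → Tr.weight i j ≡ IntegralPowers.pow L (u i) (v i) (uv i) j
                same (+ n) = ≡.refl
                same -[1+ n ] = ≡.refl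

        Θ : ℤ → ℕ → GL.PS
        Θ i k = GL.poch (GL.q SL.^ 1) k SL.* SL.∏ k (Tr.factor i)

        theta : ∀ i k → IsTheta k (λ j → zp (i ℤ.* j)) (expo 0 1) (Θ i k)
        theta i k n l = L.trans (Tr.triple i k n l) (SyL.∑±-cong k (λ j → GL.at (SL.*-congʳ {GL.q SL.^ expo 0 1 j} (C.cong (weight≈ i j))) n))

        module R = Triple L (z L.^ 5) (z⁻¹ L.^ 5) (L.trans (L.sym (L.^-distrib-* z z⁻¹ 5)) (L.trans (L.^-congˡ 5 zz⁻¹) (L.solve 0 (Κ 1ℤ ⊛ 5 L.⊜ Κ 1ℤ) L.refl))) 0 4

        R-weight : ∀ j → R.weight j L.≈ pow (+ 5 ℤ.* j)
        R-weight (+ n) = L.trans (L.^-assocʳ z 5 n) (L.reflexive (≡.cong pow (ℤP.pos-* 5 n)))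
        R-weight -[1+ n ] = L.^-assocʳ z⁻¹ 5 (suc n)

        η : GL.PS
        η = GL.C emb.⟦ ζ ⟧

        Cemb-^ : ∀ j → GL.C emb.⟦ ζ K.^ j ⟧ SL.≈ η SL.^ j
        Cemb-^ j = SL.trans (C.cong (emb.^-hom ζ j)) (C.^-hom emb.⟦ ζ ⟧ j)

        Cemb : ∀ i j → zp i K.≈ ζ K.^ j → ∀ w x y → GL.C (emb.⟦ zp i ⟧ L.* w) SL.* x SL.* y SL.≈ η SL.^ j SL.* (GL.C w SL.* x SL.* y)
        Cemb i j e w x y = SL.trans (SL.*-congʳ {y} (SL.*-congʳ {x} (SL.trans (C.*-hom _ _) (SL.*-congʳ {GL.C w} (SL.trans (C.cong (emb.cong e)) (Cemb-^ j))))))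
          (SL.solve 4 (λ h w x y → (h ⊗ w) ⊗ x ⊗ y SL.⊜ h ⊗ (w ⊗ x ⊗ y)) SL.refl (η SL.^ j) (GL.C w) x y)

        η-sum : SL.1# SL.+ η SL.+ η SL.^ 2 SL.+ η SL.^ 3 SL.+ η SL.^ 4 SL.≈ SL.0#
        η-sum = SL.trans (SL.sym (SL.trans (h+ _ _) (SL.+-cong (SL.trans (h+ _ _) (SL.+-cong (SL.trans (h+ _ _) (SL.+-cong (SL.trans (h+ _ _) (SL.+-congʳ {η} (SL.trans (C.cong emb.1-hom) C.1-hom))) (Cemb-^ 2))) (Cemb-^ 3))) (Cemb-^ 4))))
          (SL.trans (C.cong (L.trans (emb.cong ζ-sum) emb.0-hom)) C.0-hom)
          where h+ : ∀ a b → GL.C emb.⟦ a K.+ b ⟧ SL.≈ GL.C emb.⟦ a ⟧ SL.+ GL.C emb.⟦ b ⟧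
                h+ a b = SL.trans (C.cong (emb.+-hom a b)) (C.+-hom _ _)

        roots-product : ∀ x → (SL.1# SL.+ η SL.^ 0 SL.* x) SL.* ((SL.1# SL.+ η SL.^ 1 SL.* x) SL.* ((SL.1# SL.+ η SL.^ 2 SL.* x) SL.* ((SL.1# SL.+ η SL.^ 3 SL.* x) SL.* (SL.1# SL.+ η SL.^ 4 SL.* x)))) SL.≈ SL.1# SL.+ x SL.^ 5
        roots-product x = SL.trans (SL.solve 2 (λ h x → (Κ 1ℤ ⊕ h ⊛ 0 ⊗ x) ⊗ ((Κ 1ℤ ⊕ h ⊛ 1 ⊗ x) ⊗ ((Κ 1ℤ ⊕ h ⊛ 2 ⊗ x) ⊗ ((Κ 1ℤ ⊕ h ⊛ 3 ⊗ x) ⊗ (Κ 1ℤ ⊕ h ⊛ 4 ⊗ x)))) SL.⊜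
            (Κ 1ℤ SL.⊖ ⊝ x) ⊗ (Κ 1ℤ SL.⊖ h ⊗ ⊝ x) ⊗ (Κ 1ℤ SL.⊖ h ⊛ 2 ⊗ ⊝ x) ⊗ (Κ 1ℤ SL.⊖ h ⊛ 3 ⊗ ⊝ x) ⊗ (Κ 1ℤ SL.⊖ h ⊛ 4 ⊗ ⊝ x)) SL.refl η x)
          (SL.trans (RootsOfUnity.∏-roots GL.ring η (SL.- x) η-sum) (SL.solve 1 (λ x → Κ 1ℤ SL.⊖ (⊝ x) ⊛ 5 SL.⊜ Κ 1ℤ ⊕ x ⊛ 5) SL.refl x))

        ζ-powers : zp -[1+ 1 ] K.≈ ζ K.^ 3 × zp -[1+ 0 ] K.≈ ζ K.^ 4
        ζ-powers = K.trans (K.solve 1 (λ z → (z ⊛ 4) ⊛ 2 K.⊜ z ⊛ 5 ⊗ z ⊛ 3) K.refl ζ) (K.trans (K.*-congʳ ζ⁵) (K.*-identityˡ _)) , K.refl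

        -- Since the product of 1 + ζ^j x over j is 1 + x^5, the five factors for ζ^i z combine into
        -- the factor of a triple product in z^5 and q^5.
        factors : ∀ κ → Tr.factor -[1+ 1 ] κ SL.* (Tr.factor -[1+ 0 ] κ SL.* (Tr.factor 0ℤ κ SL.* (Tr.factor (+ 1) κ SL.* Tr.factor (+ 2) κ))) SL.≈ R.factor κ
        factors κ = begin
          Tr.factor -[1+ 1 ] κ SL.* (Tr.factor -[1+ 0 ] κ SL.* (Tr.factor 0ℤ κ SL.* (Tr.factor (+ 1) κ SL.* Tr.factor (+ 2) κ)))
            ≈⟨ SL.*-cong (f -[1+ 1 ] 3 2 z³ K.refl) (SL.*-cong (f -[1+ 0 ] 4 1 z⁴ K.refl) (SL.*-cong (f 0ℤ 0 0 K.refl K.refl) (SL.*-cong (f (+ 1) 1 4 K.refl z⁴) (f (+ 2) 2 3 K.refl z³)))) ⟩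
          g 3 2 SL.* (g 4 1 SL.* (g 0 0 SL.* (g 1 4 SL.* g 2 3)))
            ≈⟨ SL.solve 10 (λ a₀ a₁ a₂ a₃ a₄ b₀ b₁ b₂ b₃ b₄ → (a₃ ⊗ b₂) ⊗ ((a₄ ⊗ b₁) ⊗ ((a₀ ⊗ b₀) ⊗ ((a₁ ⊗ b₄) ⊗ (a₂ ⊗ b₃)))) SL.⊜ (a₀ ⊗ (a₁ ⊗ (a₂ ⊗ (a₃ ⊗ a₄)))) ⊗ (b₀ ⊗ (b₁ ⊗ (b₂ ⊗ (b₃ ⊗ b₄))))) SL.refl
                (h 0 Z) (h 1 Z) (h 2 Z) (h 3 Z) (h 4 Z) (h 0 Z′) (h 1 Z′) (h 2 Z′) (h 3 Z′) (h 4 Z′) ⟩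
          (h 0 Z SL.* (h 1 Z SL.* (h 2 Z SL.* (h 3 Z SL.* h 4 Z)))) SL.* (h 0 Z′ SL.* (h 1 Z′ SL.* (h 2 Z′ SL.* (h 3 Z′ SL.* h 4 Z′))))
            ≈⟨ SL.*-cong (roots-product Z) (roots-product Z′) ⟩
          (SL.1# SL.+ Z SL.^ 5) SL.* (SL.1# SL.+ Z′ SL.^ 5)
            ≈⟨ SL.*-cong (SL.+-congˡ {SL.1#} (fifth z 0)) (SL.+-congˡ {SL.1#} (fifth z⁻¹ 1)) ⟩
          R.factor κ ∎
          where
          open SL.Rsn
          z³ = proj₁ ζ-powers
          z⁴ = proj₂ ζ-powers
          Z = GL.C z SL.* GL.q SL.^ 0 SL.* (GL.q SL.^ 1) SL.^ κ
          Z′ = GL.C z⁻¹ SL.* GL.q SL.^ 1 SL.* (GL.q SL.^ 1) SL.^ κ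
          h : ℕ → GL.PS → GL.PS
          h j x = SL.1# SL.+ η SL.^ j SL.* x
          g : ℕ → ℕ → GL.PS
          g i j = h i Z SL.* h j Z′
          f : ∀ i j j′ → zp i K.≈ ζ K.^ j → zp (ℤ.- i) K.≈ ζ K.^ j′ → Tr.factor i κ SL.≈ g j j′
          f i j j′ e e′ = SL.*-cong (SL.+-congˡ {SL.1#} (Cemb i j e z (GL.q SL.^ 0) ((GL.q SL.^ 1) SL.^ κ))) (SL.+-congˡ {SL.1#} (Cemb (ℤ.- i) j′ e′ z⁻¹ (GL.q SL.^ 1) ((GL.q SL.^ 1) SL.^ κ)))
          fifth : ∀ w c → (GL.C w SL.* GL.q SL.^ c SL.* (GL.q SL.^ 1) SL.^ κ) SL.^ 5 SL.≈ GL.C (w L.^ 5) SL.* GL.q SL.^ (c ℕ.* 5) SL.* (GL.q SL.^ 5) SL.^ κ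
          fifth w c = SL.trans (SL.solve 3 (λ a b c → (a ⊗ b ⊗ c) ⊛ 5 SL.⊜ a ⊛ 5 ⊗ b ⊛ 5 ⊗ c ⊛ 5) SL.refl (GL.C w) (GL.q SL.^ c) (GL.q SL.^ κ))
            (SL.*-cong (SL.*-cong (SL.sym (C.^-hom w 5)) (SL.^-assocʳ GL.q c 5)) (SL.trans (SL.^-assocʳ GL.q κ 5) (SL.trans (SL.≡⇒≈ (≡.cong (GL.q SL.^_) (ℕP.*-comm κ 5))) (SL.sym (SL.^-assocʳ GL.q 5 κ)))))

        product : ℕ → GL.PS
        product k = Θ -[1+ 1 ] k SL.* (Θ -[1+ 0 ] k SL.* (Θ 0ℤ k SL.* (Θ (+ 1) k SL.* Θ (+ 2) k)))

        5j≢0 : ∀ j → ¬ j ≡ 0ℤ → ¬ + 5 ℤ.* j ≡ 0ℤ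
        5j≢0 j n e = n (ℤP.*-cancelˡ-≡ (+ 5) j 0ℤ (≡.trans e (≡.sym (ℤP.*-zeroʳ (+ 5)))))

        -- The factor `poch (q ^ 5)` completes the product in z^5 to a theta series, whose constant
        -- term in z is 1; the five copies of `poch q` remain.
        CT-product : ∀ k → (GK.poch (GK.q SK.^ 5) k SK.* CT (product k)) ≈[ k ] (GK.poch GK.q k SK.^ 5)
        CT-product k = compare k (GK.poch (GK.q SK.^ 5) k) (GK.poch GK.q k SK.^ 5) (product k) (λ n → SyL.∑± k (λ j → R.term j n))
          (GL.[]-trans (GL.≋⇒≈[] (SL.trans (SL.*-cong (map-poch 5 k) (SL.trans (gather P (Tr.factor -[1+ 1 ]) (Tr.factor -[1+ 0 ]) (Tr.factor 0ℤ) (Tr.factor (+ 1)) (Tr.factor (+ 2)) k) (SL.*-congˡ {P SL.^ 5} (SL.∏-cong k factors))))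
              (SL.solve 3 (λ a b c → a ⊗ (b ⊗ c) SL.⊜ b ⊗ (a ⊗ c)) SL.refl (GL.poch (GL.q SL.^ 5) k) (P SL.^ 5) (SL.∏ k R.factor))))
            (GL.[]-* (GL.≋⇒≈[] (SL.sym (SL.trans (m.^-hom (GK.poch GK.q k) 5) (SL.^-congˡ 5 (map-poch 1 k))))) (R.triple k)))
          (CT-theta k R.weight (expo 0 5) ≡.refl L.refl (λ j n → K.trans (ct-cong (R-weight j)) (ct-pow (+ 5 ℤ.* j) (5j≢0 j n))))
          where P = GL.poch (GL.q SL.^ 1) k

      -- Replacing z by ζ^i z in the i-th theta series, i = -2, ..., 2, weights v by ζ^(moment v);
      -- for total 0 the exponents j(j-1)/2 add up to half the square norm.
      roots-series : ∀ k → (GK.poch (GK.q SK.^ 5) k SK.* (λ n → K.sumL (roots k n) (λ v → zp (moment v)))) ≈[ k ] (GK.poch GK.q k SK.^ 5)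
      roots-series k = GK.[]-trans (GK.[]-* (GK.[]-refl {f = GK.poch (GK.q SK.^ 5) k}) (λ n l → K.sym (five-theta k (w -[1+ 1 ]) (w -[1+ 0 ]) (w 0ℤ) (w (+ 1)) (w (+ 2)) (expo 0 1) (expo 0 1) (expo 0 1) (expo 0 1) (expo 0 1) (Θ -[1+ 1 ] k) (Θ -[1+ 0 ] k) (Θ 0ℤ k) (Θ (+ 1) k) (Θ (+ 2) k)
          (theta -[1+ 1 ] k) (theta -[1+ 0 ] k) (theta 0ℤ k) (theta (+ 1) k) (theta (+ 2) k) n l (root? n) (λ v → zp (moment v)) (to n) (from n)))) (CT-product k)
        where
        w : ℤ → ℤ → K.Carrier
        w i j = zp (i ℤ.* j)
        2deg : ∀ a b c d e → + 2 ℤ.* + (expo 0 1 a ℕ.+ (expo 0 1 b ℕ.+ (expo 0 1 c ℕ.+ (expo 0 1 d ℕ.+ expo 0 1 e)))) ≡ norm² (a , b , c , d , e) ℤ.- total (a , b , c , d , e)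
        2deg a b c d e = ≡.trans (2*sum (expo 0 1 a) (expo 0 1 b) (expo 0 1 c) (expo 0 1 d) (expo 0 1 e)) (≡.trans (cong₅ (2expo 0 1 a) (2expo 0 1 b) (2expo 0 1 c) (2expo 0 1 d) (2expo 0 1 e))
          (ℤR.solve 5 (λ a b c d e → let f : Expr ℤ 5 → Expr ℤ 5 ; f = λ x → Κ (+ 1) ⊗ (x ⊗ x) ⊕ Κ -[1+ 0 ] ⊗ x ; v = a , b , c , d , e in f a ⊕ (f b ⊕ (f c ⊕ (f d ⊕ f e))) ℤR.⊜ Syntax.norm² v ℤR.⊖ Syntax.total v) ≡.refl a b c d e))
        deg : ℤ⁵ → ℕ
        deg (a , b , c , d , e) = expo 0 1 a ℕ.+ (expo 0 1 b ℕ.+ (expo 0 1 c ℕ.+ (expo 0 1 d ℕ.+ expo 0 1 e)))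
        tot : ℤ⁵ → ℤ
        tot (a , b , c , d , e) = a ℤ.+ (b ℤ.+ (c ℤ.+ (d ℤ.+ e)))
        wt : ℤ⁵ → K.Carrier
        wt (a , b , c , d , e) = zp (-[1+ 1 ] ℤ.* a) K.* (zp (-[1+ 0 ] ℤ.* b) K.* (zp (0ℤ ℤ.* c) K.* (zp (+ 1 ℤ.* d) K.* zp (+ 2 ℤ.* e))))
        to : ∀ n v → Root n v → tot v ≡ 0ℤ × deg v ≡ n × wt v K.≈ zp (moment v)
        to n v@(a , b , c , d , e) (t , p) = ≡.trans (+-total a b c d e) t ,
          ℤP.+-injective (ℤP.*-cancelˡ-≡ (+ 2) _ _ (≡.trans (2deg a b c d e) (≡.trans (≡.cong₂ ℤ._-_ p t) (ℤP.+-identityʳ _)))) ,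
          K.trans (K.*-congˡ (K.trans (K.*-congˡ (K.trans (K.*-congˡ (K.sym (zp-+ d′ e′))) (K.sym (zp-+ c′ (d′ ℤ.+ e′))))) (K.sym (zp-+ b′ (c′ ℤ.+ (d′ ℤ.+ e′)))))) (K.trans (K.sym (zp-+ a′ (b′ ℤ.+ (c′ ℤ.+ (d′ ℤ.+ e′)))))
            (K.reflexive (≡.cong zp {x = a′ ℤ.+ (b′ ℤ.+ (c′ ℤ.+ (d′ ℤ.+ e′)))} {y = moment v} (ℤR.solve 5 (λ a b c d e → Κ -[1+ 1 ] ⊗ a ⊕ (Κ -[1+ 0 ] ⊗ b ⊕ (Κ 0ℤ ⊗ c ⊕ (Κ (+ 1) ⊗ d ⊕ Κ (+ 2) ⊗ e))) ℤR.⊜ Syntax.moment (a , b , c , d , e)) ≡.refl a b c d e))))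
          where a′ = -[1+ 1 ] ℤ.* a ; b′ = -[1+ 0 ] ℤ.* b ; c′ = 0ℤ ℤ.* c ; d′ = + 1 ℤ.* d ; e′ = + 2 ℤ.* e
        from : ∀ n v → tot v ≡ 0ℤ → deg v ≡ n → Root n v
        from n v@(a , b , c , d , e) t p = t′ , ≡.trans (≡.trans (ℤS.solve 1 (λ x → x ℤS.:= x ℤS.:- ℤS.con 0ℤ) ≡.refl (norm² v)) (≡.cong (λ t → norm² v ℤ.- t) (≡.sym t′))) (≡.trans (≡.sym (2deg a b c d e)) (≡.cong (λ n → + 2 ℤ.* + n) p))
          where t′ = ≡.trans (≡.sym (+-total a b c d e)) t

    private
      one-weight : ∀ j → emb.⟦ K.1# ⟧ L.* pow j L.≈ pow j
      one-weight j = L.trans (L.*-congʳ emb.1-hom) (L.*-identityˡ _)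

      module Tc (c d′ : ℕ) = Triple L z z⁻¹ zz⁻¹ c d′

      weight-pow : ∀ c d′ j → Tc.weight c d′ j ≡ pow j
      weight-pow c d′ (+ n) = ≡.refl
      weight-pow c d′ -[1+ n ] = ≡.refl

      Φ : ℕ → ℕ → ℕ → GL.PS
      Φ c d′ k = GL.poch (GL.q SL.^ (c ℕ.+ suc d′)) k SL.* SL.∏ k (Tc.factor c d′)

      theta′ : ∀ c d′ k → IsTheta k (λ _ → K.1#) (expo c (suc d′)) (Φ c d′ k)
      theta′ c d′ k n l = L.trans (Tc.triple c d′ k n l) (SyL.∑±-cong k (λ j → GL.at (SL.*-congʳ {GL.q SL.^ expo c (suc d′) j} (C.cong (L.trans (L.reflexive (weight-pow c d′ j)) (L.sym (one-weight j))))) n))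

      -- The residues modulo 5 of the exponents in the product for z and q interleave.
      interleave : ∀ k → SL.∏ k (λ i → Tc.factor 0 4 i SL.* (Tc.factor 1 3 i SL.* (Tc.factor 2 2 i SL.* (Tc.factor 3 1 i SL.* Tc.factor 4 0 i)))) SL.≈ SL.∏ (k ℕ.* 5) (Tc.factor 0 0)
      interleave zero = SL.refl
      interleave (suc k) = begin
        F SL.* (Tc.factor 0 4 k SL.* (Tc.factor 1 3 k SL.* (Tc.factor 2 2 k SL.* (Tc.factor 3 1 k SL.* Tc.factor 4 0 k))))
          ≈⟨ SL.*-cong (interleave k) (SL.*-cong (f 0 4) (SL.*-cong (f 1 3) (SL.*-cong (f 2 2) (SL.*-cong (f 3 1) (f 4 0))))) ⟩
        F′ SL.* ((a 0 SL.* b 4) SL.* ((a 1 SL.* b 3) SL.* ((a 2 SL.* b 2) SL.* ((a 3 SL.* b 1) SL.* (a 4 SL.* b 0)))))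
          ≈⟨ SL.solve 11 (λ F a₀ a₁ a₂ a₃ a₄ b₀ b₁ b₂ b₃ b₄ → F ⊗ ((a₀ ⊗ b₄) ⊗ ((a₁ ⊗ b₃) ⊗ ((a₂ ⊗ b₂) ⊗ ((a₃ ⊗ b₁) ⊗ (a₄ ⊗ b₀))))) SL.⊜ F ⊗ (a₀ ⊗ b₀) ⊗ (a₁ ⊗ b₁) ⊗ (a₂ ⊗ b₂) ⊗ (a₃ ⊗ b₃) ⊗ (a₄ ⊗ b₄)) SL.refl
               F′ (a 0) (a 1) (a 2) (a 3) (a 4) (b 0) (b 1) (b 2) (b 3) (b 4) ⟩
        F′ SL.* (a 0 SL.* b 0) SL.* (a 1 SL.* b 1) SL.* (a 2 SL.* b 2) SL.* (a 3 SL.* b 3) SL.* (a 4 SL.* b 4)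
          ≈⟨ SL.*-cong (SL.*-cong (SL.*-cong (SL.*-cong (SL.*-congˡ {F′} (g 0)) (g 1)) (g 2)) (g 3)) (g 4) ⟩
        SL.∏ (suc k ℕ.* 5) (Tc.factor 0 0) ∎
        where
        open SL.Rsn
        F = SL.∏ k (λ i → Tc.factor 0 4 i SL.* (Tc.factor 1 3 i SL.* (Tc.factor 2 2 i SL.* (Tc.factor 3 1 i SL.* Tc.factor 4 0 i))))
        F′ = SL.∏ (k ℕ.* 5) (Tc.factor 0 0)
        a b : ℕ → GL.PS
        a r = SL.1# SL.+ GL.C z SL.* GL.q SL.^ (r ℕ.+ k ℕ.* 5)
        b r = SL.1# SL.+ GL.C z⁻¹ SL.* GL.q SL.^ (suc r ℕ.+ k ℕ.* 5)
        term : ∀ w c i j n → c ℕ.+ i ℕ.* j ≡ n → SL.1# SL.+ GL.C w SL.* GL.q SL.^ c SL.* (GL.q SL.^ i) SL.^ j SL.≈ SL.1# SL.+ GL.C w SL.* GL.q SL.^ n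
        term w c i j n e = SL.+-congˡ {SL.1#} (SL.trans (SL.*-assoc (GL.C w) (GL.q SL.^ c) ((GL.q SL.^ i) SL.^ j)) (SL.*-congˡ {GL.C w} (SL.trans (SL.*-congˡ {GL.q SL.^ c} (SL.^-assocʳ GL.q i j)) (SL.trans (SL.sym (SL.^-homo-* GL.q c (i ℕ.* j))) (SL.≡⇒≈ (≡.cong (GL.q SL.^_) e))))))
        f : ∀ c d′ {_ : True (c ℕ.+ suc d′ ℕ.≟ 5)} → Tc.factor c d′ k SL.≈ a c SL.* b d′
        f c d′ {w} = SL.*-cong (term z c (c ℕ.+ suc d′) k _ (≡.cong (c ℕ.+_) e)) (term z⁻¹ (suc d′) (c ℕ.+ suc d′) k _ (≡.cong (suc d′ ℕ.+_) e))
          where e : (c ℕ.+ suc d′) ℕ.* k ≡ k ℕ.* 5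
                e = ≡.trans (≡.cong (ℕ._* k) (toWitness w)) (ℕP.*-comm 5 k)
        g : ∀ r → a r SL.* b r SL.≈ Tc.factor 0 0 (r ℕ.+ k ℕ.* 5)
        g r = SL.sym (SL.*-cong (term z 0 1 (r ℕ.+ k ℕ.* 5) _ (ℕP.+-identityʳ _)) (term z⁻¹ 1 1 (r ℕ.+ k ℕ.* 5) _ (≡.cong suc (ℕP.+-identityʳ _))))

      product′ : ℕ → GL.PS
      product′ k = Φ 0 4 k SL.* (Φ 1 3 k SL.* (Φ 2 2 k SL.* (Φ 3 1 k SL.* Φ 4 0 k)))

      -- After `interleave` only `poch q` is missing for a single theta series in z and q, whose
      -- constant term is 1.
      CT-product′ : ∀ k → (GK.poch GK.q (k ℕ.* 5) SK.* CT (product′ k)) ≈[ k ] (GK.poch (GK.q SK.^ 5) k SK.^ 5)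
      CT-product′ k = compare k (GK.poch GK.q (k ℕ.* 5)) (GK.poch (GK.q SK.^ 5) k SK.^ 5) (product′ k) (λ n → SyL.∑± (k ℕ.* 5) (λ j → Tc.term 0 0 j n))
        (GL.[]-trans (GL.≋⇒≈[] (SL.trans (SL.*-cong (map-poch 1 (k ℕ.* 5)) (SL.trans (gather P (Tc.factor 0 4) (Tc.factor 1 3) (Tc.factor 2 2) (Tc.factor 3 1) (Tc.factor 4 0) k) (SL.*-congˡ {P SL.^ 5} (interleave k))))
            (SL.solve 3 (λ a b c → a ⊗ (b ⊗ c) SL.⊜ b ⊗ (a ⊗ c)) SL.refl (GL.poch (GL.q SL.^ 1) (k ℕ.* 5)) (P SL.^ 5) (SL.∏ (k ℕ.* 5) (Tc.factor 0 0)))))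
          (GL.[]-* (GL.≋⇒≈[] (SL.sym (SL.trans (m.^-hom (GK.poch (GK.q SK.^ 5) k) 5) (SL.^-congˡ 5 (map-poch 5 k))))) (GL.≈[]-weaken (ℕP.m≤m*n k 5) (Tc.triple 0 0 (k ℕ.* 5)))))
        (CT-theta (k ℕ.* 5) (Tc.weight 0 0) (expo 0 1) ≡.refl L.refl (λ j n → K.trans (ct-cong (L.reflexive (weight-pow 0 0 j))) (ct-pow j n)))
        where P = GL.poch (GL.q SL.^ 5) k

    -- The exponents `expo c (5 - c)` for c = 0, ..., 4 are (5j² + (2c-5)j)/2. For total 0 their sum
    -- is half of 5 norm² + 2 moment, as in `Coset`.
    cosets-series : ∀ k → (GK.poch GK.q (k ℕ.* 5) SK.* (λ n → K.sumL (cosets k n) (λ _ → K.1#))) ≈[ k ] (GK.poch (GK.q SK.^ 5) k SK.^ 5)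
    cosets-series k = GK.[]-trans (GK.[]-* (GK.[]-refl {f = GK.poch GK.q (k ℕ.* 5)}) (λ n l → K.sym (five-theta k W W W W W (expo 0 5) (expo 1 4) (expo 2 3) (expo 3 2) (expo 4 1) (Φ 0 4 k) (Φ 1 3 k) (Φ 2 2 k) (Φ 3 1 k) (Φ 4 0 k)
        (theta′ 0 4 k) (theta′ 1 3 k) (theta′ 2 2 k) (theta′ 3 1 k) (theta′ 4 0 k) n l (coset? n) (λ _ → K.1#) (to n) (from n)))) (CT-product′ k)
      where
      W : ℤ → K.Carrier
      W _ = K.1#
      deg : ℤ⁵ → ℕ
      deg (a , b , c , d , e) = expo 0 5 a ℕ.+ (expo 1 4 b ℕ.+ (expo 2 3 c ℕ.+ (expo 3 2 d ℕ.+ expo 4 1 e)))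
      tot : ℤ⁵ → ℤ
      tot (a , b , c , d , e) = a ℤ.+ (b ℤ.+ (c ℤ.+ (d ℤ.+ e)))
      2deg : ∀ v → + 2 ℤ.* + deg v ≡ (+ 5 ℤ.* norm² v ℤ.+ + 2 ℤ.* moment v) ℤ.- total v
      2deg (a , b , c , d , e) = ≡.trans (2*sum (expo 0 5 a) (expo 1 4 b) (expo 2 3 c) (expo 3 2 d) (expo 4 1 e)) (≡.trans (cong₅ (2expo 0 5 a) (2expo 1 4 b) (2expo 2 3 c) (2expo 3 2 d) (2expo 4 1 e))
        (ℤR.solve 5 (λ a b c d e → let v = a , b , c , d , e in (Κ (+ 5) ⊗ (a ⊗ a) ⊕ Κ -[1+ 4 ] ⊗ a) ⊕ ((Κ (+ 5) ⊗ (b ⊗ b) ⊕ Κ -[1+ 2 ] ⊗ b) ⊕ ((Κ (+ 5) ⊗ (c ⊗ c) ⊕ Κ -[1+ 0 ] ⊗ c) ⊕ ((Κ (+ 5) ⊗ (d ⊗ d) ⊕ Κ (+ 1) ⊗ d) ⊕ (Κ (+ 5) ⊗ (e ⊗ e) ⊕ Κ (+ 3) ⊗ e))))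
          ℤR.⊜ (Κ (+ 5) ⊗ Syntax.norm² v ⊕ Κ (+ 2) ⊗ Syntax.moment v) ℤR.⊖ Syntax.total v) ≡.refl a b c d e))
      to : ∀ n v → Coset n v → tot v ≡ 0ℤ × deg v ≡ n × K.1# K.* (K.1# K.* (K.1# K.* (K.1# K.* K.1#))) K.≈ K.1#
      to n v@(a , b , c , d , e) (t , p) = ≡.trans (+-total a b c d e) t ,
        ℤP.+-injective (ℤP.*-cancelˡ-≡ (+ 2) _ _ (≡.trans (2deg v) (≡.trans (≡.cong₂ ℤ._-_ p t) (ℤP.+-identityʳ _)))) ,
        K.solve 0 (Κ 1ℤ ⊗ (Κ 1ℤ ⊗ (Κ 1ℤ ⊗ (Κ 1ℤ ⊗ Κ 1ℤ))) K.⊜ Κ 1ℤ) K.refl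
      from : ∀ n v → tot v ≡ 0ℤ → deg v ≡ n → Coset n v
      from n v@(a , b , c , d , e) t p = t′ , ≡.trans (≡.trans (ℤS.solve 1 (λ x → x ℤS.:= x ℤS.:- ℤS.con 0ℤ) ≡.refl (+ 5 ℤ.* norm² v ℤ.+ + 2 ℤ.* moment v)) (≡.cong (λ t → (+ 5 ℤ.* norm² v ℤ.+ + 2 ℤ.* moment v) ℤ.- t) (≡.sym t′))) (≡.trans (≡.sym (2deg v)) (≡.cong (λ n → + 2 ℤ.* + n) p))
        where t′ = ≡.trans (≡.sym (+-total a b c d e)) t

-- The partition generating function

-- The filter local to prodInv cannot be named; the sums over its values are recovered by unification,
-- as selected k n js = Σ prodInv k (n - (k+1)j) over the j in js with (k+1)j ≤ n.
mutual
  unfolded : ℕ → ℕ → List ℕ → ℕ → ℕ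
  unfolded = _

  prodInv≡unfolded : ∀ k n → prodInv (suc k) n ≡ unfolded k n (List.applyUpTo suc n) (k ℕ.* 0)
  prodInv≡unfolded k n with List.applyUpTo suc n | k ℕ.* 0
  ... | js | x = ≡.refl

mutual
  selected : ℕ → ℕ → List ℕ → ℕ
  selected = _

  unfolded≡selected : ∀ k n js → unfolded k n js 0 ≡ prodInv k (n ∸ suc k ℕ.* 0) ℕ.+ selected k n js
  unfolded≡selected k n js = ≡.refl

mutual
  -- The inner conditional with the comparison of x and m still pending, also recovered by
  -- unification; `compared-suc` displays its clauses, so that the goals below reduce far enough to
  -- determine it.
  compared : ℕ → ℕ → ℕ → ℕ → ℕ → List ℕ → ℕ
  compared = _

  compared-suc : ℕ → ℕ → ℕ → ℕ → ℕ → List ℕ → ℕ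
  compared-suc k n zero _ j js = prodInv k (n ∸ suc k ℕ.* j) ℕ.+ selected k n js
  compared-suc k n (suc _) zero j js = selected k n js
  compared-suc k n (suc x) (suc m) j js = compared k n x m j js

  selected-compared : ∀ k n j js → prodInv k (n ∸ suc k ℕ.* 0) ℕ.+ selected k n (j ∷ js) ≡ prodInv k (n ∸ suc k ℕ.* 0) ℕ.+ compared-suc k n (suc k ℕ.* j) n j js
  selected-compared k n j js with j ℕ.+ k ℕ.* j
  selected-compared k n j js | zero = ≡.refl
  selected-compared k zero j js | suc x = ≡.refl
  selected-compared k (suc n) j js | suc x with suc n
  ... | N = ≡.refl

compared-≤ : ∀ k n x m j js → x ≤ m → compared k n x m j js ≡ prodInv k (n ∸ suc k ℕ.* j) ℕ.+ selected k n js
compared-≤ k n zero m j js _ = ≡.refl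
compared-≤ k n (suc x) (suc m) j js (s≤s l) = compared-≤ k n x m j js l

compared-> : ∀ k n x m j js → m < x → compared k n x m j js ≡ selected k n js
compared-> k n (suc x) zero j js _ = ≡.refl
compared-> k n (suc x) (suc m) j js (s≤s l) = compared-> k n x m j js l

compared-suc≡compared : ∀ k n x m j js → compared-suc k n x m j js ≡ compared k n x m j js
compared-suc≡compared k n zero m j js = ≡.refl
compared-suc≡compared k n (suc x) zero j js = ≡.refl
compared-suc≡compared k n (suc x) (suc m) j js = ≡.refl

selected-∷ : ∀ k n j js → selected k n (j ∷ js) ≡ compared k n (suc k ℕ.* j) n j js
selected-∷ k n j js = ≡.trans (ℕP.+-cancelˡ-≡ (prodInv k (n ∸ suc k ℕ.* 0)) _ _ (selected-compared k n j js)) (compared-suc≡compared k n (suc k ℕ.* j) n j js)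

selected-none : ∀ k n M (h : ℕ → ℕ) → (∀ i → n < suc k ℕ.* h i) → selected k n (List.applyUpTo h M) ≡ 0
selected-none k n zero h l = ≡.refl
selected-none k n (suc M) h l = ≡.trans (selected-∷ k n (h 0) (List.applyUpTo (h ∘ suc) M)) (≡.trans (compared-> k n (suc k ℕ.* h 0) n (h 0) (List.applyUpTo (h ∘ suc) M) (l 0)) (selected-none k n M (h ∘ suc) (l ∘ suc)))

-- Replacing n by n + (k+1) and every j by j + 1 changes nothing; surplus j contribute nothing.
selected-shift : ∀ k n M N (h : ℕ → ℕ) → (∀ i → n < suc k ℕ.* h (M ℕ.+ i)) → M ≤ N →
  selected k (suc k ℕ.+ n) (List.applyUpTo (suc ∘ h) N) ≡ selected k n (List.applyUpTo h M)
selected-shift k n zero N h l _ = selected-none k (suc k ℕ.+ n) N (suc ∘ h) (λ i → ≡.subst (suc k ℕ.+ n <_) (≡.sym (ℕP.*-suc (suc k) (h i))) (ℕP.+-monoʳ-< (suc k) (l i)))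
selected-shift k n (suc M) (suc N) h l (s≤s M≤N) = go (suc k ℕ.* h 0 ℕP.≤? n)
  where
  c = suc k
  js = List.applyUpTo (h ∘ suc) M
  js′ = List.applyUpTo (suc ∘ h ∘ suc) N
  c* : c ℕ.* suc (h 0) ≡ c ℕ.+ c ℕ.* h 0
  c* = ℕP.*-suc c (h 0)
  rest : selected k (c ℕ.+ n) js′ ≡ selected k n js
  rest = selected-shift k n M N (h ∘ suc) l M≤N
  go : Dec (c ℕ.* h 0 ≤ n) → selected k (c ℕ.+ n) (suc (h 0) ∷ js′) ≡ selected k n (h 0 ∷ js)
  go (yes p) = ≡.trans (≡.trans (selected-∷ k (c ℕ.+ n) (suc (h 0)) js′) (compared-≤ k (c ℕ.+ n) (c ℕ.* suc (h 0)) (c ℕ.+ n) (suc (h 0)) js′ (≡.subst (_≤ c ℕ.+ n) (≡.sym c*) (ℕP.+-monoʳ-≤ c p))))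
    (≡.trans (≡.cong₂ ℕ._+_ (≡.cong (prodInv k) (≡.trans (≡.cong (c ℕ.+ n ∸_) c*) (ℕP.[m+n]∸[m+o]≡n∸o c n _))) rest)
      (≡.sym (≡.trans (selected-∷ k n (h 0) js) (compared-≤ k n (c ℕ.* h 0) n (h 0) js p))))
  go (no ¬p) = ≡.trans (≡.trans (selected-∷ k (c ℕ.+ n) (suc (h 0)) js′) (compared-> k (c ℕ.+ n) (c ℕ.* suc (h 0)) (c ℕ.+ n) (suc (h 0)) js′ (≡.subst (c ℕ.+ n <_) (≡.sym c*) (ℕP.+-monoʳ-< c (ℕP.≰⇒> ¬p)))))
    (≡.trans rest (≡.sym (≡.trans (selected-∷ k n (h 0) js) (compared-> k n (c ℕ.* h 0) n (h 0) js (ℕP.≰⇒> ¬p)))))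

prodInv-selected : ∀ k n → prodInv (suc k) n ≡ prodInv k n ℕ.+ selected k n (List.applyUpTo suc n)
prodInv-selected k n = ≡.trans (prodInv≡unfolded k n) (≡.trans (≡.cong (unfolded k n (List.applyUpTo suc n)) (ℕP.*-zeroʳ k))
  (≡.cong (λ i → prodInv k (n ∸ i) ℕ.+ selected k n (List.applyUpTo suc n)) (ℕP.*-zeroʳ k)))

prodInv-< : ∀ k n → n < suc k → prodInv (suc k) n ≡ prodInv k n
prodInv-< k n l = ≡.trans (prodInv-selected k n) (≡.trans (≡.cong (prodInv k n ℕ.+_) (selected-none k n n suc (λ i → ℕP.<-≤-trans l (ℕP.m≤m*n (suc k) (suc i))))) (ℕP.+-identityʳ _))

-- A partition into parts of size at most k + 1 either has no part k + 1 or becomes smaller by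
-- removing one. As a series this is (1 - q^(k+1)) P(k+1) = P(k).
prodInv-+ : ∀ k n → prodInv (suc k) (suc k ℕ.+ n) ≡ prodInv k (suc k ℕ.+ n) ℕ.+ prodInv (suc k) n
prodInv-+ k n = ≡.trans (prodInv-selected k (suc k ℕ.+ n)) (≡.cong (prodInv k (suc k ℕ.+ n) ℕ.+_)
  (≡.trans (selected-shift k n (suc n) (suc k ℕ.+ n) id (λ i → ℕP.<-≤-trans (s≤s (ℕP.m≤m+n n i)) (ℕP.m≤n*m (suc n ℕ.+ i) (suc k))) (s≤s (ℕP.m≤n+m n k)))
    (≡.trans (selected-∷ k n 0 js) (≡.trans (compared-≤ k n (k ℕ.* 0) n 0 js (≡.subst (_≤ n) (≡.sym (ℕP.*-zeroʳ k)) z≤n)) (≡.trans (≡.cong (λ i → prodInv k (n ∸ i) ℕ.+ selected k n js) (ℕP.*-zeroʳ k)) (≡.sym (prodInv-selected k n)))))))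
  where js = List.applyUpTo suc n

module Partitions (A : CommutativeRing 0ℓ 0ℓ) where
  private module A = Ring A
  open Gauss A
  open S using (_*_; _+_; _-_; -_; 0#; 1#; _^_)
  open Eta A

  series : (ℕ → ℕ) → PS
  series f n = A.ι (+ f n)

  private
    P : ℕ → PS
    P k = series (prodInv k)

    P-step : ∀ k → P (suc k) ≋ P k + q ^ suc k * P (suc k)
    P-step k = mk λ n → go n (n ℕP.<? suc k)
      where
      go : ∀ n → Dec (n < suc k) → P (suc k) n A.≈ P k n A.+ (q ^ suc k * P (suc k)) n
      go n (yes l) = A.trans (A.reflexive (≡.cong (λ i → A.ι (+ i)) (prodInv-< k n l))) (A.sym (A.trans (A.+-congˡ (q^*-< (suc k) (P (suc k)) n l)) (A.+-identityʳ _)))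
      go n (no g) = ≡.subst (λ n → P (suc k) n A.≈ P k n A.+ (q ^ suc k * P (suc k)) n) (ℕP.m+[n∸m]≡n (ℕP.≮⇒≥ g)) (add (n ∸ suc k))
        where add : ∀ n → P (suc k) (suc k ℕ.+ n) A.≈ P k (suc k ℕ.+ n) A.+ (q ^ suc k * P (suc k)) (suc k ℕ.+ n)
              add n = A.trans (A.reflexive (≡.cong (λ i → A.ι (+ i)) (prodInv-+ k n))) (A.trans (A.ι-+ (+ prodInv k (suc k ℕ.+ n)) (+ prodInv (suc k) n)) (A.+-congˡ (A.sym (q^*-+ (suc k) (P (suc k)) n))))

    P-zero : P 0 ≋ 1#
    P-zero = mk λ { zero → A.refl ; (suc n) → A.refl }

    poch-P : ∀ k → poch q k * P k ≋ 1#
    poch-P zero = S.trans (S.*-identityˡ (P 0)) P-zero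
    poch-P (suc k) = S.trans (S.solve 3 (λ p x b → p ⊗ (Κ 1ℤ S.⊖ x) ⊗ b S.⊜ p ⊗ (b S.⊖ x ⊗ b)) S.refl (poch q k) (q ^ suc k) (P (suc k)))
      (S.trans (S.*-congˡ {poch q k} (S.trans (S.+-congʳ (P-step k)) (S.solve 2 (λ a b → a ⊕ b S.⊖ b S.⊜ a) S.refl (P k) (q ^ suc k * P (suc k))))) (poch-P k))

    stable : ∀ n k → prodInv (k ℕ.+ n) n ≡ prodInv n n
    stable n zero = ≡.refl
    stable n (suc k) = ≡.trans (prodInv-< (k ℕ.+ n) n (s≤s (ℕP.m≤n+m n k))) (stable n k)

  p : PS
  p = series partitions

  eta-p : eta * p ≋ 1#
  eta-p = ≈[]⇒≋ λ N → []-trans ([]-* (≈[]-weaken (ℕP.n≤1+n N) (eta-poch N)) (near N)) (≋⇒≈[] (poch-P N))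
    where near : ∀ N → p ≈[ N ] P N
          near N n l = A.reflexive (≡.cong (λ i → A.ι (+ i)) (≡.trans (≡.sym (stable n (N ∸ n))) (≡.cong (λ k → prodInv k n) (ℕP.m∸n+n≡m (ℕP.<⇒≤ l)))))

-- The coefficients of the theta series as counts of lattice vectors

module ThetaCount (R : CommutativeRing 0ℓ 0ℓ) where
  open Ring R
  open ListSums R
  open Rsn

  sumL-concatMap : ∀ {X Y : Set} (f : X → List Y) (l : List X) (F : Y → Carrier) → sumL (concatMap f l) F ≈ sumL l (λ x → sumL (f x) F)
  sumL-concatMap f [] F = refl
  sumL-concatMap f (x ∷ l) F = trans (sumL-++ (f x) (concatMap f l) F) (+-congˡ (sumL-concatMap f l F))

  indicator : Bool → Carrier
  indicator b = if b then 1# else 0#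

  ι-length-filter : ∀ l → ι (+ length (filterᵇ (λ b → b) l)) ≈ sumL l indicator
  ι-length-filter [] = refl
  ι-length-filter (false ∷ l) = trans (ι-length-filter l) (sym (+-identityˡ _))
  ι-length-filter (true ∷ l) = trans (ι-+ (+ 1) (+ length (filterᵇ (λ b → b) l))) (+-congˡ (ι-length-filter l))

  ℤ⁴ : Set
  ℤ⁴ = ℤ × ℤ × ℤ × ℤ

  private
    box : ℕ → List ℤ⁴
    box m = cartesianProduct (range m) (cartesianProduct (range m) (cartesianProduct (range m) (range m)))

    value : ℤ⁴ → ℤ
    value (a , b , c , d) = Defs.Q a b c d

    solutions : ℕ → List ℤ⁴
    solutions n = filter (λ v → value v ℤ.≟ + n) (box (2 ℕ.* n))

    eqℤ⇒≡ : ∀ i j → T (eqℤ i j) → i ≡ j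
    eqℤ⇒≡ (+ m) (+ n) t = ≡.cong +_ (ℕP.≡ᵇ⇒≡ m n t)
    eqℤ⇒≡ -[1+ m ] -[1+ n ] t = ≡.cong -[1+_] (ℕP.≡ᵇ⇒≡ m n t)

    ≡⇒eqℤ : ∀ i → T (eqℤ i i)
    ≡⇒eqℤ (+ m) = ℕP.≡⇒≡ᵇ m m ≡.refl
    ≡⇒eqℤ -[1+ m ] = ℕP.≡⇒≡ᵇ m m ≡.refl

    indicator-yes : ∀ {b} → T b → indicator b ≈ 1#
    indicator-yes {true} _ = refl

    indicator-no : ∀ {b} → ¬ T b → indicator b ≈ 0#
    indicator-no {true} h = ⊥-elim (h tt)
    indicator-no {false} _ = refl

    -- The fifth coordinate -(a+b+c+d) places the point in A₄, where the square norm is twice the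
    -- quadratic form.
    solutions-roots : ∀ {m n} → 2 ℕ.* n ≤ m → Matching (solutions n) (roots m n)
    solutions-roots {m} {n} l = record
      { to = to
      ; from = from
      ; to-∈ = λ {v} p → roots-∈ {m} {n} {to v} (≡.subst (_≤ m) (≡.cong (n ℕ.+_) (ℕP.+-identityʳ n)) l)
          (total-to v , ≡.trans (norm-to v) (≡.cong (+ 2 ℤ.*_) (proj₂ (∈P.∈-filter⁻ (λ v → value v ℤ.≟ + n) {xs = box (2 ℕ.* n)} p))))
      ; from-∈ = from-∈
      ; from-to = λ _ → ≡.refl
      ; to-from = λ {v} p → to-from v (proj₁ (∈-roots {m} {n} p))
      }
      where
      to : ℤ⁴ → ℤ⁵
      to (a , b , c , d) = a , b , c , d , ℤ.- (a ℤ.+ b ℤ.+ c ℤ.+ d)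
      from : ℤ⁵ → ℤ⁴
      from (a , b , c , d , e) = a , b , c , d
      total-to : ∀ v → total (to v) ≡ 0ℤ
      total-to (a , b , c , d) = ℤP.+-inverseʳ (a ℤ.+ b ℤ.+ c ℤ.+ d)
      norm-to : ∀ v → norm² (to v) ≡ + 2 ℤ.* value v
      norm-to (a , b , c , d) = ℤS.solve 4 (λ a b c d → let e = ℤS.:- (a ℤS.:+ b ℤS.:+ c ℤS.:+ d) in
        a ℤS.:* a ℤS.:+ b ℤS.:* b ℤS.:+ c ℤS.:* c ℤS.:+ d ℤS.:* d ℤS.:+ e ℤS.:* e ℤS.:=
        ℤS.con (+ 2) ℤS.:* ((a ℤS.:* a ℤS.:+ b ℤS.:* b ℤS.:+ c ℤS.:* c ℤS.:+ d ℤS.:* d) ℤS.:+ (a ℤS.:* b ℤS.:+ a ℤS.:* c ℤS.:+ a ℤS.:* d ℤS.:+ b ℤS.:* c ℤS.:+ b ℤS.:* d ℤS.:+ c ℤS.:* d))) ≡.refl a b c d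
      to-from : ∀ v → total v ≡ 0ℤ → to (from v) ≡ v
      to-from (a , b , c , d , e) t = ≡.cong (λ e → a , b , c , d , e) (≡.trans (≡.sym (ℤP.+-identityʳ (ℤ.- (a ℤ.+ b ℤ.+ c ℤ.+ d)))) (≡.trans (≡.cong (ℤ._+_ (ℤ.- (a ℤ.+ b ℤ.+ c ℤ.+ d))) (≡.sym t))
        (ℤS.solve 2 (λ s e → ℤS.:- s ℤS.:+ (s ℤS.:+ e) ℤS.:= e) ≡.refl (a ℤ.+ b ℤ.+ c ℤ.+ d) e)))
      from-∈ : ∀ {v} → v ∈ roots m n → from v ∈ solutions n
      from-∈ {v@(a , b , c , d , e)} p = ∈P.∈-filter⁺ (λ v → value v ℤ.≟ + n) (inside (norm-bound a b c d e (ℤP.≤-reflexive (≡.trans norm (≡.sym (ℤP.pos-* 2 n))))))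
          (ℤP.*-cancelˡ-≡ (+ 2) (value (from v)) (+ n) (≡.trans (≡.sym (norm-to (from v))) (≡.trans (≡.cong norm² (to-from v tot)) norm)))
        where
        tot = proj₁ (∈-roots {m} {n} p)
        norm = proj₂ (∈-roots {m} {n} p)
        inside : ∣ a ∣ ≤ 2 ℕ.* n × ∣ b ∣ ≤ 2 ℕ.* n × ∣ c ∣ ≤ 2 ℕ.* n × ∣ d ∣ ≤ 2 ℕ.* n × ∣ e ∣ ≤ 2 ℕ.* n → from v ∈ box (2 ℕ.* n)
        inside (ba , bb , bc , bd , _) = ∈P.∈-cartesianProduct⁺ (range-∈ ba) (∈P.∈-cartesianProduct⁺ (range-∈ bb) (∈P.∈-cartesianProduct⁺ (range-∈ bc) (range-∈ bd)))

    solutions-unique : ∀ n → Unique (solutions n)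
    solutions-unique n = UniqueP.filter⁺ (λ v → value v ℤ.≟ + n) (UniqueP.cartesianProduct⁺ r (UniqueP.cartesianProduct⁺ r (UniqueP.cartesianProduct⁺ r r)))
      where r = range-unique (2 ℕ.* n)

  theta-roots : ∀ {m n} → 2 ℕ.* n ≤ m → ι (+ Defs.theta n) ≈ sumL (roots m n) (λ _ → 1#)
  theta-roots {m} {n} l = begin
    ι (+ Defs.theta n) ≈⟨ ι-length-filter (concatMap (λ a → concatMap (λ b → concatMap (λ c → List.map (λ d → eqℤ (Defs.Q a b c d) (+ n)) B) B) B) B) ⟩
    sumL (concatMap (λ a → concatMap (λ b → concatMap (λ c → List.map (λ d → eqℤ (Defs.Q a b c d) (+ n)) B) B) B) B) indicator
      ≈⟨ trans (sumL-concatMap (λ a → concatMap (λ b → concatMap (λ c → List.map (λ d → eqℤ (Defs.Q a b c d) (+ n)) B) B) B) B indicator) (sumL-cong B λ a →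
         trans (sumL-concatMap (λ b → concatMap (λ c → List.map (λ d → eqℤ (Defs.Q a b c d) (+ n)) B) B) B indicator) (sumL-cong B λ b →
         trans (sumL-concatMap (λ c → List.map (λ d → eqℤ (Defs.Q a b c d) (+ n)) B) B indicator) (sumL-cong B λ c →
         reflexive (sumL-map (λ d → eqℤ (Defs.Q a b c d) (+ n)) B indicator)))) ⟩
    sumL B (λ a → sumL B (λ b → sumL B (λ c → sumL B (λ d → F (a , b , c , d)))))
      ≈⟨ trans (sumL-product B (cartesianProduct B (cartesianProduct B B)) F) (sumL-cong B λ a → trans (sumL-product B (cartesianProduct B B) (λ v → F (a , v))) (sumL-cong B λ b → sumL-product B B (λ v → F (a , b , v)))) ⟨
    sumL (box (2 ℕ.* n)) F
      ≈⟨ sumL-filter (λ v → value v ℤ.≟ + n) (box (2 ℕ.* n)) (λ v p → indicator-yes (≡.subst (λ i → T (eqℤ i (+ n))) (≡.sym p) (≡⇒eqℤ (+ n)))) (λ v ¬p → indicator-no (λ t → ¬p (eqℤ⇒≡ (value v) (+ n) t))) ⟩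
    sumL (solutions n) (λ _ → 1#) ≈⟨ sumL-matching (solutions-unique n) (roots-unique m n) (solutions-roots {m} {n} l) (λ _ → 1#) ⟨
    sumL (roots m n) (λ _ → 1#) ∎
    where
    B = range (2 ℕ.* n)
    F : ℤ⁴ → Carrier
    F v = indicator (eqℤ (value v) (+ n))

-- The theta series of A₄ as a sum of two eta quotients

-- With `p` for 1/E(q), this is E(q)^5/E(q^5) + 25 q E(q^5)^5/E(q).
ThetaExpansion : (A : CommutativeRing 0ℓ 0ℓ) → Series.PS A → Set
ThetaExpansion A p = (λ n → Ring.ι A (+ Defs.theta n)) ≋ eta ^ 5 * V p + ι (+ 25) * (q * (V eta ^ 5 * p))
  where
  open Gauss A
  open S using (_*_; _+_; _^_; ι)
  open Eta A using (eta)
  open Spread A 4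

module ThetaSeries (A K : CommutativeRing 0ℓ 0ℓ) (φ : Hom A K) (φ-injective : Injective φ)
  (ζ : CommutativeRing.Carrier K) (ζ-sum : CyclotomicSum K ζ)
  (p : Series.PS A) (eta-p : IsInverseEta A p) where
  private
    module A = Ring A
    module K = Ring K
    module φ = Hom φ
    module GA = Gauss A
    module GK = Gauss K
    module SA = GA.S
    module M = MapSeries φ
    module m = Hom M.map
    module VA = Spread A 4
    module VK = Spread K 4
    module v = Hom VK.V-hom
    η = Eta.eta A
    ηK = Eta.eta K
    pK = m.⟦ p ⟧
  open GK using (_≈[_]_; []-trans; []-*; []-refl; []-sym; ≋⇒≈[]; ≈[]-weaken; _≋_; q; poch; PS)
  open GK.S using (_*_; _+_; _^_; 1#)
  open Characters K ζ ζ-sum using (zp; root-count; root-count₀)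
  open Eta K using (eta-poch)

  R M′ : ℕ → PS
  R k n = K.sumL (roots k n) (λ v → zp (moment v))
  M′ k n = K.sumL (cosets k n) (λ _ → K.1#)

  θ : SA.Carrier
  θ n = A.ι (+ Defs.theta n)

  module _ (roots-series : ∀ k → (poch (q ^ 5) k * R k) ≈[ k ] (poch q k ^ 5))
    (cosets-series : ∀ k → (poch q (k ℕ.* 5) * M′ k) ≈[ k ] (poch (q ^ 5) k ^ 5)) where
    private
      eta-pK : ηK * pK ≋ 1#
      eta-pK = GK.S.trans (GK.S.*-congʳ (GK.S.sym (MapSpread.map-eta φ))) (GK.S.trans (GK.S.sym (m.*-hom η p)) (GK.S.trans (m.cong eta-p) m.1-hom))

      V-eta-pK : VK.V ηK * VK.V pK ≋ 1#
      V-eta-pK = GK.S.trans (GK.S.sym (v.*-hom ηK pK)) (GK.S.trans (VK.V-cong eta-pK) v.1-hom)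

      ^5-cong[] : ∀ {k f g} → f ≈[ k ] g → (f ^ 5) ≈[ k ] (g ^ 5)
      ^5-cong[] e = []-* ([]-* ([]-* ([]-* e e) e) e) e

      V-poch : ∀ k → VK.V ηK ≈[ k ] poch (q ^ 5) k
      V-poch k = []-trans (VK.V-[] k (≈[]-weaken (ℕP.n≤1+n k) (eta-poch k)))
        (≋⇒≈[] (GK.S.trans (v.poch-hom k q) (GK.S.∏-cong k (λ i → GK.S.+-congˡ {1#} (GK.S.-‿cong (GK.S.^-congˡ (suc i) VK.V-q))))))

      divide : ∀ {k} a b f g → a * b ≋ 1# → (a * f) ≈[ k ] g → f ≈[ k ] (g * b)
      divide a b f g ab e = []-trans (≋⇒≈[] (GK.S.trans (GK.S.sym (GK.S.*-identityˡ f)) (GK.S.trans (GK.S.*-congʳ (GK.S.sym ab)) (GK.S.solve 3 (λ a b f → a ⊗ b ⊗ f GK.S.⊜ (a ⊗ f) ⊗ b) GK.S.refl a b f)))) ([]-* e ([]-refl {f = b}))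

      R≈ : ∀ k → R k ≈[ k ] (ηK ^ 5 * VK.V pK)
      R≈ k = divide (VK.V ηK) (VK.V pK) (R k) (ηK ^ 5) V-eta-pK
        ([]-trans ([]-* (V-poch k) ([]-refl {f = R k})) ([]-trans (roots-series k) ([]-sym (^5-cong[] (≈[]-weaken (ℕP.n≤1+n k) (eta-poch k))))))

      M′≈ : ∀ k → M′ k ≈[ k ] (VK.V ηK ^ 5 * pK)
      M′≈ k = divide ηK pK (M′ k) (VK.V ηK ^ 5) eta-pK
        ([]-trans ([]-* (≈[]-weaken (ℕP.≤-trans (ℕP.m≤m*n k 5) (ℕP.n≤1+n _)) (eta-poch (k ℕ.* 5))) ([]-refl {f = M′ k})) ([]-trans (cosets-series k) ([]-sym (^5-cong[] (V-poch k)))))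

      D E : SA.Carrier
      D = η SA.^ 5 SA.* VA.V p
      E = VA.V η SA.^ 5 SA.* p

      V-map : ∀ f → m.⟦ VA.V f ⟧ ≋ VK.V m.⟦ f ⟧
      V-map = MapSpread.map-V φ 4

      D-map : m.⟦ D ⟧ ≋ ηK ^ 5 * VK.V pK
      D-map = GK.S.trans (m.*-hom (η SA.^ 5) (VA.V p)) (GK.S.*-cong (GK.S.trans (m.^-hom η 5) (GK.S.^-congˡ 5 (MapSpread.map-eta φ))) (V-map p))

      E-map : m.⟦ E ⟧ ≋ VK.V ηK ^ 5 * pK
      E-map = GK.S.trans (m.*-hom (VA.V η SA.^ 5) p) (GK.S.*-congʳ (GK.S.trans (m.^-hom (VA.V η) 5) (GK.S.^-congˡ 5 (GK.S.trans (V-map η) (VK.V-cong (MapSpread.map-eta φ))))))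

      θ-0 : θ 0 A.≈ D 0
      θ-0 = φ-injective (begin
        φ.⟦ θ 0 ⟧ ≈⟨ φ.ι-hom (+ Defs.theta 0) ⟩
        K.ι (+ Defs.theta 0) ≈⟨ ThetaCount.theta-roots K {1} {0} z≤n ⟩
        K.sumL (roots 1 0) (λ _ → K.1#) ≈⟨ root-count₀ 1 ⟩
        R 1 0 ≈⟨ R≈ 1 0 (s≤s z≤n) ⟩
        (ηK ^ 5 * VK.V pK) 0 ≈⟨ GK.at D-map 0 ⟨
        φ.⟦ D 0 ⟧ ∎)
        where open K.Rsn

      θ-suc : ∀ n → θ (suc n) A.≈ D (suc n) A.+ A.ι (+ 25) A.* E n
      θ-suc n = φ-injective (begin
        φ.⟦ θ (suc n) ⟧ ≈⟨ φ.ι-hom (+ Defs.theta (suc n)) ⟩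
        K.ι (+ Defs.theta (suc n)) ≈⟨ ThetaCount.theta-roots K {k} {suc n} 2n≤ ⟩
        K.sumL (roots k (suc n)) (λ _ → K.1#) ≈⟨ root-count {k} {n} ℕP.≤-refl ⟩
        R k (suc n) K.+ K.ι (+ 25) K.* M′ k n ≈⟨ K.+-cong (R≈ k (suc n) n<) (K.*-congˡ (M′≈ k n (ℕP.<-trans ℕP.≤-refl n<))) ⟩
        (ηK ^ 5 * VK.V pK) (suc n) K.+ K.ι (+ 25) K.* (VK.V ηK ^ 5 * pK) n ≈⟨ K.+-cong (GK.at D-map (suc n)) (K.*-cong (φ.ι-hom (+ 25)) (GK.at E-map n)) ⟨
        φ.⟦ D (suc n) ⟧ K.+ φ.⟦ A.ι (+ 25) ⟧ K.* φ.⟦ E n ⟧ ≈⟨ K.trans (φ.+-hom (D (suc n)) (A.ι (+ 25) A.* E n)) (K.+-congˡ (φ.*-hom (A.ι (+ 25)) (E n))) ⟨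
        φ.⟦ D (suc n) A.+ A.ι (+ 25) A.* E n ⟧ ∎)
        where
        open K.Rsn
        -- One number serves as the box size demanded by `root-count` and as a precision exceeding
        -- degree n + 1.
        k = 2 ℕ.* n ℕ.+ 10
        2n≤ : 2 ℕ.* suc n ≤ k
        2n≤ = ≡.subst (_≤ k) (≡.trans (ℕP.+-comm (2 ℕ.* n) 2) (≡.sym (ℕP.*-suc 2 n))) (ℕP.+-monoʳ-≤ (2 ℕ.* n) (s≤s (s≤s z≤n)))
        n< : suc n < k
        n< = ≡.subst (_≤ k) (ℕP.+-comm n 2) (ℕP.+-mono-≤ (ℕP.m≤n*m n 2) (s≤s (s≤s (z≤n {8}))))

    theta-series : ThetaExpansion A p
    theta-series = GA.mk go
      where
      coef : ∀ f n → (SA.ι (+ 25) SA.* f) n A.≈ A.ι (+ 25) A.* f n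
      coef f n = A.trans (GA.at (SA.*-congʳ {f} (SA.sym (Hom.ι-hom GA.C-hom (+ 25)))) n) (GA.C*-coef (A.ι (+ 25)) f n)
      go : ∀ n → θ n A.≈ D n A.+ (SA.ι (+ 25) SA.* (GA.q SA.* E)) n
      go zero = A.trans θ-0 (A.sym (A.trans (A.+-congˡ (A.trans (coef (GA.q SA.* E) 0) (A.trans (A.*-congˡ (A.zeroˡ (E 0))) (A.zeroʳ _)))) (A.+-identityʳ (D 0))))
      go (suc n) = A.trans (θ-suc n) (A.+-congˡ (A.sym (A.trans (coef (GA.q SA.* E) (suc n)) (A.*-congˡ (GA.q*-suc E n)))))

module LaurentTheta (K : CommutativeRing 0ℓ 0ℓ) where
  private
    module K = Ring K
    module L = Laurent K
    module GK = Gauss K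
    module LR = Ring L.ring

    zz⁻¹ : L.monomial (+ 1) K.1# LR.* L.monomial -[1+ 0 ] K.1# LR.≈ LR.1#
    zz⁻¹ = LR.trans (L.monomial-* (+ 1) -[1+ 0 ] K.1# K.1#) (L.monomial-cong _ (K.*-identityˡ K.1#))

    pow-monomial : ∀ j → L.monomial j K.1# LR.≈ IntegralPowers.pow L.ring (L.monomial (+ 1) K.1#) (L.monomial -[1+ 0 ] K.1#) zz⁻¹ j
    pow-monomial = IntegralPowers.pow-unique L.ring (L.monomial (+ 1) K.1#) (L.monomial -[1+ 0 ] K.1#) zz⁻¹ (λ j → L.monomial j K.1#) LR.refl
      (λ j → LR.sym (LR.trans (L.monomial-* (+ 1) j K.1# K.1#) (L.monomial-cong _ (K.*-identityˡ K.1#))))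

    ct-pow : ∀ j → ¬ j ≡ 0ℤ → L.ct (IntegralPowers.pow L.ring (L.monomial (+ 1) K.1#) (L.monomial -[1+ 0 ] K.1#) zz⁻¹ j) K.≈ K.0#
    ct-pow j j≢0 = K.trans (L.ct-cong (LR.sym (pow-monomial j))) (L.ct-monomial-≢0 j K.1# j≢0)

  open GK using (_≈[_]_; poch; q)
  open GK.S using (_*_; _^_)

  roots-series : (ζ : K.Carrier) (ζ-sum : CyclotomicSum K ζ) → ∀ k →
    (poch (q ^ 5) k * (λ n → K.sumL (roots k n) (λ v → Characters.zp K ζ ζ-sum (moment v)))) ≈[ k ] (poch q k ^ 5)
  roots-series = ConstantTerm.roots-series K L.ring L.embed L.ct L.ct-cong L.ct-+ K.refl L.ct-* (L.monomial (+ 1) K.1#) (L.monomial -[1+ 0 ] K.1#) zz⁻¹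
    (L.ct-monomial-0 K.1#) ct-pow

  cosets-series : ∀ k → (poch q (k ℕ.* 5) * (λ n → K.sumL (cosets k n) (λ _ → K.1#))) ≈[ k ] (poch (q ^ 5) k ^ 5)
  cosets-series = ConstantTerm.cosets-series K L.ring L.embed L.ct L.ct-cong L.ct-+ K.refl L.ct-* (L.monomial (+ 1) K.1#) (L.monomial -[1+ 0 ] K.1#) zz⁻¹
    (L.ct-monomial-0 K.1#) ct-pow

theta-expansion-over : (A K : CommutativeRing 0ℓ 0ℓ) (φ : Hom A K) → Injective φ → (ζ : CommutativeRing.Carrier K) → CyclotomicSum K ζ →
  (p : Series.PS A) → IsInverseEta A p → ThetaExpansion A p
theta-expansion-over A K φ φ-injective ζ ζ-sum p eta-p = ThetaSeries.theta-series A K φ φ-injective ζ ζ-sum p eta-p (LaurentTheta.roots-series K ζ ζ-sum) (LaurentTheta.cosets-series K)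

theta-expansion : (A : CommutativeRing 0ℓ 0ℓ) (p : Series.PS A) → IsInverseEta A p → ThetaExpansion A p
theta-expansion A = theta-expansion-over A (Cyclotomic.ring A) (Cyclotomic.embed A) (Cyclotomic.embed-injective A) (Cyclotomic.ζ A) (Cyclotomic.ζ-sum A)

-- Polynomial identities modulo m by computation

-- Polynomials over ℤ as lists of coefficients, constant term first.
module Polynomial where
  Poly : Set
  Poly = List ℤ

  infixl 6 _⊞_
  _⊞_ : Poly → Poly → Poly
  [] ⊞ m = m
  (c ∷ l) ⊞ [] = c ∷ l
  (c ∷ l) ⊞ (d ∷ m) = c ℤ.+ d ∷ l ⊞ m

  scale : ℤ → Poly → Poly
  scale c = List.map (c ℤ.*_)

  infixl 7 _⊠_
  _⊠_ : Poly → Poly → Poly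
  [] ⊠ m = []
  (c ∷ l) ⊠ m = scale c m ⊞ (0ℤ ∷ l ⊠ m)

  pow : Poly → ℕ → Poly
  pow l zero = 1ℤ ∷ []
  pow l (suc n) = l ⊠ pow l n

  coefficients : Expr ℤ 1 → Poly
  coefficients (Κ c) = c ∷ []
  coefficients (Ι _) = 0ℤ ∷ 1ℤ ∷ []
  coefficients (e ⊕ f) = coefficients e ⊞ coefficients f
  coefficients (e ⊗ f) = coefficients e ⊠ coefficients f
  coefficients (e ⊛ n) = pow (coefficients e) n
  coefficients (⊝ e) = scale -[1+ 0 ] (coefficients e)

  horner : Poly → Expr ℤ 1 → Expr ℤ 1
  horner [] e = Κ 0ℤ
  horner (c ∷ l) e = Κ c ⊕ e ⊗ horner l e

  Vanishing : ℕ → Poly → Set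
  Vanishing m = All (λ c → + m ℤ∣ c)

  vanishing? : ∀ m l → Dec (Vanishing m l)
  vanishing? m = All.all? (+ m ℤ∣?_)

open Polynomial public hiding (pow)

module Evaluation (R : CommutativeRing 0ℓ 0ℓ) where
  open Ring R
  open Rsn
  open Eval rawRing ι public using (⟦_⟧)

  eval : Carrier → Poly → Carrier
  eval x [] = 0#
  eval x (c ∷ l) = ι c + x * eval x l

  eval-⊞ : ∀ x l m → eval x (l ⊞ m) ≈ eval x l + eval x m
  eval-⊞ x [] m = sym (+-identityˡ _)
  eval-⊞ x (c ∷ l) [] = sym (+-identityʳ _)
  eval-⊞ x (c ∷ l) (d ∷ m) = trans (+-cong (ι-+ c d) (*-congˡ (eval-⊞ x l m)))
    (solve 5 (λ c d x a b → c ⊕ d ⊕ x ⊗ (a ⊕ b) ⊜ c ⊕ x ⊗ a ⊕ (d ⊕ x ⊗ b)) refl (ι c) (ι d) x (eval x l) (eval x m))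

  eval-scale : ∀ x c l → eval x (scale c l) ≈ ι c * eval x l
  eval-scale x c [] = sym (zeroʳ _)
  eval-scale x c (d ∷ l) = trans (+-cong (ι-* c d) (*-congˡ (eval-scale x c l)))
    (solve 4 (λ c d x a → c ⊗ d ⊕ x ⊗ (c ⊗ a) ⊜ c ⊗ (d ⊕ x ⊗ a)) refl (ι c) (ι d) x (eval x l))

  eval-⊠ : ∀ x l m → eval x (l ⊠ m) ≈ eval x l * eval x m
  eval-⊠ x [] m = sym (zeroˡ _)
  eval-⊠ x (c ∷ l) m = trans (eval-⊞ x (scale c m) (0ℤ ∷ l ⊠ m)) (trans (+-cong (eval-scale x c m) (+-congˡ (*-congˡ (eval-⊠ x l m))))
    (solve 4 (λ c x a b → c ⊗ b ⊕ (Κ 0ℤ ⊕ x ⊗ (a ⊗ b)) ⊜ (c ⊕ x ⊗ a) ⊗ b) refl (ι c) x (eval x l) (eval x m)))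

  eval-pow : ∀ x l n → eval x (Polynomial.pow l n) ≈ eval x l ^ n
  eval-pow x l zero = solve 1 (λ x → Κ 1ℤ ⊕ x ⊗ Κ 0ℤ ⊜ Κ 1ℤ) refl x
  eval-pow x l (suc n) = trans (eval-⊠ x l (Polynomial.pow l n)) (trans (*-congˡ (eval-pow x l n)) (sym (^-suc (eval x l) n)))

  eval-coefficients : ∀ x e → eval x (coefficients e) ≈ ⟦ e ⟧ (x Vec.∷ Vec.[])
  eval-coefficients x (Κ c) = solve 2 (λ c x → c ⊕ x ⊗ Κ 0ℤ ⊜ c) refl (ι c) x
  eval-coefficients x (Ι Fin.zero) = solve 1 (λ x → Κ 0ℤ ⊕ x ⊗ (Κ 1ℤ ⊕ x ⊗ Κ 0ℤ) ⊜ x) refl x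
  eval-coefficients x (e ⊕ f) = trans (eval-⊞ x (coefficients e) (coefficients f)) (+-cong (eval-coefficients x e) (eval-coefficients x f))
  eval-coefficients x (e ⊗ f) = trans (eval-⊠ x (coefficients e) (coefficients f)) (*-cong (eval-coefficients x e) (eval-coefficients x f))
  eval-coefficients x (e ⊛ n) = trans (eval-pow x (coefficients e) n) (^-congˡ n (eval-coefficients x e))
  eval-coefficients x (⊝ e) = trans (eval-scale x -[1+ 0 ] (coefficients e)) (trans (*-congˡ (eval-coefficients x e)) (solve 1 (λ a → Κ -[1+ 0 ] ⊗ a ⊜ ⊝ a) refl _))

  eval-horner : ∀ x l e → ⟦ horner l e ⟧ (x Vec.∷ Vec.[]) ≡ eval (⟦ e ⟧ (x Vec.∷ Vec.[])) l
  eval-horner x [] e = ≡.refl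
  eval-horner x (c ∷ l) e = ≡.cong (λ y → ι c + ⟦ e ⟧ (x Vec.∷ Vec.[]) * y) (eval-horner x l e)

  module Modulo (m : ℕ) (char : ι (+ m) ≈ 0#) where
    eval-vanishing : ∀ x {l} → Vanishing m l → eval x l ≈ 0#
    eval-vanishing x [] = refl
    eval-vanishing x {c ∷ l} (divides k e ∷ v) = begin
      ι c + x * eval x l ≈⟨ +-cong (trans (≡⇒≈ (≡.cong ι e)) (trans (ι-* k (+ m)) (*-congˡ char))) (*-congˡ (eval-vanishing x v)) ⟩
      ι k * 0# + x * 0# ≈⟨ solve 2 (λ k x → k ⊗ Κ 0ℤ ⊕ x ⊗ Κ 0ℤ ⊜ Κ 0ℤ) refl (ι k) x ⟩
      0# ∎

    -- Both sides are expanded to integer coefficients and the divisibility of the difference by m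
    -- is decided; the identity then holds at every point of every ring of characteristic m.
    congruent : ∀ e f → {True (vanishing? m (coefficients (e ⊕ ⊝ f)))} → ∀ x → ⟦ e ⟧ (x Vec.∷ Vec.[]) ≈ ⟦ f ⟧ (x Vec.∷ Vec.[])
    congruent e f {t} x = begin
      a ≈⟨ solve 2 (λ a b → a ⊜ (a ⊖ b) ⊕ b) refl a b ⟩
      (a - b) + b ≈⟨ +-congʳ (eval-coefficients x (e ⊕ ⊝ f)) ⟨
      eval x (coefficients (e ⊕ ⊝ f)) + b ≈⟨ +-congʳ (eval-vanishing x (toWitness t)) ⟩
      0# + b ≈⟨ +-identityˡ b ⟩
      b ∎
      where
      a = ⟦ e ⟧ (x Vec.∷ Vec.[])
      b = ⟦ f ⟧ (x Vec.∷ Vec.[])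

-- The coefficients of the powers of x congruent to 0, ..., 4 modulo 5.
parts : Poly → Poly × Poly × Poly × Poly × Poly
parts [] = [] , [] , [] , [] , []
parts (c ∷ l) = let (a , b , d , e , f) = parts l in (c ∷ f) , a , b , d , e

part₀ part₁ part₄ : Poly → Poly
part₀ l = proj₁ (parts l)
part₁ l = proj₁ (proj₂ (parts l))
part₄ l = proj₂ (proj₂ (proj₂ (proj₂ (parts l))))

-- The polynomials in ρ

module Modular where
  -- Read at ρ, these describe the dissection: λ = X g and μ^6 = X^5 ν h, with h the product of g
  -- over the five substitutions ρ ↦ ζ^j ρ.
  X₀ g h G : Expr ℤ 1
  X₀ = Ι Fin.zero
  g = Κ 1ℤ ⊕ ⊝ X₀ ⊕ ⊝ (X₀ ⊛ 2)
  h = Κ 1ℤ ⊕ ⊝ (Κ (+ 11) ⊗ X₀ ⊛ 5) ⊕ ⊝ (X₀ ⊛ 10)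
  -- h / g
  G = horner (+ 1 ∷ + 1 ∷ + 2 ∷ + 3 ∷ + 5 ∷ -[1+ 2 ] ∷ + 2 ∷ -[1+ 0 ] ∷ + 1 ∷ []) X₀

  -- At a = λ^6 and v = q μ^6, dividing by (λμ)^6 gives a combination of eta quotients of weight 12
  -- and level 5. The coefficients are such that it is 1 modulo 13.
  H : ∀ {n} → Expr ℤ n → Expr ℤ n → Expr ℤ n
  H a v = a ⊛ 6 ⊕ ⊝ (Κ (+ 9) ⊗ a ⊛ 5 ⊗ v) ⊕ ⊝ (Κ (+ 10) ⊗ a ⊛ 4 ⊗ v ⊛ 2) ⊕ ⊝ (Κ (+ 11) ⊗ a ⊛ 2 ⊗ v ⊛ 4) ⊕ ⊝ (Κ (+ 9) ⊗ a ⊗ v ⊛ 5) ⊕ ⊝ (Κ (+ 5) ⊗ v ⊛ 6)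

  -- Up to series in q^5, `L₀` is the second term of the generating function of `cφ5`, and `J₀` is
  -- λ^5/μ^6 + 5q/λ.
  L₀ J₀ : Expr ℤ 1
  L₀ = X₀ ⊗ G ⊛ 6
  J₀ = g ⊛ 5 ⊕ Κ (+ 5) ⊗ X₀ ⊗ G

  -- The expanded lists stay opaque outside this block; `L-coefficients` and `J-coefficients` reopen
  -- them where a computation is wanted.
  abstract
    L J : Poly
    L = coefficients L₀
    J = coefficients J₀

    L-coefficients : L ≡ coefficients L₀
    L-coefficients = ≡.refl

    J-coefficients : J ≡ coefficients J₀
    J-coefficients = ≡.refl

    -- This and `J₄` are the finite computations behind the classes 1 and 4 modulo 5.
    J₁ : Vanishing 13 (part₁ J)
    J₁ = toWitness {a? = vanishing? 13 (part₁ (coefficients J₀))} tt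

    J₄ : Vanishing 13 (part₄ J)
    J₄ = toWitness {a? = vanishing? 13 (part₄ (coefficients J₀))} tt

-- Eta quotients expressed through ρ

-- The relations between λ = η(q), μ = η(q⁵), ν = η(q²⁵), their inverses p, m, n, and the quantities X and ρ of the
-- 5-dissection of λ, all in characteristic 13.
module Relations (R : CommutativeRing 0ℓ 0ℓ) (char : CommutativeRing._≈_ R (Ring.ι R (+ 13)) (CommutativeRing.0# R)) where
  open Ring R
  open Evaluation R
  open Modulo 13 char
  open Rsn

  Hᴿ : Carrier → Carrier → Carrier
  Hᴿ a v = ⟦ Modular.H (Ι Fin.zero) (Ι (Fin.suc Fin.zero)) ⟧ (a Vec.∷ v Vec.∷ Vec.[])

  Hᴿ-cong : ∀ {a a′ v v′} → a ≈ a′ → v ≈ v′ → Hᴿ a v ≈ Hᴿ a′ v′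
  Hᴿ-cong e f = +-cong (+-cong (+-cong (+-cong (+-cong (^-congˡ 6 e) (-‿cong (*-cong (*-congˡ (^-congˡ 5 e)) f)))
    (-‿cong (*-cong (*-congˡ (^-congˡ 4 e)) (^-congˡ 2 f)))) (-‿cong (*-cong (*-congˡ (^-congˡ 2 e)) (^-congˡ 4 f)))) (-‿cong (*-cong (*-congˡ e) (^-congˡ 5 f)))) (-‿cong (*-congˡ (^-congˡ 6 f)))

  Hᴿ-homogeneous : ∀ c a v → Hᴿ (c * a) (c * v) ≈ c ^ 6 * Hᴿ a v
  Hᴿ-homogeneous = solve 3 (λ c a v → Modular.H (c ⊗ a) (c ⊗ v) ⊜ c ⊛ 6 ⊗ Modular.H a v) refl

  module _ (l μ ν p m n X ρ q g h G Hh K : Carrier)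
    (l-ρ : l ≈ X * g) (Xρ : X * ρ ≈ q * ν) (golden : X ^ 5 * h * ν ≈ μ ^ 6)
    (lp : l * p ≈ 1#) (μm : μ * m ≈ 1#) (νn : ν * n ≈ 1#)
    (gG : g * G ≈ h) (Hh≈ : Hᴿ h (ρ ^ 5) ≈ Hh) (identity : Hᴿ (g ^ 6) (ρ * h) ≈ g ^ 6 * Hh)
    (identity′ : ρ ^ 5 * (h ^ 5 + ι (+ 25) * K) ≈ h ^ 6 + ι (+ 5) * ρ ^ 5 * h ^ 5 - Hh) where
    private
      1^ : ∀ {x} k → x ≈ 1# → x ^ k ≈ 1#
      1^ zero e = refl
      1^ (suc k) e = trans (^-suc _ k) (trans (*-cong e (1^ k e)) (*-identityˡ _))

      μ⁶ : μ ^ 6 ≈ X ^ 5 * ν * h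
      μ⁶ = trans (sym golden) (solve 3 (λ x h v → x ⊛ 5 ⊗ h ⊗ v ⊜ x ⊛ 5 ⊗ v ⊗ h) refl X h ν)

      lower : Hᴿ (l ^ 6) (q * μ ^ 6) ≈ (X ^ 6) ^ 6 * (g ^ 6 * Hh)
      lower = begin
        Hᴿ (l ^ 6) (q * μ ^ 6) ≈⟨ Hᴿ-cong (trans (^-congˡ 6 l-ρ) (^-distrib-* X g 6)) (trans (*-congˡ μ⁶) (trans (solve 4 (λ q x v h → q ⊗ (x ⊛ 5 ⊗ v ⊗ h) ⊜ (q ⊗ v) ⊗ x ⊛ 5 ⊗ h) refl q X ν h)
            (trans (*-congʳ (*-congʳ (sym Xρ))) (solve 3 (λ x r h → x ⊗ r ⊗ x ⊛ 5 ⊗ h ⊜ x ⊛ 6 ⊗ (r ⊗ h)) refl X ρ h)))) ⟩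
        Hᴿ (X ^ 6 * g ^ 6) (X ^ 6 * (ρ * h)) ≈⟨ Hᴿ-homogeneous (X ^ 6) (g ^ 6) (ρ * h) ⟩
        (X ^ 6) ^ 6 * Hᴿ (g ^ 6) (ρ * h) ≈⟨ *-congˡ identity ⟩
        (X ^ 6) ^ 6 * (g ^ 6 * Hh) ∎

      upper : Hᴿ (μ ^ 6) (q ^ 5 * ν ^ 6) ≈ (X ^ 5 * ν) ^ 6 * Hh
      upper = begin
        Hᴿ (μ ^ 6) (q ^ 5 * ν ^ 6) ≈⟨ Hᴿ-cong μ⁶ (trans (solve 2 (λ q v → q ⊛ 5 ⊗ v ⊛ 6 ⊜ (q ⊗ v) ⊛ 5 ⊗ v) refl q ν) (trans (*-congʳ (^-congˡ 5 (sym Xρ))) (solve 3 (λ x r v → (x ⊗ r) ⊛ 5 ⊗ v ⊜ x ⊛ 5 ⊗ v ⊗ r ⊛ 5) refl X ρ ν))) ⟩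
        Hᴿ (X ^ 5 * ν * h) (X ^ 5 * ν * ρ ^ 5) ≈⟨ trans (Hᴿ-homogeneous (X ^ 5 * ν) h (ρ ^ 5)) (*-congˡ Hh≈) ⟩
        (X ^ 5 * ν) ^ 6 * Hh ∎

    -- Here λ^6 = X^6 g^6, qμ^6 = X^6 ρh, μ^6 = X^5 ν h and q^5 ν^6 = X^5 ν ρ^5. Homogeneity of `H`
    -- takes out X and ν, leaving the polynomial identity between H(g^6, ρh) and H(h, ρ^5).
    modular-step : Hᴿ (l ^ 6) (q * μ ^ 6) * ν ^ 6 ≈ l ^ 6 * Hᴿ (μ ^ 6) (q ^ 5 * ν ^ 6)
    modular-step = begin
      Hᴿ (l ^ 6) (q * μ ^ 6) * ν ^ 6 ≈⟨ *-congʳ lower ⟩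
      (X ^ 6) ^ 6 * (g ^ 6 * Hh) * ν ^ 6 ≈⟨ solve 4 (λ x v g h → (x ⊛ 6) ⊛ 6 ⊗ (g ⊛ 6 ⊗ h) ⊗ v ⊛ 6 ⊜ (x ⊗ g) ⊛ 6 ⊗ ((x ⊛ 5 ⊗ v) ⊛ 6 ⊗ h)) refl X ν g Hh ⟩
      (X * g) ^ 6 * ((X ^ 5 * ν) ^ 6 * Hh) ≈⟨ *-cong (^-congˡ 6 l-ρ) upper ⟨
      l ^ 6 * Hᴿ (μ ^ 6) (q ^ 5 * ν ^ 6) ∎

    private
      unit : X ^ 25 * ν ^ 5 * m ^ 30 * h ^ 5 ≈ 1#
      unit = begin
        X ^ 25 * ν ^ 5 * m ^ 30 * h ^ 5 ≈⟨ solve 4 (λ x v m h → x ⊛ 25 ⊗ v ⊛ 5 ⊗ m ⊛ 30 ⊗ h ⊛ 5 ⊜ (x ⊛ 5 ⊗ v ⊗ h) ⊛ 5 ⊗ m ⊛ 30) refl X ν m h ⟩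
        (X ^ 5 * ν * h) ^ 5 * m ^ 30 ≈⟨ *-congʳ (^-congˡ 5 μ⁶) ⟨
        (μ ^ 6) ^ 5 * m ^ 30 ≈⟨ solve 2 (λ μ m → (μ ⊛ 6) ⊛ 5 ⊗ m ⊛ 30 ⊜ (μ ⊗ m) ⊛ 30) refl μ m ⟩
        (μ * m) ^ 30 ≈⟨ 1^ 30 μm ⟩
        1# ∎

      insert : ∀ {u} a → u ≈ 1# → a ≈ a * u
      insert a e = sym (trans (*-congˡ e) (*-identityʳ a))

      drop¹ : ∀ {u} a → u ≈ 1# → u * a ≈ a
      drop¹ a e = trans (*-congʳ e) (*-identityˡ a)

      -- 1/λ = 1/(Xg) = G/(Xh) = ν X^4 G/μ^6.
      p-G : p ≈ ν * X ^ 4 * G * m ^ 6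
      p-G = begin
        p ≈⟨ insert p (1^ 6 μm) ⟩
        p * (μ * m) ^ 6 ≈⟨ *-congˡ (trans (^-distrib-* μ m 6) (*-congʳ (trans μ⁶ (*-congˡ (sym gG))))) ⟩
        p * (X ^ 5 * ν * (g * G) * m ^ 6) ≈⟨ solve 6 (λ p x v g G m → p ⊗ (x ⊛ 5 ⊗ v ⊗ (g ⊗ G) ⊗ m ⊛ 6) ⊜ (x ⊗ g) ⊗ p ⊗ (v ⊗ x ⊛ 4 ⊗ G ⊗ m ⊛ 6)) refl p X ν g G m ⟩
        (X * g) * p * (ν * X ^ 4 * G * m ^ 6) ≈⟨ drop¹ _ (trans (*-congʳ (sym l-ρ)) lp) ⟩
        ν * X ^ 4 * G * m ^ 6 ∎

      q-ρ : q ≈ X * ρ * n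
      q-ρ = trans (insert q νn) (trans (sym (*-assoc q ν n)) (*-congʳ (sym Xρ)))

    -- On the right only the polynomial ρG^6 is not a series in q^5, so taking a section concerns
    -- that polynomial alone.
    partition-expansion : (l ^ 5 * m + ι (+ 25) * (q * (μ ^ 5 * p))) * p ^ 5 ≈ m + ι (+ 25) * (X ^ 25 * ν ^ 5 * m ^ 31) * (ρ * G ^ 6)
    partition-expansion = begin
      (l ^ 5 * m + ι (+ 25) * (q * (μ ^ 5 * p))) * p ^ 5
        ≈⟨ solve 6 (λ l m q μ p c → (l ⊛ 5 ⊗ m ⊕ c ⊗ (q ⊗ (μ ⊛ 5 ⊗ p))) ⊗ p ⊛ 5 ⊜ (l ⊗ p) ⊛ 5 ⊗ m ⊕ c ⊗ (q ⊗ μ ⊛ 5 ⊗ p ⊛ 6)) refl l m q μ p (ι (+ 25)) ⟩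
      (l * p) ^ 5 * m + ι (+ 25) * (q * μ ^ 5 * p ^ 6) ≈⟨ +-cong (drop¹ m (1^ 5 lp)) (*-congˡ (*-congˡ (^-congˡ 6 p-G))) ⟩
      m + ι (+ 25) * (q * μ ^ 5 * (ν * X ^ 4 * G * m ^ 6) ^ 6)
        ≈⟨ +-congˡ (*-congˡ (solve 6 (λ q μ v x G m → q ⊗ μ ⊛ 5 ⊗ (v ⊗ x ⊛ 4 ⊗ G ⊗ m ⊛ 6) ⊛ 6 ⊜ (μ ⊗ m) ⊛ 5 ⊗ (q ⊗ v ⊗ (x ⊛ 24 ⊗ v ⊛ 5 ⊗ m ⊛ 31 ⊗ G ⊛ 6))) refl q μ ν X G m)) ⟩
      m + ι (+ 25) * ((μ * m) ^ 5 * (q * ν * (X ^ 24 * ν ^ 5 * m ^ 31 * G ^ 6))) ≈⟨ +-congˡ (*-congˡ (trans (drop¹ _ (1^ 5 μm)) (*-congʳ (sym Xρ)))) ⟩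
      m + ι (+ 25) * (X * ρ * (X ^ 24 * ν ^ 5 * m ^ 31 * G ^ 6))
        ≈⟨ +-congˡ (solve 6 (λ c x r v m G → c ⊗ (x ⊗ r ⊗ (x ⊛ 24 ⊗ v ⊗ m ⊗ G)) ⊜ c ⊗ (x ⊛ 25 ⊗ v ⊗ m) ⊗ (r ⊗ G)) refl (ι (+ 25)) X ρ (ν ^ 5) (m ^ 31) (G ^ 6)) ⟩
      m + ι (+ 25) * (X ^ 25 * ν ^ 5 * m ^ 31) * (ρ * G ^ 6) ∎

    fifth-expansion : l ^ 5 * m ^ 6 + ι (+ 5) * (q * p) ≈ X ^ 5 * m ^ 6 * (g ^ 5 + ι (+ 5) * ρ * G)
    fifth-expansion = begin
      l ^ 5 * m ^ 6 + ι (+ 5) * (q * p) ≈⟨ +-cong (*-congʳ (trans (^-congˡ 5 l-ρ) (^-distrib-* X g 5))) (*-congˡ (*-congˡ p-G)) ⟩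
      X ^ 5 * g ^ 5 * m ^ 6 + ι (+ 5) * (q * (ν * X ^ 4 * G * m ^ 6))
        ≈⟨ +-congˡ (*-congˡ (trans (solve 5 (λ q v x G m → q ⊗ (v ⊗ x ⊛ 4 ⊗ G ⊗ m) ⊜ q ⊗ v ⊗ (x ⊛ 4 ⊗ G ⊗ m)) refl q ν X G (m ^ 6)) (*-congʳ (sym Xρ)))) ⟩
      X ^ 5 * g ^ 5 * m ^ 6 + ι (+ 5) * (X * ρ * (X ^ 4 * G * m ^ 6))
        ≈⟨ solve 6 (λ x g m c r G → x ⊛ 5 ⊗ g ⊗ m ⊕ c ⊗ (x ⊗ r ⊗ (x ⊛ 4 ⊗ G ⊗ m)) ⊜ x ⊛ 5 ⊗ m ⊗ (g ⊕ c ⊗ r ⊗ G)) refl X (g ^ 5) (m ^ 6) (ι (+ 5)) ρ G ⟩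
      X ^ 5 * m ^ 6 * (g ^ 5 + ι (+ 5) * ρ * G) ∎

    -- Each term is u = X^30 m^31 times a polynomial in ρ: the first gives h^6, the second 5ρ^5 h^5,
    -- and m^25 gives H(h, ρ^5) by the modular relation. The claim is then u times `identity′`.
    section-expansion : Hᴿ (μ ^ 6) (q ^ 5 * ν ^ 6) ≈ μ ^ 6 * ν ^ 6 →
      q ^ 5 * (m + ι (+ 25) * (X ^ 25 * ν ^ 5 * m ^ 31) * K) ≈ μ ^ 5 * n ^ 6 + ι (+ 5) * (q ^ 5 * m) - m ^ 25
    section-expansion modular = begin
      q ^ 5 * (m + ι (+ 25) * (X ^ 25 * ν ^ 5 * m ^ 31) * K) ≈⟨ *-cong (^-congˡ 5 q-ρ) (+-congʳ (insert m unit)) ⟩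
      (X * ρ * n) ^ 5 * (m * (X ^ 25 * ν ^ 5 * m ^ 30 * h ^ 5) + ι (+ 25) * (X ^ 25 * ν ^ 5 * m ^ 31) * K)
        ≈⟨ solve 8 (λ x r n m v h c k → (x ⊗ r ⊗ n) ⊛ 5 ⊗ (m ⊗ (x ⊛ 25 ⊗ v ⊛ 5 ⊗ m ⊛ 30 ⊗ h) ⊕ c ⊗ (x ⊛ 25 ⊗ v ⊛ 5 ⊗ m ⊛ 31) ⊗ k) ⊜ (v ⊗ n) ⊛ 5 ⊗ (x ⊛ 30 ⊗ m ⊛ 31 ⊗ (r ⊛ 5 ⊗ (h ⊕ c ⊗ k)))) refl X ρ n m ν (h ^ 5) (ι (+ 25)) K ⟩
      (ν * n) ^ 5 * (u * (ρ ^ 5 * (h ^ 5 + ι (+ 25) * K))) ≈⟨ drop¹ _ (1^ 5 νn) ⟩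
      u * (ρ ^ 5 * (h ^ 5 + ι (+ 25) * K)) ≈⟨ *-congˡ identity′ ⟩
      u * (h ^ 6 + ι (+ 5) * ρ ^ 5 * h ^ 5 - Hh) ≈⟨ solve 4 (λ u a b c → u ⊗ (a ⊕ b ⊖ c) ⊜ u ⊗ a ⊕ u ⊗ b ⊖ u ⊗ c) refl u (h ^ 6) (ι (+ 5) * ρ ^ 5 * h ^ 5) Hh ⟩
      u * h ^ 6 + u * (ι (+ 5) * ρ ^ 5 * h ^ 5) - u * Hh ≈⟨ +-cong (+-cong first second) (-‿cong third) ⟨
      μ ^ 5 * n ^ 6 + ι (+ 5) * (q ^ 5 * m) - m ^ 25 ∎
      where
      u = X ^ 30 * m ^ 31
      X³⁰ : X ^ 30 * Hh ≈ μ ^ 6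
      X³⁰ = begin
        X ^ 30 * Hh ≈⟨ insert _ (1^ 6 νn) ⟩
        X ^ 30 * Hh * (ν * n) ^ 6 ≈⟨ solve 4 (λ x h v n → x ⊛ 30 ⊗ h ⊗ (v ⊗ n) ⊛ 6 ⊜ (x ⊛ 5 ⊗ v) ⊛ 6 ⊗ h ⊗ n ⊛ 6) refl X Hh ν n ⟩
        (X ^ 5 * ν) ^ 6 * Hh * n ^ 6 ≈⟨ *-congʳ (trans (sym upper) modular) ⟩
        μ ^ 6 * ν ^ 6 * n ^ 6 ≈⟨ solve 3 (λ μ v n → μ ⊗ v ⊛ 6 ⊗ n ⊛ 6 ⊜ (v ⊗ n) ⊛ 6 ⊗ μ) refl (μ ^ 6) ν n ⟩
        (ν * n) ^ 6 * μ ^ 6 ≈⟨ drop¹ _ (1^ 6 νn) ⟩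
        μ ^ 6 ∎
      first : μ ^ 5 * n ^ 6 ≈ u * h ^ 6
      first = begin
        μ ^ 5 * n ^ 6 ≈⟨ trans (insert _ μm) (insert _ unit) ⟩
        μ ^ 5 * n ^ 6 * (μ * m) * (X ^ 25 * ν ^ 5 * m ^ 30 * h ^ 5) ≈⟨ solve 6 (λ μ n m x v h → μ ⊛ 5 ⊗ n ⊛ 6 ⊗ (μ ⊗ m) ⊗ (x ⊛ 25 ⊗ v ⊛ 5 ⊗ m ⊛ 30 ⊗ h ⊛ 5) ⊜ μ ⊛ 6 ⊗ (n ⊛ 6 ⊗ (x ⊛ 25 ⊗ v ⊛ 5 ⊗ m ⊛ 31 ⊗ h ⊛ 5))) refl μ n m X ν h ⟩
        μ ^ 6 * (n ^ 6 * (X ^ 25 * ν ^ 5 * m ^ 31 * h ^ 5)) ≈⟨ *-congʳ μ⁶ ⟩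
        X ^ 5 * ν * h * (n ^ 6 * (X ^ 25 * ν ^ 5 * m ^ 31 * h ^ 5)) ≈⟨ solve 5 (λ n m x v h → x ⊛ 5 ⊗ v ⊗ h ⊗ (n ⊛ 6 ⊗ (x ⊛ 25 ⊗ v ⊛ 5 ⊗ m ⊛ 31 ⊗ h ⊛ 5)) ⊜ (v ⊗ n) ⊛ 6 ⊗ (x ⊛ 30 ⊗ m ⊛ 31 ⊗ h ⊛ 6)) refl n m X ν h ⟩
        (ν * n) ^ 6 * (u * h ^ 6) ≈⟨ drop¹ _ (1^ 6 νn) ⟩
        u * h ^ 6 ∎
      second : ι (+ 5) * (q ^ 5 * m) ≈ u * (ι (+ 5) * ρ ^ 5 * h ^ 5)
      second = begin
        ι (+ 5) * (q ^ 5 * m) ≈⟨ *-congˡ (*-cong (^-congˡ 5 q-ρ) (insert m unit)) ⟩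
        ι (+ 5) * ((X * ρ * n) ^ 5 * (m * (X ^ 25 * ν ^ 5 * m ^ 30 * h ^ 5)))
          ≈⟨ solve 7 (λ c x r n m v h → c ⊗ ((x ⊗ r ⊗ n) ⊛ 5 ⊗ (m ⊗ (x ⊛ 25 ⊗ v ⊛ 5 ⊗ m ⊛ 30 ⊗ h))) ⊜ (v ⊗ n) ⊛ 5 ⊗ (x ⊛ 30 ⊗ m ⊛ 31 ⊗ (c ⊗ r ⊛ 5 ⊗ h))) refl (ι (+ 5)) X ρ n m ν (h ^ 5) ⟩
        (ν * n) ^ 5 * (u * (ι (+ 5) * ρ ^ 5 * h ^ 5)) ≈⟨ drop¹ _ (1^ 5 νn) ⟩
        u * (ι (+ 5) * ρ ^ 5 * h ^ 5) ∎
      third : m ^ 25 ≈ u * Hh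
      third = begin
        m ^ 25 ≈⟨ insert _ (1^ 6 μm) ⟩
        m ^ 25 * (μ * m) ^ 6 ≈⟨ solve 2 (λ m μ → m ⊛ 25 ⊗ (μ ⊗ m) ⊛ 6 ⊜ m ⊛ 31 ⊗ μ ⊛ 6) refl m μ ⟩
        m ^ 31 * μ ^ 6 ≈⟨ *-congˡ X³⁰ ⟨
        m ^ 31 * (X ^ 30 * Hh) ≈⟨ solve 3 (λ m x h → m ⊗ (x ⊗ h) ⊜ x ⊗ m ⊗ h) refl (m ^ 31) (X ^ 30) Hh ⟩
        u * Hh ∎

module ModularValues (R : CommutativeRing 0ℓ 0ℓ) (char : CommutativeRing._≈_ R (Ring.ι R (+ 13)) (CommutativeRing.0# R)) (ρ : CommutativeRing.Carrier R) where
  open Ring R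
  open Evaluation R
  open Modulo 13 char
  open Relations R char using (Hᴿ)
  open Modular using (X₀; H; L₀; L-coefficients; J₀; J-coefficients)

  -- A bundle of polynomial values and their relations. The later argument takes it as a parameter,
  -- so that the large polynomials behave there as variables.
  record ModularData : Set where
    field
      g h G K Hh : Carrier
      g-value : 1# - ρ - ρ ^ 2 ≈ g
      h-value : 1# - ι (+ 11) * ρ ^ 5 - ρ ^ 10 ≈ h
      g*G : g * G ≈ h
      Hh-value : Hᴿ h (ρ ^ 5) ≈ Hh
      identity : Hᴿ (g ^ 6) (ρ * h) ≈ g ^ 6 * Hh
      identity′ : ρ ^ 5 * (h ^ 5 + ι (+ 25) * K) ≈ h ^ 6 + ι (+ 5) * ρ ^ 5 * h ^ 5 - Hh
      K-value : eval (ρ ^ 5) (part₀ Modular.L) ≈ K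
      L-value : eval ρ Modular.L ≈ ρ * G ^ 6
      J-value : eval ρ Modular.J ≈ g ^ 5 + ι (+ 5) * ρ * G

  private
    g h G : Carrier
    g = ⟦ Modular.g ⟧ (ρ Vec.∷ Vec.[])
    h = ⟦ Modular.h ⟧ (ρ Vec.∷ Vec.[])
    G = ⟦ Modular.G ⟧ (ρ Vec.∷ Vec.[])

    g-value : 1# - ρ - ρ ^ 2 ≈ g
    g-value = refl

    h-value : 1# - ι (+ 11) * ρ ^ 5 - ρ ^ 10 ≈ h
    h-value = refl

    g*G : g * G ≈ h
    g*G = congruent (Modular.g ⊗ Modular.G) Modular.h ρ

    -- The modular invariance under q ↦ q^5 in terms of ρ, checked coefficient by coefficient modulo
    -- 13.
    identity : Hᴿ (g ^ 6) (ρ * h) ≈ g ^ 6 * Hᴿ h (ρ ^ 5)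
    identity = congruent (H (Modular.g ⊛ 6) (X₀ ⊗ Modular.h)) (Modular.g ⊛ 6 ⊗ H Modular.h (X₀ ⊛ 5)) ρ

    left : Poly → Expr ℤ 1
    left l = X₀ ⊛ 5 ⊗ (Modular.h ⊛ 5 ⊕ Κ (+ 25) ⊗ horner l (X₀ ⊛ 5))

    right : Expr ℤ 1
    right = Modular.h ⊛ 6 ⊕ Κ (+ 5) ⊗ X₀ ⊛ 5 ⊗ Modular.h ⊛ 5 ⊕ ⊝ H Modular.h (X₀ ⊛ 5)

    value-left : ∀ l → ρ ^ 5 * (h ^ 5 + ι (+ 25) * eval (ρ ^ 5) l) ≈ ⟦ left l ⟧ (ρ Vec.∷ Vec.[])
    value-left l = *-congˡ (+-congˡ (*-congˡ (reflexive (≡.sym (eval-horner ρ l (X₀ ⊛ 5))))))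

    left≈right : ⟦ left (part₀ Modular.L) ⟧ (ρ Vec.∷ Vec.[]) ≈ ⟦ right ⟧ (ρ Vec.∷ Vec.[])
    left≈right = ≡.subst (λ l → ⟦ left (part₀ l) ⟧ (ρ Vec.∷ Vec.[]) ≈ ⟦ right ⟧ (ρ Vec.∷ Vec.[])) (≡.sym L-coefficients) (congruent (left (part₀ (coefficients L₀))) right ρ)

    value-right : ⟦ right ⟧ (ρ Vec.∷ Vec.[]) ≈ h ^ 6 + ι (+ 5) * ρ ^ 5 * h ^ 5 - Hᴿ h (ρ ^ 5)
    value-right = refl

    identity′ : ρ ^ 5 * (h ^ 5 + ι (+ 25) * eval (ρ ^ 5) (part₀ Modular.L)) ≈ h ^ 6 + ι (+ 5) * ρ ^ 5 * h ^ 5 - Hᴿ h (ρ ^ 5)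
    identity′ = trans (value-left (part₀ Modular.L)) (trans left≈right value-right)

    L-value : eval ρ Modular.L ≈ ρ * G ^ 6
    L-value = trans (reflexive (≡.cong (eval ρ) L-coefficients)) (eval-coefficients ρ L₀)

    J-value : eval ρ Modular.J ≈ g ^ 5 + ι (+ 5) * ρ * G
    J-value = trans (reflexive (≡.cong (eval ρ) J-coefficients)) (eval-coefficients ρ J₀)

  modular-data : ModularData
  modular-data = record
    { g = g ; h = h ; G = G ; K = eval (ρ ^ 5) (part₀ Modular.L) ; Hh = Hᴿ h (ρ ^ 5)
    ; g-value = g-value ; h-value = h-value ; g*G = g*G ; Hh-value = refl ; identity = identity ; identity′ = identity′ ; K-value = refl ; L-value = L-value ; J-value = J-value }

-- Evaluation under homomorphisms, sections of polynomials, fixed points of q ↦ q^5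

module _ {R R′ : CommutativeRing 0ℓ 0ℓ} (φ : Hom R R′) where
  private
    module R = Ring R
    module R′ = Ring R′
    module E = Evaluation R
    module E′ = Evaluation R′
    module φ = Hom φ

  expression-hom : ∀ {n} (e : Expr ℤ n) ρ → φ.⟦ E.⟦ e ⟧ ρ ⟧ R′.≈ E′.⟦ e ⟧ (Vec.map φ.⟦_⟧ ρ)
  expression-hom (Κ c) ρ = φ.ι-hom c
  expression-hom (Ι i) ρ = R′.reflexive (≡.sym (lookup-map i φ.⟦_⟧ ρ))
  expression-hom (e ⊕ f) ρ = R′.trans (φ.+-hom _ _) (R′.+-cong (expression-hom e ρ) (expression-hom f ρ))
  expression-hom (e ⊗ f) ρ = R′.trans (φ.*-hom _ _) (R′.*-cong (expression-hom e ρ) (expression-hom f ρ))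
  expression-hom (e ⊛ n) ρ = R′.trans (φ.^-hom _ n) (R′.^-congˡ n (expression-hom e ρ))
  expression-hom (⊝ e) ρ = R′.trans (φ.neg-hom _) (R′.-‿cong (expression-hom e ρ))

  eval-hom : ∀ x l → φ.⟦ E.eval x l ⟧ R′.≈ E′.eval φ.⟦ x ⟧ l
  eval-hom x [] = φ.0-hom
  eval-hom x (c ∷ l) = R′.trans (φ.+-hom _ _) (R′.+-cong (φ.ι-hom c) (R′.trans (φ.*-hom _ _) (R′.*-congˡ (eval-hom x l))))

module Parts (R : CommutativeRing 0ℓ 0ℓ) where
  open Ring R
  open Evaluation R

  eval-cong : ∀ {x y} l → x ≈ y → eval x l ≈ eval y l
  eval-cong [] e = refl
  eval-cong (c ∷ l) e = +-congˡ (*-cong e (eval-cong l e))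

  eval-parts : ∀ x l → let y = x ^ 5 ; (a , b , c , d , e) = parts l in
    eval x l ≈ eval y a + x * eval y b + x ^ 2 * eval y c + x ^ 3 * eval y d + x ^ 4 * eval y e
  eval-parts x [] = solve 1 (λ x → Κ 0ℤ ⊜ Κ 0ℤ ⊕ x ⊗ Κ 0ℤ ⊕ x ⊛ 2 ⊗ Κ 0ℤ ⊕ x ⊛ 3 ⊗ Κ 0ℤ ⊕ x ⊛ 4 ⊗ Κ 0ℤ) refl x
  eval-parts x (k ∷ l) = trans (+-congˡ (*-congˡ (eval-parts x l)))
    (solve 7 (λ k x a b c d e → k ⊕ x ⊗ (a ⊕ x ⊗ b ⊕ x ⊛ 2 ⊗ c ⊕ x ⊛ 3 ⊗ d ⊕ x ⊛ 4 ⊗ e) ⊜ k ⊕ x ⊛ 5 ⊗ e ⊕ x ⊗ a ⊕ x ⊛ 2 ⊗ b ⊕ x ⊛ 3 ⊗ c ⊕ x ⊛ 4 ⊗ d) refl (ι k) x _ _ _ _ _)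

module Fixed (A : CommutativeRing 0ℓ 0ℓ) where
  private module A = Ring A
  open Series A
  open Spread A 4
  open S using (1#)

  -- The coefficient at an exponent prime to 5 is zero and the one at 5m equals the one at m, so by
  -- descent every coefficient of positive degree vanishes.
  V-fixed : ∀ f → f ≋ V f → f 0 A.≈ A.1# → f ≋ 1#
  V-fixed f e f0 = mk λ { zero → f0 ; (suc n) → vanish (suc (suc n)) (suc n) ℕP.≤-refl (λ ()) }
    where
    vanish : ∀ N n → n < N → ¬ n ≡ 0 → f n A.≈ A.0#
    vanish (suc N) n l n≢0 with split-index n
    ... | zero , zero , _ , ≡.refl = ⊥-elim (n≢0 ≡.refl)
    ... | suc m , zero , _ , ≡.refl = A.trans (at e (suc m ℕ.* 5 ℕ.+ 0)) (A.trans (at (U0V f) (suc m)) (vanish N (suc m) (ℕP.<-≤-trans m< (ℕP.≤-pred l)) (λ ())))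
      where m< : suc m < suc m ℕ.* 5 ℕ.+ 0
            m< = s≤s (s≤s (ℕP.≤-trans (ℕP.m≤m*n m 5) (ℕP.≤-trans (ℕP.m≤n+m (m ℕ.* 5) 3) (ℕP.≤-reflexive (≡.sym (ℕP.+-identityʳ _))))))
    ... | m , suc r , r< , ≡.refl = A.trans (at e (m ℕ.* 5 ℕ.+ suc r)) (at (UrV r f r<) m)

module Convolution (A : CommutativeRing 0ℓ 0ℓ) where
  private module A = Ring A
  open Series A
  open S using (_*_)
  open Partitions A using (series)

  ⊙-series : ∀ f g → series (f ⊙ g) ≋ series f * series g
  ⊙-series f g = mk λ n → A.trans (ι-sum (upTo (suc n)) (λ k → f k ℕ.* g (n ∸ k))) (A.trans (A.sumL-applyUpTo n id (λ k → A.ι (+ (f k ℕ.* g (n ∸ k)))))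
    (A.∑²-cong n (λ k d e → A.trans (A.reflexive (≡.cong A.ι (≡.trans (ℤP.pos-* (f k) (g (n ∸ k))) (≡.cong (λ i → + f k ℤ.* + g i) (≡.trans (≡.cong (_∸ k) (≡.sym e)) (ℕP.m+n∸m≡n k d)))))) (A.ι-* (+ f k) (+ g d)))))
    where
    ι-sum : ∀ (l : List ℕ) F → A.ι (+ sum (List.map F l)) A.≈ A.sumL l (λ k → A.ι (+ F k))
    ι-sum [] F = A.refl
    ι-sum (k ∷ l) F = A.trans (A.ι-+ (+ F k) (+ sum (List.map F l))) (A.+-congˡ (ι-sum l F))

-- The section of the generating function in characteristic 13

IsZero13 : CommutativeRing 0ℓ 0ℓ → Set
IsZero13 R = ι (+ 13) ≈ 0#
  where open Ring R

data ±1mod5 : ℕ → Set where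
  one : ±1mod5 1
  four : ±1mod5 4

module Thirteen (A : CommutativeRing 0ℓ 0ℓ) (char : IsZero13 A) where
  private module A = Ring A
  open Gauss A
  open S using (_*_; _+_; _-_; -_; 0#; 1#; _^_; ι)
  open Eta A
  open Spread A 4
  open Dissection A using (x; z; assemble; U0-assemble; U1-assemble; U4-assemble)
  private
    module V₁₃ = Spread A 12
    module C = Hom C-hom

  char-S : ι (+ 13) ≋ 0#
  char-S = S.trans (S.sym (C.ι-hom (+ 13))) (S.trans (C.cong char) C.0-hom)

  open Relations ring char-S
  open Evaluation ring
  open Modulo 13 char-S
  open Parts ring

  -- The Frobenius endomorphism is applied only to the factors of the product.
  eta^13 : eta ^ 13 ≋ V₁₃.V eta
  eta^13 = ≈[]⇒≋ λ N → []-trans (^13-cong N (≈[]-weaken (ℕP.n≤1+n N) (eta-poch N))) ([]-trans (≋⇒≈[] (poch^13 N)) ([]-sym (V₁₃.V-[] N (≈[]-weaken (ℕP.n≤1+n N) (eta-poch N)))))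
    where
    module V = Hom V₁₃.V-hom
    ^13-cong : ∀ N {f g} → f ≈[ N ] g → (f ^ 13) ≈[ N ] (g ^ 13)
    ^13-cong N {f} {g} e = go 12
      where go : ∀ k → (f ^ suc k) ≈[ N ] (g ^ suc k)
            go zero = e
            go (suc k) = []-* {f = f ^ suc k} {g = f} {f′ = g ^ suc k} {g′ = g} (go k) e
    factor^13 : ∀ x → (1# - x) ^ 13 ≋ 1# - x ^ 13
    factor^13 = congruent ((Κ 1ℤ ⊕ ⊝ Ι Fin.zero) ⊛ 13) (Κ 1ℤ ⊕ ⊝ (Ι Fin.zero ⊛ 13))
    ∏^13 : ∀ N f → S.∏ N f ^ 13 ≋ S.∏ N (λ i → f i ^ 13)
    ∏^13 zero f = S.solve 0 (Κ 1ℤ ⊛ 13 S.⊜ Κ 1ℤ) S.refl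
    ∏^13 (suc N) f = S.trans (S.^-distrib-* (S.∏ N f) (f N) 13) (S.*-congʳ (∏^13 N f))
    poch^13 : ∀ N → poch q N ^ 13 ≋ V₁₃.V (poch q N)
    poch^13 N = S.trans (∏^13 N (λ i → 1# - q ^ suc i)) (S.trans (S.∏-cong N (λ i → S.trans (factor^13 (q ^ suc i)) (S.+-congˡ {1#} (S.-‿cong (swap (suc i)))))) (S.sym (V.poch-hom N q)))
      where swap : ∀ i → (q ^ i) ^ 13 ≋ V₁₃.V q ^ i
            swap i = S.trans (S.^-assocʳ q i 13) (S.trans (S.≡⇒≈ (≡.cong (q ^_) (ℕP.*-comm i 13))) (S.trans (S.sym (S.^-assocʳ q 13 i)) (S.^-congˡ i (S.sym V₁₃.V-q))))

  module _ (p : PS) (eta-p : IsInverseEta A p) where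
    -- E(q)^26 is E(q^13)² by `eta^13`, so E(q)^(-25) is E(q) times a series in q^13 and inherits
    -- the empty sections of `eta` modulo 13.
    p^25 : p ^ 25 ≋ eta * V₁₃.V (p ^ 2)
    p^25 = begin
      p ^ 25 ≈⟨ S.*-identityʳ (p ^ 25) ⟨
      p ^ 25 * 1# ≈⟨ S.*-congˡ {p ^ 25} (S.trans (S.*-congʳ {V₁₃.V p ^ 2} (S.^-congˡ 2 eta^13)) inverse²) ⟨
      p ^ 25 * ((eta ^ 13) ^ 2 * V₁₃.V p ^ 2) ≈⟨ S.solve 3 (λ l p v → p ⊛ 25 ⊗ ((l ⊛ 13) ⊛ 2 ⊗ v) S.⊜ (l ⊗ p) ⊛ 25 ⊗ (l ⊗ v)) S.refl eta p (V₁₃.V p ^ 2) ⟩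
      (eta * p) ^ 25 * (eta * V₁₃.V p ^ 2) ≈⟨ S.*-cong (S.^-congˡ 25 eta-p) (S.*-congˡ {eta} (S.sym (V.^-hom p 2))) ⟩
      1# ^ 25 * (eta * V₁₃.V (p ^ 2)) ≈⟨ S.solve 1 (λ a → Κ 1ℤ ⊛ 25 ⊗ a S.⊜ a) S.refl (eta * V₁₃.V (p ^ 2)) ⟩
      eta * V₁₃.V (p ^ 2) ∎
      where
      open S.Rsn
      module V = Hom V₁₃.V-hom
      inverse² : V₁₃.V eta ^ 2 * V₁₃.V p ^ 2 ≋ 1#
      inverse² = S.trans (S.sym (S.^-distrib-* (V₁₃.V eta) (V₁₃.V p) 2)) (S.trans (S.^-congˡ 2 (S.trans (S.sym (V.*-hom eta p)) (S.trans (V₁₃.V-cong eta-p) V.1-hom))) (S.*-identityˡ 1#))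

    p^25-section : ∀ r → r < 13 → V₁₃.U r eta ≋ 0# → V₁₃.U r (p ^ 25) ≋ 0#
    p^25-section r l e = S.trans (V₁₃.U-cong r p^25) (S.trans (V₁₃.U-*V r eta (p ^ 2) l) (S.trans (S.*-congʳ {p ^ 2} e) (S.zeroˡ (p ^ 2))))

    open Modular using (L; J; J₁; J₄)

    module Assembly (ρ : PS) (d : ModularValues.ModularData ring char-S ρ) where
      open ModularValues.ModularData d using (g; h; G; K; Hh; g-value; h-value; identity; identity′)
        renaming (g*G to gG; Hh-value to Hh≈; K-value to K-parts; L-value to L-eval; J-value to J-eval)

      μ ν m n X ω y : PS
      μ = V eta
      ν = V μ
      m = V p
      n = V m
      X = V x
      -- Chosen so that ρ is q times `V ω`; then ρ^5 is `V y`, and sections of polynomials in ρ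
      -- become polynomials in `y`.
      ω = z * m
      y = q * ω ^ 5

      module _ (ρ-V : ρ ≋ q * (V z * V (V p))) (η-ρ : eta ≋ V x * (1# - ρ - ρ ^ 2)) (Xρ : V x * ρ ≋ q * V (V eta)) (η⁶ : V x ^ 5 * (1# - ι (+ 11) * ρ ^ 5 - ρ ^ 10) * V (V eta) ≋ V eta ^ 6) where
        private
          module v = Hom V-hom

          V-inverse : ∀ {f g} → f * g ≋ 1# → V f * V g ≋ 1#
          V-inverse {f} {g} e = S.trans (S.sym (v.*-hom f g)) (S.trans (V-cong e) v.1-hom)

          μm : μ * m ≋ 1#
          μm = V-inverse eta-p
          νn : ν * n ≋ 1#
          νn = V-inverse μm

          l-ρ : eta ≋ X * g
          l-ρ = S.trans η-ρ (S.*-congˡ {X} g-value)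

          golden : X ^ 5 * h * ν ≋ μ ^ 6
          golden = S.trans (S.*-congʳ {ν} (S.*-congˡ {X ^ 5} (S.sym h-value))) η⁶

          W H₁ H₂ : PS
          H₁ = Hᴿ (eta ^ 6) (q * μ ^ 6)
          H₂ = Hᴿ (μ ^ 6) (q ^ 5 * ν ^ 6)
          W = H₁ * (p * m) ^ 6

          1^ : ∀ {f} k → f ≋ 1# → f ^ k ≋ 1#
          1^ zero e = S.refl
          1^ {f} (suc k) e = S.trans (S.^-suc f k) (S.trans (S.*-cong e (1^ k e)) (S.*-identityˡ 1#))

          drop¹ : ∀ {u} f → u ≋ 1# → u * f ≋ f
          drop¹ f e = S.trans (S.*-congʳ {f} e) (S.*-identityˡ f)

          V-H₁ : V H₁ ≋ H₂
          V-H₁ = S.trans (expression-hom V-hom (Modular.H (Ι Fin.zero) (Ι (Fin.suc Fin.zero))) (eta ^ 6 Vec.∷ q * μ ^ 6 Vec.∷ Vec.[]))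
            (Hᴿ-cong (v.^-hom eta 6) (S.trans (v.*-hom q (μ ^ 6)) (S.*-cong V-q (v.^-hom μ 6))))

          V-W : V W ≋ H₂ * (m * n) ^ 6
          V-W = S.trans (v.*-hom H₁ ((p * m) ^ 6)) (S.*-cong V-H₁ (S.trans (v.^-hom (p * m) 6) (S.^-congˡ 6 (v.*-hom p m))))

          -- This is `modular-step` divided by (λμν)^6: W is H(λ^6, qμ^6)/(λμ)^6, and its image
          -- under q ↦ q^5 is H(μ^6, q^5 ν^6)/(μν)^6.
          W-fixed : W ≋ V W
          W-fixed = begin
            H₁ * (p * m) ^ 6 ≈⟨ drop¹ (H₁ * (p * m) ^ 6) (1^ 6 νn) ⟨
            (ν * n) ^ 6 * (H₁ * (p * m) ^ 6) ≈⟨ S.solve 5 (λ v n h p m → (v ⊗ n) ⊛ 6 ⊗ (h ⊗ (p ⊗ m) ⊛ 6) S.⊜ h ⊗ v ⊛ 6 ⊗ (p ⊗ m ⊗ n) ⊛ 6) S.refl ν n H₁ p m ⟩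
            H₁ * ν ^ 6 * (p * m * n) ^ 6 ≈⟨ S.*-congʳ {(p * m * n) ^ 6} (modular-step eta μ ν p m n X ρ q g h G Hh K l-ρ Xρ golden eta-p μm νn gG Hh≈ identity identity′) ⟩
            eta ^ 6 * H₂ * (p * m * n) ^ 6 ≈⟨ S.solve 5 (λ l n h p m → l ⊛ 6 ⊗ h ⊗ (p ⊗ m ⊗ n) ⊛ 6 S.⊜ (l ⊗ p) ⊛ 6 ⊗ (h ⊗ (m ⊗ n) ⊛ 6)) S.refl eta n H₂ p m ⟩
            (eta * p) ^ 6 * (H₂ * (m * n) ^ 6) ≈⟨ drop¹ (H₂ * (m * n) ^ 6) (1^ 6 eta-p) ⟩
            H₂ * (m * n) ^ 6 ≈⟨ V-W ⟨
            V W ∎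
            where open S.Rsn

          -- Every term of `H` other than a^6 contains v = qμ^6, hence a factor q, as `separate`
          -- makes explicit.
          W-0 : W 0 A.≈ A.1#
          W-0 = A.trans (at (separate (eta ^ 6) q (μ ^ 6) ((p * m) ^ 6)) 0)
            (A.trans (A.+-cong (A.*-cong (A.^-congˡ 6 (A.^-congˡ 6 eta0)) (A.^-congˡ 6 (A.*-cong p0 p0))) (A.zeroˡ _)) (A.solve 0 ((Κ 1ℤ ⊛ 6) ⊛ 6 ⊗ (Κ 1ℤ ⊗ Κ 1ℤ) ⊛ 6 ⊕ Κ 0ℤ A.⊜ Κ 1ℤ) A.refl))
            where
            p0 : p 0 A.≈ A.1#
            p0 = A.trans (A.sym (A.*-identityˡ (p 0))) (A.trans (A.*-congʳ (A.sym eta0)) (at eta-p 0))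
            separate : ∀ l q M u → Hᴿ l (q * M) * u ≋ l ^ 6 * u + q * (M * u * (- (ι (+ 9) * l ^ 5) - ι (+ 10) * l ^ 4 * (q * M) - ι (+ 11) * l ^ 2 * (q * M) ^ 3 - ι (+ 9) * l * (q * M) ^ 4 - ι (+ 5) * (q * M) ^ 5))
            separate = S.solve 4 (λ l q M u → Modular.H l (q ⊗ M) ⊗ u S.⊜ l ⊛ 6 ⊗ u ⊕ q ⊗ (M ⊗ u ⊗
              (⊝ (Κ (+ 9) ⊗ l ⊛ 5) S.⊖ Κ (+ 10) ⊗ l ⊛ 4 ⊗ (q ⊗ M) S.⊖ Κ (+ 11) ⊗ l ⊛ 2 ⊗ (q ⊗ M) ⊛ 3 S.⊖ Κ (+ 9) ⊗ l ⊗ (q ⊗ M) ⊛ 4 S.⊖ Κ (+ 5) ⊗ (q ⊗ M) ⊛ 5))) S.refl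

          -- A series fixed by q ↦ q^5 with constant term 1 is 1, so W is 1; the denominators in its
          -- image under `V` are then cleared.
          modular : H₂ ≋ μ ^ 6 * ν ^ 6
          modular = begin
            H₂ ≈⟨ S.trans (S.sym (drop¹ H₂ (1^ 6 μm))) (S.sym (drop¹ _ (1^ 6 νn))) ⟩
            (ν * n) ^ 6 * ((μ * m) ^ 6 * H₂) ≈⟨ S.solve 5 (λ v n μ m h → (v ⊗ n) ⊛ 6 ⊗ ((μ ⊗ m) ⊛ 6 ⊗ h) S.⊜ h ⊗ (m ⊗ n) ⊛ 6 ⊗ (μ ⊛ 6 ⊗ v ⊛ 6)) S.refl ν n μ m H₂ ⟩
            H₂ * (m * n) ^ 6 * (μ ^ 6 * ν ^ 6) ≈⟨ drop¹ (μ ^ 6 * ν ^ 6) (S.trans (S.sym V-W) (S.trans (S.sym W-fixed) (Fixed.V-fixed A W W-fixed W-0))) ⟩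
            μ ^ 6 * ν ^ 6 ∎
            where open S.Rsn

          Vy : V y ≋ ρ ^ 5
          Vy = S.trans (v.*-hom q (ω ^ 5)) (S.trans (S.*-cong V-q (S.trans (v.^-hom ω 5) (S.^-congˡ 5 (v.*-hom z m)))) (S.sym (S.trans (S.^-congˡ 5 ρ-V) (S.^-distrib-* q (V z * n) 5))))

          eval-V : ∀ l → eval (ρ ^ 5) l ≋ V (eval y l)
          eval-V l = S.trans (eval-cong l (S.sym Vy)) (S.sym (eval-hom V-hom y l))

          ρ^-V : ∀ r l → ρ ^ r * eval (ρ ^ 5) l ≋ q ^ r * V (ω ^ r * eval y l)
          ρ^-V r l = S.trans (S.*-cong (S.trans (S.trans (S.^-congˡ r ρ-V) (S.^-distrib-* q (V z * n) r)) (S.*-congˡ {q ^ r} (S.trans (S.^-congˡ r (S.sym (v.*-hom z m))) (S.sym (v.^-hom ω r))))) (eval-V l))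
            (S.trans (S.*-assoc (q ^ r) (V (ω ^ r)) (V (eval y l))) (S.*-congˡ {q ^ r} (S.sym (v.*-hom (ω ^ r) (eval y l)))))

          -- As ρ^r is q^r times a series in q^5, the exponents of a polynomial in ρ and those of
          -- its value in q agree modulo 5, and `parts` yields the sections.
          eval-assemble : ∀ l → let (a , b , c , d , e) = parts l in
            eval ρ l ≋ assemble (eval y a) (ω * eval y b) (ω ^ 2 * eval y c) (ω ^ 3 * eval y d) (ω ^ 4 * eval y e)
          eval-assemble l = S.trans (eval-parts ρ l) (S.+-cong (S.+-cong (S.+-cong (S.+-cong (eval-V (part₀ l)) (ρ^-V 1 (part₁ l))) (ρ^-V 2 (proj₁ (proj₂ (proj₂ (parts l)))))) (ρ^-V 3 (proj₁ (proj₂ (proj₂ (proj₂ (parts l))))))) (ρ^-V 4 (part₄ l)))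

          U0-eval : ∀ l → U 0 (eval ρ l) ≋ eval y (part₀ l)
          U0-eval l = S.trans (U-cong 0 (eval-assemble l)) (U0-assemble _ _ _ _ _)

          U1-eval : ∀ l → U 1 (eval ρ l) ≋ ω * eval y (part₁ l)
          U1-eval l = S.trans (U-cong 1 (eval-assemble l)) (U1-assemble _ _ _ _ _)

          U4-eval : ∀ l → U 4 (eval ρ l) ≋ ω ^ 4 * eval y (part₄ l)
          U4-eval l = S.trans (U-cong 4 (eval-assemble l)) (U4-assemble _ _ _ _ _)

          -- `B` is the generating function of `cφ5` by `cφ5-series`, `f` its section at exponents
          -- divisible by 5, and `F` is λ^5/μ^6 + 5q/λ.
          B F f : PS
          B = (eta ^ 5 * V p + ι (+ 25) * (q * (V eta ^ 5 * p))) * p ^ 5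
          F = eta ^ 5 * m ^ 6 + ι (+ 5) * (q * p)
          f = U 0 B

          a : PS
          a = x ^ 25 * μ ^ 5 * p ^ 31

          V-a : V (ι (+ 25) * a) ≋ ι (+ 25) * (X ^ 25 * ν ^ 5 * m ^ 31)
          V-a = S.trans (v.*-hom (ι (+ 25)) a) (S.*-cong (v.ι-hom (+ 25)) (S.trans (v.*-hom (x ^ 25 * μ ^ 5) (p ^ 31)) (S.*-cong (S.trans (v.*-hom (x ^ 25) (μ ^ 5)) (S.*-cong (v.^-hom x 25) (v.^-hom μ 5))) (v.^-hom p 31))))

          f-expansion : f ≋ p + eval y (part₀ L) * (ι (+ 25) * a)
          f-expansion = S.trans (U-cong 0 (S.trans (partition-expansion eta μ ν p m n X ρ q g h G Hh K l-ρ Xρ golden eta-p μm νn gG Hh≈ identity identity′)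
              (S.+-congˡ {m} (S.trans (S.*-cong (S.sym V-a) (S.sym L-eval)) (S.*-comm (V (ι (+ 25) * a)) (eval ρ L))))))
            (S.trans (mk λ _ → A.refl) (S.+-cong (U0V p) (S.trans (U-*V 0 (eval ρ L) (ι (+ 25) * a) (s≤s z≤n)) (S.*-congʳ {ι (+ 25) * a} (U0-eval L)))))

          V-f : V f ≋ m + ι (+ 25) * (X ^ 25 * ν ^ 5 * m ^ 31) * K
          V-f = S.trans (V-cong f-expansion) (S.trans (v.+-hom p (eval y (part₀ L) * (ι (+ 25) * a))) (S.+-congˡ {m} (S.trans (v.*-hom (eval y (part₀ L)) (ι (+ 25) * a))
            (S.trans (S.*-cong (S.trans (S.sym (eval-V (part₀ L))) K-parts) V-a) (S.*-comm K (ι (+ 25) * (X ^ 25 * ν ^ 5 * m ^ 31)))))))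

          -- The central congruence. Its image under q ↦ q^5 is `section-expansion`, and `V` is
          -- injective.
          q*f : q * f ≋ F - p ^ 25
          q*f = V-injective (begin
            V (q * f) ≈⟨ S.trans (v.*-hom q f) (S.*-cong V-q V-f) ⟩
            q ^ 5 * (m + ι (+ 25) * (X ^ 25 * ν ^ 5 * m ^ 31) * K)
              ≈⟨ section-expansion eta μ ν p m n X ρ q g h G Hh K l-ρ Xρ golden eta-p μm νn gG Hh≈ identity identity′ modular ⟩
            μ ^ 5 * n ^ 6 + ι (+ 5) * (q ^ 5 * m) - m ^ 25
              ≈⟨ S.+-cong (S.trans (v.+-hom (eta ^ 5 * m ^ 6) (ι (+ 5) * (q * p))) (S.+-cong (S.trans (v.*-hom (eta ^ 5) (m ^ 6)) (S.*-cong (v.^-hom eta 5) (v.^-hom m 6)))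
                  (S.trans (v.*-hom (ι (+ 5)) (q * p)) (S.*-cong (v.ι-hom (+ 5)) (S.trans (v.*-hom q p) (S.*-congʳ {m} V-q))))))
                 (S.trans (v.neg-hom (p ^ 25)) (S.-‿cong (v.^-hom p 25))) ⟨
            V F + V (- p ^ 25) ≈⟨ v.+-hom F (- p ^ 25) ⟨
            V (F - p ^ 25) ∎)
            where open S.Rsn

          F-V : F ≋ eval ρ J * V (x ^ 5 * p ^ 6)
          F-V = S.trans (fifth-expansion eta μ ν p m n X ρ q g h G Hh K l-ρ Xρ golden eta-p μm νn gG Hh≈ identity identity′)
            (S.trans (S.*-cong (S.trans (S.*-cong (S.sym (v.^-hom x 5)) (S.sym (v.^-hom p 6))) (S.sym (v.*-hom (x ^ 5) (p ^ 6)))) (S.sym J-eval)) (S.*-comm (V (x ^ 5 * p ^ 6)) (eval ρ J)))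

          U-F : ∀ r e → r < 5 → U r (eval ρ J) ≋ e → e ≋ 0# → U r F ≋ 0#
          U-F r e l u e0 = S.trans (U-cong r F-V) (S.trans (U-*V r (eval ρ J) (x ^ 5 * p ^ 6) l) (S.trans (S.*-congʳ {x ^ 5 * p ^ 6} (S.trans u e0)) (S.zeroˡ (x ^ 5 * p ^ 6))))

        F-section : ∀ {r} → ±1mod5 r → U r F ≋ 0#
        F-section one = U-F 1 (ω * eval y (part₁ J)) (s≤s (s≤s z≤n)) (U1-eval J)
          (S.trans (S.*-congˡ {ω} (eval-vanishing y J₁)) (S.zeroʳ ω))
        F-section four = U-F 4 (ω ^ 4 * eval y (part₄ J)) (s≤s (s≤s (s≤s (s≤s (s≤s z≤n))))) (U4-eval J)
          (S.trans (S.*-congˡ {ω ^ 4} (eval-vanishing y J₄)) (S.zeroʳ (ω ^ 4)))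

        -- The coefficient of q^M in `f` is that of q^(M+1) in F - p^25. The class of M + 1 modulo 5
        -- removes the first term, its class modulo 13 the second.
        coefficient-vanishes : ∀ M i j {r s} → ±1mod5 r → s < 13 → V₁₃.U s eta ≋ 0# → suc M ≡ i ℕ.* 5 ℕ.+ r → suc M ≡ j ℕ.* 13 ℕ.+ s →
          ((eta ^ 5 * V p + ι (+ 25) * (q * (V eta ^ 5 * p))) * p ^ 5) (M ℕ.* 5 ℕ.+ 0) A.≈ A.0#
        coefficient-vanishes M i j {r} {s} r±1 s<13 e M₅ M₁₃ = begin
          f M ≈⟨ q*-suc f M ⟨
          (q * f) (suc M) ≈⟨ at q*f (suc M) ⟩
          F (suc M) A.+ A.- (p ^ 25) (suc M) ≈⟨ A.+-cong (A.trans (A.reflexive (≡.cong F M₅)) (at (F-section r±1) i)) (A.-‿cong (A.trans (A.reflexive (≡.cong (p ^ 25) M₁₃)) (at (p^25-section s s<13 e) j))) ⟩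
          A.0# A.+ A.- A.0# ≈⟨ A.-‿inverseʳ A.0# ⟩
          A.0# ∎
          where open A.Rsn

    module _ (third : A.Carrier) (3≠0 : IsThird A third) where
      private
        ρ : PS
        ρ = q * (V z * V (V p))

        GoldenRelations : Set
        GoldenRelations = eta ≋ V x * (1# - ρ - ρ ^ 2) × V x * ρ ≋ q * V (V eta) × V x ^ 5 * (1# - ι (+ 11) * ρ ^ 5 - ρ ^ 10) * V (V eta) ≋ V eta ^ 6

        golden-relations-over : (K : CommutativeRing 0ℓ 0ℓ) (φ : Hom A K) → Injective φ → (ζ : CommutativeRing.Carrier K) → CyclotomicSum K ζ → GoldenRelations
        golden-relations-over K φ φ-injective ζ ζ-sum = eta-ρ , Xρ , golden
          where open Golden A K φ φ-injective ζ ζ-sum third 3≠0 p eta-p using (eta-ρ; Xρ; golden)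

        golden-relations : GoldenRelations
        golden-relations = golden-relations-over (Cyclotomic.ring A) (Cyclotomic.embed A) (Cyclotomic.embed-injective A) (Cyclotomic.ζ A) (Cyclotomic.ζ-sum A)

      sections-vanish : ∀ M i j {r s} → ±1mod5 r → s < 13 → V₁₃.U s eta ≋ 0# → suc M ≡ i ℕ.* 5 ℕ.+ r → suc M ≡ j ℕ.* 13 ℕ.+ s →
        ((eta ^ 5 * V p + ι (+ 25) * (q * (V eta ^ 5 * p))) * p ^ 5) (M ℕ.* 5 ℕ.+ 0) A.≈ A.0#
      sections-vanish = Assembly.coefficient-vanishes ρ (ModularValues.modular-data ring char-S ρ) S.refl (proj₁ golden-relations) (proj₁ (proj₂ golden-relations)) (proj₂ (proj₂ golden-relations))

-- The generating function of `cφ5` and integers modulo 13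

module Congruence (A : CommutativeRing 0ℓ 0ℓ) (char : IsZero13 A) (third : CommutativeRing.Carrier A) (3≠0 : IsThird A third) where
  private module A = Ring A
  open Gauss A
  open S using (_*_; _+_; 0#; _^_; ι)
  open Eta A
  open Spread A 4
  open Partitions A
  open Convolution A
  private module V₁₃ = Spread A 12

  cφ5-series : series cφ5 ≋ (eta ^ 5 * V p + ι (+ 25) * (q * (V eta ^ 5 * p))) * p ^ 5
  cφ5-series = S.trans (⊙-series Defs.theta invEta5) (S.*-cong (theta-expansion A p eta-p) (begin
    series invEta5 ≈⟨ multiply (partitions ⊙ (partitions ⊙ (partitions ⊙ partitions))) (multiply (partitions ⊙ (partitions ⊙ partitions)) (multiply (partitions ⊙ partitions) (⊙-series partitions partitions))) ⟩
    p * (p * (p * (p * p))) ≈⟨ S.solve 1 (λ p → p ⊗ (p ⊗ (p ⊗ (p ⊗ p))) S.⊜ p ⊛ 5) S.refl p ⟩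
    p ^ 5 ∎))
    where
    open S.Rsn
    multiply : ∀ f {g} → series f ≋ g → series (partitions ⊙ f) ≋ p * g
    multiply f e = S.trans (⊙-series partitions f) (S.*-congˡ {p} e)

  cφ5-vanishes : ∀ M i j {r s} → ±1mod5 r → s < 13 → Insoluble 13 (+ 3) -[1+ 0 ] (+ (2 ℕ.* s)) → suc M ≡ i ℕ.* 5 ℕ.+ r → suc M ≡ j ℕ.* 13 ℕ.+ s → A.ι (+ cφ5 (M ℕ.* 5 ℕ.+ 0)) A.≈ A.0#
  cφ5-vanishes M i j {r} {s} r±1 s<13 w e e′ = A.trans (at cφ5-series (M ℕ.* 5 ℕ.+ 0))
    (Thirteen.sections-vanish A char p eta-p third 3≠0 M i j r±1 s<13 (mk λ n → eta-support _ (expo-missing 13 1 2 s w n)) e e′)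

module Residues (m : ℕ) where
  infix 4 _≈_
  -- The carrier stays ℤ and the quotient is data, so congruences between literals hold by
  -- reflexivity.
  record _≈_ (x y : ℤ) : Set where
    constructor mk
    field
      quotient : ℤ
      equality : x ≡ quotient ℤ.* + m ℤ.+ y

  private
    M = + m

    ≡⇒≈ : ∀ {x y} → x ≡ y → x ≈ y
    ≡⇒≈ {x} ≡.refl = mk 0ℤ (ℤS.solve 2 (λ x m → x ℤS.:= ℤS.con 0ℤ ℤS.:* m ℤS.:+ x) ≡.refl x M)

    sym : ∀ {x y} → x ≈ y → y ≈ x
    sym {y = y} (mk k ≡.refl) = mk (ℤ.- k) (ℤS.solve 3 (λ k m y → y ℤS.:= (ℤS.:- k) ℤS.:* m ℤS.:+ (k ℤS.:* m ℤS.:+ y)) ≡.refl k M y)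

    trans : ∀ {x y z} → x ≈ y → y ≈ z → x ≈ z
    trans {z = z} (mk k ≡.refl) (mk l ≡.refl) = mk (k ℤ.+ l) (ℤS.solve 4 (λ k l m z → k ℤS.:* m ℤS.:+ (l ℤS.:* m ℤS.:+ z) ℤS.:= (k ℤS.:+ l) ℤS.:* m ℤS.:+ z) ≡.refl k l M z)

    +-cong : ∀ {x y u v} → x ≈ y → u ≈ v → x ℤ.+ u ≈ y ℤ.+ v
    +-cong {y = y} {v = v} (mk k ≡.refl) (mk l ≡.refl) = mk (k ℤ.+ l)
      (ℤS.solve 5 (λ k l m y v → (k ℤS.:* m ℤS.:+ y) ℤS.:+ (l ℤS.:* m ℤS.:+ v) ℤS.:= (k ℤS.:+ l) ℤS.:* m ℤS.:+ (y ℤS.:+ v)) ≡.refl k l M y v)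

    *-cong : ∀ {x y u v} → x ≈ y → u ≈ v → x ℤ.* u ≈ y ℤ.* v
    *-cong {y = y} {v = v} (mk k ≡.refl) (mk l ≡.refl) = mk (k ℤ.* (l ℤ.* M ℤ.+ v) ℤ.+ y ℤ.* l)
      (ℤS.solve 5 (λ k l m y v → (k ℤS.:* m ℤS.:+ y) ℤS.:* (l ℤS.:* m ℤS.:+ v) ℤS.:= (k ℤS.:* (l ℤS.:* m ℤS.:+ v) ℤS.:+ y ℤS.:* l) ℤS.:* m ℤS.:+ y ℤS.:* v) ≡.refl k l M y v)

    neg-cong : ∀ {x y} → x ≈ y → ℤ.- x ≈ ℤ.- y
    neg-cong {y = y} (mk k ≡.refl) = mk (ℤ.- k) (ℤS.solve 3 (λ k m y → ℤS.:- (k ℤS.:* m ℤS.:+ y) ℤS.:= (ℤS.:- k) ℤS.:* m ℤS.:+ (ℤS.:- y)) ≡.refl k M y)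

  ring : CommutativeRing 0ℓ 0ℓ
  ring = record
    { Carrier = ℤ ; _≈_ = _≈_ ; _+_ = ℤ._+_ ; _*_ = ℤ._*_ ; -_ = ℤ.-_ ; 0# = 0ℤ ; 1# = 1ℤ
    ; isCommutativeRing = record
      { isRing = record
        { +-isAbelianGroup = record
          { isGroup = record
            { isMonoid = record
              { isSemigroup = record
                { isMagma = record { isEquivalence = record { refl = ≡⇒≈ ≡.refl ; sym = sym ; trans = trans } ; ∙-cong = +-cong }
                ; assoc = λ x y z → ≡⇒≈ (ℤP.+-assoc x y z) }
              ; identity = (λ x → ≡⇒≈ (ℤP.+-identityˡ x)) , (λ x → ≡⇒≈ (ℤP.+-identityʳ x)) }
            ; inverse = (λ x → ≡⇒≈ (ℤP.+-inverseˡ x)) , (λ x → ≡⇒≈ (ℤP.+-inverseʳ x))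
            ; ⁻¹-cong = neg-cong }
          ; comm = λ x y → ≡⇒≈ (ℤP.+-comm x y) }
        ; *-cong = *-cong
        ; *-assoc = λ x y z → ≡⇒≈ (ℤP.*-assoc x y z)
        ; *-identity = (λ x → ≡⇒≈ (ℤP.*-identityˡ x)) , (λ x → ≡⇒≈ (ℤP.*-identityʳ x))
        ; distrib = (λ x y z → ≡⇒≈ (ℤP.*-distribˡ-+ x y z)) , (λ x y z → ≡⇒≈ (ℤP.*-distribʳ-+ x y z)) }
      ; *-comm = λ x y → ≡⇒≈ (ℤP.*-comm x y) } }

  private module R = Ring ring

  ι-residue : ∀ n → R.ι (+ n) ≈ + n
  ι-residue zero = R.refl
  ι-residue (suc n) = R.trans (R.ι-+ (+ 1) (+ n)) (R.+-congˡ {1ℤ} (ι-residue n))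

  ι≈0⇒∣ : ∀ n → R.ι (+ n) ≈ 0ℤ → m ℕ∣ n
  ι≈0⇒∣ n e = divisor (R.trans (R.sym (ι-residue n)) e)
    where
    divisor : + n ≈ 0ℤ → m ℕ∣ n
    divisor (mk k p) = signed⇒abs (divides k (≡.trans p (ℤP.+-identityʳ (k ℤ.* + m))))

private
  open Residues 13 using (mk; ι≈0⇒∣)

  -- As 325 = 5 · 65 and 65 = 5 · 13, the argument is 5M with M = 65n + s, and the classes of M + 1
  -- modulo 5 and 13 are those of s + 1; i and j are the quotients of s + 1.
  section : ∀ n s i j {r r′} → ±1mod5 r → Insoluble 13 (+ 3) -[1+ 0 ] (+ (2 ℕ.* r′)) → {True (r′ ℕP.<? 13)} →
    suc s ≡ i ℕ.* 5 ℕ.+ r → suc s ≡ j ℕ.* 13 ℕ.+ r′ → 13 ℕ∣ cφ5 (325 ℕ.* n ℕ.+ s ℕ.* 5)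
  section n s i j {r} {r′} r±1 w {l} e e′ = ≡.subst (λ k → 13 ℕ∣ cφ5 k) index (ι≈0⇒∣ (cφ5 (M ℕ.* 5 ℕ.+ 0))
    -- The inverse of 3 is 9, since 27 = 2 · 13 + 1.
    (Congruence.cφ5-vanishes (Residues.ring 13) (mk (+ 1) ≡.refl) (+ 9) (mk (+ 2) ≡.refl) M (13 ℕ.* n ℕ.+ i) (5 ℕ.* n ℕ.+ j) r±1 (toWitness l) w index₅ index₁₃))
    where
    M = 65 ℕ.* n ℕ.+ s
    open Data.Nat.Solver.+-*-Solver using (solve; _:+_; _:*_; _:=_; con)
    index : M ℕ.* 5 ℕ.+ 0 ≡ 325 ℕ.* n ℕ.+ s ℕ.* 5
    index = solve 2 (λ n s → (con 65 :* n :+ s) :* con 5 :+ con 0 := con 325 :* n :+ s :* con 5) ≡.refl n s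
    index₅ : suc M ≡ (13 ℕ.* n ℕ.+ i) ℕ.* 5 ℕ.+ r
    index₅ = ≡.trans (≡.sym (ℕP.+-suc (65 ℕ.* n) s)) (≡.trans (≡.cong (65 ℕ.* n ℕ.+_) e) (solve 3 (λ n i r → con 65 :* n :+ (i :* con 5 :+ r) := (con 13 :* n :+ i) :* con 5 :+ r) ≡.refl n i r))
    index₁₃ : suc M ≡ (5 ℕ.* n ℕ.+ j) ℕ.* 13 ℕ.+ r′
    index₁₃ = ≡.trans (≡.sym (ℕP.+-suc (65 ℕ.* n) s)) (≡.trans (≡.cong (65 ℕ.* n ℕ.+_) e′) (solve 3 (λ n j r → con 65 :* n :+ (j :* con 13 :+ r) := (con 5 :* n :+ j) :* con 13 :+ r) ≡.refl n j r′))

open import Data.Nat using (_+_; _*_)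
open import Data.Nat.Divisibility using (_∣_)

theorem10 : (n t : ℕ) → t ∈ (15 ∷ 25 ∷ 50 ∷ 75 ∷ 90 ∷ 100 ∷ 115 ∷ 140 ∷ 165 ∷ 175 ∷ 240 ∷ 275 ∷ []) →
  13 ∣ cφ5 (325 * n + t)
-- Here t = 5s, and s + 1 runs through the classes modulo 65 that are ±1 modulo 5 and one of 3, 4,
-- 6, 8, 10, 11 modulo 13, the classes without pentagonal numbers.
theorem10 n _ (here ≡.refl) = section n 3 0 0 four _ ≡.refl ≡.refl
theorem10 n _ (there (here ≡.refl)) = section n 5 1 0 one _ ≡.refl ≡.refl
theorem10 n _ (there (there (here ≡.refl))) = section n 10 2 0 one _ ≡.refl ≡.refl
theorem10 n _ (there (there (there (here ≡.refl)))) = section n 15 3 1 one _ ≡.refl ≡.refl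
theorem10 n _ (there (there (there (there (here ≡.refl))))) = section n 18 3 1 four _ ≡.refl ≡.refl
theorem10 n _ (there (there (there (there (there (here ≡.refl)))))) = section n 20 4 1 one _ ≡.refl ≡.refl
theorem10 n _ (there (there (there (there (there (there (here ≡.refl))))))) = section n 23 4 1 four _ ≡.refl ≡.refl
theorem10 n _ (there (there (there (there (there (there (there (here ≡.refl)))))))) = section n 28 5 2 four _ ≡.refl ≡.refl
theorem10 n _ (there (there (there (there (there (there (there (there (here ≡.refl))))))))) = section n 33 6 2 four _ ≡.refl ≡.refl
theorem10 n _ (there (there (there (there (there (there (there (there (there (here ≡.refl)))))))))) = section n 35 7 2 one _ ≡.refl ≡.refl
theorem10 n _ (there (there (there (there (there (there (there (there (there (there (here ≡.refl))))))))))) = section n 48 9 3 four _ ≡.refl ≡.refl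
theorem10 n _ (there (there (there (there (there (there (there (there (there (there (there (here ≡.refl)))))))))))) = section n 55 11 4 one _ ≡.refl ≡.refl
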